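{- Let $q$ be an odd prime power, $n\ge1$, $M>0$, let $\underline{s}=(s_1,\dots,s_n)$ be a tuple of nonnegative integers with $s_1+2s_2+\dots+ns_n=n$, and let $U_1,\dots,U_n\subseteq\mathbb{F}_q$ be nonempty subsets of complexity $\leq M$. Let $\xi_1,\dots,\xi_n$ be independent random variables with $\xi_i$ uniformly distributed on $U_i$, and let $P(x)=x^n+\xi_1x^{n-1}+\dots+\xi_n\in\mathbb{F}_q[x]$. Then \[ \Pr\big[\mathrm{SplitType}(P)=\underline{s}\big]=\Big(\prod_{i=1}^n i^{s_i}\,s_i!\Big)^{ -1}+O_{n,M}\big(q^{n-1/2}\cdot\#U_1^{ -1}\cdots\#U_n^{ -1}\big) \] as $q\to\infty$, where the implied constant depends only on $n$ and $M$.
   Context: For a polynomial $P\in k[x]$ of degree $n$ over a field $k$, its splitting type $\mathrm{SplitType}(P)$ is the tuple $(s_1,\dots,s_n)$ where $s_i$ is the number of irreducible factors of $P$ of degree $i$, counted with multiplicity. For $M>0$, a subset $U\subseteq\mathbb{F}_q$ is of complexity $\leq M$ if there exist $m\ge1$, integers $k_1,\dots,k_m\ge1$ and polynomials $f_{ij}\in\mathbb{F}_q[x]$ of positive degree ($1\le i\le m$, $1\le j\le k_i$) such that $U=\bigcup_{i=1}^m\bigcap_{j=1}^{k_i}f_{ij}(\mathbb{F}_q)$ and $\max_{i,j}\{m,k_i,\deg f_{ij}\}\leq M$. -}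

module Defs where

open import Level using (0ℓ)
open import Algebra.Bundles using (CommutativeRing)
open import Data.Nat as ℕ using (ℕ; zero; suc; _≤_; _^_; _≟_)
open import Data.Nat.Primality using (Prime)
open import Data.Nat.Combinatorics using ()
open import Data.Nat.Base using (_!)
open import Data.Nat.ListAction using (product)
open import Data.Fin using (Fin; toℕ)
open import Data.List as List using (List; []; _∷_; _++_; [_]; length; filter; concatMap; reverse)
open import Data.List.Relation.Unary.Any using (Any)
open import Data.List.Relation.Unary.All using (All)
open import Data.List.Relation.Unary.AllPairs using (AllPairs)
open import Data.List.Relation.Binary.Pointwise using (Pointwise)
open import Data.Vec as Vec using (Vec; lookup)
open import Data.Product using (Σ; ∃; ∃-syntax; _×_; proj₁; proj₂; _,_)
open import Relation.Nullary using (¬_; Dec)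
open import Relation.Binary.PropositionalEquality using (_≡_)
open import Function.Bundles using (_⇔_)

OddPrimePower : ℕ → Set
OddPrimePower q = ∃[ p ] ∃[ k ] (Prime p × ¬ (p ≡ 2) × 1 ≤ k × q ≡ p ^ k)

record FiniteField (q : ℕ) : Set₁ where
  field
    cring    : CommutativeRing 0ℓ 0ℓ
  open CommutativeRing cring public hiding (ring)
  field
    _≈?_     : (x y : Carrier) → Dec (x ≈ y)
    1≉0      : ¬ (1# ≈ 0#)
    inverse  : (x : Carrier) → ¬ (x ≈ 0#) → ∃[ y ] (x * y ≈ 1#)
    elements : List Carrier
    complete : (x : Carrier) → Any (x ≈_) elements
    distinct : AllPairs (λ x y → ¬ (x ≈ y)) elements
    card     : length elements ≡ q

data CountOf {A : Set} (P : A → Set) : List A → ℕ → Set where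
  c-nil  : CountOf P [] 0
  c-yes  : ∀ {x xs n} → P x → CountOf P xs n → CountOf P (x ∷ xs) (suc n)
  c-no   : ∀ {x xs n} → ¬ P x → CountOf P xs n → CountOf P (x ∷ xs) n

module _ {q : ℕ} (F : FiniteField q) where
  open FiniteField F

  -- Polynomials as coefficient lists, lowest degree first.
  Poly : Set
  Poly = List Carrier

  _+ₚ_ : Poly → Poly → Poly
  [] +ₚ g = g
  (a ∷ f) +ₚ [] = a ∷ f
  (a ∷ f) +ₚ (b ∷ g) = (a + b) ∷ (f +ₚ g)

  _*ₚ_ : Poly → Poly → Poly
  [] *ₚ g = []
  (a ∷ []) *ₚ g = List.map (a *_) g
  (a ∷ f@(_ ∷ _)) *ₚ g = List.map (a *_) g +ₚ (0# ∷ (f *ₚ g))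

  _≈ₚ_ : Poly → Poly → Set
  f ≈ₚ g = Pointwise _≈_ f g

  eval : Poly → Carrier → Carrier
  eval [] y = 0#
  eval (a ∷ f) y = a + y * eval f y

  -- A monic polynomial of degree d: its d lower coefficients (leading coefficient 1).
  Monic : ℕ → Set
  Monic d = Vec Carrier d

  monicPoly : ∀ {d} → Monic d → Poly
  monicPoly c = Vec.toList c ++ [ 1# ]

  Irreducible : ∀ {d} → Monic d → Set
  Irreducible {d} f = 1 ≤ d × (∀ a b (g : Monic a) (h : Monic b) → 1 ≤ a → 1 ≤ b →
                         ¬ ((monicPoly g *ₚ monicPoly h) ≈ₚ monicPoly f))

  prodₚ : List (Σ ℕ Monic) → Poly
  prodₚ [] = [ 1# ]
  prodₚ ((_ , f) ∷ fs) = monicPoly f *ₚ prodₚ fs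

  countDeg : ℕ → List (Σ ℕ Monic) → ℕ
  countDeg i fs = length (filter (λ f → proj₁ f ≟ i) fs)

  -- SplitType(P) = s, for P monic given by its coefficient list and s = (s_1,…,s_n)
  -- stored as a vector whose entry at index i is s_{i+1}.
  HasSplitType : ∀ {n} → Poly → Vec ℕ n → Set
  HasSplitType {n} P s =
    ∃[ fs ] (All (λ f → Irreducible (Data.Product.proj₂ f)) fs
            × prodₚ fs ≈ₚ P
            × ((i : Fin n) → countDeg (suc (toℕ i)) fs ≡ lookup s i))

  charPoly : ∀ {n} → Vec Carrier n → Poly
  charPoly ξ = reverse (Vec.toList ξ) ++ [ 1# ]

  PosPolyDeg≤ : ℕ → Set
  PosPolyDeg≤ M = ∃[ d ] Σ (Vec Carrier (suc d)) λ c →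
                    1 ≤ d × d ≤ M × ¬ (Vec.last c ≈ 0#)

  _∈U_ : Carrier → List Carrier → Set
  x ∈U U = Any (x ≈_) U

  ComplexityLe : ℕ → List Carrier → Set
  ComplexityLe M U =
    ∃[ m ] Σ (Vec ℕ m) λ ks →
      Σ ((i : Fin m) → (j : Fin (lookup ks i)) → PosPolyDeg≤ M) λ f →
        1 ≤ m × m ≤ M × ((i : Fin m) → 1 ≤ lookup ks i × lookup ks i ≤ M)
        × ((x : Carrier) → (x ∈U U) ⇔
             (∃[ i ] ((j : Fin (lookup ks i)) →
                 ∃[ y ] (eval (Vec.toList (proj₁ (proj₂ (f i j)))) y ≈ x))))

  GoodSubset : ℕ → List Carrier → Set
  GoodSubset M U = AllPairs (λ x y → ¬ (x ≈ y)) U × 1 ≤ length U × ComplexityLe M U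

  allTuples : ∀ {n} → Vec (List Carrier) n → List (Vec Carrier n)
  allTuples Vec.[] = [ Vec.[] ]
  allTuples (U Vec.∷ Us) = concatMap (λ x → List.map (x Vec.∷_) (allTuples Us)) U

prodCard : ∀ {A : Set} {n} → Vec (List A) n → ℕ
prodCard Us = product (List.map length (Vec.toList Us))

-- Σ_i i·s_i  (entry at index i is s_{i+1})
weightedSum : ∀ {n} → Vec ℕ n → ℕ
weightedSum s = go 1 (Vec.toList s)
  where
  go : ℕ → List ℕ → ℕ
  go k [] = 0
  go k (x ∷ xs) = k ℕ.* x ℕ.+ go (suc k) xs

splitDenom : ∀ {n} → Vec ℕ n → ℕ
splitDenom s = go 1 (Vec.toList s)
  where
  go : ℕ → List ℕ → ℕ
  go k [] = 1
  go k (x ∷ xs) = (k ^ x) ℕ.* (x !) ℕ.* go (suc k) xs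

-- Let T be the indicator of "F / ξ₀ has splitting type s" on forms F = (ξ₀, …, ξₙ), with T = 0 when ξ₀ = 0.
-- T is invariant under scaling, x ↦ x + a, x ↦ l x and, off ξ₀ = 0 and ξₙ = 0, under reversal; hence, off a
-- set of density O(1/q), also under the opposite unipotents sh b, the conjugates of the translations by
-- reversal. This makes T independent, up to O(q^(-1/2)), of any functions gᵢ(ξᵢ) with values in [0, 1].
--
-- Call a set B of indices closed if it is symmetric and binom(k, i) = 0 in K for i in B, k not in B. For
-- i₀ = max B put B′ = {i in B : binom(i₀, i) = 0}, which is again closed; E[T Π_B gᵢ] is reduced to
-- E[T Π_B′ gᵢ]. Averaging in the coordinates outside B and i₀ is conjugated by sh b to averaging in those
-- outside B and in the direction sh b e_{i₀}; any n + 1 of these directions span the coordinates outside B′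
-- (Vandermonde), and the averagings are commuting projections, so T and T v(ξ_{i₀}), v of mean zero, may be
-- replaced by their averages over the coordinates outside B′. For T v(ξ_{i₀}) this average is O(q^(-1/2)) by
-- Bessel's inequality, because the translates of v(ξ_{i₀}) under x ↦ x + a (or its dilates, if 2 i₀ = n) are
-- orthogonal for all but O(q) pairs. Monic polynomials are the slice ξ₀ = 1, to which one passes by scaling
-- and dilations.
--
-- The mean of T comes from unique factorisation. Counting the irreducible factors of degree i of a polynomial
-- of type s gives s_i M(s) = p_i M(s − e_i) + O(1/q), where p_i is the density of the irreducible polynomials
-- of degree i, and Σ_{i ≤ m} i p_i = m + O(1/q), the sum of the degrees of the factors being m.

module Submission where

-- The obstacle is small characteristic. If the characteristic exceeds n, no binomial coefficient
-- binom(n, i) with i ≤ n vanishes, the directions sh b e_n span the whole space, and one reduction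
-- already leaves the empty set. In characteristic at most n they miss the coordinates with binom(n,
-- i) = 0. Closed sets are what survives such a reduction: closedness makes the span of the
-- coordinates outside B stable under every sh b, and symmetry makes it stable under the
-- translations too. A single b gives nothing, since only the mean over b of the averages along sh b
-- e_{i₀} is small. It suffices because conjugation by sh b bounds a quantity that does not depend
-- on b. The two unipotent groups enter differently. Invariance under translations is exact and
-- feeds the orthogonality argument; invariance under sh b rests on two reversals and holds only in
-- mean square. All estimates are second moments over the rationals, without characters or square
-- roots: the q^(-1/2) of the statement is the bound of a squared error by a constant times `ω` =
-- 1/q, and the final inequality keeps this squared form.

open import Algebra.Bundles using (CommutativeRing)
open import Level using (Level)

-- Rational arithmetic with sealed operations.

module Rat where

  import Data.Rational as Q
  import Data.Rational.Properties as QP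
  open import Relation.Nullary using (Dec; yes; no; ¬_)
  open import Relation.Nullary.Decidable using (dec⇒maybe)
  open import Relation.Nullary.Negation using (contradiction)
  open import Relation.Binary.PropositionalEquality
  open import Data.Sum using (inj₁; inj₂)
  open import Algebra.Structures using (IsCommutativeRing)
  open import Tactic.RingSolver.Core.AlmostCommutativeRing using (AlmostCommutativeRing; fromCommutativeRing)
  open import Tactic.RingSolver using (solve-∀)
  open import Level using (0ℓ)

  open Q using (ℚ; 0ℚ; 1ℚ; ½; _≤_; _<_) public
  open QP using (≤-refl; ≤-trans; ≤-reflexive; ≤-antisym; ≤-total) public

  infixl 6 _+_ _-_
  infixl 7 _*_
  infix 8 -_

  -- Opaque copies of the operations of ℚ, so that they are injective for the unifier.
  opaque
    _+_ _*_ : ℚ → ℚ → ℚ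
    _+_ = Q._+_
    _*_ = Q._*_
    -_ : ℚ → ℚ
    -_ = Q.-_

    isCommutativeRing : IsCommutativeRing _≡_ _+_ _*_ -_ 0ℚ 1ℚ
    isCommutativeRing = QP.+-*-isCommutativeRing

  _-_ : ℚ → ℚ → ℚ
  x - y = x + - y

  open IsCommutativeRing isCommutativeRing public using (+-comm; +-assoc; +-identityˡ; +-identityʳ; *-comm; *-assoc; *-identityˡ; *-identityʳ) renaming (zeroˡ to *-zeroˡ; zeroʳ to *-zeroʳ; distribˡ to *-distribˡ-+; distribʳ to *-distribʳ-+; -‿inverseʳ to +-inverseʳ; -‿inverseˡ to +-inverseˡ)

  ℚ-ring : AlmostCommutativeRing 0ℓ 0ℓ
  ℚ-ring = fromCommutativeRing (record { isCommutativeRing = isCommutativeRing }) (λ x → dec⇒maybe (0ℚ QP.≟ x))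

  opaque
    unfolding _+_
    +-mono-≤ : ∀ {x y u v} → x ≤ y → u ≤ v → x + u ≤ y + v
    +-mono-≤ = QP.+-mono-≤

    0≤* : ∀ {x y} → 0ℚ ≤ x → 0ℚ ≤ y → 0ℚ ≤ x * y
    0≤* {x} {y} p q = QP.nonNegative⁻¹ (x * y) {{QP.nonNeg*nonNeg⇒nonNeg x {{Q.nonNegative p}} y {{Q.nonNegative q}}}}

    0<* : ∀ {x y} → 0ℚ < x → 0ℚ < y → 0ℚ < x * y
    0<* {x} {y} p q = subst (Q._< x * y) (*-zeroʳ x) (QP.*-monoʳ-<-pos x {{Q.positive p}} q)

    <-diff : ∀ {x y} → x < y → 0ℚ < y - x
    <-diff {x} {y} p = subst (Q._< y - x) (+-inverseʳ x) (QP.+-monoˡ-< (- x) p)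

    ½*2 : ½ * (1ℚ + 1ℚ) ≡ 1ℚ
    ½*2 = refl

  2ℚ 3ℚ 4ℚ : ℚ
  2ℚ = 1ℚ + 1ℚ
  3ℚ = 2ℚ + 1ℚ
  4ℚ = 2ℚ + 2ℚ

  0≤1 : 0ℚ ≤ 1ℚ
  0≤1 = QP.nonNegative⁻¹ 1ℚ

  0≤+ : ∀ {x y} → 0ℚ ≤ x → 0ℚ ≤ y → 0ℚ ≤ x + y
  0≤+ {x} {y} p q = subst (_≤ x + y) (+-identityˡ 0ℚ) (+-mono-≤ p q)

  0≤2 : 0ℚ ≤ 2ℚ
  0≤2 = 0≤+ 0≤1 0≤1

  0≤½ : 0ℚ ≤ ½
  0≤½ = QP.nonNegative⁻¹ ½

  diff-≤ : ∀ {x y} → 0ℚ ≤ y - x → x ≤ y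
  diff-≤ {x} {y} p = subst₂ _≤_ (+-identityʳ x) (lem x y) (+-mono-≤ (≤-refl {x}) p)
    where
    opaque
      unfolding _+_
      lem : ∀ x y → x + (y - x) ≡ y
      lem = solve-∀ ℚ-ring

  ≤-diff : ∀ {x y} → x ≤ y → 0ℚ ≤ y - x
  ≤-diff {x} {y} p = subst (_≤ y - x) (+-inverseʳ x) (+-mono-≤ p (≤-refl { - x}))

  ≤-from : ∀ {x y} d → 0ℚ ≤ d → y - x ≡ d → x ≤ y
  ≤-from d p e = diff-≤ (subst (0ℚ ≤_) (sym e) p)

  neg-mono : ∀ {x y} → x ≤ y → - y ≤ - x
  neg-mono {x} {y} p = ≤-from (y - x) (≤-diff p) (lem x y)
    where
    opaque
      unfolding _+_
      lem : ∀ x y → - x - - y ≡ y - x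
      lem = solve-∀ ℚ-ring

  0≤sq : ∀ x → 0ℚ ≤ x * x
  0≤sq x with ≤-total 0ℚ x
  ... | inj₁ p = 0≤* p p
  ... | inj₂ p = subst (0ℚ ≤_) (lem x) (0≤* (≤-diff p) (≤-diff p))
    where
    opaque
      unfolding _+_
      lem : ∀ x → (0ℚ - x) * (0ℚ - x) ≡ x * x
      lem = solve-∀ ℚ-ring

  *-monoˡ : ∀ {z x y} → 0ℚ ≤ z → x ≤ y → z * x ≤ z * y
  *-monoˡ {z} {x} {y} p q = ≤-from (z * (y - x)) (0≤* p (≤-diff q)) (lem x y z)
    where
    opaque
      unfolding _+_
      lem : ∀ x y z → z * y - z * x ≡ z * (y - x)
      lem = solve-∀ ℚ-ring

  *-monoʳ : ∀ {z x y} → 0ℚ ≤ z → x ≤ y → x * z ≤ y * z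
  *-monoʳ {z} {x} {y} p q = subst₂ _≤_ (*-comm z x) (*-comm z y) (*-monoˡ p q)

  *-mono : ∀ {x y u v} → 0ℚ ≤ x → 0ℚ ≤ u → x ≤ y → u ≤ v → x * u ≤ y * v
  *-mono 0x 0u xy uv = ≤-trans (*-monoˡ 0x uv) (*-monoʳ (≤-trans 0u uv) xy)

  -- The closing move of the second moment arguments: Cauchy-Schwarz bounds the square of a mean by
  -- a multiple of that same mean. If `y > c ≥ 0`, then `(y - c) * y` would be positive.
  sq-cancel : ∀ {y c} → 0ℚ ≤ c → y * y ≤ c * y → y ≤ c
  sq-cancel {y} {c} 0c p with y QP.≤? c
  ... | yes q = q
  ... | no y≰c = contradiction (QP.<-≤-trans (0<* (<-diff c<y) (QP.≤-<-trans 0c c<y)) (≤-from _ (≤-diff p) (lem y c))) (QP.<-irrefl refl)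
    where
    opaque
      unfolding _+_
      lem : ∀ y c → 0ℚ - (y - c) * y ≡ c * y - y * y
      lem = solve-∀ ℚ-ring
    c<y : c < y
    c<y = QP.≰⇒> y≰c

  sq-add : ∀ x y → (x + y) * (x + y) ≤ 2ℚ * (x * x) + 2ℚ * (y * y)
  sq-add x y = ≤-from ((x - y) * (x - y)) (0≤sq (x - y)) (lem x y)
    where
    opaque
      unfolding _+_
      lem : ∀ x y → 2ℚ * (x * x) + 2ℚ * (y * y) - (x + y) * (x + y) ≡ (x - y) * (x - y)
      lem = solve-∀ ℚ-ring

  ⟦_⟧ : ∀ {a} {A : Set a} → Dec A → ℚ
  ⟦ yes _ ⟧ = 1ℚ
  ⟦ no _ ⟧ = 0ℚ

  module _ {a} {A : Set a} where
    0≤⟦⟧ : (d : Dec A) → 0ℚ ≤ ⟦ d ⟧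
    0≤⟦⟧ (yes _) = 0≤1
    0≤⟦⟧ (no _) = ≤-refl

    ⟦⟧≤1 : (d : Dec A) → ⟦ d ⟧ ≤ 1ℚ
    ⟦⟧≤1 (yes _) = ≤-refl
    ⟦⟧≤1 (no _) = 0≤1

    ⟦⟧-yes : (d : Dec A) → A → ⟦ d ⟧ ≡ 1ℚ
    ⟦⟧-yes (yes _) a = refl
    ⟦⟧-yes (no ¬a) a = contradiction a ¬a

    ⟦⟧-no : (d : Dec A) → ¬ A → ⟦ d ⟧ ≡ 0ℚ
    ⟦⟧-no (yes a) ¬a = contradiction a ¬a
    ⟦⟧-no (no _) ¬a = refl

  ⟦⟧-⇔ : ∀ {a b} {A : Set a} {B : Set b} (d : Dec A) (e : Dec B) → (A → B) → (B → A) → ⟦ d ⟧ ≡ ⟦ e ⟧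
  ⟦⟧-⇔ (yes a) e f g = sym (⟦⟧-yes e (f a))
  ⟦⟧-⇔ (no ¬a) e f g = sym (⟦⟧-no e (λ b → ¬a (g b)))

  ⟦⟧-× : ∀ {a b c} {A : Set a} {B : Set b} {C : Set c} (d : Dec A) (e : Dec B) (f : Dec C) →
    (A → B → C) → (C → A) → (C → B) → ⟦ f ⟧ ≡ ⟦ d ⟧ * ⟦ e ⟧
  ⟦⟧-× (yes a) (yes b) f i p r = trans (⟦⟧-yes f (i a b)) (sym (*-identityˡ 1ℚ))
  ⟦⟧-× (yes a) (no ¬b) f i p r = trans (⟦⟧-no f (λ c → ¬b (r c))) (sym (*-zeroʳ 1ℚ))
  ⟦⟧-× (no ¬a) e f i p r = trans (⟦⟧-no f (λ c → ¬a (p c))) (sym (*-zeroˡ ⟦ e ⟧))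

-- Finite sums and means over uniform probability spaces.

module Mean where

  open Rat
  open import Data.List using (List; []; _∷_; map; concatMap; _++_)
  open import Data.Nat using (ℕ; zero; suc)
  open import Data.Vec using (Vec; []; _∷_)
  import Data.Vec.Properties as VecP
  open import Data.Product using (_,_; ∃)
  open import Relation.Nullary using (Dec; yes; no; ¬_)
  open import Relation.Binary.PropositionalEquality
  open import Relation.Binary.Definitions using (DecidableEquality)
  open import Tactic.RingSolver using (solve-∀)
  open import Data.List.Membership.Propositional using (_∈_; _∉_)
  import Data.List.Membership.DecPropositional as DecMem
  open import Data.List.Relation.Unary.Any as Any using (here; there; any?)
  open import Data.Sum using (_⊎_; inj₁; inj₂)
  open import Relation.Nullary.Negation using (contradiction)

  ∑ : ∀ {X : Set} → List X → (X → ℚ) → ℚ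
  ∑ [] f = 0ℚ
  ∑ (x ∷ xs) f = f x + ∑ xs f

  module _ {X : Set} where
    ∑-cong : ∀ (xs : List X) {f g} → (∀ x → f x ≡ g x) → ∑ xs f ≡ ∑ xs g
    ∑-cong [] p = refl
    ∑-cong (x ∷ xs) p = cong₂ _+_ (p x) (∑-cong xs p)

    ∑-+ : ∀ (xs : List X) f g → ∑ xs (λ x → f x + g x) ≡ ∑ xs f + ∑ xs g
    ∑-+ [] f g = sym (+-identityˡ 0ℚ)
    ∑-+ (x ∷ xs) f g = trans (cong (f x + g x +_) (∑-+ xs f g)) (lem (f x) (g x) (∑ xs f) (∑ xs g))
      where
      opaque
        unfolding _+_
        lem : ∀ a b c d → a + b + (c + d) ≡ a + c + (b + d)
        lem = solve-∀ ℚ-ring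

    ∑-*ˡ : ∀ (xs : List X) c f → ∑ xs (λ x → c * f x) ≡ c * ∑ xs f
    ∑-*ˡ [] c f = sym (*-zeroʳ c)
    ∑-*ˡ (x ∷ xs) c f = trans (cong (c * f x +_) (∑-*ˡ xs c f)) (sym (*-distribˡ-+ c (f x) _))

    ∑-0 : ∀ (xs : List X) → ∑ xs (λ _ → 0ℚ) ≡ 0ℚ
    ∑-0 [] = refl
    ∑-0 (x ∷ xs) = trans (+-identityˡ _) (∑-0 xs)

    ∑-nonneg : ∀ (xs : List X) {f} → (∀ x → 0ℚ ≤ f x) → 0ℚ ≤ ∑ xs f
    ∑-nonneg [] p = ≤-refl
    ∑-nonneg (x ∷ xs) p = 0≤+ (p x) (∑-nonneg xs p)

    ∑-++ : ∀ (xs ys : List X) f → ∑ (xs ++ ys) f ≡ ∑ xs f + ∑ ys f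
    ∑-++ [] ys f = sym (+-identityˡ _)
    ∑-++ (x ∷ xs) ys f = trans (cong (f x +_) (∑-++ xs ys f)) (sym (+-assoc (f x) _ _))

  ∑-swap : ∀ {X Y : Set} (xs : List X) (ys : List Y) (f : X → Y → ℚ) →
    ∑ xs (λ x → ∑ ys (f x)) ≡ ∑ ys (λ y → ∑ xs (λ x → f x y))
  ∑-swap [] ys f = sym (∑-0 ys)
  ∑-swap (x ∷ xs) ys f = trans (cong (∑ ys (f x) +_) (∑-swap xs ys f)) (sym (∑-+ ys (f x) _))

  ∑-map : ∀ {X Y : Set} (g : X → Y) (xs : List X) f → ∑ (map g xs) f ≡ ∑ xs (λ x → f (g x))
  ∑-map g [] f = refl
  ∑-map g (x ∷ xs) f = cong (f (g x) +_) (∑-map g xs f)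

  ∑-concatMap : ∀ {X Y : Set} (g : X → List Y) (xs : List X) f →
    ∑ (concatMap g xs) f ≡ ∑ xs (λ x → ∑ (g x) f)
  ∑-concatMap g [] f = refl
  ∑-concatMap g (x ∷ xs) f = trans (∑-++ (g x) (concatMap g xs) f) (cong (∑ (g x) f +_) (∑-concatMap g xs f))

  -- A finite uniform space, described by the behaviour of sums: `point` says that `points` meets
  -- every element exactly once, and `total` then makes `ω` the reciprocal of their number.
  record Uniform (X : Set) : Set where
    field
      _≟_ : DecidableEquality X
      points : List X
      ω : ℚ
      0≤ω : 0ℚ ≤ ω
      total : ω * ∑ points (λ _ → 1ℚ) ≡ 1ℚ
      point : ∀ c (f : X → ℚ) → ∑ points (λ x → ⟦ x ≟ c ⟧ * f x) ≡ f c

    E : (X → ℚ) → ℚ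
    E f = ω * ∑ points f

    E-cong : ∀ {f g} → (∀ x → f x ≡ g x) → E f ≡ E g
    E-cong p = cong (ω *_) (∑-cong points p)

    E-+ : ∀ f g → E (λ x → f x + g x) ≡ E f + E g
    E-+ f g = trans (cong (ω *_) (∑-+ points f g)) (*-distribˡ-+ ω _ _)

    E-*ˡ : ∀ c f → E (λ x → c * f x) ≡ c * E f
    E-*ˡ c f = trans (cong (ω *_) (∑-*ˡ points c f)) (lem ω c (∑ points f))
      where
      opaque
        unfolding _+_
        lem : ∀ a b c → a * (b * c) ≡ b * (a * c)
        lem = solve-∀ ℚ-ring

    E-*ʳ : ∀ c f → E (λ x → f x * c) ≡ E f * c
    E-*ʳ c f = trans (E-cong (λ x → *-comm (f x) c)) (trans (E-*ˡ c f) (*-comm c _))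

    E-1 : E (λ _ → 1ℚ) ≡ 1ℚ
    E-1 = total

    E-const : ∀ c → E (λ _ → c) ≡ c
    E-const c = trans (E-cong (λ _ → sym (*-identityʳ c))) (trans (E-*ˡ c (λ _ → 1ℚ)) (trans (cong (c *_) total) (*-identityʳ c)))

    E-neg : ∀ f → E (λ x → - f x) ≡ - E f
    E-neg f = trans (E-cong (λ x → lem (f x))) (trans (E-*ˡ (- 1ℚ) f) (sym (lem (E f))))
      where
      opaque
        unfolding _+_
        lem : ∀ a → - a ≡ (- 1ℚ) * a
        lem = solve-∀ ℚ-ring

    E-- : ∀ f g → E (λ x → f x - g x) ≡ E f - E g
    E-- f g = trans (E-+ f (λ x → - g x)) (cong (E f +_) (E-neg g))

    E-nonneg : ∀ {f} → (∀ x → 0ℚ ≤ f x) → 0ℚ ≤ E f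
    E-nonneg p = 0≤* 0≤ω (∑-nonneg points p)

    E-mono : ∀ {f g} → (∀ x → f x ≤ g x) → E f ≤ E g
    E-mono {f} {g} p = ≤-from _ (E-nonneg (λ x → ≤-diff (p x))) (sym (E-- g f))

    E-point : ∀ c f → E (λ x → ⟦ x ≟ c ⟧ * f x) ≡ ω * f c
    E-point c f = cong (ω *_) (point c f)

    E-≤const : ∀ {f c} → (∀ x → f x ≤ c) → E f ≤ c
    E-≤const {f} {c} p = ≤-trans (E-mono p) (≤-reflexive (E-const c))

    ω≤1 : X → ω ≤ 1ℚ
    ω≤1 c = subst (_≤ 1ℚ) (trans (E-point c (λ _ → 1ℚ)) (*-identityʳ ω))
              (E-≤const (λ x → subst (_≤ 1ℚ) (sym (*-identityʳ _)) (⟦⟧≤1 (x ≟ c))))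

    -- For an element missing from the list the sum in `point` would be 0, whereas with the constant
    -- function 1 it has to be 1.
    complete : ∀ x → x ∈ points
    complete x with DecMem._∈?_ _≟_ x points
    ... | yes i = i
    ... | no i = contradiction (trans (sym (point x (λ _ → 1ℚ))) (none points i)) λ ()
      where
      none : ∀ xs → x ∉ xs → ∑ xs (λ y → ⟦ y ≟ x ⟧ * 1ℚ) ≡ 0ℚ
      none [] i = refl
      none (y ∷ xs) i = trans (cong₂ _+_ (trans (*-identityʳ _) (⟦⟧-no (y ≟ x) (λ e → i (here (sym e))))) (none xs (λ j → i (there j)))) (+-identityˡ 0ℚ)

    search : ∀ {P : X → Set} → (∀ x → Dec (P x)) → ∃ P ⊎ (∀ x → ¬ P x)
    search P? with any? P? points
    ... | yes i = inj₁ (Any.satisfied i)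
    ... | no i = inj₂ (λ x p → i (Any.map (λ { refl → p }) (complete x)))

    infix 8 ⟨_,_⟩
    ⟨_,_⟩ : (X → ℚ) → (X → ℚ) → ℚ
    ⟨ f , g ⟩ = E (λ x → f x * g x)

    ⟨⟩-cong : ∀ {f f' g g'} → (∀ x → f x ≡ f' x) → (∀ x → g x ≡ g' x) → ⟨ f , g ⟩ ≡ ⟨ f' , g' ⟩
    ⟨⟩-cong p r = E-cong (λ x → cong₂ _*_ (p x) (r x))

    ⟨⟩-comm : ∀ f g → ⟨ f , g ⟩ ≡ ⟨ g , f ⟩
    ⟨⟩-comm f g = E-cong (λ x → *-comm (f x) (g x))

    ‖_‖² : (X → ℚ) → ℚ
    ‖ f ‖² = ⟨ f , f ⟩

    0≤‖‖² : ∀ f → 0ℚ ≤ ‖ f ‖²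
    0≤‖‖² f = E-nonneg (λ x → 0≤sq (f x))


  E-swap : ∀ {X Y : Set} (U : Uniform X) (W : Uniform Y) (f : X → Y → ℚ) →
    Uniform.E U (λ x → Uniform.E W (f x)) ≡ Uniform.E W (λ y → Uniform.E U (λ x → f x y))
  E-swap U W f = begin
    U.ω * ∑ U.points (λ x → W.ω * ∑ W.points (f x))
      ≡⟨ cong (U.ω *_) (∑-*ˡ U.points W.ω _) ⟩
    U.ω * (W.ω * ∑ U.points (λ x → ∑ W.points (f x)))
      ≡⟨ cong (λ z → U.ω * (W.ω * z)) (∑-swap U.points W.points f) ⟩
    U.ω * (W.ω * ∑ W.points (λ y → ∑ U.points (λ x → f x y)))
      ≡⟨ lem U.ω W.ω _ ⟩
    W.ω * (U.ω * ∑ W.points (λ y → ∑ U.points (λ x → f x y)))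
      ≡⟨ cong (W.ω *_) (sym (∑-*ˡ W.points U.ω _)) ⟩
    W.ω * ∑ W.points (λ y → U.ω * ∑ U.points (λ x → f x y)) ∎
    where
    open ≡-Reasoning
    module U = Uniform U
    module W = Uniform W
    opaque
      unfolding _+_
      lem : ∀ a b c → a * (b * c) ≡ b * (a * c)
      lem = solve-∀ ℚ-ring

  module Bijection {X : Set} (U : Uniform X) where
    open Uniform U

    -- Expanding `f (g x)` into point masses and exchanging the two sums turns the condition
    -- `y = g x` into `x = h y`, so no permutation of the list of points has to be constructed.
    E-bij : (g h : X → X) → (∀ x → g (h x) ≡ x) → (∀ x → h (g x) ≡ x) → ∀ f → E (λ x → f (g x)) ≡ E f
    E-bij g h gh hg f = cong (ω *_) (begin
      ∑ points (λ x → f (g x))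
        ≡⟨ ∑-cong points (λ x → sym (point (g x) f)) ⟩
      ∑ points (λ x → ∑ points (λ y → ⟦ y ≟ g x ⟧ * f y))
        ≡⟨ ∑-swap points points _ ⟩
      ∑ points (λ y → ∑ points (λ x → ⟦ y ≟ g x ⟧ * f y))
        ≡⟨ ∑-cong points (λ y → ∑-cong points (λ x → cong (_* f y)
             (⟦⟧-⇔ (y ≟ g x) (x ≟ h y) (λ e → trans (sym (hg x)) (cong h (sym e))) (λ e → trans (sym (gh y)) (cong g (sym e)))))) ⟩
      ∑ points (λ y → ∑ points (λ x → ⟦ x ≟ h y ⟧ * f y))
        ≡⟨ ∑-cong points (λ y → point (h y) (λ _ → f y)) ⟩
      ∑ points f ∎)
      where open ≡-Reasoning

  module CauchySchwarz {X : Set} (U : Uniform X) where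
    open Uniform U

    -- Lagrange's identity: the mean of `D x y * D x y` over all pairs is nonnegative and is twice
    -- the difference of the two sides. No norm is divided by.
    cauchy-schwarz : ∀ f g → ⟨ f , g ⟩ * ⟨ f , g ⟩ ≤ ‖ f ‖² * ‖ g ‖²
    cauchy-schwarz f g = halve (≤-from _ sq-pos (lem _ _ _ _ expand))
      where
      D : X → X → ℚ
      D x y = f x * g y - f y * g x
      sq-pos : 0ℚ ≤ E (λ x → E (λ y → D x y * D x y))
      sq-pos = E-nonneg (λ x → E-nonneg (λ y → 0≤sq (D x y)))
      opaque
        unfolding _+_
        sqr : ∀ a b c d → (a * d - c * b) * (a * d - c * b)
            ≡ a * a * (d * d) + (b * b * (c * c) + (- 2ℚ) * (a * b) * (c * d))
        sqr = solve-∀ ℚ-ring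
      inner : ∀ x → E (λ y → D x y * D x y)
            ≡ f x * f x * ‖ g ‖² + (g x * g x * ‖ f ‖² + (- 2ℚ) * (f x * g x) * ⟨ f , g ⟩)
      inner x = trans (E-cong (λ y → sqr (f x) (g x) (f y) (g y)))
               (trans (E-+ _ _) (cong₂ _+_ (E-*ˡ _ _)
               (trans (E-+ _ _) (cong₂ _+_ (E-*ˡ _ _) (E-*ˡ _ _)))))
      expand : E (λ x → E (λ y → D x y * D x y))
             ≡ ‖ f ‖² * ‖ g ‖² + (‖ g ‖² * ‖ f ‖² + (- 2ℚ) * ⟨ f , g ⟩ * ⟨ f , g ⟩)
      expand = trans (E-cong inner)
              (trans (E-+ _ _) (cong₂ _+_ (E-*ʳ _ _)
              (trans (E-+ _ _) (cong₂ _+_ (E-*ʳ _ _) (trans (E-*ʳ _ _) (cong (_* ⟨ f , g ⟩) (E-*ˡ _ _)))))))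
      lem : ∀ a b c e → e ≡ a * b + (b * a + (- 2ℚ) * c * c) → 2ℚ * (a * b) - 2ℚ * (c * c) ≡ e
      lem a b c e p = trans (lem' a b c) (sym p)
        where
        opaque
          unfolding _+_
          lem' : ∀ a b c → 2ℚ * (a * b) - 2ℚ * (c * c) ≡ a * b + (b * a + (- 2ℚ) * c * c)
          lem' = solve-∀ ℚ-ring
      halve : ∀ {a b} → 2ℚ * a ≤ 2ℚ * b → a ≤ b
      halve {a} {b} p = subst₂ _≤_ (h a) (h b) (*-monoˡ {½} 0≤½ p)
        where
        h : ∀ a → ½ * (2ℚ * a) ≡ a
        h a = trans (sym (*-assoc ½ 2ℚ a)) (trans (cong (_* a) ½*2) (*-identityˡ a))

  module VecSpace {K : Set} (U : Uniform K) where
    open Uniform U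

    vecs : ∀ n → List (Vec K n)
    vecs zero = [] ∷ []
    vecs (suc n) = concatMap (λ x → map (x ∷_) (vecs n)) points

    _^^_ : ℚ → ℕ → ℚ
    a ^^ zero = 1ℚ
    a ^^ suc n = a * a ^^ n

    ∑-vecs : ∀ n f → ∑ (vecs (suc n)) f ≡ ∑ points (λ x → ∑ (vecs n) (λ v → f (x ∷ v)))
    ∑-vecs n f = trans (∑-concatMap _ points f) (∑-cong points (λ x → ∑-map (x ∷_) (vecs n) f))

    vecU : ∀ n → Uniform (Vec K n)
    vecU n = record
      { _≟_ = VecP.≡-dec _≟_ ; points = vecs n ; ω = ω ^^ n
      ; 0≤ω = nonneg n ; total = tot n ; point = pt n }
      where
      nonneg : ∀ n → 0ℚ ≤ ω ^^ n
      nonneg zero = 0≤1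
      nonneg (suc n) = 0≤* 0≤ω (nonneg n)
      tot : ∀ n → ω ^^ n * ∑ (vecs n) (λ _ → 1ℚ) ≡ 1ℚ
      tot zero = trans (*-identityˡ _) (+-identityʳ _)
      tot (suc n) = begin
        ω * ω ^^ n * ∑ (vecs (suc n)) (λ _ → 1ℚ) ≡⟨ cong (ω * ω ^^ n *_) (∑-vecs n _) ⟩
        ω * ω ^^ n * ∑ points (λ _ → S) ≡⟨ cong (ω * ω ^^ n *_) (trans (∑-cong points (λ _ → sym (*-identityʳ S))) (∑-*ˡ points S _)) ⟩
        ω * ω ^^ n * (S * ∑ points (λ _ → 1ℚ)) ≡⟨ lem ω (ω ^^ n) S _ ⟩
        (ω ^^ n * S) * (ω * ∑ points (λ _ → 1ℚ)) ≡⟨ cong₂ _*_ (tot n) total ⟩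
        1ℚ * 1ℚ ≡⟨ *-identityˡ 1ℚ ⟩
        1ℚ ∎
        where
        open ≡-Reasoning
        S = ∑ (vecs n) (λ _ → 1ℚ)
        opaque
          unfolding _+_
          lem : ∀ a b c d → a * b * (c * d) ≡ b * c * (a * d)
          lem = solve-∀ ℚ-ring
      split : ∀ {n} (x y : K) (v w : Vec K n) → ⟦ VecP.≡-dec _≟_ (x ∷ v) (y ∷ w) ⟧ ≡ ⟦ x ≟ y ⟧ * ⟦ VecP.≡-dec _≟_ v w ⟧
      split x y v w = ⟦⟧-× (x ≟ y) (VecP.≡-dec _≟_ v w) (VecP.≡-dec _≟_ (x ∷ v) (y ∷ w)) (cong₂ _∷_) VecP.∷-injectiveˡ VecP.∷-injectiveʳ
      pt : ∀ n c (f : Vec K n → ℚ) → ∑ (vecs n) (λ v → ⟦ VecP.≡-dec _≟_ v c ⟧ * f v) ≡ f c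
      pt zero [] f = trans (+-identityʳ _) (*-identityˡ _)
      pt (suc n) (y ∷ w) f = begin
        ∑ (vecs (suc n)) (λ v → ⟦ VecP.≡-dec _≟_ v (y ∷ w) ⟧ * f v) ≡⟨ ∑-vecs n _ ⟩
        ∑ points (λ x → ∑ (vecs n) (λ v → ⟦ VecP.≡-dec _≟_ (x ∷ v) (y ∷ w) ⟧ * f (x ∷ v)))
          ≡⟨ ∑-cong points (λ x → trans (∑-cong (vecs n) (λ v → trans (cong (_* f (x ∷ v)) (split x y v w)) (*-assoc ⟦ x ≟ y ⟧ _ _)))
                                  (trans (∑-*ˡ (vecs n) ⟦ x ≟ y ⟧ _) (cong (⟦ x ≟ y ⟧ *_) (pt n w (λ v → f (x ∷ v)))))) ⟩
        ∑ points (λ x → ⟦ x ≟ y ⟧ * f (x ∷ w)) ≡⟨ point y (λ x → f (x ∷ w)) ⟩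
        f (y ∷ w) ∎
        where open ≡-Reasoning

    E-∷ : ∀ n f → Uniform.E (vecU (suc n)) f ≡ E (λ x → Uniform.E (vecU n) (λ v → f (x ∷ v)))
    E-∷ n f = trans (cong (ω * ω ^^ n *_) (∑-vecs n f))
              (trans (lem ω (ω ^^ n) _) (cong (ω *_) (sym (∑-*ˡ points (ω ^^ n) _))))
      where
      opaque
        unfolding _+_
        lem : ∀ a b c → a * b * c ≡ a * (b * c)
        lem = solve-∀ ℚ-ring

-- A ring solver with integer coefficients.

module IntSolver {a ℓ : Level} (R : CommutativeRing a ℓ) where

  open CommutativeRing R
  open import Data.Nat as ℕ using (ℕ; zero; suc)
  import Data.Nat.Properties as ℕP
  open import Data.Integer as ℤ using (ℤ; +_; -[1+_])
  import Data.Integer.Properties as ℤP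
  open import Data.Maybe using (Maybe; just; nothing)
  open import Relation.Nullary using (yes; no)
  import Relation.Binary.PropositionalEquality as P
  open import Algebra.Properties.Semiring.Mult.TCOptimised semiring using (_×_; ×-homo-+; ×1-homo-*; 1+×)
  open import Algebra.Properties.Ring ring using (-‿+-comm; -‿involutive; -0#≈0#; -‿distribˡ-*; -‿distribʳ-*)
  open import Algebra.Solver.Ring.AlmostCommutativeRing using (_-Raw-AlmostCommutative⟶_; fromCommutativeRing)
  open import Relation.Binary.Reasoning.Setoid setoid

  -- The canonical map from ℤ. Coefficients are compared in ℤ, where equality is decidable, so the
  -- solver also serves the ring of power series, where it is not.
  φ : ℤ → Carrier
  φ (+ n) = n × 1#
  φ -[1+ n ] = - (suc n × 1#)

  φ-⊖ : ∀ m n → φ (m ℤ.⊖ n) ≈ m × 1# - n × 1#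
  φ-⊖ zero zero = sym (trans (+-identityˡ _) -0#≈0#)
  φ-⊖ (suc m) zero = sym (trans (+-congˡ -0#≈0#) (+-identityʳ _))
  φ-⊖ zero (suc n) = sym (+-identityˡ _)
  φ-⊖ (suc m) (suc n) = begin
    φ (suc m ℤ.⊖ suc n) ≡⟨ P.cong φ (ℤP.[1+m]⊖[1+n]≡m⊖n m n) ⟩
    φ (m ℤ.⊖ n) ≈⟨ φ-⊖ m n ⟩
    m × 1# - n × 1# ≈⟨ +-congʳ (+-identityˡ _) ⟨
    0# + m × 1# - n × 1# ≈⟨ +-congʳ (+-congʳ (-‿inverseʳ 1#)) ⟨
    1# - 1# + m × 1# - n × 1# ≈⟨ +-congʳ (trans (+-assoc _ _ _) (trans (+-congˡ (+-comm _ _)) (sym (+-assoc _ _ _)))) ⟩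
    1# + m × 1# - 1# - n × 1# ≈⟨ trans (+-assoc _ _ _) (+-congˡ (-‿+-comm _ _)) ⟩
    1# + m × 1# - (1# + n × 1#) ≈⟨ +-cong (1+× m 1#) (-‿cong (1+× n 1#)) ⟨
    suc m × 1# - suc n × 1# ∎

  φ-neg : ∀ x → φ (ℤ.- x) ≈ - φ x
  φ-neg (+ zero) = sym -0#≈0#
  φ-neg (+ suc n) = refl
  φ-neg -[1+ n ] = sym (-‿involutive _)

  φ-+ : ∀ x y → φ (x ℤ.+ y) ≈ φ x + φ y
  φ-+ (+ m) (+ n) = ×-homo-+ 1# m n
  φ-+ (+ m) -[1+ n ] = φ-⊖ m (suc n)
  φ-+ -[1+ m ] (+ n) = trans (φ-⊖ n (suc m)) (+-comm _ _)
  φ-+ -[1+ m ] -[1+ n ] = begin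
    - (suc (suc (m ℕ.+ n)) × 1#) ≡⟨ P.cong (λ k → - (k × 1#)) (P.cong suc (ℕP.+-suc m n)) ⟨
    - ((suc m ℕ.+ suc n) × 1#) ≈⟨ -‿cong (×-homo-+ 1# (suc m) (suc n)) ⟩
    - (suc m × 1# + suc n × 1#) ≈⟨ -‿+-comm _ _ ⟨
    - (suc m × 1#) - suc n × 1# ∎

  φ-*⁺ : ∀ m y → φ (+ m ℤ.* y) ≈ m × 1# * φ y
  φ-*⁺ m (+ n) = trans (reflexive (P.cong φ (P.sym (ℤP.pos-* m n)))) (×1-homo-* m n)
  φ-*⁺ m -[1+ n ] = begin
    φ (+ m ℤ.* -[1+ n ]) ≡⟨ P.cong φ (ℤP.neg-distribʳ-* (+ m) (+ suc n)) ⟨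
    φ (ℤ.- (+ m ℤ.* + suc n)) ≈⟨ φ-neg (+ m ℤ.* + suc n) ⟩
    - φ (+ m ℤ.* + suc n) ≈⟨ -‿cong (φ-*⁺ m (+ suc n)) ⟩
    - (m × 1# * (suc n × 1#)) ≈⟨ -‿distribʳ-* _ _ ⟩
    m × 1# * (- (suc n × 1#)) ∎

  φ-* : ∀ x y → φ (x ℤ.* y) ≈ φ x * φ y
  φ-* (+ m) y = φ-*⁺ m y
  φ-* -[1+ m ] y = begin
    φ (-[1+ m ] ℤ.* y) ≡⟨ P.cong φ (ℤP.neg-distribˡ-* (+ suc m) y) ⟨
    φ (ℤ.- (+ suc m ℤ.* y)) ≈⟨ φ-neg (+ suc m ℤ.* y) ⟩
    - φ (+ suc m ℤ.* y) ≈⟨ -‿cong (φ-*⁺ (suc m) y) ⟩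
    - (suc m × 1# * φ y) ≈⟨ -‿distribˡ-* _ _ ⟩
    - (suc m × 1#) * φ y ∎

  test : (x y : ℤ) → Maybe (φ x ≈ φ y)
  test x y with x ℤ.≟ y
  ... | yes e = just (reflexive (P.cong φ e))
  ... | no _ = nothing

  morphism : ℤ.+-*-rawRing -Raw-AlmostCommutative⟶ fromCommutativeRing R
  morphism = record { ⟦_⟧ = φ ; +-homo = φ-+ ; *-homo = φ-* ; -‿homo = φ-neg ; 0-homo = refl ; 1-homo = refl }

  open import Algebra.Solver.Ring ℤ.+-*-rawRing (fromCommutativeRing R) morphism test public

-- Finite fields and vector spaces over them.

module Field where

  open Mean
  open import Data.Nat using (ℕ; zero; suc)
  open import Data.Vec as Vec using (Vec; []; _∷_; replicate; zipWith)
  open import Data.Product using (∃; _,_)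
  open import Relation.Binary.PropositionalEquality
  open import Algebra.Bundles using (CommutativeRing)
  open import Algebra.Structures using (IsCommutativeRing)
  open import Level using (0ℓ)

  -- Equality is propositional, so that functions of vectors may be rewritten freely; the setoid
  -- fields of the statement are replaced by such a field in `Model`.
  record FinField : Set₁ where
    infixl 6 _⊕_
    infixl 7 _⊗_
    infix 8 ⊖_
    field
      K : Set
      _⊕_ _⊗_ : K → K → K
      ⊖_ : K → K
      𝟘 𝟙 : K
      isCommutativeRing : IsCommutativeRing _≡_ _⊕_ _⊗_ ⊖_ 𝟘 𝟙
      𝟙≢𝟘 : 𝟙 ≢ 𝟘
      inverse : ∀ x → x ≢ 𝟘 → ∃ λ y → x ⊗ y ≡ 𝟙
      uniform : Uniform K

    commutativeRing : CommutativeRing 0ℓ 0ℓ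
    commutativeRing = record { isCommutativeRing = isCommutativeRing }

    open IsCommutativeRing isCommutativeRing public using ()
      renaming (+-comm to ⊕-comm; +-assoc to ⊕-assoc; +-identityˡ to ⊕-identityˡ; +-identityʳ to ⊕-identityʳ
               ; *-comm to ⊗-comm; *-assoc to ⊗-assoc; *-identityˡ to ⊗-identityˡ; *-identityʳ to ⊗-identityʳ
               ; zeroˡ to ⊗-zeroˡ; zeroʳ to ⊗-zeroʳ; distribˡ to ⊗-distribˡ; distribʳ to ⊗-distribʳ
               ; -‿inverseʳ to ⊖-inverseʳ; -‿inverseˡ to ⊖-inverseˡ)
    open Uniform uniform public using (_≟_)

  module FieldFacts (𝔽 : FinField) where
    open FinField 𝔽
    open IntSolver commutativeRing using (solve; _:=_; _:+_; _:*_; :-_)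

    integral : ∀ {x y} → x ⊗ y ≡ 𝟘 → x ≢ 𝟘 → y ≡ 𝟘
    integral {x} {y} e x≢0 with inverse x x≢0
    ... | z , xz = begin
      y ≡⟨ sym (⊗-identityˡ y) ⟩
      𝟙 ⊗ y ≡⟨ cong (_⊗ y) (trans (sym xz) (⊗-comm x z)) ⟩
      z ⊗ x ⊗ y ≡⟨ ⊗-assoc z x y ⟩
      z ⊗ (x ⊗ y) ≡⟨ cong (z ⊗_) e ⟩
      z ⊗ 𝟘 ≡⟨ ⊗-zeroʳ z ⟩
      𝟘 ∎
      where open ≡-Reasoning

    ⊗-≢0 : ∀ {x y} → x ≢ 𝟘 → y ≢ 𝟘 → x ⊗ y ≢ 𝟘
    ⊗-≢0 p r e = r (integral e p)

    _⊝_ : K → K → K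
    x ⊝ y = x ⊕ ⊖ y

    ⊝≡0 : ∀ {x y} → x ⊝ y ≡ 𝟘 → x ≡ y
    ⊝≡0 {x} {y} e = trans (sym (lem x y)) (trans (cong (_⊕ y) e) (⊕-identityˡ y))
      where
      lem : ∀ x y → (x ⊕ ⊖ y) ⊕ y ≡ x
      lem x y = trans (⊕-assoc x (⊖ y) y) (trans (cong (x ⊕_) (⊖-inverseˡ y)) (⊕-identityʳ x))

    0≡⊝ : ∀ {x y} → x ≡ y → x ⊝ y ≡ 𝟘
    0≡⊝ {x} refl = ⊖-inverseʳ x

    ⊗-cancelˡ : ∀ {a x y} → a ≢ 𝟘 → a ⊗ x ≡ a ⊗ y → x ≡ y
    ⊗-cancelˡ {a} {x} {y} a≢0 e = ⊝≡0 (integral (trans (lem a x y) (0≡⊝ e)) a≢0)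
      where
      lem : ∀ a x y → a ⊗ (x ⊕ ⊖ y) ≡ a ⊗ x ⊕ ⊖ (a ⊗ y)
      lem = solve 3 (λ a x y → a :* (x :+ :- y) := a :* x :+ :- (a :* y)) refl

    open Uniform uniform
    open Bijection uniform

    E-shift : ∀ c f → E (λ x → f (x ⊕ c)) ≡ E f
    E-shift c = E-bij (_⊕ c) (_⊕ ⊖ c) (λ x → lem1 x c) (λ x → lem2 x c)
      where
      lem1 : ∀ x c → x ⊕ ⊖ c ⊕ c ≡ x
      lem1 = solve 2 (λ x c → x :+ :- c :+ c := x) refl
      lem2 : ∀ x c → x ⊕ c ⊕ ⊖ c ≡ x
      lem2 = solve 2 (λ x c → x :+ c :+ :- c := x) refl

    E-⊖ : ∀ f → E (λ x → f (⊖ x)) ≡ E f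
    E-⊖ = E-bij ⊖_ ⊖_ lem lem
      where
      lem : ∀ x → ⊖ (⊖ x) ≡ x
      lem = solve 1 (λ x → :- (:- x) := x) refl

    E-scale : ∀ c → c ≢ 𝟘 → ∀ f → E (λ x → f (c ⊗ x)) ≡ E f
    E-scale c c≢0 with inverse c c≢0
    ... | d , cd = E-bij (c ⊗_) (d ⊗_) (λ x → lem c d x cd) (λ x → lem d c x (trans (⊗-comm d c) cd))
      where
      lem : ∀ c d x → c ⊗ d ≡ 𝟙 → c ⊗ (d ⊗ x) ≡ x
      lem c d x e = trans (sym (⊗-assoc c d x)) (trans (cong (_⊗ x) e) (⊗-identityˡ x))

  module Space (𝔽 : FinField) where
    open FinField 𝔽
    open IntSolver commutativeRing using (solve; _:=_; _:+_; _:*_; :-_)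
    open FieldFacts 𝔽
    open VecSpace uniform

    infixl 6 _⊞_
    infixr 7 _⊡_

    _⊞_ : ∀ {n} → Vec K n → Vec K n → Vec K n
    _⊞_ = zipWith _⊕_

    _⊡_ : ∀ {n} → K → Vec K n → Vec K n
    t ⊡ v = Vec.map (t ⊗_) v

    0v : ∀ {n} → Vec K n
    0v = replicate _ 𝟘

    neg : ∀ {n} → Vec K n → Vec K n
    neg = Vec.map ⊖_

    ⊞-assoc : ∀ {n} (u v w : Vec K n) → u ⊞ v ⊞ w ≡ u ⊞ (v ⊞ w)
    ⊞-assoc [] [] [] = refl
    ⊞-assoc (x ∷ u) (y ∷ v) (z ∷ w) = cong₂ _∷_ (⊕-assoc x y z) (⊞-assoc u v w)

    ⊞-comm : ∀ {n} (u v : Vec K n) → u ⊞ v ≡ v ⊞ u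
    ⊞-comm [] [] = refl
    ⊞-comm (x ∷ u) (y ∷ v) = cong₂ _∷_ (⊕-comm x y) (⊞-comm u v)

    ⊞-0 : ∀ {n} (u : Vec K n) → u ⊞ 0v ≡ u
    ⊞-0 [] = refl
    ⊞-0 (x ∷ u) = cong₂ _∷_ (⊕-identityʳ x) (⊞-0 u)

    ⊞-neg : ∀ {n} (u : Vec K n) → u ⊞ neg u ≡ 0v
    ⊞-neg [] = refl
    ⊞-neg (x ∷ u) = cong₂ _∷_ (⊖-inverseʳ x) (⊞-neg u)

    ⊡-⊞ : ∀ {n} t (u v : Vec K n) → t ⊡ (u ⊞ v) ≡ t ⊡ u ⊞ t ⊡ v
    ⊡-⊞ t [] [] = refl
    ⊡-⊞ t (x ∷ u) (y ∷ v) = cong₂ _∷_ (⊗-distribˡ t x y) (⊡-⊞ t u v)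

    ⊡-⊕ : ∀ {n} s t (u : Vec K n) → (s ⊕ t) ⊡ u ≡ s ⊡ u ⊞ t ⊡ u
    ⊡-⊕ s t [] = refl
    ⊡-⊕ s t (x ∷ u) = cong₂ _∷_ (⊗-distribʳ x s t) (⊡-⊕ s t u)

    ⊡-⊗ : ∀ {n} s t (u : Vec K n) → s ⊡ t ⊡ u ≡ (s ⊗ t) ⊡ u
    ⊡-⊗ s t [] = refl
    ⊡-⊗ s t (x ∷ u) = cong₂ _∷_ (sym (⊗-assoc s t x)) (⊡-⊗ s t u)

    0⊡ : ∀ {n} (u : Vec K n) → 𝟘 ⊡ u ≡ 0v
    0⊡ [] = refl
    0⊡ (x ∷ u) = cong₂ _∷_ (⊗-zeroˡ x) (0⊡ u)

    ⊡0 : ∀ {n} t → t ⊡ 0v {n} ≡ 0v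
    ⊡0 {zero} t = refl
    ⊡0 {suc n} t = cong₂ _∷_ (⊗-zeroʳ t) (⊡0 t)

    1⊡ : ∀ {n} (u : Vec K n) → 𝟙 ⊡ u ≡ u
    1⊡ [] = refl
    1⊡ (x ∷ u) = cong₂ _∷_ (⊗-identityˡ x) (1⊡ u)

    neg-⊡ : ∀ {n} t (u : Vec K n) → neg (t ⊡ u) ≡ (⊖ t) ⊡ u
    neg-⊡ t [] = refl
    neg-⊡ t (x ∷ u) = cong₂ _∷_ (lem t x) (neg-⊡ t u)
      where
      lem : ∀ t x → ⊖ (t ⊗ x) ≡ (⊖ t) ⊗ x
      lem = solve 2 (λ t x → :- (t :* x) := (:- t) :* x) refl

    ⊞-neg-cancel : ∀ {n} (u v : Vec K n) → u ⊞ v ⊞ neg v ≡ u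
    ⊞-neg-cancel u v = trans (⊞-assoc u v (neg v)) (trans (cong (u ⊞_) (⊞-neg v)) (⊞-0 u))

    neg-⊞-cancel : ∀ {n} (u v : Vec K n) → u ⊞ neg v ⊞ v ≡ u
    neg-⊞-cancel u v = trans (⊞-assoc u (neg v) v) (trans (cong (u ⊞_) (trans (⊞-comm (neg v) v) (⊞-neg v))) (⊞-0 u))

    module _ {n : ℕ} where
      open Uniform (vecU n) using () renaming (E to 𝐄)

      𝐄-translate : ∀ (v : Vec K n) φ → 𝐄 (λ F → φ (F ⊞ v)) ≡ 𝐄 φ
      𝐄-translate v = Bijection.E-bij (vecU n) (_⊞ v) (_⊞ neg v) (λ F → neg-⊞-cancel F v) (λ F → ⊞-neg-cancel F v)

    ⊞-swap : ∀ {n} (u v w : Vec K n) → u ⊞ v ⊞ w ≡ u ⊞ w ⊞ v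
    ⊞-swap u v w = trans (⊞-assoc u v w) (trans (cong (u ⊞_) (⊞-comm v w)) (sym (⊞-assoc u w v)))

-- Averaging projections along directions.

module Averages where

  open Rat
  open Mean
  open Field
  open import Data.Nat as ℕ using (ℕ; zero; suc)
  open import Data.Vec using (Vec)
  open import Data.List using (List; []; _∷_; map; _++_; length)
  open import Data.List.Membership.Propositional using (_∈_; _∉_)
  open import Data.List.Relation.Unary.Any using (here; there)
  import Data.List.Membership.DecPropositional as DecMem
  open import Data.Product using (_,_)
  open import Relation.Nullary using (yes; no; Dec)
  open import Relation.Nullary.Decidable using (¬?)
  open import Relation.Binary.PropositionalEquality
  open import Tactic.RingSolver using (solve-∀)

  ⌜_⌝ : ℕ → ℚ
  ⌜ zero ⌝ = 0ℚ
  ⌜ suc k ⌝ = 1ℚ + ⌜ k ⌝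

  0≤⌜⌝ : ∀ k → 0ℚ ≤ ⌜ k ⌝
  0≤⌜⌝ zero = ≤-refl
  0≤⌜⌝ (suc k) = 0≤+ 0≤1 (0≤⌜⌝ k)

  ⌜⌝-mono : ∀ {a b} → a ℕ.≤ b → ⌜ a ⌝ ≤ ⌜ b ⌝
  ⌜⌝-mono {b = b} ℕ.z≤n = 0≤⌜⌝ b
  ⌜⌝-mono (ℕ.s≤s p) = +-mono-≤ (≤-refl {1ℚ}) (⌜⌝-mono p)

  -- Origins: in `C₁`, `⌜ n ⌝` is the rank bound of `tower`, each 4 is the cost of a difference of
  -- two projections, and 3 comes from `T-sh-close`. `C₂` adds the two cases of `decay`, `C₃` is for
  -- `weighted`, `Cst f` for `claim`, and `C₅` for `equidistribution`.
  module Constants (n : ℕ) where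
    C₁ C₂ C₃ : ℚ
    C₁ = 2ℚ * (⌜ n ⌝ * 4ℚ) + 2ℚ * (4ℚ * 3ℚ)
    C₂ = ⌜ n ⌝ + (2ℚ + 2ℚ * 4ℚ)
    C₃ = 2ℚ * C₁ + 2ℚ * C₂

    0≤C₁ : 0ℚ ≤ C₁
    0≤C₁ = 0≤+ (0≤* 0≤2 (0≤* (0≤⌜⌝ n) (0≤+ 0≤2 0≤2))) (0≤* 0≤2 (0≤* (0≤+ 0≤2 0≤2) (0≤+ 0≤2 0≤1)))

    0≤C₃ : 0ℚ ≤ C₃
    0≤C₃ = 0≤+ (0≤* 0≤2 0≤C₁) (0≤* 0≤2 (0≤+ (0≤⌜⌝ n) (0≤+ 0≤2 (0≤* 0≤2 (0≤+ 0≤2 0≤2)))))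

    Cst : ℕ → ℚ
    Cst zero = 0ℚ
    Cst (suc f) = 2ℚ * C₃ + 4ℚ * (C₁ + Cst f)

    0≤Cst : ∀ f → 0ℚ ≤ Cst f
    0≤Cst zero = ≤-refl
    0≤Cst (suc f) = 0≤+ (0≤* 0≤2 0≤C₃) (0≤* (0≤+ 0≤2 0≤2) (0≤+ 0≤C₁ (0≤Cst f)))

    Cst-mono : ∀ f → Cst f ≤ Cst (suc f)
    Cst-mono f = ≤-from (2ℚ * C₃ + 4ℚ * C₁ + 3ℚ * Cst f) (0≤+ (0≤+ (0≤* 0≤2 0≤C₃) (0≤* (0≤+ 0≤2 0≤2) 0≤C₁)) (0≤* (0≤+ 0≤2 0≤1) (0≤Cst f))) (lem C₃ C₁ (Cst f))
      where
      opaque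
        unfolding _+_
        lem : ∀ a b c → 2ℚ * a + 4ℚ * (b + c) - c ≡ 2ℚ * a + 4ℚ * b + 3ℚ * c
        lem = solve-∀ ℚ-ring

    C₅ : ℚ
    C₅ = 2ℚ * (2ℚ * (⌜ n ⌝ * C₃)) + 2ℚ * (2ℚ * (4ℚ * (2ℚ * C₁ + 2ℚ * Cst n)) + 2ℚ)

  module Averaging (𝔽 : FinField) (n : ℕ) where
    open FinField 𝔽
    open FieldFacts 𝔽
    open Space 𝔽
    open VecSpace uniform using (vecU)

    V : Set
    V = Vec K n

    module 𝐊 = Uniform uniform
    module 𝐕 = Uniform (vecU n)
    open 𝐕 using (⟨_,_⟩; ‖_‖²)

    infix 4 _≐_
    _≐_ : (V → ℚ) → (V → ℚ) → Set
    φ ≐ ψ = ∀ F → φ F ≡ ψ F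

    -- Conditional expectation modulo the line of `d`: by `A-adj` and `A-idem` an orthogonal
    -- projection, and by `A-comm` all of these commute.
    A : V → (V → ℚ) → V → ℚ
    A d φ F = 𝐊.E (λ t → φ (F ⊞ t ⊡ d))

    Inv : (V → ℚ) → V → Set
    Inv φ d = ∀ t F → φ (F ⊞ t ⊡ d) ≡ φ F

    A-cong : ∀ d {φ ψ} → φ ≐ ψ → A d φ ≐ A d ψ
    A-cong d p F = 𝐊.E-cong (λ t → p _)

    A-comm : ∀ c d φ → A c (A d φ) ≐ A d (A c φ)
    A-comm c d φ F = trans (𝐊.E-cong (λ s → 𝐊.E-cong (λ t → cong φ (⊞-swap F (s ⊡ c) (t ⊡ d)))))
                           (E-swap uniform uniform (λ s t → φ (F ⊞ t ⊡ d ⊞ s ⊡ c)))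

    A-inv : ∀ d φ → Inv (A d φ) d
    A-inv d φ t F = trans (𝐊.E-cong (λ s → cong φ (trans (⊞-assoc F _ _) (cong (F ⊞_) (trans (sym (⊡-⊕ t s d)) (cong (_⊡ d) (⊕-comm t s)))))))
                          (E-shift t (λ s → φ (F ⊞ s ⊡ d)))

    A-inv′ : ∀ c {d φ} → Inv φ d → Inv (A c φ) d
    A-inv′ c {d} {φ} p t F = 𝐊.E-cong (λ s → trans (cong φ (⊞-swap F (t ⊡ d) (s ⊡ c))) (p t _))

    A-fix : ∀ {d φ} → Inv φ d → A d φ ≐ φ
    A-fix {d} {φ} p F = trans (𝐊.E-cong (λ t → p t F)) (𝐊.E-const (φ F))

    A-- : ∀ d φ ψ → A d (λ F → φ F - ψ F) ≐ (λ F → A d φ F - A d ψ F)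
    A-- d φ ψ F = 𝐊.E-- _ _

    -- For each `t` the substitution `F ↦ F - t d` moves the translation to the other factor, and
    -- `t ↦ - t` restores its sign.
    A-adj : ∀ d φ ψ → ⟨ A d φ , ψ ⟩ ≡ ⟨ φ , A d ψ ⟩
    A-adj d φ ψ = begin
      𝐕.E (λ F → 𝐊.E (λ t → φ (F ⊞ t ⊡ d)) * ψ F)
        ≡⟨ 𝐕.E-cong (λ F → sym (𝐊.E-*ʳ (ψ F) _)) ⟩
      𝐕.E (λ F → 𝐊.E (λ t → φ (F ⊞ t ⊡ d) * ψ F))
        ≡⟨ E-swap (vecU n) uniform _ ⟩
      𝐊.E (λ t → 𝐕.E (λ F → φ (F ⊞ t ⊡ d) * ψ F))
        ≡⟨ 𝐊.E-cong (λ t → trans (sym (𝐄-translate ((⊖ t) ⊡ d) _)) (𝐕.E-cong (λ F → cong (λ G → φ G * ψ (F ⊞ (⊖ t) ⊡ d)) (back t F)))) ⟩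
      𝐊.E (λ t → 𝐕.E (λ F → φ F * ψ (F ⊞ (⊖ t) ⊡ d)))
        ≡⟨ E-⊖ (λ t → 𝐕.E (λ F → φ F * ψ (F ⊞ t ⊡ d))) ⟩
      𝐊.E (λ t → 𝐕.E (λ F → φ F * ψ (F ⊞ t ⊡ d)))
        ≡⟨ E-swap uniform (vecU n) _ ⟩
      𝐕.E (λ F → 𝐊.E (λ t → φ F * ψ (F ⊞ t ⊡ d)))
        ≡⟨ 𝐕.E-cong (λ F → 𝐊.E-*ˡ (φ F) _) ⟩
      ⟨ φ , A d ψ ⟩ ∎
      where
      open ≡-Reasoning
      back : ∀ t F → F ⊞ (⊖ t) ⊡ d ⊞ t ⊡ d ≡ F
      back t F = trans (⊞-assoc F _ _) (trans (cong (F ⊞_) (trans (sym (⊡-⊕ (⊖ t) t d)) (trans (cong (_⊡ d) (⊖-inverseˡ t)) (0⊡ d)))) (⊞-0 F))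

    A-idem : ∀ d φ → A d (A d φ) ≐ A d φ
    A-idem d φ = A-fix (A-inv d φ)

    ‖A‖² : ∀ d φ → ‖ A d φ ‖² ≡ ⟨ φ , A d φ ⟩
    ‖A‖² d φ = trans (A-adj d φ (A d φ)) (𝐕.⟨⟩-cong (λ _ → refl) (A-idem d φ))

    -- The squared norm of a projection is its pairing with `φ`, so Cauchy-Schwarz is quadratic in
    -- the left side and `sq-cancel` applies.
    A-contr : ∀ d φ → ‖ A d φ ‖² ≤ ‖ φ ‖²
    A-contr d φ = sq-cancel (𝐕.0≤‖‖² φ) (≤-trans (subst (λ z → z * z ≤ ‖ φ ‖² * ‖ A d φ ‖²) (sym (‖A‖² d φ)) (CauchySchwarz.cauchy-schwarz (vecU n) φ (A d φ))) ≤-refl)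

    As : List V → (V → ℚ) → V → ℚ
    As [] φ = φ
    As (d ∷ ds) φ = A d (As ds φ)

    As-cong : ∀ ds {φ ψ} → φ ≐ ψ → As ds φ ≐ As ds ψ
    As-cong [] p = p
    As-cong (d ∷ ds) p = A-cong d (As-cong ds p)

    As-inv : ∀ ds φ {d} → d ∈ ds → Inv (As ds φ) d
    As-inv (d ∷ ds) φ (here refl) = A-inv d (As ds φ)
    As-inv (d ∷ ds) φ (there i) = A-inv′ d (As-inv ds φ i)

    As-fix : ∀ ds {φ} → (∀ {d} → d ∈ ds → Inv φ d) → As ds φ ≐ φ
    As-fix [] p F = refl
    As-fix (d ∷ ds) p F = trans (A-cong d (As-fix ds (λ i → p (there i))) F) (A-fix (p (here refl)) F)

    As-A : ∀ ds c φ → As ds (A c φ) ≐ A c (As ds φ)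
    As-A [] c φ F = refl
    As-A (d ∷ ds) c φ F = trans (A-cong d (As-A ds c φ) F) (A-comm d c (As ds φ) F)

    As-As : ∀ ds es φ → As ds (As es φ) ≐ As es (As ds φ)
    As-As ds [] φ F = refl
    As-As ds (e ∷ es) φ F = trans (As-A ds e (As es φ) F) (A-cong e (As-As ds es φ) F)

    As-- : ∀ ds φ ψ → As ds (λ F → φ F - ψ F) ≐ (λ F → As ds φ F - As ds ψ F)
    As-- [] φ ψ F = refl
    As-- (d ∷ ds) φ ψ F = trans (A-cong d (As-- ds φ ψ) F) (A-- d (As ds φ) (As ds ψ) F)

    As-adj : ∀ ds φ ψ → ⟨ As ds φ , ψ ⟩ ≡ ⟨ φ , As ds ψ ⟩
    As-adj [] φ ψ = refl
    As-adj (d ∷ ds) φ ψ = trans (A-adj d (As ds φ) ψ) (trans (As-adj ds φ (A d ψ)) (𝐕.⟨⟩-cong (λ _ → refl) (As-A ds d ψ)))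

    As-contr : ∀ ds φ → ‖ As ds φ ‖² ≤ ‖ φ ‖²
    As-contr [] φ = ≤-refl
    As-contr (d ∷ ds) φ = ≤-trans (A-contr d (As ds φ)) (As-contr ds φ)

    As-idem : ∀ ds φ → As ds (As ds φ) ≐ As ds φ
    As-idem ds φ = As-fix ds (As-inv ds φ)

    As-E : ∀ ds φ → 𝐕.E (As ds φ) ≡ 𝐕.E φ
    As-E [] φ = refl
    As-E (d ∷ ds) φ = trans (E-swap (vecU n) uniform _) (trans (𝐊.E-cong (λ t → 𝐄-translate (t ⊡ d) (As ds φ))) (trans (𝐊.E-const _) (As-E ds φ)))

    infix 4 _⊩_
    -- Linear span through its effect on functions: whatever is constant along `ds` is constant
    -- along `v`. Closure under sums and multiples is then immediate, and no linear combination is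
    -- ever written down.
    _⊩_ : List V → V → Set
    ds ⊩ v = ∀ φ → (∀ {d} → d ∈ ds → Inv φ d) → Inv φ v

    ⊩-∈ : ∀ {ds d} → d ∈ ds → ds ⊩ d
    ⊩-∈ i φ p = p i

    ⊩-⊞ : ∀ {ds u v} → ds ⊩ u → ds ⊩ v → ds ⊩ u ⊞ v
    ⊩-⊞ {ds} {u} {v} p q φ r t F = trans (cong φ (trans (cong (F ⊞_) (⊡-⊞ t u v)) (sym (⊞-assoc F _ _)))) (trans (q φ r t _) (p φ r t F))

    ⊩-⊡ : ∀ {ds v} s → ds ⊩ v → ds ⊩ s ⊡ v
    ⊩-⊡ s p φ r t F = trans (cong (λ w → φ (F ⊞ w)) (⊡-⊗ t s _)) (p φ r (t ⊗ s) F)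

    ⊩-0 : ∀ {ds} → ds ⊩ 0v
    ⊩-0 φ r t F = cong φ (trans (cong (F ⊞_) (⊡0 t)) (⊞-0 F))

    As-⊩ : ∀ ds φ {v} → ds ⊩ v → Inv (As ds φ) v
    As-⊩ ds φ p = p (As ds φ) (As-inv ds φ)

    -- The product of the two commuting projections equals each of them, because the image of each
    -- is invariant along the other family. Hence `As` depends only on the span.
    As-span : ∀ ds es → (∀ {d} → d ∈ ds → es ⊩ d) → (∀ {e} → e ∈ es → ds ⊩ e) → ∀ φ → As ds φ ≐ As es φ
    As-span ds es p q φ F = trans (sym (As-fix es (λ i → As-⊩ ds φ (q i)) F))
                           (trans (As-As es ds φ F) (As-fix ds (λ i → As-⊩ es φ (p i)) F))

    As-absorb : ∀ ds es → (∀ {d} → d ∈ ds → es ⊩ d) → ∀ φ → As ds (As es φ) ≐ As es φ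
    As-absorb ds es p φ = As-fix ds (λ i → As-⊩ es φ (p i))

    As-++ : ∀ ds es φ → As (ds ++ es) φ ≐ As ds (As es φ)
    As-++ [] es φ F = refl
    As-++ (d ∷ ds) es φ F = A-cong d (As-++ ds es φ) F

    record Linear : Set where
      field
        to from : V → V
        to-from : ∀ v → to (from v) ≡ v
        from-to : ∀ v → from (to v) ≡ v
        to-⊞ : ∀ u v → to (u ⊞ v) ≡ to u ⊞ to v
        to-⊡ : ∀ t v → to (t ⊡ v) ≡ t ⊡ to v

      E-to : ∀ φ → 𝐕.E (λ F → φ (to F)) ≡ 𝐕.E φ
      E-to = Bijection.E-bij (vecU n) to from to-from from-to

      A-conj : ∀ d φ → (λ F → A d φ (to F)) ≐ A (from d) (λ F → φ (to F))
      A-conj d φ F = 𝐊.E-cong (λ t → cong φ (sym (trans (to-⊞ F _) (cong (to F ⊞_) (trans (to-⊡ t _) (cong (t ⊡_) (to-from d)))))))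

      -- Substituting `to` carries a line in direction `from d` to a line in direction `d`;
      -- directions therefore transform by the inverse map.
      As-conj : ∀ ds φ → (λ F → As ds φ (to F)) ≐ As (map from ds) (λ F → φ (to F))
      As-conj [] φ F = refl
      As-conj (d ∷ ds) φ F = trans (A-conj d (As ds φ) F) (A-cong (from d) (As-conj ds φ) F)

    module _ (d : K → V) where

      open DecMem _≟_ using (_∈?_)

      data Fresh : List K → List K → Set where
        [] : ∀ {ex} → Fresh ex []
        _∷_ : ∀ {ex b bs} → b ∉ ex → Fresh (b ∷ ex) bs → Fresh ex (b ∷ bs)

      χ : List K → K → ℚ
      χ ex b = ⟦ ¬? (b ∈? ex) ⟧

      χ-∷ : ∀ b ex x → χ ex x ≡ ⟦ x ≟ b ⟧ * χ ex x + χ (b ∷ ex) x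
      χ-∷ b ex x with x ≟ b | x ∈? ex
      ... | yes _ | yes _ = trans (sym (*-zeroʳ 1ℚ)) (sym (+-identityʳ _))
      ... | yes _ | no _ = trans (sym (*-identityʳ 1ℚ)) (sym (+-identityʳ _))
      ... | no _ | yes _ = sym (trans (+-identityʳ _) (*-zeroʳ _))
      ... | no _ | no _ = sym (trans (cong (_+ 1ℚ) (*-zeroˡ _)) (+-identityˡ _))

      -- On the joint spectrum of the commuting projections A (d b), at most k of them can be nonzero at once.
      tower : ∀ k ex φ → (∀ bs → length bs ≡ suc k → Fresh ex bs → As (map d bs) φ ≐ (λ _ → 0ℚ)) →
        𝐊.E (λ b → χ ex b * ⟨ φ , A (d b) φ ⟩) ≤ ⌜ k ⌝ * 𝐊.ω * ‖ φ ‖²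
      tower zero ex φ h = ≤-reflexive (trans (trans (𝐊.E-cong (λ b → zero-term b (b ∈? ex))) (𝐊.E-const 0ℚ)) (lem 𝐊.ω ‖ φ ‖²))
        where
        opaque
          unfolding _+_
          lem : ∀ x y → 0ℚ ≡ 0ℚ * x * y
          lem = solve-∀ ℚ-ring
        zero-term : ∀ b (i : Dec (b ∈ ex)) → ⟦ ¬? i ⟧ * ⟨ φ , A (d b) φ ⟩ ≡ 0ℚ
        zero-term b (yes _) = *-zeroˡ _
        zero-term b (no i) = trans (*-identityˡ _) (trans (𝐕.E-cong (λ F → trans (cong (φ F *_) (h (b ∷ []) refl (i ∷ []) F)) (*-zeroʳ _))) (𝐕.E-const 0ℚ))
      tower (suc k) ex φ h = sq-cancel (0≤* (0≤* (0≤⌜⌝ (suc k)) 𝐊.0≤ω) (𝐕.0≤‖‖² φ)) (begin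
          Y * Y ≡⟨ cong (λ z → z * z) Y≡ ⟩
          ⟨ φ , W ⟩ * ⟨ φ , W ⟩ ≤⟨ CauchySchwarz.cauchy-schwarz (vecU n) φ W ⟩
          ‖ φ ‖² * ‖ W ‖² ≤⟨ *-monoˡ (𝐕.0≤‖‖² φ) ‖W‖²≤ ⟩
          ‖ φ ‖² * (c * Y) ≡⟨ lem ‖ φ ‖² c Y ⟩
          c * ‖ φ ‖² * Y ∎)
        where
        open import Data.Rational.Properties using (module ≤-Reasoning)
        open ≤-Reasoning
        c = ⌜ suc k ⌝ * 𝐊.ω
        opaque
          unfolding _+_
          lem : ∀ x y z → x * (y * z) ≡ y * x * z
          lem = solve-∀ ℚ-ring
        B : K → V → ℚ
        B b = A (d b) φ
        Y = 𝐊.E (λ b → χ ex b * ⟨ φ , B b ⟩)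
        W : V → ℚ
        W F = 𝐊.E (λ b → χ ex b * B b F)
        pull : ∀ (ψ : V → ℚ) → ⟨ ψ , W ⟩ ≡ 𝐊.E (λ b → χ ex b * ⟨ ψ , B b ⟩)
        pull ψ = trans (𝐕.E-cong (λ F → trans (sym (𝐊.E-*ˡ (ψ F) _)) (𝐊.E-cong (λ b → comm3 (ψ F) (χ ex b) (B b F)))))
                (trans (E-swap (vecU n) uniform _) (𝐊.E-cong (λ b → 𝐕.E-*ˡ (χ ex b) _)))
          where
          opaque
            unfolding _+_
            comm3 : ∀ x y z → x * (y * z) ≡ y * (x * z)
            comm3 = solve-∀ ℚ-ring
        Y≡ : Y ≡ ⟨ φ , W ⟩
        Y≡ = sym (pull φ)
        BB : ∀ b b' → ⟨ B b , B b' ⟩ ≡ ⟨ B b , A (d b') (B b) ⟩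
        BB b b' = trans (𝐕.⟨⟩-cong (λ F → sym (A-idem (d b) φ F)) (λ _ → refl))
                 (trans (A-adj (d b) (B b) (B b')) (𝐕.⟨⟩-cong (λ _ → refl) (λ F → A-comm (d b) (d b') φ F)))
        -- The diagonal term `x = b` costs at most `ω` times the squared norm of `B b`. For the
        -- other `x` the induction hypothesis applies to `B b` in place of `φ`, with `b` excluded,
        -- since any `suc k` further projections kill it.
        inner : ∀ b → b ∉ ex → ⟨ B b , W ⟩ ≤ c * ⟨ φ , B b ⟩
        inner b b∉ = begin
          ⟨ B b , W ⟩ ≡⟨ pull (B b) ⟩
          𝐊.E (λ x → χ ex x * ⟨ B b , B x ⟩)
            ≡⟨ 𝐊.E-cong (λ x → trans (cong (_* ⟨ B b , B x ⟩) (χ-∷ b ex x)) (lem₁ _ _ _ _)) ⟩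
          𝐊.E (λ x → ⟦ x ≟ b ⟧ * (χ ex x * ⟨ B b , B x ⟩) + χ (b ∷ ex) x * ⟨ B b , B x ⟩)
            ≡⟨ 𝐊.E-+ _ _ ⟩
          𝐊.E (λ x → ⟦ x ≟ b ⟧ * (χ ex x * ⟨ B b , B x ⟩)) + 𝐊.E (λ x → χ (b ∷ ex) x * ⟨ B b , B x ⟩)
            ≡⟨ cong₂ _+_ (𝐊.E-point b _) (𝐊.E-cong (λ x → cong (χ (b ∷ ex) x *_) (BB b x))) ⟩
          𝐊.ω * (χ ex b * ‖ B b ‖²) + 𝐊.E (λ x → χ (b ∷ ex) x * ⟨ B b , A (d x) (B b) ⟩)
            ≤⟨ +-mono-≤ (*-monoˡ 𝐊.0≤ω (≤-trans (*-monoʳ (𝐕.0≤‖‖² (B b)) (⟦⟧≤1 (¬? (b ∈? ex)))) (≤-reflexive (*-identityˡ _))))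
                        (tower k (b ∷ ex) (B b) (λ bs l f F → trans (As-A (map d bs) (d b) φ F) (h (b ∷ bs) (cong suc l) (b∉ ∷ f) F))) ⟩
          𝐊.ω * ‖ B b ‖² + ⌜ k ⌝ * 𝐊.ω * ‖ B b ‖²
            ≡⟨ lem₂ 𝐊.ω ‖ B b ‖² ⌜ k ⌝ ⟩
          c * ‖ B b ‖² ≡⟨ cong (c *_) (‖A‖² (d b) φ) ⟩
          c * ⟨ φ , B b ⟩ ∎
          where
          opaque
            unfolding _+_
            lem₁ : ∀ p x y z → (p * x + y) * z ≡ p * (x * z) + y * z
            lem₁ = solve-∀ ℚ-ring
          opaque
            unfolding _+_
            lem₂ : ∀ o z k → o * z + k * o * z ≡ (1ℚ + k) * o * z
            lem₂ = solve-∀ ℚ-ring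
        term : ∀ b → χ ex b * ⟨ B b , W ⟩ ≤ c * (χ ex b * ⟨ φ , B b ⟩)
        term b with b ∈? ex
        ... | yes _ = ≤-reflexive (trans (*-zeroˡ _) (sym (trans (cong (c *_) (*-zeroˡ _)) (*-zeroʳ c))))
        ... | no b∉ = subst₂ _≤_ (sym (*-identityˡ _)) (cong (c *_) (sym (*-identityˡ _))) (inner b b∉)
        ‖W‖²≤ : ‖ W ‖² ≤ c * Y
        ‖W‖²≤ = begin
          ‖ W ‖² ≡⟨ pull W ⟩
          𝐊.E (λ b → χ ex b * ⟨ W , B b ⟩) ≡⟨ 𝐊.E-cong (λ b → cong (χ ex b *_) (𝐕.⟨⟩-comm W (B b))) ⟩
          𝐊.E (λ b → χ ex b * ⟨ B b , W ⟩) ≤⟨ 𝐊.E-mono term ⟩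
          𝐊.E (λ b → c * (χ ex b * ⟨ φ , B b ⟩)) ≡⟨ 𝐊.E-*ˡ c _ ⟩
          c * Y ∎

-- Taylor shifts, binomial coefficients in the field, and interpolation.

module Shift where

  open Field
  open import Data.Nat using (ℕ; zero; suc; _≤_; _<_; _∸_; s≤s)
  import Data.Nat.Properties as ℕP
  import Data.Integer as ℤ
  open import Data.Fin using (Fin; zero; suc; toℕ; fromℕ; inject₁; opposite)
  import Data.Fin.Properties as FinP
  open import Data.Vec using (Vec; []; _∷_; _∷ʳ_; lookup; reverse)
  import Data.Vec.Properties as VecP
  open import Data.List using (List; []; _∷_; length)
  open import Data.List.Relation.Unary.All as All using (All; []; _∷_)
  open import Data.List.Relation.Unary.Any using (here; there)
  open import Data.List.Membership.Propositional using (_∈_)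
  open import Data.List.Relation.Unary.AllPairs using (AllPairs; []; _∷_)
  open import Data.Product using (_,_)
  open import Data.Sum using (_⊎_; inj₁; inj₂)
  open import Relation.Nullary using (yes; no)
  open import Relation.Nullary.Negation using (contradiction)
  open import Relation.Binary.PropositionalEquality

  module Shifts (𝔽 : FinField) where
    open FinField 𝔽
    open FieldFacts 𝔽
    open Space 𝔽
    open IntSolver commutativeRing using (solve; _:=_; _:+_; _:*_; :-_; con)

    -- Horner's scheme for `f(x + b)` with coefficients listed from the constant term upwards. Forms
    -- are listed from the leading coefficient downwards, so on them this is the opposite unipotent.
    sh : ∀ {m} → K → Vec K m → Vec K m
    sh b [] = []
    sh b (x ∷ xs) = (x ∷ sh b xs) ⊞ b ⊡ (sh b xs ∷ʳ 𝟘)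

    -- Entry `i` is multiplied by the i-th power of `l`; on a form of degree n listed from the
    -- leading coefficient downwards this is the dilation that sends `f(x)` to `l^n f(x / l)`, for
    -- nonzero `l`.
    tor : ∀ {k} → K → Vec K k → Vec K k
    tor l [] = []
    tor l (x ∷ xs) = x ∷ l ⊡ tor l xs

    ∷ʳ-⊞ : ∀ {m} (u v : Vec K m) x y → (u ∷ʳ x) ⊞ (v ∷ʳ y) ≡ (u ⊞ v) ∷ʳ (x ⊕ y)
    ∷ʳ-⊞ [] [] x y = refl
    ∷ʳ-⊞ (a ∷ u) (b ∷ v) x y = cong (a ⊕ b ∷_) (∷ʳ-⊞ u v x y)

    medial : ∀ {m} (u v w z : Vec K m) → u ⊞ v ⊞ (w ⊞ z) ≡ u ⊞ w ⊞ (v ⊞ z)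
    medial [] [] [] [] = refl
    medial (a ∷ u) (b ∷ v) (c ∷ w) (d ∷ z) = cong₂ _∷_
      (solve 4 (λ a b c d → a :+ b :+ (c :+ d) := a :+ c :+ (b :+ d)) refl a b c d) (medial u v w z)

    sh-⊞ : ∀ {m} b (u v : Vec K m) → sh b (u ⊞ v) ≡ sh b u ⊞ sh b v
    sh-⊞ b [] [] = refl
    sh-⊞ b (x ∷ u) (y ∷ v) = begin
      (x ⊕ y ∷ sh b (u ⊞ v)) ⊞ b ⊡ (sh b (u ⊞ v) ∷ʳ 𝟘)
        ≡⟨ cong (λ w → (x ⊕ y ∷ w) ⊞ b ⊡ (w ∷ʳ 𝟘)) (sh-⊞ b u v) ⟩
      (x ⊕ y ∷ su ⊞ sv) ⊞ b ⊡ ((su ⊞ sv) ∷ʳ 𝟘)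
        ≡⟨ cong (λ w → (x ⊕ y ∷ su ⊞ sv) ⊞ b ⊡ w) (trans (cong ((su ⊞ sv) ∷ʳ_) (sym (⊕-identityʳ 𝟘))) (sym (∷ʳ-⊞ su sv 𝟘 𝟘))) ⟩
      (x ∷ su) ⊞ (y ∷ sv) ⊞ b ⊡ ((su ∷ʳ 𝟘) ⊞ (sv ∷ʳ 𝟘))
        ≡⟨ cong ((x ∷ su) ⊞ (y ∷ sv) ⊞_) (⊡-⊞ b _ _) ⟩
      (x ∷ su) ⊞ (y ∷ sv) ⊞ (b ⊡ (su ∷ʳ 𝟘) ⊞ b ⊡ (sv ∷ʳ 𝟘))
        ≡⟨ medial _ _ _ _ ⟩
      sh b (x ∷ u) ⊞ sh b (y ∷ v) ∎
      where
      open ≡-Reasoning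
      su = sh b u
      sv = sh b v

    ⊡-comm : ∀ {m} s t (u : Vec K m) → s ⊡ t ⊡ u ≡ t ⊡ s ⊡ u
    ⊡-comm s t u = trans (⊡-⊗ s t u) (trans (cong (_⊡ u) (⊗-comm s t)) (sym (⊡-⊗ t s u)))

    sh-⊡ : ∀ {m} b t (u : Vec K m) → sh b (t ⊡ u) ≡ t ⊡ sh b u
    sh-⊡ b t [] = refl
    sh-⊡ b t (x ∷ u) = begin
      (t ⊗ x ∷ sh b (t ⊡ u)) ⊞ b ⊡ (sh b (t ⊡ u) ∷ʳ 𝟘)
        ≡⟨ cong (λ w → (t ⊗ x ∷ w) ⊞ b ⊡ (w ∷ʳ 𝟘)) (sh-⊡ b t u) ⟩
      t ⊡ (x ∷ sh b u) ⊞ b ⊡ (t ⊡ sh b u ∷ʳ 𝟘)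
        ≡⟨ cong (λ w → t ⊡ (x ∷ sh b u) ⊞ b ⊡ w) (trans (cong (t ⊡ sh b u ∷ʳ_) (sym (⊗-zeroʳ t))) (sym (VecP.map-∷ʳ (t ⊗_) 𝟘 (sh b u)))) ⟩
      t ⊡ (x ∷ sh b u) ⊞ b ⊡ t ⊡ (sh b u ∷ʳ 𝟘)
        ≡⟨ cong (t ⊡ (x ∷ sh b u) ⊞_) (⊡-comm b t _) ⟩
      t ⊡ (x ∷ sh b u) ⊞ t ⊡ b ⊡ (sh b u ∷ʳ 𝟘)
        ≡⟨ sym (⊡-⊞ t _ _) ⟩
      t ⊡ sh b (x ∷ u) ∎
      where open ≡-Reasoning

    sh-∷ʳ0 : ∀ {m} b (u : Vec K m) → sh b (u ∷ʳ 𝟘) ≡ sh b u ∷ʳ 𝟘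
    sh-∷ʳ0 b [] = cong (_∷ []) (trans (cong (𝟘 ⊕_) (⊗-zeroʳ b)) (⊕-identityʳ 𝟘))
    sh-∷ʳ0 b (x ∷ u) = begin
      (x ∷ sh b (u ∷ʳ 𝟘)) ⊞ b ⊡ (sh b (u ∷ʳ 𝟘) ∷ʳ 𝟘) ≡⟨ cong (λ w → (x ∷ w) ⊞ b ⊡ (w ∷ʳ 𝟘)) (sh-∷ʳ0 b u) ⟩
      ((x ∷ sh b u) ∷ʳ 𝟘) ⊞ b ⊡ ((sh b u ∷ʳ 𝟘) ∷ʳ 𝟘) ≡⟨ cong (((x ∷ sh b u) ∷ʳ 𝟘) ⊞_) (trans (VecP.map-∷ʳ (b ⊗_) 𝟘 _) (cong (b ⊡ (sh b u ∷ʳ 𝟘) ∷ʳ_) (⊗-zeroʳ b))) ⟩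
      ((x ∷ sh b u) ∷ʳ 𝟘) ⊞ (b ⊡ (sh b u ∷ʳ 𝟘) ∷ʳ 𝟘) ≡⟨ ∷ʳ-⊞ (x ∷ sh b u) _ 𝟘 𝟘 ⟩
      sh b (x ∷ u) ∷ʳ (𝟘 ⊕ 𝟘) ≡⟨ cong (sh b (x ∷ u) ∷ʳ_) (⊕-identityʳ 𝟘) ⟩
      sh b (x ∷ u) ∷ʳ 𝟘 ∎
      where open ≡-Reasoning

    sh-inv : ∀ {m} b c → b ⊕ c ≡ 𝟘 → (u : Vec K m) → sh c (sh b u) ≡ u
    sh-inv b c e [] = refl
    sh-inv b c e (x ∷ u) = begin
      sh c ((x ∷ sh b u) ⊞ b ⊡ (sh b u ∷ʳ 𝟘))
        ≡⟨ trans (sh-⊞ c (x ∷ sh b u) (b ⊡ (sh b u ∷ʳ 𝟘))) (cong (sh c (x ∷ sh b u) ⊞_) (trans (sh-⊡ c b (sh b u ∷ʳ 𝟘)) (cong (b ⊡_) (sh-∷ʳ0 c (sh b u))))) ⟩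
      sh c (x ∷ sh b u) ⊞ b ⊡ (sh c (sh b u) ∷ʳ 𝟘)
        ≡⟨ cong (λ w → (x ∷ w) ⊞ c ⊡ (w ∷ʳ 𝟘) ⊞ b ⊡ (w ∷ʳ 𝟘)) (sh-inv b c e u) ⟩
      (x ∷ u) ⊞ c ⊡ (u ∷ʳ 𝟘) ⊞ b ⊡ (u ∷ʳ 𝟘)
        ≡⟨ trans (⊞-assoc (x ∷ u) _ _) (cong ((x ∷ u) ⊞_) (sym (⊡-⊕ c b _))) ⟩
      (x ∷ u) ⊞ (c ⊕ b) ⊡ (u ∷ʳ 𝟘)
        ≡⟨ cong (λ z → (x ∷ u) ⊞ z ⊡ (u ∷ʳ 𝟘)) (trans (⊕-comm c b) e) ⟩
      (x ∷ u) ⊞ 𝟘 ⊡ (u ∷ʳ 𝟘)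
        ≡⟨ trans (cong ((x ∷ u) ⊞_) (0⊡ _)) (⊞-0 _) ⟩
      x ∷ u ∎
      where open ≡-Reasoning

    basis : ∀ {m} → Fin m → Vec K m
    basis zero = 𝟙 ∷ 0v
    basis (suc i) = 𝟘 ∷ basis i

    lookup-0v : ∀ {m} (i : Fin m) → lookup (0v {m}) i ≡ 𝟘
    lookup-0v i = VecP.lookup-replicate i 𝟘

    lookup-⊞ : ∀ {m} (u v : Vec K m) i → lookup (u ⊞ v) i ≡ lookup u i ⊕ lookup v i
    lookup-⊞ u v i = VecP.lookup-zipWith _⊕_ i u v

    lookup-⊡ : ∀ {m} t (u : Vec K m) i → lookup (t ⊡ u) i ≡ t ⊗ lookup u i
    lookup-⊡ t u i = VecP.lookup-map i (t ⊗_) u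

    lookup-basis : ∀ {m} (i : Fin m) → lookup (basis i) i ≡ 𝟙
    lookup-basis zero = refl
    lookup-basis (suc i) = lookup-basis i

    lookup-basis-≢ : ∀ {m} {i k : Fin m} → i ≢ k → lookup (basis k) i ≡ 𝟘
    lookup-basis-≢ {i = zero} {zero} p = contradiction refl p
    lookup-basis-≢ {i = zero} {suc k} p = refl
    lookup-basis-≢ {i = suc i} {zero} p = lookup-0v i
    lookup-basis-≢ {i = suc i} {suc k} p = lookup-basis-≢ (λ e → p (cong suc e))

    record Subspace {m} (S : Vec K m → Set) : Set where
      field
        S-⊞ : ∀ {u v} → S u → S v → S (u ⊞ v)
        S-⊡ : ∀ {u} t → S u → S (t ⊡ u)
        S-0 : S 0v

    support : ∀ {m} {S : Vec K m → Set} → Subspace S → ∀ v → (∀ i → lookup v i ≡ 𝟘 ⊎ S (basis i)) → S v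
    support sub [] h = Subspace.S-0 sub
    support {suc m} {S} sub (x ∷ v) h = subst S (cong₂ _∷_ (trans (⊕-identityʳ _) refl) (⊞-0v v)) (S-⊞ hd tl)
      where
      open Subspace sub
      ⊞-0v : ∀ v → 0v ⊞ v ≡ v
      ⊞-0v v = trans (⊞-comm 0v v) (⊞-0 v)
      hd : S (x ∷ 0v)
      hd with h zero
      ... | inj₁ refl = S-0
      ... | inj₂ s = subst S (cong₂ _∷_ (⊗-identityʳ x) (⊡0 x)) (S-⊡ x s)
      tl : S (𝟘 ∷ v)
      tl = support {S = λ w → S (𝟘 ∷ w)} (record
        { S-⊞ = λ p q → subst S (cong₂ _∷_ (⊕-identityʳ 𝟘) refl) (S-⊞ p q)
        ; S-⊡ = λ t p → subst S (cong₂ _∷_ (⊗-zeroʳ t) refl) (S-⊡ t p)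
        ; S-0 = S-0 }) v (λ i → h (suc i))

    -- The coefficient of `x^i` in `(x + b)^k`, computed in the field, where it may vanish even for
    -- `i ≤ k`. By `lookup-sh` these are the matrix entries of `sh b`; `bin` is the case `b = 1`.
    mono : K → ℕ → ℕ → K
    mono b zero zero = 𝟙
    mono b zero (suc i) = 𝟘
    mono b (suc k) zero = b ⊗ mono b k zero
    mono b (suc k) (suc i) = mono b k i ⊕ b ⊗ mono b k (suc i)

    mono-< : ∀ b {k i} → k < i → mono b k i ≡ 𝟘
    mono-< b {zero} {suc i} p = refl
    mono-< b {suc k} {suc i} (s≤s p) = trans (cong₂ (λ x y → x ⊕ b ⊗ y) (mono-< b p) (mono-< b (ℕP.m≤n⇒m≤1+n p)))
      (trans (⊕-identityˡ _) (⊗-zeroʳ b))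

    sh-0v : ∀ {m} b → sh b (0v {m}) ≡ 0v
    sh-0v b = trans (cong (sh b) (sym (0⊡ 0v))) (trans (sh-⊡ b 𝟘 0v) (0⊡ _))

    lookup-∷ʳ-toℕ : ∀ {m} (u : Vec K m) (g : ℕ → K) → (∀ i → lookup u i ≡ g (toℕ i)) → g m ≡ 𝟘 → ∀ i → lookup (u ∷ʳ 𝟘) i ≡ g (toℕ i)
    lookup-∷ʳ-toℕ [] g h e zero = sym e
    lookup-∷ʳ-toℕ (x ∷ u) g h e zero = h zero
    lookup-∷ʳ-toℕ (x ∷ u) g h e (suc i) = lookup-∷ʳ-toℕ u (λ j → g (suc j)) (λ i → h (suc i)) e i

    lookup-sh : ∀ {m} b (k i : Fin m) → lookup (sh b (basis k)) i ≡ mono b (toℕ k) (toℕ i)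
    lookup-sh {suc m} b zero i = trans (cong (λ w → lookup ((𝟙 ∷ w) ⊞ b ⊡ (w ∷ʳ 𝟘)) i) (sh-0v b)) (go i)
      where
      0∷ʳ : ∀ m → 0v {m} ∷ʳ 𝟘 ≡ 0v
      0∷ʳ zero = refl
      0∷ʳ (suc m) = cong (𝟘 ∷_) (0∷ʳ m)
      tl : lookup ((𝟙 ∷ 0v) ⊞ b ⊡ (0v {m} ∷ʳ 𝟘)) ≗ lookup (𝟙 ∷ 0v)
      tl i = cong (λ w → lookup w i) (trans (cong ((𝟙 ∷ 0v) ⊞_) (trans (cong (b ⊡_) (0∷ʳ m)) (⊡0 b))) (⊞-0 _))
      go : ∀ i → lookup ((𝟙 ∷ 0v) ⊞ b ⊡ (0v {m} ∷ʳ 𝟘)) i ≡ mono b 0 (toℕ i)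
      go zero = tl zero
      go (suc i) = trans (tl (suc i)) (lookup-0v i)
    lookup-sh {suc m} b (suc k) i = trans (lookup-⊞ (𝟘 ∷ g) (b ⊡ (g ∷ʳ 𝟘)) i)
        (trans (cong (lookup (𝟘 ∷ g) i ⊕_) (trans (lookup-⊡ b (g ∷ʳ 𝟘) i) (cong (b ⊗_) (lookup-∷ʳ-toℕ g (mono b (toℕ k)) (lookup-sh b k) (mono-< b (FinP.toℕ<n k)) i)))) (fin i))
      where
      g = sh b (basis k)
      fin : ∀ i → lookup (𝟘 ∷ g) i ⊕ b ⊗ mono b (toℕ k) (toℕ i) ≡ mono b (suc (toℕ k)) (toℕ i)
      fin zero = ⊕-identityˡ _
      fin (suc i) = cong (_⊕ b ⊗ mono b (toℕ k) (suc (toℕ i))) (lookup-sh b k i)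

    pow : K → ℕ → K
    pow b zero = 𝟙
    pow b (suc k) = b ⊗ pow b k

    bin : ℕ → ℕ → K
    bin = mono 𝟙

    mono-bin : ∀ b k i → mono b k i ≡ bin k i ⊗ pow b (k ∸ i)
    mono-bin b zero zero = sym (⊗-identityʳ 𝟙)
    mono-bin b zero (suc i) = sym (⊗-zeroˡ _)
    mono-bin b (suc k) zero = trans (cong (b ⊗_) (mono-bin b k zero)) (solve 3 (λ b x y → b :* (x :* y) := (con (ℤ.+ 1) :* x) :* (b :* y)) refl b (bin k 0) (pow b k))
    mono-bin b (suc k) (suc i) = trans (cong₂ (λ x y → x ⊕ b ⊗ y) (mono-bin b k i) (mono-bin b k (suc i))) (step (ℕP.<-≤-connex i k))
      where
      -- Exponents are truncated differences. For `i < k` one factor `b` splits off; for `k ≤ i` the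
      -- exponent no longer drops, but there `bin k (suc i)` is 0.
      step : i < k ⊎ k ≤ i → bin k i ⊗ pow b (k ∸ i) ⊕ b ⊗ (bin k (suc i) ⊗ pow b (k ∸ suc i)) ≡ (bin k i ⊕ 𝟙 ⊗ bin k (suc i)) ⊗ pow b (k ∸ i)
      step (inj₁ p) rewrite ℕP.+-∸-assoc 1 p = solve 4 (λ x y b z → x :* (b :* z) :+ b :* (y :* z) := (x :+ con (ℤ.+ 1) :* y) :* (b :* z)) refl (bin k i) (bin k (suc i)) b (pow b (k ∸ suc i))
      step (inj₂ p) rewrite mono-< 𝟙 (s≤s p) = solve 4 (λ x b z w → x :* w :+ b :* (con (ℤ.+ 0) :* z) := (x :+ con (ℤ.+ 1) :* con (ℤ.+ 0)) :* w) refl (bin k i) b (pow b (k ∸ suc i)) (pow b (k ∸ i))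

    bin-diag : ∀ k → bin k k ≡ 𝟙
    bin-diag zero = refl
    bin-diag (suc k) = trans (cong₂ (λ x y → x ⊕ 𝟙 ⊗ y) (bin-diag k) (mono-< 𝟙 (ℕP.n<1+n k))) (trans (cong (𝟙 ⊕_) (⊗-zeroʳ 𝟙)) (⊕-identityʳ 𝟙))

    bin-0 : ∀ k → bin k 0 ≡ 𝟙
    bin-0 zero = refl
    bin-0 (suc k) = trans (⊗-identityˡ _) (bin-0 k)

    lookup-∷ʳ-inject₁ : ∀ {m} (u : Vec K m) x i → lookup (u ∷ʳ x) (inject₁ i) ≡ lookup u i
    lookup-∷ʳ-inject₁ (y ∷ u) x zero = refl
    lookup-∷ʳ-inject₁ (y ∷ u) x (suc i) = lookup-∷ʳ-inject₁ u x i

    lookup-∷ʳ-fromℕ : ∀ {m} (u : Vec K m) x → lookup (u ∷ʳ x) (fromℕ m) ≡ x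
    lookup-∷ʳ-fromℕ [] x = refl
    lookup-∷ʳ-fromℕ (y ∷ u) x = lookup-∷ʳ-fromℕ u x

    lookup-reverse : ∀ {m} (v : Vec K m) i → lookup (reverse v) (opposite i) ≡ lookup v i
    lookup-reverse (x ∷ v) zero = trans (cong (λ w → lookup w (opposite (zero {_}))) (VecP.reverse-∷ x v)) (lookup-∷ʳ-fromℕ (reverse v) x)
    lookup-reverse (x ∷ v) (suc i) = trans (cong (λ w → lookup w (inject₁ (opposite i))) (VecP.reverse-∷ x v)) (trans (lookup-∷ʳ-inject₁ (reverse v) x (opposite i)) (lookup-reverse v i))

    lookup-reverse′ : ∀ {m} (v : Vec K m) i → lookup (reverse v) i ≡ lookup v (opposite i)
    lookup-reverse′ v i = trans (cong (lookup (reverse v)) (sym (FinP.opposite-involutive i))) (lookup-reverse v (opposite i))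

    lookup-ext : ∀ {m} {u v : Vec K m} → (∀ i → lookup u i ≡ lookup v i) → u ≡ v
    lookup-ext {u = []} {[]} h = refl
    lookup-ext {u = x ∷ u} {y ∷ v} h = cong₂ _∷_ (h zero) (lookup-ext (λ i → h (suc i)))

    reverse-⊞ : ∀ {m} (u v : Vec K m) → reverse (u ⊞ v) ≡ reverse u ⊞ reverse v
    reverse-⊞ u v = lookup-ext (λ i → trans (lookup-reverse′ (u ⊞ v) i) (trans (lookup-⊞ u v (opposite i))
      (sym (trans (lookup-⊞ (reverse u) (reverse v) i) (cong₂ _⊕_ (lookup-reverse′ u i) (lookup-reverse′ v i))))))

    reverse-⊡ : ∀ {m} t (u : Vec K m) → reverse (t ⊡ u) ≡ t ⊡ reverse u
    reverse-⊡ t u = sym (VecP.map-reverse (t ⊗_) u)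

    reverse-basis : ∀ {m} (k : Fin m) → reverse (basis k) ≡ basis (opposite k)
    reverse-basis k = lookup-ext go
      where
      go : ∀ i → lookup (reverse (basis k)) i ≡ lookup (basis (opposite k)) i
      go i with i FinP.≟ opposite k
      ... | yes refl = trans (lookup-reverse (basis k) k) (trans (lookup-basis k) (sym (lookup-basis (opposite k))))
      ... | no p = trans (lookup-reverse′ (basis k) i) (trans (lookup-basis-≢ (λ e → p (trans (sym (FinP.opposite-involutive i)) (cong opposite e)))) (sym (lookup-basis-≢ p)))

    -- The translation of the variable on coefficients listed from the leading one downwards; `sh`
    -- is its conjugate by reversal.
    sh⁺ : ∀ {m} → K → Vec K m → Vec K m
    sh⁺ a v = reverse (sh a (reverse v))

    sh⁺-⊞ : ∀ {m} b (u v : Vec K m) → sh⁺ b (u ⊞ v) ≡ sh⁺ b u ⊞ sh⁺ b v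
    sh⁺-⊞ b u v = trans (cong (λ w → reverse (sh b w)) (reverse-⊞ u v)) (trans (cong reverse (sh-⊞ b (reverse u) (reverse v))) (reverse-⊞ (sh b (reverse u)) (sh b (reverse v))))

    sh⁺-⊡ : ∀ {m} b t (u : Vec K m) → sh⁺ b (t ⊡ u) ≡ t ⊡ sh⁺ b u
    sh⁺-⊡ b t u = trans (cong (λ w → reverse (sh b w)) (reverse-⊡ t u)) (trans (cong reverse (sh-⊡ b t (reverse u))) (reverse-⊡ t (sh b (reverse u))))

    sh⁺-inv : ∀ {m} b c → b ⊕ c ≡ 𝟘 → (u : Vec K m) → sh⁺ c (sh⁺ b u) ≡ u
    sh⁺-inv b c e u = trans (cong (λ w → reverse (sh c w)) (VecP.reverse-involutive (sh b (reverse u)))) (trans (cong reverse (sh-inv b c e (reverse u))) (VecP.reverse-involutive u))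

    lookup-sh⁺ : ∀ {m} b (k i : Fin m) → lookup (sh⁺ b (basis k)) i ≡ mono b (toℕ (opposite k)) (toℕ (opposite i))
    lookup-sh⁺ b k i = trans (lookup-reverse′ (sh b (reverse (basis k))) i) (trans (cong (λ w → lookup (sh b w) (opposite i)) (reverse-basis k)) (lookup-sh b (opposite k) (opposite i)))

    peval : ∀ {m} → List (Vec K m) → K → Vec K m
    peval [] b = 0v
    peval (c ∷ cs) b = c ⊞ b ⊡ peval cs b

    -- Synthetic division by `x - b`: the coefficients of the quotient are the Horner values of the
    -- proper tails.
    quot : ∀ {m} → K → List (Vec K m) → List (Vec K m)
    quot b [] = []
    quot b (c ∷ []) = []
    quot b (c ∷ cs@(_ ∷ _)) = peval cs b ∷ quot b cs

    length-quot : ∀ {m} b (c : Vec K m) cs → length (quot b (c ∷ cs)) ≡ length cs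
    length-quot b c [] = refl
    length-quot b c (d ∷ cs) = cong suc (length-quot b d cs)

    peval-quot : ∀ {m} a b (cs : List (Vec K m)) → peval cs b ≡ peval cs a ⊞ (b ⊝ a) ⊡ peval (quot a cs) b
    peval-quot a b [] = sym (trans (cong (0v ⊞_) (⊡0 _)) (⊞-0 0v))
    peval-quot a b (c ∷ []) = sym (trans (cong (c ⊞ a ⊡ 0v ⊞_) (⊡0 _)) (trans (⊞-0 _) (cong (c ⊞_) (trans (⊡0 a) (sym (⊡0 b))))))
    peval-quot a b (c ∷ cs@(_ ∷ _)) = trans (cong (λ w → c ⊞ b ⊡ w) (peval-quot a b cs)) (go c (peval cs a) (peval (quot a cs) b))
      where
      go : ∀ {m} (c p q : Vec K m) → c ⊞ b ⊡ (p ⊞ (b ⊝ a) ⊡ q) ≡ c ⊞ a ⊡ p ⊞ (b ⊝ a) ⊡ (p ⊞ b ⊡ q)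
      go [] [] [] = refl
      go (c ∷ cs) (p ∷ ps) (q ∷ qs) = cong₂ _∷_ (solve 5 (λ a b c p q → c :+ b :* (p :+ (b :+ :- a) :* q) := c :+ a :* p :+ (b :+ :- a) :* (p :+ b :* q)) refl a b c p q) (go cs ps qs)

    -- Divided differences replace the determinant. By `peval-quot` the value at `b` minus the value
    -- at `a` is `b - a` times a value of the quotient, which has one coefficient fewer; `rebuild`
    -- recovers the original coefficients from those of the quotient and the value at `a`.
    vandermonde : ∀ {m} {S : Vec K m → Set} → Subspace S → ∀ bs cs → length bs ≡ length cs → AllPairs _≢_ bs →
      (∀ {b} → b ∈ bs → S (peval cs b)) → All S cs
    vandermonde sub [] [] l d h = []
    vandermonde {S = S} sub (a ∷ bs) (c ∷ cs) l (a∉ ∷ d) h = rebuild c cs (h (here refl))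
        (vandermonde sub bs (quot a (c ∷ cs)) (trans (ℕP.suc-injective l) (sym (length-quot a c cs))) d quots)
      where
      open Subspace sub
      minus : ∀ {u v} → S (u ⊞ v) → S u → S v
      minus {u} {v} p q = subst S (trans (cong (u ⊞ v ⊞_) (trans (sym (neg-⊡ 𝟙 u)) (cong neg (1⊡ u)))) (trans (cong (_⊞ neg u) (⊞-comm u v)) (⊞-neg-cancel v u))) (S-⊞ p (S-⊡ (⊖ 𝟙) q))
      quots : ∀ {b} → b ∈ bs → S (peval (quot a (c ∷ cs)) b)
      quots {b} i with inverse (b ⊝ a) (λ e → All.lookup a∉ i (sym (⊝≡0 e)))
      ... | y , by = subst S (trans (⊡-⊗ y (b ⊝ a) _) (trans (cong (_⊡ peval (quot a (c ∷ cs)) b) (trans (⊗-comm y _) by)) (1⊡ _)))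
                       (S-⊡ y (minus (subst S (peval-quot a b (c ∷ cs)) (h (there i))) (h (here refl))))
      rebuild : ∀ c cs → S (peval (c ∷ cs) a) → All S (quot a (c ∷ cs)) → All S (c ∷ cs)
      rebuild c [] p [] = subst S (trans (cong (c ⊞_) (⊡0 a)) (⊞-0 c)) p ∷ []
      rebuild c (c′ ∷ cs) p (q ∷ qs) = minus (subst S (⊞-comm c _) p) (S-⊡ a q) ∷ rebuild c′ cs q qs

-- Vanishing of binomial coefficients and closed sets of indices.

module Binomial where

  open Field
  open Shift
  open import Data.Bool using (Bool; true; false; _∧_)
  open import Data.Nat using (zero; suc; _≤_; _<_; _∸_; _+_; _*_; s≤s; z≤n; _!)
  import Data.Nat.Properties as ℕP
  import Data.Nat.DivMod as DivMod
  open import Data.Nat.Combinatorics using (_C_; nCk≡nC[n∸k]; nCk+nC[k+1]≡[n+1]C[k+1]; k![n∸k]!∣n!; k>n⇒nCk≡0)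
  open import Data.Nat.Combinatorics.Specification using (nCk≡n!/k![n-k]!)
  open import Data.Fin using (Fin; zero; suc; toℕ; fromℕ<; opposite)
  import Data.Fin.Properties as FinP
  open import Data.Product using (_×_; _,_)
  open import Data.Sum using (_⊎_; inj₁; inj₂)
  open import Relation.Nullary using (yes; no; does)
  open import Relation.Nullary.Negation using (contradiction)
  open import Relation.Binary.PropositionalEquality
  open import Algebra.Bundles using (CommutativeRing)
  open import Data.Nat.Tactic.RingSolver using (solve-∀)

  C-! : ∀ {n k} → k ≤ n → (n C k) * (k ! * (n ∸ k) !) ≡ n !
  C-! {n} {k} p = trans (cong (_* (k ! * (n ∸ k) !)) (nCk≡n!/k![n-k]! p)) (DivMod.m/n*n≡m (k![n∸k]!∣n! p))
    where instance _ = ℕP._!*_!≢0 k (n ∸ k)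

  -- Multiplied by `i! (k - i)! (m - k)!`, both sides become `m!`.
  trinomial : ∀ {i k m} → i ≤ k → k ≤ m → (k C i) * (m C k) ≡ (m C i) * ((m ∸ i) C (k ∸ i))
  trinomial {i} {k} {m} i≤k k≤m = ℕP.*-cancelʳ-≡ _ _ (i ! * (x ! * y !)) (begin
    (k C i) * (m C k) * (i ! * (x ! * y !)) ≡⟨ lem₁ (k C i) (m C k) (i !) (x !) (y !) ⟩
    (m C k) * ((k C i) * (i ! * x !) * y !) ≡⟨ cong (λ z → (m C k) * (z * y !)) (C-! i≤k) ⟩
    (m C k) * (k ! * y !) ≡⟨ C-! k≤m ⟩
    m ! ≡⟨ C-! (ℕP.≤-trans i≤k k≤m) ⟨
    (m C i) * (i ! * (m ∸ i) !) ≡⟨ cong (λ z → (m C i) * (i ! * z)) (trans (cong (λ z → ((m ∸ i) C x) * (x ! * z !)) y≡) (C-! (ℕP.∸-monoˡ-≤ i k≤m))) ⟨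
    (m C i) * (i ! * (((m ∸ i) C x) * (x ! * y !))) ≡⟨ lem₂ (m C i) ((m ∸ i) C x) (i !) (x !) (y !) ⟩
    (m C i) * ((m ∸ i) C x) * (i ! * (x ! * y !)) ∎)
    where
    open ≡-Reasoning
    x = k ∸ i
    y = m ∸ k
    instance
      _ = ℕP.m*n≢0 (i !) (x ! * y !) {{i ℕP.!≢0}} {{ℕP._!*_!≢0 x y}}
    y≡ : y ≡ (m ∸ i) ∸ x
    y≡ = sym (trans (ℕP.∸-+-assoc m i x) (cong (m ∸_) (ℕP.m+[n∸m]≡n i≤k)))
    lem₁ : ∀ a b c d e → a * b * (c * (d * e)) ≡ b * (a * (c * d) * e)
    lem₁ = solve-∀
    lem₂ : ∀ a b c d e → a * (c * (b * (d * e))) ≡ a * b * (c * (d * e))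
    lem₂ = solve-∀

  module Closure (𝔽 : FinField) where
    open FinField 𝔽
    open FieldFacts 𝔽
    open Shifts 𝔽
    open import Algebra.Properties.Semiring.Mult (CommutativeRing.semiring commutativeRing) using (×-homo-+; ×1-homo-*) renaming (_×_ to _⊙_)

    bin-C : ∀ k i → bin k i ≡ (k C i) ⊙ 𝟙
    bin-C zero zero = sym (⊕-identityʳ 𝟙)
    bin-C zero (suc i) = sym (cong (_⊙ 𝟙) (k>n⇒nCk≡0 {0} {suc i} (s≤s z≤n)))
    bin-C (suc k) zero = trans (⊗-identityˡ _) (bin-C k zero)
    bin-C (suc k) (suc i) = trans (cong₂ _⊕_ (bin-C k i) (trans (⊗-identityˡ _) (bin-C k (suc i))))
      (trans (sym (×-homo-+ 𝟙 (k C i) (k C suc i))) (cong (_⊙ 𝟙) (nCk+nC[k+1]≡[n+1]C[k+1] k i)))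

    bin-sym : ∀ {k i} → i ≤ k → bin k (k ∸ i) ≡ bin k i
    bin-sym {k} {i} p = trans (bin-C k (k ∸ i)) (trans (cong (_⊙ 𝟙) (sym (nCk≡nC[n∸k] p))) (sym (bin-C k i)))

    -- Read in the field, `trinomial` makes `bin k i ⊗ bin m k` a multiple of `bin m i`, and a field
    -- has no zero divisors. This is what carries closedness over to the reduced set.
    bin-chain : ∀ {m k i} → k ≤ m → bin m i ≡ 𝟘 → bin m k ≢ 𝟘 → bin k i ≡ 𝟘
    bin-chain {m} {k} {i} k≤m mi mk with ℕP.<-≤-connex k i
    ... | inj₁ k<i = mono-< 𝟙 k<i
    ... | inj₂ i≤k = integral (trans (⊗-comm (bin m k) (bin k i)) (begin
      bin k i ⊗ bin m k ≡⟨ cong₂ _⊗_ (bin-C k i) (bin-C m k) ⟩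
      ((k C i) ⊙ 𝟙) ⊗ ((m C k) ⊙ 𝟙) ≡⟨ ×1-homo-* (k C i) (m C k) ⟨
      ((k C i) * (m C k)) ⊙ 𝟙 ≡⟨ cong (_⊙ 𝟙) (trinomial i≤k k≤m) ⟩
      ((m C i) * ((m ∸ i) C (k ∸ i))) ⊙ 𝟙 ≡⟨ ×1-homo-* (m C i) _ ⟩
      ((m C i) ⊙ 𝟙) ⊗ (((m ∸ i) C (k ∸ i)) ⊙ 𝟙) ≡⟨ cong (_⊗ (((m ∸ i) C (k ∸ i)) ⊙ 𝟙)) (trans (sym (bin-C m i)) mi) ⟩
      𝟘 ⊗ _ ≡⟨ ⊗-zeroˡ _ ⟩
      𝟘 ∎)) mk
      where open ≡-Reasoning

    -- Iterated differences: by Pascal's rule, zeros at two consecutive upper indices give a zero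
    -- with the lower index reduced by one. From `j + 1` consecutive zeros this can be done `j`
    -- times.
    bin-diff : ∀ j m r → (∀ t → t ≤ j → bin (t + m) (j + r) ≡ 𝟘) → bin m r ≡ 𝟘
    bin-diff zero m r h = h 0 z≤n
    bin-diff (suc j) m r h = bin-diff j m r (λ t t≤j → down {t + m} {j + r} (h (suc t) (s≤s t≤j)) (h t (ℕP.m≤n⇒m≤1+n t≤j)))
      where
      down : ∀ {k i} → bin (suc k) (suc i) ≡ 𝟘 → bin k (suc i) ≡ 𝟘 → bin k i ≡ 𝟘
      down {k} {i} p q = trans (sym (⊕-identityʳ _)) (trans (cong (bin k i ⊕_) (trans (sym (⊗-identityˡ 𝟘)) (cong (𝟙 ⊗_) (sym q)))) p)

    -- `cl` says that no `sh b` leads from a coordinate outside `B` into `B`; together with `op` the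
    -- same holds for `sh⁺ b`, the conjugate by reversal.
    record Closed {n} (B : Fin (suc n) → Bool) : Set where
      field
        cl : ∀ {i k} → B i ≡ true → B k ≡ false → bin (toℕ k) (toℕ i) ≡ 𝟘
        op : ∀ {i} → B i ≡ true → B (opposite i) ≡ true

    next : ∀ {n} → (Fin (suc n) → Bool) → Fin (suc n) → Fin (suc n) → Bool
    next B i₀ i = B i ∧ does (bin (toℕ i₀) (toℕ i) ≟ 𝟘)

    next-true : ∀ {n} (B : Fin (suc n) → Bool) i₀ {i} → next B i₀ i ≡ true → B i ≡ true × bin (toℕ i₀) (toℕ i) ≡ 𝟘
    next-true B i₀ {i} e with B i | bin (toℕ i₀) (toℕ i) ≟ 𝟘 | e
    ... | true | yes p | _ = refl , p
    ... | true | no p | ()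
    ... | false | _ | ()

    next-true⁻ : ∀ {n} (B : Fin (suc n) → Bool) i₀ {i} → B i ≡ true → bin (toℕ i₀) (toℕ i) ≡ 𝟘 → next B i₀ i ≡ true
    next-true⁻ B i₀ {i} b z with B i | bin (toℕ i₀) (toℕ i) ≟ 𝟘
    ... | true | yes p = refl
    ... | true | no p = contradiction z p
    next-true⁻ B i₀ {i} () z | false | _

    next-false : ∀ {n} (B : Fin (suc n) → Bool) i₀ {i} → next B i₀ i ≡ false → B i ≡ false ⊎ bin (toℕ i₀) (toℕ i) ≢ 𝟘
    next-false B i₀ {i} e with B i | bin (toℕ i₀) (toℕ i) ≟ 𝟘 | e
    ... | true | yes p | ()
    ... | true | no p | _ = inj₂ p
    ... | false | _ | _ = inj₁ refl

    module _ {n} {B : Fin (suc n) → Bool} (closed : Closed B) (i₀ : Fin (suc n)) (B₀ : B i₀ ≡ true)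
             (maxi : ∀ k → B k ≡ true → toℕ k ≤ toℕ i₀) where
      open Closed closed

      -- Put `p = i₀` and `N = n - p`. As `n - i` lies in `B`, it is at most `p`, so `i ≥ N`. The
      -- coefficients `bin (t + p) i` vanish for `t ≤ N`: at `t = 0` by assumption, later because
      -- `t + p` lies beyond the maximum of `B`. Then `bin-diff` gives `bin p (i - N) = 0`, which
      -- equals `bin p (n - i)` by symmetry.
      next-op : ∀ {i} → B i ≡ true → bin (toℕ i₀) (toℕ i) ≡ 𝟘 → bin (toℕ i₀) (toℕ (opposite i)) ≡ 𝟘
      next-op {i} b z = trans (cong (bin p) eq) (trans (bin-sym r≤p) (bin-diff N p r vanish))
        where
        open ≡-Reasoning
        p = toℕ i₀
        N = n ∸ p
        p≤n : p ≤ n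
        p≤n = FinP.toℕ≤pred[n] i₀
        i≤n : toℕ i ≤ n
        i≤n = FinP.toℕ≤pred[n] i
        oi : toℕ (opposite i) ≡ n ∸ toℕ i
        oi = FinP.opposite-prop i
        N≤i : N ≤ toℕ i
        N≤i = subst (_≤ toℕ i) refl (ℕP.≤-trans (ℕP.∸-monoʳ-≤ n (subst (_≤ p) oi (maxi (opposite i) (op b)))) (ℕP.≤-reflexive (ℕP.m∸[m∸n]≡n i≤n)))
        r = toℕ i ∸ N
        r+N : N + r ≡ toℕ i
        r+N = ℕP.m+[n∸m]≡n N≤i
        r≤p : r ≤ p
        r≤p = ℕP.≤-trans (ℕP.∸-monoˡ-≤ N i≤n) (ℕP.≤-reflexive (ℕP.m∸[m∸n]≡n p≤n))
        eq : toℕ (opposite i) ≡ p ∸ r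
        eq = begin
          toℕ (opposite i) ≡⟨ oi ⟩
          n ∸ toℕ i ≡⟨ cong (n ∸_) r+N ⟨
          n ∸ (N + r) ≡⟨ ℕP.∸-+-assoc n N r ⟨
          n ∸ N ∸ r ≡⟨ cong (_∸ r) (ℕP.m∸[m∸n]≡n p≤n) ⟩
          p ∸ r ∎
        vanish : ∀ t → t ≤ N → bin (t + p) (N + r) ≡ 𝟘
        vanish zero _ = trans (cong (bin p) r+N) z
        vanish (suc t) t<N = trans (cong₂ bin (sym (FinP.toℕ-fromℕ< lt)) r+N) (cl b (out k refl))
          where
          lt : suc t + p < suc n
          lt = s≤s (ℕP.≤-trans (ℕP.+-monoˡ-≤ p t<N) (ℕP.≤-reflexive (ℕP.m∸n+n≡m p≤n)))
          k = fromℕ< lt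
          out : ∀ k → k ≡ fromℕ< lt → B k ≡ false
          out k refl with B k in e
          ... | false = refl
          ... | true = contradiction (subst (_≤ p) (FinP.toℕ-fromℕ< lt) (maxi k e)) (ℕP.<⇒≱ (s≤s (ℕP.m≤n+m p t)))

      -- An index leaves the reduced set in two ways. Outside `B` the old closedness applies; inside
      -- `B` its binomial coefficient with `i₀` is nonzero, and `bin-chain` through `i₀` applies.
      next-closed : Closed (next B i₀)
      next-closed = record { cl = cl′ ; op = op′ }
        where
        cl′ : ∀ {i k} → next B i₀ i ≡ true → next B i₀ k ≡ false → bin (toℕ k) (toℕ i) ≡ 𝟘
        cl′ {i} {k} e f with next-true B i₀ e | next-false B i₀ {k} f | B k in bk
        ... | b , z | inj₁ g | true = contradiction (trans (sym bk) g) (λ ())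
        ... | b , z | inj₁ g | false = cl b bk
        ... | b , z | inj₂ g | false = cl b bk
        ... | b , z | inj₂ g | true = bin-chain (maxi k bk) z g
        op′ : ∀ {i} → next B i₀ i ≡ true → next B i₀ (opposite i) ≡ true
        op′ {i} e with next-true B i₀ e
        ... | b , z = next-true⁻ B i₀ (op b) (next-op b z)

-- Directions of averaging and their spans.

module Stage where

  open Rat
  open Field
  open Averages
  open Shift
  open Binomial
  open import Data.Bool using (Bool; true; false)
  import Data.Bool as Bool
  open import Data.Nat as ℕ using (ℕ; zero; suc; _∸_)
  import Data.Nat.Properties as ℕP
  open import Data.Fin using (Fin; zero; suc; toℕ)
  import Data.Fin.Properties as FinP
  open import Data.Vec using ([]; _∷_; lookup; tabulate)
  import Data.Vec.Properties as VecP
  open import Data.List as List using (List; []; _∷_; map; length; _++_)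
  open import Data.List.Membership.Propositional using (_∈_; _∉_)
  open import Data.List.Membership.Propositional.Properties using (∈-map⁺; ∈-map⁻; ∈-filter⁺; ∈-filter⁻; ∈-allFin; ∈-++⁺ˡ; ∈-++⁺ʳ)
  open import Data.List.Relation.Unary.Any using (here; there)
  open import Data.List.Relation.Unary.All as All using (All; []; _∷_)
  open import Data.List.Relation.Unary.AllPairs using (AllPairs; []; _∷_)
  open import Data.Product using (∃; _×_; _,_; proj₁; proj₂)
  open import Data.Sum using (_⊎_; inj₁; inj₂)
  open import Relation.Nullary using (yes; no; Dec)
  open import Relation.Nullary.Negation using (contradiction)
  open import Relation.Binary.PropositionalEquality

  module Directions (𝔽 : FinField) (n : ℕ) where
    open FinField 𝔽
    open FieldFacts 𝔽
    open Space 𝔽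
    open Shifts 𝔽
    open Closure 𝔽
    open Averaging 𝔽 (suc n)

    B-Set : Set
    B-Set = Fin (suc n) → Bool

    off : B-Set → List V
    off B = map basis (List.filter (λ i → B i Bool.≟ false) (List.allFin (suc n)))

    off-∈ : ∀ B {i} → B i ≡ false → basis i ∈ off B
    off-∈ B {i} e = ∈-map⁺ basis (∈-filter⁺ (λ i → B i Bool.≟ false) (∈-allFin i) e)

    off-∈⁻ : ∀ B {d} → d ∈ off B → ∃ λ i → B i ≡ false × d ≡ basis i
    off-∈⁻ B m with ∈-map⁻ basis m
    ... | i , i∈ , refl = i , proj₂ (∈-filter⁻ (λ i → B i Bool.≟ false) {xs = List.allFin (suc n)} i∈) , refl

    span-sub : ∀ ds → Subspace (ds ⊩_)
    span-sub ds = record { S-⊞ = ⊩-⊞ ; S-⊡ = ⊩-⊡ ; S-0 = ⊩-0 }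

    off-⊩ : ∀ B {v} → (∀ i → B i ≡ true → lookup v i ≡ 𝟘) → off B ⊩ v
    off-⊩ B {v} h = support (span-sub (off B)) v go
      where
      go : ∀ i → lookup v i ≡ 𝟘 ⊎ off B ⊩ basis i
      go i with B i in e
      ... | true = inj₁ (h i e)
      ... | false = inj₂ (⊩-∈ (off-∈ B e))

    -- A function that is invariant along the image directions becomes, composed with `g`, invariant
    -- along `ds`; the right inverse `h` lets every point be written as `g` of something.
    ⊩-map : ∀ {g h : V → V} → (∀ u v → g (u ⊞ v) ≡ g u ⊞ g v) → (∀ t v → g (t ⊡ v) ≡ t ⊡ g v) → (∀ v → g (h v) ≡ v) →
      ∀ {ds v} → ds ⊩ v → map g ds ⊩ g v
    ⊩-map {g} {h} g⊞ g⊡ gh {ds} {v} p φ r t F = trans (cong φ (trans (cong (_⊞ t ⊡ g v) (sym (gh F))) (sym (g-lin (h F) t v))))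
        (trans (p (λ G → φ (g G)) (λ {d} i t G → trans (cong φ (g-lin G t d)) (r (∈-map⁺ g i) t (g G))) t (h F)) (cong φ (gh F)))
      where
      g-lin : ∀ u t v → g (u ⊞ t ⊡ v) ≡ g u ⊞ t ⊡ g v
      g-lin u t v = trans (g⊞ u (t ⊡ v)) (cong (g u ⊞_) (g⊡ t v))

    -- `to` is the map with parameter `- b`, because directions transform by `from`, which then has
    -- parameter `b`.
    linear : (g : K → V → V) → (∀ b u v → g b (u ⊞ v) ≡ g b u ⊞ g b v) → (∀ b t v → g b (t ⊡ v) ≡ t ⊡ g b v) →
      (∀ b c → b ⊕ c ≡ 𝟘 → ∀ u → g c (g b u) ≡ u) → K → Linear
    linear g g⊞ g⊡ ginv b = record
      { to = g (⊖ b) ; from = g b ; to-from = ginv b (⊖ b) (⊖-inverseʳ b) ; from-to = ginv (⊖ b) b (⊖-inverseˡ b)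
      ; to-⊞ = g⊞ (⊖ b) ; to-⊡ = g⊡ (⊖ b) }

    shL sh⁺L : K → Linear
    shL = linear sh sh-⊞ sh-⊡ sh-inv
    sh⁺L = linear sh⁺ sh⁺-⊞ sh⁺-⊡ sh⁺-inv

    module Stable (g : K → V → V) (g⊞ : ∀ b u v → g b (u ⊞ v) ≡ g b u ⊞ g b v) (g⊡ : ∀ b t v → g b (t ⊡ v) ≡ t ⊡ g b v)
             (ginv : ∀ b c → b ⊕ c ≡ 𝟘 → ∀ u → g c (g b u) ≡ u) (B : B-Set)
             (h : ∀ b {i k} → B i ≡ true → B k ≡ false → lookup (g b (basis k)) i ≡ 𝟘) where
      stable : ∀ b {d} → d ∈ off B → off B ⊩ g b d
      stable b m with off-∈⁻ B m
      ... | k , Bk , refl = off-⊩ B (λ i Bi → h b Bi Bk)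

      stable-map : ∀ b {d} → d ∈ map (g b) (off B) → off B ⊩ d
      stable-map b m with ∈-map⁻ (g b) m
      ... | d , d∈ , refl = stable b d∈

      -- `d` is `g b` applied to `g (- b) d`, and the latter is in the span by stability under the
      -- parameter `- b`.
      stable-map⁻ : ∀ b {d} → d ∈ off B → map (g b) (off B) ⊩ d
      stable-map⁻ b {d} m = subst (map (g b) (off B) ⊩_) (ginv (⊖ b) b (⊖-inverseˡ b) d)
        (⊩-map {g b} {g (⊖ b)} (g⊞ b) (g⊡ b) (ginv (⊖ b) b (⊖-inverseˡ b)) (stable (⊖ b) m))

    -- The coefficient of `b^j` in entry `i` of `sh b` applied to the basis vector of index `p`. For
    -- `i > p` the truncated difference is 0, but `bin p i` vanishes there.
    entry : ℕ → ℕ → Fin (suc n) → K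
    entry p j i with p ∸ toℕ i ℕ.≟ j
    ... | yes _ = bin p (toℕ i)
    ... | no _ = 𝟘

    coef : ℕ → ℕ → V
    coef p j = tabulate (entry p j)

    coefs : ℕ → ℕ → ℕ → List V
    coefs p zero j = []
    coefs p (suc m) j = coef p j ∷ coefs p m (suc j)

    length-coefs : ∀ p m j → length (coefs p m j) ≡ m
    length-coefs p zero j = refl
    length-coefs p (suc m) j = cong suc (length-coefs p m (suc j))

    coef-∈ : ∀ p m j k → j ℕ.≤ k → k ℕ.< j ℕ.+ m → coef p k ∈ coefs p m j
    coef-∈ p zero j k j≤k k< = contradiction j≤k (ℕP.<⇒≱ (subst (k ℕ.<_) (ℕP.+-identityʳ j) k<))
    coef-∈ p (suc m) j k j≤k k< with j ℕ.≟ k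
    ... | yes refl = here refl
    ... | no j≢k = there (coef-∈ p m (suc j) k (ℕP.≤∧≢⇒< j≤k j≢k) (subst (k ℕ.<_) (ℕP.+-suc j m) k<))

    coef-yes : ∀ p j i → p ∸ toℕ i ≡ j → lookup (coef p j) i ≡ bin p (toℕ i)
    coef-yes p j i e = trans (VecP.lookup∘tabulate (entry p j) i) go
      where
      go : entry p j i ≡ bin p (toℕ i)
      go with p ∸ toℕ i ℕ.≟ j
      ... | yes _ = refl
      ... | no q = contradiction e q

    coef-no : ∀ p j i → p ∸ toℕ i ≢ j → lookup (coef p j) i ≡ 𝟘
    coef-no p j i e = trans (VecP.lookup∘tabulate (entry p j) i) go
      where
      go : entry p j i ≡ 𝟘
      go with p ∸ toℕ i ℕ.≟ j
      ... | yes q = contradiction q e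
      ... | no _ = refl

    peval-coefs-≡ : ∀ p m j b i → j ℕ.+ m ℕ.≤ p ∸ toℕ i ⊎ p ∸ toℕ i ℕ.< j → lookup (peval (coefs p m j) b) i ≡ 𝟘
    peval-coefs-≡ p zero j b i h = lookup-0v i
    peval-coefs-≡ p (suc m) j b i h = trans (lookup-⊞ (coef p j) (b ⊡ peval (coefs p m (suc j)) b) i) (trans (cong₂ _⊕_ (coef-no p j i (ne h))
        (trans (lookup-⊡ b (peval (coefs p m (suc j)) b) i) (cong (b ⊗_) (peval-coefs-≡ p m (suc j) b i (up h))))) (trans (⊕-identityˡ _) (⊗-zeroʳ b)))
      where
      ne : j ℕ.+ suc m ℕ.≤ p ∸ toℕ i ⊎ p ∸ toℕ i ℕ.< j → p ∸ toℕ i ≢ j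
      ne (inj₁ q) refl = contradiction q (ℕP.<⇒≱ (ℕP.m<m+n (p ∸ toℕ i) (ℕ.s≤s ℕ.z≤n)))
      ne (inj₂ q) refl = ℕP.<-irrefl refl q
      up : j ℕ.+ suc m ℕ.≤ p ∸ toℕ i ⊎ p ∸ toℕ i ℕ.< j → suc j ℕ.+ m ℕ.≤ p ∸ toℕ i ⊎ p ∸ toℕ i ℕ.< suc j
      up (inj₁ q) = inj₁ (subst (ℕ._≤ p ∸ toℕ i) (ℕP.+-suc j m) q)
      up (inj₂ q) = inj₂ (ℕP.m≤n⇒m≤1+n q)

    peval-coefs : ∀ p m j b i → j ℕ.≤ p ∸ toℕ i → p ∸ toℕ i ℕ.< j ℕ.+ m →
      lookup (peval (coefs p m j) b) i ≡ bin p (toℕ i) ⊗ pow b ((p ∸ toℕ i) ∸ j)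
    peval-coefs p zero j b i j≤ <j = contradiction j≤ (ℕP.<⇒≱ (subst (p ∸ toℕ i ℕ.<_) (ℕP.+-identityʳ j) <j))
    peval-coefs p (suc m) j b i j≤ <j = step (p ∸ toℕ i ℕ.≟ j)
      where
      step : Dec (p ∸ toℕ i ≡ j) → lookup (peval (coefs p (suc m) j) b) i ≡ bin p (toℕ i) ⊗ pow b ((p ∸ toℕ i) ∸ j)
      step (yes e) = trans (lookup-⊞ (coef p j) (b ⊡ peval (coefs p m (suc j)) b) i) (trans (cong₂ _⊕_ (coef-yes p j i e)
        (trans (lookup-⊡ b (peval (coefs p m (suc j)) b) i) (trans (cong (b ⊗_) (peval-coefs-≡ p m (suc j) b i (inj₂ (ℕ.s≤s (ℕP.≤-reflexive e))))) (⊗-zeroʳ b))))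
        (trans (⊕-identityʳ _) (sym (trans (cong (λ z → bin p (toℕ i) ⊗ pow b z) (trans (cong (_∸ j) e) (ℕP.n∸n≡0 j))) (⊗-identityʳ _)))))
      step (no e) = trans (lookup-⊞ (coef p j) (b ⊡ peval (coefs p m (suc j)) b) i) (trans (cong₂ _⊕_ (coef-no p j i e)
        (trans (lookup-⊡ b (peval (coefs p m (suc j)) b) i) (cong (b ⊗_) (peval-coefs p m (suc j) b i j< (subst (p ∸ toℕ i ℕ.<_) (ℕP.+-suc j m) <j)))))
        (trans (⊕-identityˡ _) (trans (sym (⊗-assoc b _ _)) (trans (cong (_⊗ pow b (p ∸ toℕ i ∸ suc j)) (⊗-comm b _)) (trans (⊗-assoc _ b _)
          (cong (λ z → bin p (toℕ i) ⊗ pow b z) (sym (ℕP.+-∸-assoc 1 j<))))))))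
        where
        j< : j ℕ.< p ∸ toℕ i
        j< = ℕP.≤∧≢⇒< j≤ (λ q → e (sym q))

    dir : Fin (suc n) → K → V
    dir i₀ b = sh b (basis i₀)

    dir-peval : ∀ i₀ b → dir i₀ b ≡ peval (coefs (toℕ i₀) (suc n) 0) b
    dir-peval i₀ b = lookup-ext {u = dir i₀ b} {peval (coefs (toℕ i₀) (suc n) 0) b} (λ i → trans (lookup-sh b i₀ i) (trans (mono-bin b (toℕ i₀) (toℕ i))
      (sym (peval-coefs (toℕ i₀) (suc n) 0 b i ℕ.z≤n (ℕ.s≤s (ℕP.≤-trans (ℕP.m∸n≤m (toℕ i₀) (toℕ i)) (FinP.toℕ≤pred[n] i₀)))))))

    coef-basis : ∀ (i₀ i : Fin (suc n)) → toℕ i ℕ.≤ toℕ i₀ → coef (toℕ i₀) (toℕ i₀ ∸ toℕ i) ≡ bin (toℕ i₀) (toℕ i) ⊡ basis i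
    coef-basis i₀ i i≤ = lookup-ext go
      where
      p = toℕ i₀
      go : ∀ k → lookup (coef p (p ∸ toℕ i)) k ≡ lookup (bin p (toℕ i) ⊡ basis i) k
      go k with k FinP.≟ i
      ... | yes refl = trans (coef-yes p _ k refl) (sym (trans (lookup-⊡ _ (basis k) k) (trans (cong (bin p (toℕ k) ⊗_) (lookup-basis k)) (⊗-identityʳ _))))
      ... | no k≢i = trans zeroˡ (sym (trans (lookup-⊡ _ (basis i) k) (trans (cong (bin p (toℕ i) ⊗_) (lookup-basis-≢ k≢i)) (⊗-zeroʳ _))))
        where
        zeroˡ : lookup (coef p (p ∸ toℕ i)) k ≡ 𝟘
        zeroˡ with p ∸ toℕ k ℕ.≟ p ∸ toℕ i | ℕP.<-≤-connex p (toℕ k)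
        ... | no q | _ = coef-no p _ k q
        ... | yes q | inj₁ p<k = trans (coef-yes p _ k q) (mono-< 𝟙 p<k)
        ... | yes q | inj₂ k≤p = contradiction (FinP.toℕ-injective (ℕP.∸-cancelˡ-≡ k≤p i≤ q)) k≢i

    fresh-distinct : ∀ {d : K → V} {ex bs} → Fresh d ex bs → AllPairs _≢_ bs × All (_∉ ex) bs
    fresh-distinct [] = [] , []
    fresh-distinct (b∉ ∷ f) with fresh-distinct f
    ... | ds , nots = All.map (λ x∉ e → x∉ (here (sym e))) nots ∷ ds , b∉ ∷ All.map (λ x∉ m → x∉ (there m)) nots

    module Dir {B : B-Set} (closed : Closed B) (i₀ : Fin (suc n)) (B₀ : B i₀ ≡ true)
             (maxi : ∀ k → B k ≡ true → toℕ k ℕ.≤ toℕ i₀) where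
      open Closed closed

      B′ : B-Set
      B′ = next B i₀

      closed′ : Closed B′
      closed′ = next-closed closed i₀ B₀ maxi

      B′⊆B : ∀ {i} → B′ i ≡ true → B i ≡ true
      B′⊆B e = proj₁ (next-true B i₀ e)

      off⊆off′ : ∀ {d} → d ∈ off B → off B′ ⊩ d
      off⊆off′ m with off-∈⁻ B m
      ... | k , Bk , refl = off-⊩ B′ (λ i Bi → lookup-basis-≢ {i = i} {k} λ { refl → contradiction (trans (sym (B′⊆B Bi)) Bk) λ () })

      -- This is the reason for the definition of `next`: it keeps the indices of `B` that none of
      -- the directions reaches.
      dir-off′ : ∀ b → off B′ ⊩ dir i₀ b
      dir-off′ b = off-⊩ B′ (λ i Bi → trans (lookup-sh b i₀ i) (trans (mono-bin b (toℕ i₀) (toℕ i)) (trans (cong (_⊗ pow b (toℕ i₀ ∸ toℕ i)) (proj₂ (next-true B i₀ Bi))) (⊗-zeroˡ _))))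

      -- A direction is a polynomial in `b` with `suc n` vector coefficients, so `vandermonde` puts
      -- these coefficients into the span. By `coef-basis` they are the multiples `bin i₀ i` of
      -- basis vectors, and for `i` in `B` but not in `B′` this factor is invertible.
      dirs-span : ∀ bs → length bs ≡ suc n → AllPairs _≢_ bs → ∀ {d} → d ∈ off B′ → map (dir i₀) bs ++ off B ⊩ d
      dirs-span bs l ap m with off-∈⁻ B′ m
      ... | i , B′i , refl with next-false B i₀ {i} B′i
      ...   | inj₁ Bi = ⊩-∈ (∈-++⁺ʳ (map (dir i₀) bs) (off-∈ B Bi))
      ...   | inj₂ nz = unscale (All.lookup all-coefs (coef-∈ p (suc n) 0 (p ∸ toℕ i) ℕ.z≤n (ℕ.s≤s (ℕP.≤-trans (ℕP.m∸n≤m p (toℕ i)) (FinP.toℕ≤pred[n] i₀)))))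
        where
        p = toℕ i₀
        ds = map (dir i₀) bs ++ off B
        all-coefs : All (ds ⊩_) (coefs p (suc n) 0)
        all-coefs = vandermonde (span-sub ds) bs (coefs p (suc n) 0) (trans l (sym (length-coefs p (suc n) 0))) ap
          (λ {b} b∈ → subst (ds ⊩_) (dir-peval i₀ b) (⊩-∈ (∈-++⁺ˡ (∈-map⁺ (dir i₀) b∈))))
        i≤p : toℕ i ℕ.≤ p
        i≤p = ℕP.≮⇒≥ (λ p<i → nz (mono-< 𝟙 p<i))
        unscale : ds ⊩ coef p (p ∸ toℕ i) → ds ⊩ basis i
        unscale s with inverse (bin p (toℕ i)) nz
        ... | y , e = subst (ds ⊩_) (trans (cong (y ⊡_) (coef-basis i₀ i i≤p)) (trans (⊡-⊗ y _ _) (trans (cong (_⊡ basis i) (trans (⊗-comm y _) e)) (1⊡ _)))) (⊩-⊡ y s)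

-- Roots of polynomials and fibres of power maps.

module Roots where

  open Rat
  open Mean
  open Field
  open Averages
  open Shift
  open import Data.Nat as ℕ using (ℕ; zero; suc)
  open import Data.List using (List; []; _∷_; length)
  import Data.List as List
  open import Data.Product using (_,_)
  open import Data.Sum using (inj₁; inj₂)
  open import Relation.Nullary using (yes; no)
  open import Relation.Nullary.Negation using (contradiction)
  open import Relation.Binary.PropositionalEquality
  open import Tactic.RingSolver using (solve-∀)

  module RootCount (𝔽 : FinField) where
    open FinField 𝔽
    open FieldFacts 𝔽
    open Shifts 𝔽
    open Uniform uniform using (E; ω; 0≤ω; E-mono; E-+; E-point; E-const; E-cong; search)
    open IntSolver commutativeRing using (solve; _:=_; _:+_; _:*_; :-_; con)

    -- The value of the monic polynomial with lower coefficients cs.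
    value : List K → K → K
    value [] a = 𝟙
    value (c ∷ cs) a = c ⊕ a ⊗ value cs a

    divide : K → List K → List K
    divide a [] = []
    divide a (c ∷ []) = []
    divide a (c ∷ cs@(_ ∷ _)) = value cs a ∷ divide a cs

    length-divide : ∀ a c cs → length (divide a (c ∷ cs)) ≡ length cs
    length-divide a c [] = refl
    length-divide a c (d ∷ cs) = cong suc (length-divide a d cs)

    value-divide : ∀ a b c cs → value (c ∷ cs) b ≡ value (c ∷ cs) a ⊕ (b ⊝ a) ⊗ value (divide a (c ∷ cs)) b
    value-divide a b c [] = solve 3 (λ a b c → c :+ b :* con (ℤ.+ 1) := c :+ a :* con (ℤ.+ 1) :+ (b :+ :- a) :* con (ℤ.+ 1)) refl a b c
      where import Data.Integer as ℤ
    value-divide a b c cs@(d ∷ ds) = trans (cong (λ z → c ⊕ b ⊗ z) (value-divide a b d ds))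
      (solve 5 (λ a b c p q → c :+ b :* (p :+ (b :+ :- a) :* q) := c :+ a :* p :+ (b :+ :- a) :* (p :+ b :* q)) refl a b c (value cs a) (value (divide a cs) b))

    -- Search for a root `a`. If there is none, the mean is 0; otherwise a zero of the polynomial is
    -- `a` itself, of mass `ω`, or a zero of the quotient, of smaller degree.
    roots : ∀ m cs → length cs ≡ m → E (λ a → ⟦ value cs a ≟ 𝟘 ⟧) ≤ ⌜ m ⌝ * ω
    roots m cs l with search (λ a → value cs a ≟ 𝟘)
    ... | inj₂ none = ≤-trans (≤-reflexive (trans (E-cong (λ a → ⟦⟧-no (value cs a ≟ 𝟘) (none a))) (E-const 0ℚ))) (0≤* (0≤⌜⌝ m) 0≤ω)
    roots zero [] l | inj₁ (a , e) = contradiction e 𝟙≢𝟘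
    roots (suc m) (c ∷ cs) l | inj₁ (a , e) = begin
        E (λ b → ⟦ value (c ∷ cs) b ≟ 𝟘 ⟧) ≤⟨ E-mono step ⟩
        E (λ b → ⟦ b ≟ a ⟧ * 1ℚ + ⟦ value q b ≟ 𝟘 ⟧) ≡⟨ E-+ _ _ ⟩
        E (λ b → ⟦ b ≟ a ⟧ * 1ℚ) + E (λ b → ⟦ value q b ≟ 𝟘 ⟧) ≤⟨ +-mono-≤ (≤-reflexive (E-point a _)) (roots m q (trans (length-divide a c cs) (cong ℕ.pred l))) ⟩
        ω * 1ℚ + ⌜ m ⌝ * ω ≡⟨ lem ω ⌜ m ⌝ ⟩
        ⌜ suc m ⌝ * ω ∎
      where
      open import Data.Rational.Properties using (module ≤-Reasoning)
      open ≤-Reasoning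
      opaque
        unfolding _+_
        lem : ∀ o k → o * 1ℚ + k * o ≡ (1ℚ + k) * o
        lem = solve-∀ ℚ-ring
      q = divide a (c ∷ cs)
      step : ∀ b → ⟦ value (c ∷ cs) b ≟ 𝟘 ⟧ ≤ ⟦ b ≟ a ⟧ * 1ℚ + ⟦ value q b ≟ 𝟘 ⟧
      step b with b ≟ a
      ... | yes _ = ≤-trans (⟦⟧≤1 (value (c ∷ cs) b ≟ 𝟘)) (subst (_≤ 1ℚ * 1ℚ + ⟦ value q b ≟ 𝟘 ⟧) (trans (+-identityʳ _) (*-identityʳ 1ℚ)) (+-mono-≤ (≤-refl {1ℚ * 1ℚ}) (0≤⟦⟧ (value q b ≟ 𝟘))))
      ... | no b≢a = ≤-reflexive (trans (⟦⟧-⇔ (value (c ∷ cs) b ≟ 𝟘) (value q b ≟ 𝟘) to from) (sym (trans (cong (_+ ⟦ value q b ≟ 𝟘 ⟧) (*-zeroˡ 1ℚ)) (+-identityˡ _))))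
        where
        eq : value (c ∷ cs) b ≡ (b ⊝ a) ⊗ value q b
        eq = trans (value-divide a b c cs) (trans (cong (_⊕ (b ⊝ a) ⊗ value q b) e) (⊕-identityˡ _))
        to : value (c ∷ cs) b ≡ 𝟘 → value q b ≡ 𝟘
        to z = integral (trans (sym eq) z) (λ d → b≢a (⊝≡0 d))
        from : value q b ≡ 𝟘 → value (c ∷ cs) b ≡ 𝟘
        from z = trans eq (trans (cong ((b ⊝ a) ⊗_) z) (⊗-zeroʳ _))

    value-pow : ∀ m c a → value (c ∷ List.replicate m 𝟘) a ≡ c ⊕ pow a (suc m)
    value-pow m c a = cong (λ z → c ⊕ a ⊗ z) (go m)
      where
      go : ∀ m → value (List.replicate m 𝟘) a ≡ pow a m
      go zero = refl
      go (suc m) = trans (⊕-identityˡ _) (cong (a ⊗_) (go m))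

    -- The polynomial is `x^(m + 1) - c`, with lower coefficients `- c, 0, …, 0`.
    power-fibre : ∀ m c → E (λ a → ⟦ pow a (suc m) ≟ c ⟧) ≤ ⌜ suc m ⌝ * ω
    power-fibre m c = ≤-trans (≤-reflexive (E-cong (λ a → ⟦⟧-⇔ (pow a (suc m) ≟ c) (value cs a ≟ 𝟘)
        (λ e → trans (value-pow m (⊖ c) a) (trans (cong (⊖ c ⊕_) e) (⊖-inverseˡ c)))
        (λ e → ⊝≡0 (trans (⊕-comm _ _) (trans (sym (value-pow m (⊖ c) a)) e))))))
      (roots (suc m) cs (cong suc (ListP.length-replicate m)))
      where
      import Data.List.Properties as ListP
      cs = ⊖ c ∷ List.replicate m 𝟘

-- Almost invariance under the opposite unipotents, and its consequence for averages.

module Bounds where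

  open Rat
  open Mean
  open Field
  open Averages
  open Shift
  open Binomial
  open Stage
  open Roots
  open import Data.Bool using (true; false)
  open import Data.Nat as ℕ using (ℕ; zero; suc; _∸_)
  import Data.Nat.Properties as ℕP
  open import Data.Fin using (Fin; zero; suc; toℕ; fromℕ; opposite)
  import Data.Fin.Properties as FinP
  open import Data.Vec as Vec using (Vec; []; _∷_; _∷ʳ_; lookup; reverse; head)
  import Data.Vec.Properties as VecP
  open import Data.List using (List; []; _∷_; map; length; _++_)
  open import Data.List.Membership.Propositional using (_∈_)
  open import Data.List.Membership.Propositional.Properties using (∈-map⁻; ∈-++⁻)
  open import Data.Product using (_,_; proj₁)
  open import Data.Sum using (_⊎_; inj₁; inj₂; [_,_]′)
  open import Relation.Nullary using (yes; no)
  open import Relation.Binary.PropositionalEquality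
  open import Tactic.RingSolver using (solve-∀)
  open import Data.Rational.Properties using (module ≤-Reasoning)

  sq≤1 : ∀ {x} → - 1ℚ ≤ x → x ≤ 1ℚ → x * x ≤ 1ℚ
  sq≤1 {x} p q = ≤-from ((1ℚ - x) * (x - - 1ℚ)) (0≤* (≤-diff q) (≤-diff p)) (lem x)
    where
    opaque
      unfolding _+_
      lem : ∀ x → 1ℚ - x * x ≡ (1ℚ - x) * (x - - 1ℚ)
      lem = solve-∀ ℚ-ring

  module Analysis (𝔽 : FinField) (n : ℕ) where
    open Constants n using (C₁)
    open FinField 𝔽
    open FieldFacts 𝔽
    open Space 𝔽
    open Shifts 𝔽
    open Closure 𝔽
    open RootCount 𝔽
    open Averaging 𝔽 (suc n) public
    open Directions 𝔽 n public
    open VecSpace uniform using (vecU; E-∷)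
    open 𝐕 using (‖_‖²)
    open 𝐊 using (ω)

    last′ : V → K
    last′ F = lookup F (fromℕ n)

    -- Reversal is required only where both end coefficients are nonzero: elsewhere the form or its
    -- reversal has leading coefficient 0 and is no longer a polynomial of full degree.
    record Symmetric (T : V → ℚ) : Set where
      field
        T01 : ∀ F → T F ≡ 0ℚ ⊎ T F ≡ 1ℚ
        T-scale : ∀ c F → c ≢ 𝟘 → T (c ⊡ F) ≡ T F
        T-sh⁺ : ∀ a F → T (sh⁺ a F) ≡ T F
        T-rev : ∀ F → head F ≢ 𝟘 → last′ F ≢ 𝟘 → T (reverse F) ≡ T F

    sub-sq : ∀ φ ψ → ‖ (λ F → φ F - ψ F) ‖² ≤ 2ℚ * ‖ φ ‖² + 2ℚ * ‖ ψ ‖²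
    sub-sq φ ψ = ≤-trans (𝐕.E-mono (λ F → pt (φ F) (ψ F))) (≤-reflexive (trans (𝐕.E-+ _ _) (cong₂ _+_ (𝐕.E-*ˡ 2ℚ _) (𝐕.E-*ˡ 2ℚ _))))
      where
      opaque
        unfolding _+_
        lem : ∀ x y → 2ℚ * (x * x) + 2ℚ * (y * y) - (x - y) * (x - y) ≡ (x + y) * (x + y)
        lem = solve-∀ ℚ-ring
      pt : ∀ x y → (x - y) * (x - y) ≤ 2ℚ * (x * x) + 2ℚ * (y * y)
      pt x y = ≤-from _ (0≤sq (x + y)) (lem x y)

    add-sq : ∀ φ ψ → ‖ (λ F → φ F + ψ F) ‖² ≤ 2ℚ * ‖ φ ‖² + 2ℚ * ‖ ψ ‖²
    add-sq φ ψ = ≤-trans (𝐕.E-mono (λ F → sq-add (φ F) (ψ F))) (≤-reflexive (trans (𝐕.E-+ _ _) (cong₂ _+_ (𝐕.E-*ˡ 2ℚ _) (𝐕.E-*ˡ 2ℚ _))))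

    ‖‖²≤1 : ∀ {φ} → (∀ F → φ F * φ F ≤ 1ℚ) → ‖ φ ‖² ≤ 1ℚ
    ‖‖²≤1 h = 𝐕.E-≤const h

    -- For a fixed tail the event prescribes the head, which has probability `ω` whatever value `f`
    -- prescribes.
    E-head : ∀ (f : Vec K n → K) → 𝐕.E (λ F → ⟦ (head F ⊕ f (Vec.tail F)) ≟ 𝟘 ⟧) ≡ ω
    E-head f = begin-equality
      𝐕.E (λ F → ⟦ (head F ⊕ f (Vec.tail F)) ≟ 𝟘 ⟧) ≡⟨ E-∷ n _ ⟩
      𝐊.E (λ x → W.E (λ xs → ⟦ (x ⊕ f xs) ≟ 𝟘 ⟧)) ≡⟨ E-swap uniform (vecU n) _ ⟩
      W.E (λ xs → 𝐊.E (λ x → ⟦ (x ⊕ f xs) ≟ 𝟘 ⟧)) ≡⟨ W.E-cong (λ xs → trans (E-shift (f xs) (λ x → ⟦ x ≟ 𝟘 ⟧)) (trans (𝐊.E-cong (λ x → sym (*-identityʳ ⟦ x ≟ 𝟘 ⟧))) (trans (𝐊.E-point 𝟘 (λ _ → 1ℚ)) (*-identityʳ ω)))) ⟩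
      W.E (λ xs → ω) ≡⟨ W.E-const ω ⟩
      ω ∎
      where
      open ≤-Reasoning
      module W = Uniform (vecU n)

    E-reverse : ∀ φ → 𝐕.E (λ F → φ (reverse F)) ≡ 𝐕.E φ
    E-reverse = Bijection.E-bij (vecU (suc n)) reverse reverse VecP.reverse-involutive VecP.reverse-involutive

    E-head0 : 𝐕.E (λ F → ⟦ head F ≟ 𝟘 ⟧) ≡ ω
    E-head0 = trans (𝐕.E-cong (λ { (x ∷ xs) → cong (λ z → ⟦ z ≟ 𝟘 ⟧) (sym (⊕-identityʳ x)) })) (E-head (λ _ → 𝟘))

    head-lookup : ∀ (F : V) → head F ≡ lookup F zero
    head-lookup (x ∷ F) = refl

    opposite-fromℕ : opposite (fromℕ n) ≡ zero
    opposite-fromℕ = FinP.toℕ-injective (trans (FinP.opposite-prop (fromℕ n)) (trans (cong (n ∸_) (FinP.toℕ-fromℕ n)) (ℕP.n∸n≡0 n)))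

    last-reverse : ∀ F → last′ (reverse F) ≡ head F
    last-reverse F = trans (lookup-reverse′ F (fromℕ n)) (trans (cong (lookup F) opposite-fromℕ) (sym (head-lookup F)))

    head-reverse : ∀ F → head (reverse F) ≡ last′ F
    head-reverse F = trans (head-lookup (reverse F)) (lookup-reverse′ F zero)

    E-last0 : 𝐕.E (λ F → ⟦ last′ F ≟ 𝟘 ⟧) ≡ ω
    E-last0 = trans (sym (E-reverse _)) (trans (𝐕.E-cong (λ F → cong (λ z → ⟦ z ≟ 𝟘 ⟧) (last-reverse F))) E-head0)

    E-sh-head0 : ∀ b → 𝐕.E (λ F → ⟦ head (sh b F) ≟ 𝟘 ⟧) ≡ ω
    E-sh-head0 b = trans (𝐕.E-cong (λ { (x ∷ xs) → cong (λ z → ⟦ z ≟ 𝟘 ⟧) (step x xs) })) (E-head (λ xs → b ⊗ head (sh b xs ∷ʳ 𝟘)))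
      where
      step : ∀ x (xs : Vec K n) → head (sh b (x ∷ xs)) ≡ x ⊕ b ⊗ head (sh b xs ∷ʳ 𝟘)
      step x xs with sh b xs ∷ʳ 𝟘
      ... | y ∷ ys = refl

    last-sh : ∀ b F → last′ (sh b F) ≡ last′ F
    last-sh b = go
      where
      go : ∀ {m} (v : Vec K (suc m)) → lookup (sh b v) (fromℕ m) ≡ lookup v (fromℕ m)
      go {zero} (x ∷ []) = trans (cong (x ⊕_) (⊗-zeroʳ b)) (⊕-identityʳ x)
      go {suc m} (x ∷ v) = trans (lookup-⊞ (x ∷ sh b v) (b ⊡ (sh b v ∷ʳ 𝟘)) (suc (fromℕ m)))
        (trans (cong₂ _⊕_ (go v) (trans (lookup-⊡ b (sh b v ∷ʳ 𝟘) (suc (fromℕ m))) (trans (cong (b ⊗_) (lookup-∷ʳ-fromℕ (sh b v) 𝟘)) (⊗-zeroʳ b)))) (⊕-identityʳ _))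

    module Sym {T : V → ℚ} (symm : Symmetric T) where
      open Symmetric symm

      T-sq : ∀ F → T F * T F ≤ 1ℚ
      T-sq F with T01 F
      ... | inj₁ e = subst (λ z → z * z ≤ 1ℚ) (sym e) (≤-trans (≤-reflexive (*-zeroˡ 0ℚ)) 0≤1)
      ... | inj₂ e = subst (λ z → z * z ≤ 1ℚ) (sym e) (≤-reflexive (*-identityˡ 1ℚ))

      ‖T‖²≤1 : ‖ T ‖² ≤ 1ℚ
      ‖T‖²≤1 = ‖‖²≤1 T-sq

      -- `sh b` is reversal, translation, reversal. The first reversal needs both ends of `F`, the
      -- second both ends of `sh b F`, whose last entry is that of `F` by `last-sh`.
      T-sh : ∀ b F → head F ≢ 𝟘 → last′ F ≢ 𝟘 → head (sh b F) ≢ 𝟘 → T (sh b F) ≡ T F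
      T-sh b F h l h′ = begin-equality
        T (sh b F) ≡⟨ cong T (sym (VecP.reverse-involutive (sh b F))) ⟩
        T (reverse (reverse (sh b F))) ≡⟨ T-rev (reverse (sh b F)) (λ e → l (trans (sym (last-sh b F)) (trans (sym (head-reverse (sh b F))) e))) (λ e → h′ (trans (sym (last-reverse (sh b F))) e)) ⟩
        T (reverse (sh b F)) ≡⟨ cong (λ G → T (reverse (sh b G))) (sym (VecP.reverse-involutive F)) ⟩
        T (sh⁺ b (reverse F)) ≡⟨ T-sh⁺ b (reverse F) ⟩
        T (reverse F) ≡⟨ T-rev F h l ⟩
        T F ∎
        where open ≤-Reasoning

      -- The symmetry under sh fails only when one of three independent coordinates vanishes.
      T-sh-close : ∀ b → ‖ (λ F → T (sh b F) - T F) ‖² ≤ 3ℚ * ω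
      T-sh-close b = begin
        ‖ (λ F → T (sh b F) - T F) ‖² ≤⟨ 𝐕.E-mono pt ⟩
        𝐕.E (λ F → ⟦ head F ≟ 𝟘 ⟧ + ⟦ last′ F ≟ 𝟘 ⟧ + ⟦ head (sh b F) ≟ 𝟘 ⟧)
          ≡⟨ trans (𝐕.E-+ _ _) (cong₂ _+_ (trans (𝐕.E-+ _ _) (cong₂ _+_ E-head0 E-last0)) (E-sh-head0 b)) ⟩
        ω + ω + ω ≡⟨ lem ω ⟩
        3ℚ * ω ∎
        where
        open ≤-Reasoning
        opaque
          unfolding _+_
          lem : ∀ o → o + o + o ≡ 3ℚ * o
          lem = solve-∀ ℚ-ring
        sqd : ∀ {x y} → x ≡ 0ℚ ⊎ x ≡ 1ℚ → y ≡ 0ℚ ⊎ y ≡ 1ℚ → (x - y) * (x - y) ≤ 1ℚ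
        sqd {x} {y} p q = sq≤1 (lower p q) (upper p q)
          where
          z10 : 1ℚ - 0ℚ ≡ 1ℚ
          z10 = l0 1ℚ
            where
            opaque
              unfolding _+_
              l0 : ∀ x → x - 0ℚ ≡ x
              l0 = solve-∀ ℚ-ring
          z01 : 0ℚ - 1ℚ ≡ - 1ℚ
          z01 = +-identityˡ (- 1ℚ)
          m10 : - 1ℚ ≤ 0ℚ
          m10 = ≤-from 1ℚ 0≤1 (l1 1ℚ)
            where
            opaque
              unfolding _+_
              l1 : ∀ x → 0ℚ - - x ≡ x
              l1 = solve-∀ ℚ-ring
          lower : ∀ {x y} → x ≡ 0ℚ ⊎ x ≡ 1ℚ → y ≡ 0ℚ ⊎ y ≡ 1ℚ → - 1ℚ ≤ x - y
          lower (inj₁ refl) (inj₁ refl) = subst (- 1ℚ ≤_) (sym (+-inverseʳ 0ℚ)) m10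
          lower (inj₁ refl) (inj₂ refl) = ≤-reflexive (sym z01)
          lower (inj₂ refl) (inj₁ refl) = subst (- 1ℚ ≤_) (sym z10) (≤-trans m10 0≤1)
          lower (inj₂ refl) (inj₂ refl) = subst (- 1ℚ ≤_) (sym (+-inverseʳ 1ℚ)) m10
          upper : ∀ {x y} → x ≡ 0ℚ ⊎ x ≡ 1ℚ → y ≡ 0ℚ ⊎ y ≡ 1ℚ → x - y ≤ 1ℚ
          upper (inj₁ refl) (inj₁ refl) = subst (_≤ 1ℚ) (sym (+-inverseʳ 0ℚ)) 0≤1
          upper (inj₁ refl) (inj₂ refl) = subst (_≤ 1ℚ) (sym z01) (≤-trans m10 0≤1)
          upper (inj₂ refl) (inj₁ refl) = ≤-reflexive z10
          upper (inj₂ refl) (inj₂ refl) = subst (_≤ 1ℚ) (sym (+-inverseʳ 1ℚ)) 0≤1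
        big : ∀ {x y z} F → 0ℚ ≤ x → 0ℚ ≤ y → 0ℚ ≤ z → x ≡ 1ℚ ⊎ y ≡ 1ℚ ⊎ z ≡ 1ℚ → (T (sh b F) - T F) * (T (sh b F) - T F) ≤ x + y + z
        big {x} {y} {z} F p q r h = ≤-trans (sqd (T01 (sh b F)) (T01 F)) (one h)
          where
          one : x ≡ 1ℚ ⊎ y ≡ 1ℚ ⊎ z ≡ 1ℚ → 1ℚ ≤ x + y + z
          one (inj₁ refl) = ≤-from (y + z) (0≤+ q r) (l 1ℚ y z)
            where
            opaque
              unfolding _+_
              l : ∀ x y z → x + y + z - x ≡ y + z
              l = solve-∀ ℚ-ring
          one (inj₂ (inj₁ refl)) = ≤-from (x + z) (0≤+ p r) (l x 1ℚ z)
            where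
            opaque
              unfolding _+_
              l : ∀ x y z → x + y + z - y ≡ x + z
              l = solve-∀ ℚ-ring
          one (inj₂ (inj₂ refl)) = ≤-from (x + y) (0≤+ p q) (l x y 1ℚ)
            where
            opaque
              unfolding _+_
              l : ∀ x y z → x + y + z - z ≡ x + y
              l = solve-∀ ℚ-ring
        pt : ∀ F → (T (sh b F) - T F) * (T (sh b F) - T F) ≤ ⟦ head F ≟ 𝟘 ⟧ + ⟦ last′ F ≟ 𝟘 ⟧ + ⟦ head (sh b F) ≟ 𝟘 ⟧
        pt F with head F ≟ 𝟘 | last′ F ≟ 𝟘 | head (sh b F) ≟ 𝟘
        ... | no h | no l | no h′ = ≤-trans (≤-reflexive (trans (cong (λ z → (z - T F) * (z - T F)) (T-sh b F h l h′)) (l0 (T F)))) (0≤+ (0≤+ ≤-refl ≤-refl) ≤-refl)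
          where
          opaque
            unfolding _+_
            l0 : ∀ x → (x - x) * (x - x) ≡ 0ℚ
            l0 = solve-∀ ℚ-ring
        ... | yes _ | q | r = big F 0≤1 (0≤⟦⟧ q) (0≤⟦⟧ r) (inj₁ refl)
        ... | no _ | yes _ | r = big F ≤-refl 0≤1 (0≤⟦⟧ r) (inj₂ (inj₁ refl))
        ... | no _ | no _ | yes _ = big F ≤-refl ≤-refl 0≤1 (inj₂ (inj₂ refl))

      module Step {B : B-Set} (closed : Closed B) (i₀ : Fin (suc n)) (B₀ : B i₀ ≡ true)
               (maxi : ∀ k → B k ≡ true → toℕ k ℕ.≤ toℕ i₀) where
        open Dir closed i₀ B₀ maxi public

        Eₛ : List V
        Eₛ = basis i₀ ∷ off B

        vanish : ∀ {D : B-Set} → Closed D → ∀ b {i k} → D i ≡ true → D k ≡ false → lookup (sh b (basis k)) i ≡ 𝟘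
        vanish c b {i} {k} Di Dk = trans (lookup-sh b k i) (trans (mono-bin b (toℕ k) (toℕ i)) (trans (cong (_⊗ pow b (toℕ k ∸ toℕ i)) (Closed.cl c Di Dk)) (⊗-zeroˡ _)))

        module SB = Stable sh sh-⊞ sh-⊡ sh-inv B (vanish closed)
        module SB′ = Stable sh sh-⊞ sh-⊡ sh-inv B′ (vanish closed′)

        -- The weight `θ` must be fixed by every `sh b`. Two choices occur: the constant 1 and a
        -- function of the coordinate `i₀` alone.
        module _ (θ : V → ℚ) (θ-sq : ∀ F → θ F * θ F ≤ 1ℚ) (θ-sh : ∀ b F → θ (sh b F) ≡ θ F) where
          Φ₀ : V → ℚ
          Φ₀ F = T F * θ F

          Φ : V → ℚ
          Φ F = As (off B) Φ₀ F - As (off B′) Φ₀ F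

          mul-sq : ∀ φ → ‖ (λ F → φ F * θ F) ‖² ≤ ‖ φ ‖²
          mul-sq φ = 𝐕.E-mono (λ F → ≤-from _ (0≤* (0≤sq (φ F)) (≤-diff (θ-sq F))) (lem (φ F) (θ F)))
            where
            opaque
              unfolding _+_
              lem : ∀ x y → x * x - (x * y) * (x * y) ≡ (x * x) * (1ℚ - y * y)
              lem = solve-∀ ℚ-ring

          ‖Φ₀‖²≤1 : ‖ Φ₀ ‖² ≤ 1ℚ
          ‖Φ₀‖²≤1 = ≤-trans (mul-sq T) ‖T‖²≤1

          ‖Φ‖²≤4 : ‖ Φ ‖² ≤ 4ℚ
          ‖Φ‖²≤4 = ≤-trans (sub-sq (As (off B) Φ₀) (As (off B′) Φ₀)) (≤-trans (+-mono-≤ (*-monoˡ 0≤2 (≤-trans (As-contr (off B) Φ₀) ‖Φ₀‖²≤1)) (*-monoˡ 0≤2 (≤-trans (As-contr (off B′) Φ₀) ‖Φ₀‖²≤1)))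
                    (≤-reflexive (cong₂ _+_ (*-identityʳ 2ℚ) (*-identityʳ 2ℚ))))

          -- Any `suc n` distinct directions together with `off B` span the same as `off B′`, so
          -- averaging makes the two terms of `Φ` equal.
          kill : ∀ bs → length bs ≡ suc n → Fresh (dir i₀) [] bs → As (map (dir i₀) bs) Φ ≐ (λ _ → 0ℚ)
          kill bs l f F = begin-equality
            As ds Φ F ≡⟨ As-- ds (As (off B) Φ₀) (As (off B′) Φ₀) F ⟩
            As ds (As (off B) Φ₀) F - As ds (As (off B′) Φ₀) F
              ≡⟨ cong₂ _-_ (trans (sym (As-++ ds (off B) Φ₀ F)) (As-span (ds ++ off B) (off B′) sub sup Φ₀ F)) (As-absorb ds (off B′) subd Φ₀ F) ⟩
            As (off B′) Φ₀ F - As (off B′) Φ₀ F ≡⟨ +-inverseʳ _ ⟩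
            0ℚ ∎
            where
            open ≤-Reasoning
            ds = map (dir i₀) bs
            subd : ∀ {d} → d ∈ ds → off B′ ⊩ d
            subd m with ∈-map⁻ (dir i₀) m
            ... | b , _ , refl = dir-off′ b
            sub : ∀ {d} → d ∈ ds ++ off B → off B′ ⊩ d
            sub m = [ subd , off⊆off′ ]′ (∈-++⁻ ds m)
            sup : ∀ {d} → d ∈ off B′ → ds ++ off B ⊩ d
            sup = dirs-span bs l (proj₁ (fresh-distinct f))

          -- By `kill` and `tower` the further average along `dir i₀ b` is small for typical `b`,
          -- although no particular good `b` can be named.
          spread : 𝐊.E (λ b → ‖ A (dir i₀ b) Φ ‖²) ≤ ⌜ n ⌝ * ω * 4ℚ
          spread = ≤-trans (≤-reflexive (𝐊.E-cong (λ b → trans (‖A‖² (dir i₀ b) Φ) (sym (*-identityˡ _)))))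
                    (≤-trans (tower (dir i₀) n [] Φ kill) (*-monoˡ (0≤* (0≤⌜⌝ n) 𝐊.0≤ω) ‖Φ‖²≤4))

          Δ : V → ℚ
          Δ F = As Eₛ Φ₀ F - As (off B′) Φ₀ F

          -- Substituting the shift by `- b` preserves the norm, turns the average along `basis i₀`
          -- into one along `dir i₀ b`, and preserves the spans of `off B` and `off B′`. As `θ` is
          -- invariant, the error `η` comes from `T` alone and is small by `T-sh-close`.
          conj : ∀ b → ‖ Δ ‖² ≤ 2ℚ * ‖ A (dir i₀ b) Φ ‖² + 2ℚ * (4ℚ * (3ℚ * ω))
          conj b = begin
            ‖ Δ ‖² ≡⟨ sym (E-to (λ F → Δ F * Δ F)) ⟩
            ‖ (λ F → Δ (to F)) ‖² ≡⟨ 𝐕.⟨⟩-cong split split ⟩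
            ‖ (λ F → A (dir i₀ b) Φ F + (As (dir i₀ b ∷ off B) η F - As (off B′) η F)) ‖² ≤⟨ add-sq _ _ ⟩
            2ℚ * ‖ A (dir i₀ b) Φ ‖² + 2ℚ * ‖ (λ F → As (dir i₀ b ∷ off B) η F - As (off B′) η F) ‖²
              ≤⟨ +-mono-≤ ≤-refl (*-monoˡ 0≤2 (≤-trans (sub-sq (As (dir i₀ b ∷ off B) η) (As (off B′) η))
                   (≤-trans (+-mono-≤ (*-monoˡ 0≤2 (≤-trans (As-contr (dir i₀ b ∷ off B) η) ‖η‖²)) (*-monoˡ 0≤2 (≤-trans (As-contr (off B′) η) ‖η‖²)))
                     (≤-reflexive (sym (*-distribʳ-+ (3ℚ * ω) 2ℚ 2ℚ)))))) ⟩
            2ℚ * ‖ A (dir i₀ b) Φ ‖² + 2ℚ * (4ℚ * (3ℚ * ω)) ∎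
            where
            open ≤-Reasoning
            open Linear (shL b)
            η : V → ℚ
            η F = (T (to F) - T F) * θ F
            ‖η‖² : ‖ η ‖² ≤ 3ℚ * ω
            ‖η‖² = ≤-trans (mul-sq (λ F → T (to F) - T F)) (T-sh-close (⊖ b))
            Φto : (λ F → Φ₀ (to F)) ≐ (λ F → Φ₀ F + η F)
            Φto F = trans (cong (T (to F) *_) (θ-sh (⊖ b) F)) (lem (T (to F)) (T F) (θ F))
              where
              opaque
                unfolding _+_
                lem : ∀ x y z → x * z ≡ y * z + (x - y) * z
                lem = solve-∀ ℚ-ring
            As-+ : ∀ ds φ ψ → As ds (λ F → φ F + ψ F) ≐ (λ F → As ds φ F + As ds ψ F)
            As-+ [] φ ψ F = refl
            As-+ (d ∷ ds) φ ψ F = trans (A-cong d (As-+ ds φ ψ) F) (𝐊.E-+ _ _)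
            part₁ : (λ F → As Eₛ Φ₀ (to F)) ≐ (λ F → As (dir i₀ b ∷ off B) Φ₀ F + As (dir i₀ b ∷ off B) η F)
            part₁ F = trans (As-conj Eₛ Φ₀ F) (trans (A-cong (dir i₀ b) (λ G → trans (As-span (map from (off B)) (off B) (SB.stable-map b) (SB.stable-map⁻ b) _ G) (As-cong (off B) Φto G)) F) (As-+ (dir i₀ b ∷ off B) Φ₀ η F))
            part₂ : (λ F → As (off B′) Φ₀ (to F)) ≐ (λ F → As (off B′) Φ₀ F + As (off B′) η F)
            part₂ F = trans (As-conj (off B′) Φ₀ F) (trans (As-span (map from (off B′)) (off B′) (SB′.stable-map b) (SB′.stable-map⁻ b) _ F) (trans (As-cong (off B′) Φto F) (As-+ (off B′) Φ₀ η F)))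
            split : (λ F → Δ (to F)) ≐ (λ F → A (dir i₀ b) Φ F + (As (dir i₀ b ∷ off B) η F - As (off B′) η F))
            split F = trans (cong₂ _-_ (part₁ F) (part₂ F)) (trans (lem _ _ _ _) (cong (_+ (As (dir i₀ b ∷ off B) η F - As (off B′) η F))
              (sym (trans (A-- (dir i₀ b) (As (off B) Φ₀) (As (off B′) Φ₀) F) (cong (λ z → As (dir i₀ b ∷ off B) Φ₀ F - z) (A-fix (As-⊩ (off B′) Φ₀ (dir-off′ b)) F))))))
              where
              opaque
                unfolding _+_
                lem : ∀ a b c d → (a + b) - (c + d) ≡ (a - c) + (b - d)
                lem = solve-∀ ℚ-ring

          -- The left side of `conj` is free of `b`, so `conj` may be averaged over `b`, where
          -- `spread` applies.
          dir-bound : ‖ Δ ‖² ≤ C₁ * ω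
          dir-bound = begin
            ‖ Δ ‖² ≡⟨ sym (𝐊.E-const _) ⟩
            𝐊.E (λ b → ‖ Δ ‖²) ≤⟨ 𝐊.E-mono conj ⟩
            𝐊.E (λ b → 2ℚ * ‖ A (dir i₀ b) Φ ‖² + 2ℚ * (4ℚ * (3ℚ * ω))) ≡⟨ trans (𝐊.E-+ _ _) (cong₂ _+_ (𝐊.E-*ˡ 2ℚ _) (𝐊.E-const _)) ⟩
            2ℚ * 𝐊.E (λ b → ‖ A (dir i₀ b) Φ ‖²) + 2ℚ * (4ℚ * (3ℚ * ω)) ≤⟨ +-mono-≤ (*-monoˡ 0≤2 spread) ≤-refl ⟩
            2ℚ * (⌜ n ⌝ * ω * 4ℚ) + 2ℚ * (4ℚ * (3ℚ * ω)) ≡⟨ lem ⌜ n ⌝ ω 4ℚ 3ℚ ⟩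
            C₁ * ω ∎
            where
            open ≤-Reasoning
            opaque
              unfolding _+_
              lem : ∀ k o f t → 2ℚ * (k * o * f) + 2ℚ * (f * (t * o)) ≡ (2ℚ * (k * f) + 2ℚ * (f * t)) * o
              lem = solve-∀ ℚ-ring

-- Decay of the averages of a symmetric function against a centred function of one coordinate.

module Decay where

  open Rat
  open Mean
  open Field
  open Averages
  open Shift
  open Binomial
  open Stage
  open Roots
  open Bounds
  open import Data.Bool using (true; false)
  open import Data.Nat as ℕ using (ℕ; zero; suc; _∸_)
  import Data.Nat.Properties as ℕP
  open import Data.Fin using (Fin; zero; suc; toℕ; opposite)
  import Data.Fin.Properties as FinP
  open import Data.Vec using ([]; _∷_; lookup)
  open import Data.List using (List; []; _∷_; map)
  open import Data.List.Membership.Propositional using (_∈_)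
  open import Data.Product using (_,_; proj₂)
  open import Relation.Nullary using (yes; no; Dec)
  open import Relation.Nullary.Negation using (contradiction)
  open import Relation.Binary.PropositionalEquality
  open import Tactic.RingSolver using (solve-∀)
  open import Data.Rational.Properties using (module ≤-Reasoning)

  module DecayBound (𝔽 : FinField) (n : ℕ) where
    open FinField 𝔽
    open FieldFacts 𝔽
    open Space 𝔽
    open Shifts 𝔽
    open Closure 𝔽
    open RootCount 𝔽
    open Analysis 𝔽 n
    open Constants n using (C₂)
    open VecSpace uniform using (vecU)
    open 𝐕 using (⟨_,_⟩; ‖_‖²)
    open 𝐊 using (ω)

    -- The inequality of the means with a factor of absolute value at most 1, whose sign is absorbed
    -- in the square of `x - g y`.
    polar : ∀ {g x y} → g * g ≤ 1ℚ → g * x * y ≤ ½ * (x * x + y * y)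
    polar {g} {x} {y} h = ≤-from (½ * ((x - g * y) * (x - g * y) + (1ℚ - g * g) * (y * y))) (0≤* 0≤½ (0≤+ (0≤sq _) (0≤* (≤-diff h) (0≤sq y)))) (lem g x y ½ (½-half _))
      where
      ½-half : ∀ x → ½ * x + ½ * x ≡ x
      ½-half x = trans (sym (lem₀ ½ x)) (trans (cong (_* x) ½*2) (*-identityˡ x))
        where
        opaque
          unfolding _+_
          lem₀ : ∀ h x → h * (1ℚ + 1ℚ) * x ≡ h * x + h * x
          lem₀ = solve-∀ ℚ-ring
      lem : ∀ g x y h → h * (g * x * y) + h * (g * x * y) ≡ g * x * y → h * (x * x + y * y) - g * x * y ≡ h * ((x - g * y) * (x - g * y) + (1ℚ - g * g) * (y * y))
      lem g x y h e = trans (cong (λ z → h * (x * x + y * y) - z) (sym e)) (lem₁ g x y h)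
        where
        opaque
          unfolding _+_
          lem₁ : ∀ g x y h → h * (x * x + y * y) - (h * (g * x * y) + h * (g * x * y)) ≡ h * ((x - g * y) * (x - g * y) + (1ℚ - g * g) * (y * y))
          lem₁ = solve-∀ ℚ-ring

    module _ {T : V → ℚ} (symm : Symmetric T) {B : B-Set} (closed : Closed B) (i₀ : Fin (suc n)) (B₀ : B i₀ ≡ true)
             (maxi : ∀ k → B k ≡ true → toℕ k ℕ.≤ toℕ i₀)
             (v : K → ℚ) (v-sq : ∀ x → v x * v x ≤ 1ℚ) (v-mean : 𝐊.E v ≡ 0ℚ) where
      open Symmetric symm
      open Sym symm
      open Step closed i₀ B₀ maxi

      ds : List V
      ds = off B′

      p N m : ℕ
      p = toℕ i₀
      N = toℕ (opposite i₀)
      m = p ∸ N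

      Bop : B (opposite i₀) ≡ true
      Bop = Closed.op closed B₀

      γ : K
      γ = bin p N

      -- Otherwise `next-op`, applied to the opposite of `i₀`, would make `bin p p` vanish.
      γ≢0 : γ ≢ 𝟘
      γ≢0 e = 𝟙≢𝟘 (trans (sym (bin-diag p)) (trans (cong (λ k → bin p (toℕ k)) (sym (FinP.opposite-involutive i₀))) (next-op closed i₀ B₀ maxi Bop e)))

      out₀ : B′ i₀ ≡ false
      out₀ with B′ i₀ in e
      ... | false = refl
      ... | true = contradiction (trans (sym (bin-diag p)) (proj₂ (next-true B i₀ e))) 𝟙≢𝟘

      out₁ : B′ (opposite i₀) ≡ false
      out₁ with B′ (opposite i₀) in e
      ... | false = refl
      ... | true = contradiction (proj₂ (next-true B i₀ e)) γ≢0

      θ₀ : V → ℚ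
      θ₀ F = v (lookup F i₀)

      θ : K → V → ℚ
      θ a F = θ₀ (sh⁺ (⊖ a) F)

      ψ : K → V → ℚ
      ψ a = As ds (λ F → T F * θ a F)

      Y : ℚ
      Y = ‖ As ds (λ F → T F * θ₀ F) ‖²

      -- Translation preserves `T`, the mean, and the span of `ds`; the last because `B′` is closed
      -- and symmetric. So all translates of the weight give the same norm.
      ψ-norm : ∀ a → ‖ ψ a ‖² ≡ Y
      ψ-norm a = sym (trans (sym (E-to (λ F → As ds Ψ F * As ds Ψ F))) (𝐕.⟨⟩-cong eq eq))
        where
        Ψ : V → ℚ
        Ψ F = T F * θ₀ F
        open Linear (sh⁺L a)
        op-false : ∀ {k} → B′ k ≡ false → B′ (opposite k) ≡ false
        op-false {k} Bk with B′ (opposite k) in e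
        ... | false = refl
        ... | true = contradiction (trans (sym (Closed.op closed′ e)) (trans (cong B′ (FinP.opposite-involutive k)) Bk)) λ ()
        vanish⁺ : ∀ b {i k} → B′ i ≡ true → B′ k ≡ false → lookup (sh⁺ b (basis k)) i ≡ 𝟘
        vanish⁺ b {i} {k} Bi Bk = trans (lookup-sh⁺ b k i) (trans (mono-bin b (toℕ (opposite k)) (toℕ (opposite i)))
          (trans (cong (_⊗ pow b (toℕ (opposite k) ∸ toℕ (opposite i))) (Closed.cl closed′ (Closed.op closed′ Bi) (op-false Bk))) (⊗-zeroˡ _)))
        module St = Stable sh⁺ sh⁺-⊞ sh⁺-⊡ sh⁺-inv B′ vanish⁺
        eq : (λ F → As ds Ψ (to F)) ≐ ψ a
        eq F = trans (As-conj ds Ψ F) (trans (As-span (map from ds) ds (St.stable-map a) (St.stable-map⁻ a) _ F) (As-cong ds (λ G → cong (_* θ a G) (T-sh⁺ (⊖ a) G)) F))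

      -- The speed at which the argument of `v` in `θ a` moves along `basis (opposite i₀)`. Since
      -- `γ` is nonzero it separates parameters with different m-th powers, which is all the
      -- orthogonality that is available.
      slope : K → K
      slope a = γ ⊗ pow (⊖ a) m

      θ-line : ∀ a F s t → θ a (F ⊞ s ⊡ basis i₀ ⊞ t ⊡ basis (opposite i₀)) ≡ v (lookup (sh⁺ (⊖ a) F) i₀ ⊕ s ⊕ t ⊗ slope a)
      θ-line a F s t = cong v (begin
        lookup (g (F ⊞ s ⊡ basis i₀ ⊞ t ⊡ basis (opposite i₀))) i₀
          ≡⟨ cong (λ G → lookup G i₀) (trans (sh⁺-⊞ (⊖ a) (F ⊞ s ⊡ basis i₀) (t ⊡ basis (opposite i₀))) (cong₂ _⊞_ (trans (sh⁺-⊞ (⊖ a) F (s ⊡ basis i₀)) (cong (g F ⊞_) (sh⁺-⊡ (⊖ a) s (basis i₀)))) (sh⁺-⊡ (⊖ a) t (basis (opposite i₀))))) ⟩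
        lookup (g F ⊞ s ⊡ g (basis i₀) ⊞ t ⊡ g (basis (opposite i₀))) i₀
          ≡⟨ trans (lookup-⊞ (g F ⊞ s ⊡ g (basis i₀)) (t ⊡ g (basis (opposite i₀))) i₀) (cong₂ _⊕_ (lookup-⊞ (g F) (s ⊡ g (basis i₀)) i₀) refl) ⟩
        lookup (g F) i₀ ⊕ lookup (s ⊡ g (basis i₀)) i₀ ⊕ lookup (t ⊡ g (basis (opposite i₀))) i₀
          ≡⟨ cong₂ (λ x y → lookup (g F) i₀ ⊕ x ⊕ y)
               (trans (lookup-⊡ s (g (basis i₀)) i₀) (trans (cong (s ⊗_) e₀) (⊗-identityʳ s)))
               (trans (lookup-⊡ t (g (basis (opposite i₀))) i₀) (cong (t ⊗_) e₁)) ⟩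
        lookup (g F) i₀ ⊕ s ⊕ t ⊗ slope a ∎)
        where
        open ≡-Reasoning
        g = sh⁺ (⊖ a)
        e₀ : lookup (g (basis i₀)) i₀ ≡ 𝟙
        e₀ = trans (lookup-sh⁺ (⊖ a) i₀ i₀) (trans (mono-bin (⊖ a) N N) (trans (cong₂ _⊗_ (bin-diag N) (cong (pow (⊖ a)) (ℕP.n∸n≡0 N))) (⊗-identityʳ 𝟙)))
        e₁ : lookup (g (basis (opposite i₀))) i₀ ≡ slope a
        e₁ = trans (lookup-sh⁺ (⊖ a) (opposite i₀) i₀) (trans (cong (λ k → mono (⊖ a) (toℕ k) N) (FinP.opposite-involutive i₀)) (mono-bin (⊖ a) p N))

      -- A shift of `s` turns the first argument into `s`; the second is then `s` plus
      -- `y - x + (d - c) t`, which runs through the field with `t`, so the mean over `t` is that of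
      -- `v`.
      uncorrelated : ∀ {c d} → c ≢ d → ∀ x y → 𝐊.E (λ s → 𝐊.E (λ t → v (x ⊕ s ⊕ t ⊗ c) * v (y ⊕ s ⊕ t ⊗ d))) ≡ 0ℚ
      uncorrelated {c} {d} c≢d x y = begin-equality
        𝐊.E (λ s → 𝐊.E (λ t → v (x ⊕ s ⊕ t ⊗ c) * v (y ⊕ s ⊕ t ⊗ d)))
          ≡⟨ E-swap uniform uniform _ ⟩
        𝐊.E (λ t → 𝐊.E (λ s → v (x ⊕ s ⊕ t ⊗ c) * v (y ⊕ s ⊕ t ⊗ d)))
          ≡⟨ 𝐊.E-cong (λ t → trans (𝐊.E-cong (λ s → cong₂ _*_ (cong v (l₁ x s (t ⊗ c))) (cong v (l₂ x y s t c d)))) (E-shift (x ⊕ t ⊗ c) (λ s → v s * v (s ⊕ (y ⊝ x ⊕ (d ⊝ c) ⊗ t))))) ⟩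
        𝐊.E (λ t → 𝐊.E (λ s → v s * v (s ⊕ (y ⊝ x ⊕ (d ⊝ c) ⊗ t))))
          ≡⟨ E-swap uniform uniform _ ⟩
        𝐊.E (λ s → 𝐊.E (λ t → v s * v (s ⊕ (y ⊝ x ⊕ (d ⊝ c) ⊗ t))))
          ≡⟨ 𝐊.E-cong (λ s → trans (𝐊.E-*ˡ (v s) _) (trans (cong (v s *_) (mean0 s)) (*-zeroʳ _))) ⟩
        𝐊.E (λ s → 0ℚ) ≡⟨ 𝐊.E-const 0ℚ ⟩
        0ℚ ∎
        where
        open ≤-Reasoning
        open IntSolver commutativeRing using (solve; _:=_; _:+_; _:*_; :-_)
        l₁ : ∀ x s u → x ⊕ s ⊕ u ≡ s ⊕ (x ⊕ u)
        l₁ = solve 3 (λ x s u → x :+ s :+ u := s :+ (x :+ u)) refl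
        l₂ : ∀ x y s t c d → y ⊕ s ⊕ t ⊗ d ≡ s ⊕ (x ⊕ t ⊗ c) ⊕ (y ⊝ x ⊕ (d ⊝ c) ⊗ t)
        l₂ = solve 6 (λ x y s t c d → y :+ s :+ t :* d := s :+ (x :+ t :* c) :+ (y :+ :- x :+ (d :+ :- c) :* t)) refl
        mean0 : ∀ s → 𝐊.E (λ t → v (s ⊕ (y ⊝ x ⊕ (d ⊝ c) ⊗ t))) ≡ 0ℚ
        mean0 s = trans (E-scale (d ⊝ c) (λ e → c≢d (sym (⊝≡0 e))) (λ t → v (s ⊕ (y ⊝ x ⊕ t))))
          (trans (𝐊.E-cong (λ t → cong v (l₁′ s (y ⊝ x) t))) (trans (E-shift (s ⊕ (y ⊝ x)) v) v-mean))
          where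
          l₁′ : ∀ s z t → s ⊕ (z ⊕ t) ≡ t ⊕ (s ⊕ z)
          l₁′ = solve 3 (λ s z t → s :+ (z :+ t) := t :+ (s :+ z)) refl

      -- Both `basis i₀` and `basis (opposite i₀)` belong to `ds`, so the averages along them may be
      -- inserted, and on these lines `θ-line` reduces the product to `uncorrelated`.
      orthogonal : ∀ a a′ → pow (⊖ a) m ≢ pow (⊖ a′) m → As ds (λ F → θ a F * θ a′ F) ≐ (λ _ → 0ℚ)
      orthogonal a a′ ne F = begin-equality
        As ds f F ≡⟨ absorb i₀ out₀ f F ⟩
        As ds (A (basis i₀) f) F ≡⟨ absorb (opposite i₀) out₁ (A (basis i₀) f) F ⟩
        As ds (A (basis (opposite i₀)) (A (basis i₀) f)) F ≡⟨ As-cong ds (λ G → trans (A-comm (basis (opposite i₀)) (basis i₀) f G) (zero-avg G)) F ⟩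
        As ds (λ _ → 0ℚ) F ≡⟨ As-fix ds (λ _ t G → refl) F ⟩
        0ℚ ∎
        where
        open ≤-Reasoning
        f : V → ℚ
        f F = θ a F * θ a′ F
        absorb : ∀ k → B′ k ≡ false → ∀ φ → As ds φ ≐ As ds (A (basis k) φ)
        absorb k e φ G = sym (trans (As-A ds (basis k) φ G) (A-fix (As-inv ds φ (off-∈ B′ e)) G))
        zero-avg : ∀ G → A (basis i₀) (A (basis (opposite i₀)) f) G ≡ 0ℚ
        zero-avg G = trans (𝐊.E-cong (λ s → 𝐊.E-cong (λ t → cong₂ _*_ (θ-line a G s t) (θ-line a′ G s t))))
          (uncorrelated (λ e → ne (⊗-cancelˡ γ≢0 e)) _ _)

      module Generic (m′ : ℕ) (m≡ : m ≡ suc m′) where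

        κ : K → K → ℚ
        κ a a′ = ⟦ pow (⊖ a′) m ≟ pow (⊖ a) m ⟧

        W : V → ℚ
        W F = 𝐊.E (λ a → θ a F * ψ a F)

        θ-sq : ∀ a F → θ a F * θ a F ≤ 1ℚ
        θ-sq a F = v-sq _

        -- As `ψ a` is a projection of `T` times `θ a`, its squared norm is its pairing with that
        -- product. Averaging over `a`, with `T` taken out, produces `W`.
        Y≡ : Y ≡ ⟨ T , W ⟩
        Y≡ = begin-equality
          Y ≡⟨ sym (𝐊.E-const Y) ⟩
          𝐊.E (λ a → Y) ≡⟨ 𝐊.E-cong (λ a → trans (sym (ψ-norm a)) (trans (As-adj ds _ (ψ a)) (𝐕.⟨⟩-cong (λ _ → refl) (As-idem ds _)))) ⟩
          𝐊.E (λ a → 𝐕.E (λ F → T F * θ a F * ψ a F)) ≡⟨ E-swap uniform (vecU (suc n)) _ ⟩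
          𝐕.E (λ F → 𝐊.E (λ a → T F * θ a F * ψ a F)) ≡⟨ 𝐕.E-cong (λ F → trans (𝐊.E-cong (λ a → *-assoc (T F) (θ a F) (ψ a F))) (𝐊.E-*ˡ (T F) _)) ⟩
          ⟨ T , W ⟩ ∎
          where open ≤-Reasoning

        -- The product of `ψ a` and `ψ a′` is invariant along `ds`, so the product of the weights
        -- may be averaged there, and it vanishes unless the m-th powers agree. In that rare case
        -- `polar` and `ψ-norm` give the trivial bound `Y`.
        pair : ∀ a a′ → ⟨ (λ F → θ a F * ψ a F) , (λ F → θ a′ F * ψ a′ F) ⟩ ≤ κ a a′ * Y
        pair a a′ with pow (⊖ a′) m ≟ pow (⊖ a) m
        ... | yes _ = begin
          𝐕.E (λ F → θ a F * ψ a F * (θ a′ F * ψ a′ F)) ≡⟨ 𝐕.E-cong (λ F → lem₁ (θ a F) (ψ a F) (θ a′ F) (ψ a′ F)) ⟩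
          𝐕.E (λ F → θ a F * θ a′ F * ψ a F * ψ a′ F) ≤⟨ 𝐕.E-mono (λ F → polar (subst (_≤ 1ℚ) (lem₂ (θ a F) (θ a′ F)) (subst (θ a F * θ a F * (θ a′ F * θ a′ F) ≤_) (*-identityˡ 1ℚ) (*-mono (0≤sq _) (0≤sq _) (θ-sq a F) (θ-sq a′ F))))) ⟩
          𝐕.E (λ F → ½ * (ψ a F * ψ a F + ψ a′ F * ψ a′ F)) ≡⟨ trans (𝐕.E-*ˡ ½ _) (cong (½ *_) (𝐕.E-+ _ _)) ⟩
          ½ * (‖ ψ a ‖² + ‖ ψ a′ ‖²) ≡⟨ cong₂ (λ x y → ½ * (x + y)) (ψ-norm a) (ψ-norm a′) ⟩
          ½ * (Y + Y) ≡⟨ trans (lem₃ ½ Y) (cong (_* Y) ½*2) ⟩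
          1ℚ * Y ∎
          where
          open ≤-Reasoning
          opaque
            unfolding _+_
            lem₁ : ∀ a b c d → a * b * (c * d) ≡ a * c * b * d
            lem₁ = solve-∀ ℚ-ring
          opaque
            unfolding _+_
            lem₂ : ∀ a b → a * a * (b * b) ≡ a * b * (a * b)
            lem₂ = solve-∀ ℚ-ring
          opaque
            unfolding _+_
            lem₃ : ∀ h y → h * (y + y) ≡ h * (1ℚ + 1ℚ) * y
            lem₃ = solve-∀ ℚ-ring
        ... | no ne = ≤-reflexive (begin-equality
          𝐕.E (λ F → θ a F * ψ a F * (θ a′ F * ψ a′ F)) ≡⟨ 𝐕.E-cong (λ F → trans (lem₁ (θ a F) (ψ a F) (θ a′ F) (ψ a′ F)) refl) ⟩
          ⟨ (λ F → θ a F * θ a′ F) , ψψ ⟩ ≡⟨ 𝐕.⟨⟩-cong (λ _ → refl) (λ F → sym (As-fix ds ψψ-inv F)) ⟩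
          ⟨ (λ F → θ a F * θ a′ F) , As ds ψψ ⟩ ≡⟨ As-adj ds _ ψψ ⟨
          ⟨ As ds (λ F → θ a F * θ a′ F) , ψψ ⟩ ≡⟨ 𝐕.E-cong (λ F → trans (cong (_* ψψ F) (orthogonal a a′ (λ e → ne (sym e)) F)) (*-zeroˡ _)) ⟩
          𝐕.E (λ F → 0ℚ) ≡⟨ 𝐕.E-const 0ℚ ⟩
          0ℚ ≡⟨ *-zeroˡ Y ⟨
          0ℚ * Y ∎)
          where
          open ≤-Reasoning
          ψψ : V → ℚ
          ψψ F = ψ a F * ψ a′ F
          ψψ-inv : ∀ {d} → d ∈ ds → Inv ψψ d
          ψψ-inv i t F = cong₂ _*_ (As-inv ds _ i t F) (As-inv ds _ i t F)
          opaque
            unfolding _+_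
            lem₁ : ∀ a b c d → a * b * (c * d) ≡ a * c * (b * d)
            lem₁ = solve-∀ ℚ-ring

        fibre : ∀ a → 𝐊.E (κ a) ≤ ⌜ n ⌝ * ω
        fibre a = begin
          𝐊.E (κ a) ≡⟨ E-⊖ (λ x → ⟦ pow x m ≟ pow (⊖ a) m ⟧) ⟩
          𝐊.E (λ x → ⟦ pow x m ≟ pow (⊖ a) m ⟧) ≤⟨ subst (λ k → 𝐊.E (λ x → ⟦ pow x k ≟ pow (⊖ a) m ⟧) ≤ ⌜ k ⌝ * ω) (sym m≡) (power-fibre m′ (pow (⊖ a) m)) ⟩
          ⌜ m ⌝ * ω ≤⟨ *-monoʳ 𝐊.0≤ω (⌜⌝-mono (ℕP.≤-trans (ℕP.m∸n≤m p N) (FinP.toℕ≤pred[n] i₀))) ⟩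
          ⌜ n ⌝ * ω ∎
          where open ≤-Reasoning

        W-bound : ‖ W ‖² ≤ ⌜ n ⌝ * ω * Y
        W-bound = begin
          ‖ W ‖² ≡⟨ 𝐕.E-cong (λ F → trans (sym (𝐊.E-*ʳ (W F) _)) (𝐊.E-cong (λ a → sym (𝐊.E-*ˡ _ _)))) ⟩
          𝐕.E (λ F → 𝐊.E (λ a → 𝐊.E (λ a′ → θ a F * ψ a F * (θ a′ F * ψ a′ F)))) ≡⟨ E-swap (vecU (suc n)) uniform _ ⟩
          𝐊.E (λ a → 𝐕.E (λ F → 𝐊.E (λ a′ → θ a F * ψ a F * (θ a′ F * ψ a′ F)))) ≡⟨ 𝐊.E-cong (λ a → E-swap (vecU (suc n)) uniform _) ⟩
          𝐊.E (λ a → 𝐊.E (λ a′ → ⟨ (λ F → θ a F * ψ a F) , (λ F → θ a′ F * ψ a′ F) ⟩)) ≤⟨ 𝐊.E-mono (λ a → 𝐊.E-mono (pair a)) ⟩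
          𝐊.E (λ a → 𝐊.E (λ a′ → κ a a′ * Y)) ≤⟨ 𝐊.E-mono (λ a → ≤-trans (≤-reflexive (𝐊.E-*ʳ Y (κ a))) (*-monoʳ (𝐕.0≤‖‖² _) (fibre a))) ⟩
          𝐊.E (λ a → ⌜ n ⌝ * ω * Y) ≡⟨ 𝐊.E-const _ ⟩
          ⌜ n ⌝ * ω * Y ∎
          where open ≤-Reasoning

        bound : Y ≤ ⌜ n ⌝ * ω
        bound = sq-cancel (0≤* (0≤⌜⌝ n) 𝐊.0≤ω) (begin
          Y * Y ≡⟨ cong (λ z → z * z) Y≡ ⟩
          ⟨ T , W ⟩ * ⟨ T , W ⟩ ≤⟨ CauchySchwarz.cauchy-schwarz (vecU (suc n)) T W ⟩
          ‖ T ‖² * ‖ W ‖² ≤⟨ *-mono (𝐕.0≤‖‖² T) (𝐕.0≤‖‖² W) ‖T‖²≤1 W-bound ⟩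
          1ℚ * (⌜ n ⌝ * ω * Y) ≡⟨ *-identityˡ _ ⟩
          ⌜ n ⌝ * ω * Y ∎)
          where open ≤-Reasoning

      -- If m = 0 then i₀ is the only index left, and scaling the whole vector replaces the translations.
      module Degenerate (m≡0 : m ≡ 0) where

        -- By symmetry `B` lies between `N` and `p`, and a truncated difference `m = 0` means
        -- `p ≤ N`.
        only : ∀ i → B i ≡ true → i ≡ i₀
        only i Bi = FinP.toℕ-injective (ℕP.≤-antisym (maxi i Bi) (ℕP.≤-trans (ℕP.m∸n≡0⇒m≤n m≡0) lower))
          where
          lower : N ℕ.≤ toℕ i
          lower = subst₂ ℕ._≤_ (sym (FinP.opposite-prop i₀)) (ℕP.m∸[m∸n]≡n (FinP.toℕ≤pred[n] i))
            (ℕP.∸-monoʳ-≤ n (subst (ℕ._≤ p) (FinP.opposite-prop i) (maxi (opposite i) (Closed.op closed Bi))))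

        all-out : ∀ i → B′ i ≡ false
        all-out i with B′ i in e
        ... | false = refl
        ... | true with only i (B′⊆B e)
        ...   | refl = contradiction (trans (sym e) out₀) λ ()

        As-all : ∀ φ → As ds φ ≐ (λ _ → 𝐕.E φ)
        As-all φ F = begin-equality
          As ds φ F ≡⟨ 𝐕.E-const _ ⟨
          𝐕.E (λ _ → As ds φ F) ≡⟨ 𝐕.E-cong (λ G → trans (const F) (sym (const G))) ⟩
          𝐕.E (As ds φ) ≡⟨ As-E ds φ ⟩
          𝐕.E φ ∎
          where
          open ≤-Reasoning
          const : ∀ G → As ds φ G ≡ As ds φ 0v
          const G = trans (cong (As ds φ) (trans (sym (1⊡ G)) (trans (sym (⊞-0 _)) (⊞-comm _ 0v))))
            (As-⊩ ds φ (off-⊩ B′ {G} (λ i Bi → contradiction (trans (sym Bi) (all-out i)) λ ())) 𝟙 0v)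

        X S X₀ : ℚ
        X = 𝐕.E (λ F → T F * θ₀ F)
        X₀ = 𝐕.E (λ F → T F * v 𝟘)
        S = 𝐕.E (λ F → T F * (⟦ lookup F i₀ ≟ 𝟘 ⟧ * v 𝟘))

        -- For `c ≠ 0` the bijection `F ↦ c F` preserves `T` and gives `X`; the second summand
        -- corrects the value at `c = 0`.
        scaled : ∀ c → 𝐕.E (λ F → T F * v (c ⊗ lookup F i₀)) ≡ X + ⟦ c ≟ 𝟘 ⟧ * (X₀ - X)
        scaled c with c ≟ 𝟘
        ... | yes refl = trans (𝐕.E-cong (λ F → cong (λ z → T F * v z) (⊗-zeroˡ _))) (lem X X₀)
          where
          opaque
            unfolding _+_
            lem : ∀ x y → y ≡ x + 1ℚ * (y - x)
            lem = solve-∀ ℚ-ring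
        ... | no c≢0 with inverse c c≢0
        ...   | d , cd = begin-equality
          𝐕.E (λ F → T F * v (c ⊗ lookup F i₀)) ≡⟨ 𝐕.E-cong (λ F → cong₂ _*_ (sym (T-scale c F c≢0)) (cong v (sym (lookup-⊡ c F i₀)))) ⟩
          𝐕.E (λ F → T (c ⊡ F) * θ₀ (c ⊡ F)) ≡⟨ Bijection.E-bij (vecU (suc n)) (c ⊡_) (d ⊡_) (λ F → trans (⊡-⊗ c d F) (trans (cong (_⊡ F) cd) (1⊡ F))) (λ F → trans (⊡-⊗ d c F) (trans (cong (_⊡ F) (trans (⊗-comm d c) cd)) (1⊡ F))) (λ F → T F * θ₀ F) ⟩
          X ≡⟨ lem X (X₀ - X) ⟩
          X + 0ℚ * (X₀ - X) ∎
          where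
          open ≤-Reasoning
          opaque
            unfolding _+_
            lem : ∀ x z → x ≡ x + 0ℚ * z
            lem = solve-∀ ℚ-ring

        -- If the coordinate is nonzero, its multiples by `c` are equidistributed and `v` has mean
        -- 0; only forms with coordinate 0, of density `ω`, contribute.
        S≡ : 𝐊.E (λ c → 𝐕.E (λ F → T F * v (c ⊗ lookup F i₀))) ≡ S
        S≡ = trans (E-swap uniform (vecU (suc n)) _) (𝐕.E-cong (λ F → trans (𝐊.E-*ˡ (T F) _) (cong (T F *_) (inner (lookup F i₀)))))
          where
          inner : ∀ x → 𝐊.E (λ c → v (c ⊗ x)) ≡ ⟦ x ≟ 𝟘 ⟧ * v 𝟘
          inner x with x ≟ 𝟘
          ... | yes refl = trans (𝐊.E-cong (λ c → cong v (⊗-zeroʳ c))) (trans (𝐊.E-const _) (sym (*-identityˡ _)))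
          ... | no x≢0 = trans (𝐊.E-cong (λ c → cong v (⊗-comm c x))) (trans (E-scale x x≢0 v) (trans v-mean (sym (*-zeroˡ _))))

        relation : X + ω * (X₀ - X) ≡ S
        relation = trans (sym (trans (𝐊.E-cong scaled) (trans (𝐊.E-+ _ _) (cong₂ _+_ (𝐊.E-const X) (𝐊.E-point 𝟘 _))))) S≡

        E-coord : 𝐕.E (λ F → ⟦ lookup F i₀ ≟ 𝟘 ⟧) ≡ ω
        E-coord = begin-equality
          𝐕.E f ≡⟨ As-E (basis i₀ ∷ []) f ⟨
          𝐕.E (A (basis i₀) f) ≡⟨ 𝐕.E-cong (λ F → trans (𝐊.E-cong (λ t → cong (λ z → ⟦ z ≟ 𝟘 ⟧) (line F t))) (trans (E-shift (lookup F i₀) (λ t → ⟦ t ≟ 𝟘 ⟧)) (trans (𝐊.E-cong (λ x → sym (*-identityʳ ⟦ x ≟ 𝟘 ⟧))) (trans (𝐊.E-point 𝟘 (λ _ → 1ℚ)) (*-identityʳ ω))))) ⟩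
          𝐕.E (λ _ → ω) ≡⟨ 𝐕.E-const ω ⟩
          ω ∎
          where
          open ≤-Reasoning
          f : V → ℚ
          f F = ⟦ lookup F i₀ ≟ 𝟘 ⟧
          line : ∀ F t → lookup (F ⊞ t ⊡ basis i₀) i₀ ≡ t ⊕ lookup F i₀
          line F t = trans (lookup-⊞ F (t ⊡ basis i₀) i₀) (trans (cong (lookup F i₀ ⊕_) (trans (lookup-⊡ t (basis i₀) i₀) (trans (cong (t ⊗_) (lookup-basis i₀)) (⊗-identityʳ t)))) (⊕-comm _ t))

        mean-sq : ∀ φ → (∀ F → φ F * φ F ≤ 1ℚ) → 𝐕.E φ * 𝐕.E φ ≤ 1ℚ
        mean-sq φ h = begin
          𝐕.E φ * 𝐕.E φ ≡⟨ cong (λ z → z * z) (𝐕.E-cong (λ F → sym (*-identityʳ (φ F)))) ⟩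
          ⟨ φ , (λ _ → 1ℚ) ⟩ * ⟨ φ , (λ _ → 1ℚ) ⟩ ≤⟨ CauchySchwarz.cauchy-schwarz (vecU (suc n)) φ (λ _ → 1ℚ) ⟩
          ‖ φ ‖² * ‖ (λ _ → 1ℚ) ‖² ≤⟨ *-mono (𝐕.0≤‖‖² φ) (𝐕.0≤‖‖² (λ _ → 1ℚ)) (‖‖²≤1 h) (‖‖²≤1 (λ _ → ≤-reflexive (*-identityˡ 1ℚ))) ⟩
          1ℚ * 1ℚ ≡⟨ *-identityˡ 1ℚ ⟩
          1ℚ ∎
          where open ≤-Reasoning

        prod-sq : ∀ {x y} → x * x ≤ 1ℚ → y * y ≤ 1ℚ → (x * y) * (x * y) ≤ 1ℚ
        prod-sq {x} {y} p q = subst₂ _≤_ (lem x y) (*-identityˡ 1ℚ) (*-mono (0≤sq x) (0≤sq y) p q)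
          where
          opaque
            unfolding _+_
            lem : ∀ a b → a * a * (b * b) ≡ a * b * (a * b)
            lem = solve-∀ ℚ-ring

        S-sq : S * S ≤ ω
        S-sq = begin
          S * S ≡⟨ cong (λ z → z * z) (𝐕.E-cong (λ F → lem (T F) ⟦ lookup F i₀ ≟ 𝟘 ⟧ (v 𝟘))) ⟩
          ⟨ (λ F → T F * v 𝟘) , Z ⟩ * ⟨ (λ F → T F * v 𝟘) , Z ⟩ ≤⟨ CauchySchwarz.cauchy-schwarz (vecU (suc n)) _ Z ⟩
          ‖ (λ F → T F * v 𝟘) ‖² * ‖ Z ‖² ≤⟨ *-mono (𝐕.0≤‖‖² _) (𝐕.0≤‖‖² Z) (‖‖²≤1 (λ F → prod-sq (T-sq F) (v-sq 𝟘))) (≤-reflexive (trans (𝐕.E-cong (λ F → idem (lookup F i₀ ≟ 𝟘))) E-coord)) ⟩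
          1ℚ * ω ≡⟨ *-identityˡ ω ⟩
          ω ∎
          where
          open ≤-Reasoning
          Z : V → ℚ
          Z F = ⟦ lookup F i₀ ≟ 𝟘 ⟧
          opaque
            unfolding _+_
            lem : ∀ a b c → a * (b * c) ≡ a * c * b
            lem = solve-∀ ℚ-ring
          idem : ∀ {A : Set} (d : Dec A) → ⟦ d ⟧ * ⟦ d ⟧ ≡ ⟦ d ⟧
          idem (yes _) = *-identityˡ 1ℚ
          idem (no _) = *-zeroˡ 0ℚ

        bound : Y ≤ (2ℚ + 2ℚ * 4ℚ) * ω
        bound = begin
          Y ≡⟨ 𝐕.E-cong (λ F → cong (λ z → z * z) (As-all _ F)) ⟩
          𝐕.E (λ _ → X * X) ≡⟨ 𝐕.E-const _ ⟩
          X * X ≡⟨ cong (λ z → z * z) X≡ ⟩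
          (S + ω * (X - X₀)) * (S + ω * (X - X₀)) ≤⟨ sq-add S (ω * (X - X₀)) ⟩
          2ℚ * (S * S) + 2ℚ * (ω * (X - X₀) * (ω * (X - X₀))) ≤⟨ +-mono-≤ (*-monoˡ 0≤2 S-sq) (*-monoˡ 0≤2 small) ⟩
          2ℚ * ω + 2ℚ * (4ℚ * ω) ≡⟨ lem ω 4ℚ ⟩
          (2ℚ + 2ℚ * 4ℚ) * ω ∎
          where
          open ≤-Reasoning
          opaque
            unfolding _+_
            lem : ∀ o f → 2ℚ * o + 2ℚ * (f * o) ≡ (2ℚ + 2ℚ * f) * o
            lem = solve-∀ ℚ-ring
          X≡ : X ≡ S + ω * (X - X₀)
          X≡ = trans (lem₁ X X₀ ω) (cong (_+ ω * (X - X₀)) relation)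
            where
            opaque
              unfolding _+_
              lem₁ : ∀ x y o → x ≡ x + o * (y - x) + o * (x - y)
              lem₁ = solve-∀ ℚ-ring
          diff : (X - X₀) * (X - X₀) ≤ 4ℚ
          diff = ≤-trans (sub-sq′ X X₀) (≤-trans (+-mono-≤ (*-monoˡ 0≤2 (mean-sq _ (λ F → prod-sq (T-sq F) (v-sq _)))) (*-monoˡ 0≤2 (mean-sq _ (λ F → prod-sq (T-sq F) (v-sq 𝟘))))) (≤-reflexive (cong₂ _+_ (*-identityʳ 2ℚ) (*-identityʳ 2ℚ))))
            where
            sub-sq′ : ∀ x y → (x - y) * (x - y) ≤ 2ℚ * (x * x) + 2ℚ * (y * y)
            sub-sq′ x y = ≤-from ((x + y) * (x + y)) (0≤sq (x + y)) (lem₂ x y)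
              where
              opaque
                unfolding _+_
                lem₂ : ∀ x y → 2ℚ * (x * x) + 2ℚ * (y * y) - (x - y) * (x - y) ≡ (x + y) * (x + y)
                lem₂ = solve-∀ ℚ-ring
          small : ω * (X - X₀) * (ω * (X - X₀)) ≤ 4ℚ * ω
          small = begin
            ω * (X - X₀) * (ω * (X - X₀)) ≡⟨ lem₃ ω (X - X₀) ⟩
            (X - X₀) * (X - X₀) * (ω * ω) ≤⟨ *-mono (0≤sq _) (0≤sq ω) diff (≤-trans (*-monoˡ 𝐊.0≤ω (𝐊.ω≤1 𝟘)) (≤-reflexive (*-identityʳ ω))) ⟩
            4ℚ * ω ∎
            where
            opaque
              unfolding _+_
              lem₃ : ∀ o z → o * z * (o * z) ≡ z * z * (o * o)
              lem₃ = solve-∀ ℚ-ring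

      decay : Y ≤ C₂ * ω
      decay with m in e
      ... | suc m′ = ≤-trans (Generic.bound m′ e) (≤-from ((2ℚ + 2ℚ * 4ℚ) * ω) (0≤* (0≤+ 0≤2 (0≤* 0≤2 (0≤+ 0≤2 0≤2))) 𝐊.0≤ω) (lem ⌜ n ⌝ (2ℚ + 2ℚ * 4ℚ) ω))
        where
        opaque
          unfolding _+_
          lem : ∀ a b o → (a + b) * o - a * o ≡ b * o
          lem = solve-∀ ℚ-ring
      ... | zero = ≤-trans (Degenerate.bound e) (≤-from (⌜ n ⌝ * ω) (0≤* (0≤⌜⌝ n) 𝐊.0≤ω) (lem ⌜ n ⌝ (2ℚ + 2ℚ * 4ℚ) ω))
        where
        opaque
          unfolding _+_
          lem : ∀ a b o → (a + b) * o - b * o ≡ a * o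
          lem = solve-∀ ℚ-ring

-- Removing the functions of single coordinates by induction on closed sets.

module Claim where

  open Rat
  open Mean
  open Field
  open Averages
  open Shift
  open Binomial
  open Stage
  open Bounds
  open Decay
  open import Data.Bool using (Bool; true; false; _∧_; not; if_then_else_)
  import Data.Bool as Bool
  open import Data.Nat as ℕ using (ℕ; zero; suc; _∸_)
  import Data.Nat.Properties as ℕP
  open import Data.Fin as Fin using (Fin; zero; suc; toℕ; fromℕ<)
  import Data.Fin.Properties as FinP
  open import Data.Vec using (Vec; []; _∷_; lookup)
  open import Data.List as List using (List; []; _∷_; map)
  open import Data.List.Membership.Propositional using (_∈_; _∉_)
  open import Data.List.Membership.Propositional.Properties using (∈-filter⁺; ∈-filter⁻; ∈-allFin)
  open import Data.List.Relation.Unary.Any using (here; there)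
  open import Data.Product using (_,_; proj₂)
  open import Data.Sum using (_⊎_; inj₁; inj₂)
  open import Relation.Nullary using (¬_; yes; no)
  open import Relation.Nullary.Negation using (contradiction)
  open import Relation.Binary.PropositionalEquality
  open import Tactic.RingSolver using (solve-∀)
  open import Data.Rational.Properties using (module ≤-Reasoning)

  module Products (𝔽 : FinField) where
    open FinField 𝔽
    open FieldFacts 𝔽
    open Space 𝔽
    open Shifts 𝔽
    module 𝐊 = Uniform uniform

    Family : ℕ → Set
    Family m = Fin m → K → ℚ

    Π : ∀ {m} → Family m → Vec K m → ℚ
    Π h [] = 1ℚ
    Π h (x ∷ xs) = h zero x * Π (λ i → h (suc i)) xs

    Π-cong : ∀ {m} {h h′ : Family m} → (∀ i x → h i x ≡ h′ i x) → ∀ F → Π h F ≡ Π h′ F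
    Π-cong p [] = refl
    Π-cong p (x ∷ F) = cong₂ _*_ (p zero x) (Π-cong (λ i → p (suc i)) F)

    Π-0≤ : ∀ {m} {h : Family m} → (∀ i x → 0ℚ ≤ h i x) → ∀ F → 0ℚ ≤ Π h F
    Π-0≤ p [] = 0≤1
    Π-0≤ p (x ∷ F) = 0≤* (p zero x) (Π-0≤ (λ i → p (suc i)) F)

    Π-≤1 : ∀ {m} {h : Family m} → (∀ i x → 0ℚ ≤ h i x) → (∀ i x → h i x ≤ 1ℚ) → ∀ F → Π h F ≤ 1ℚ
    Π-≤1 p q [] = ≤-refl
    Π-≤1 p q (x ∷ F) = ≤-trans (*-mono (p zero x) (Π-0≤ (λ i → p (suc i)) F) (q zero x) (Π-≤1 (λ i → p (suc i)) (λ i → q (suc i)) F)) (≤-reflexive (*-identityˡ 1ℚ))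

    upd : ∀ {m} → Family m → Fin m → (K → ℚ) → Family m
    upd h k g i with i FinP.≟ k
    ... | yes _ = g
    ... | no _ = h i

    upd-suc : ∀ {m} (h : Family (suc m)) k g i x → upd h (suc k) g (suc i) x ≡ upd (λ i → h (suc i)) k g i x
    upd-suc h k g i x with i FinP.≟ k
    ... | yes refl = refl
    ... | no _ = refl

    -- Along a coordinate line only one factor varies. Hence averaging a product along the line
    -- replaces that factor by its mean, which is `A-Π`.
    Π-line : ∀ {m} (h : Family m) k F t → Π h (F ⊞ t ⊡ basis k) ≡ h k (lookup F k ⊕ t) * Π (upd h k (λ _ → 1ℚ)) F
    Π-line h zero (x ∷ F) t = cong₂ _*_ (cong (λ z → h zero (x ⊕ z)) (⊗-identityʳ t))
      (trans (cong (Π (λ i → h (suc i))) (trans (cong (F ⊞_) (⊡0 t)) (⊞-0 F))) (sym (*-identityˡ _)))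
    Π-line h (suc k) (x ∷ F) t = trans (cong₂ _*_ (cong (h zero) (trans (cong (x ⊕_) (⊗-zeroʳ t)) (⊕-identityʳ x))) (Π-line (λ i → h (suc i)) k F t))
      (trans (lem (h zero x) _ _) (cong (λ z → h (suc k) (lookup F k ⊕ t) * (h zero x * z)) (Π-cong (λ i y → sym (upd-suc h k _ i y)) F)))
      where
      opaque
        unfolding _+_
        lem : ∀ a b c → a * (b * c) ≡ b * (a * c)
        lem = solve-∀ ℚ-ring

    Π-extract : ∀ {m} (h : Family m) k F → Π h F ≡ h k (lookup F k) * Π (upd h k (λ _ → 1ℚ)) F
    Π-extract h k F = trans (cong (Π h) (sym (trans (cong (F ⊞_) (0⊡ (basis k))) (⊞-0 F)))) (trans (Π-line h k F 𝟘) (cong (λ z → h k z * Π (upd h k (λ _ → 1ℚ)) F) (⊕-identityʳ _)))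

    upd-same : ∀ {m} (h : Family m) k g → upd h k g k ≡ g
    upd-same h k g with k FinP.≟ k
    ... | yes _ = refl
    ... | no p = contradiction refl p

    upd-other : ∀ {m} (h : Family m) {k i} g → i ≢ k → upd h k g i ≡ h i
    upd-other h {k} {i} g p with i FinP.≟ k
    ... | yes e = contradiction e p
    ... | no _ = refl

    upd-upd : ∀ {m} (h : Family m) k g g′ i x → upd (upd h k g) k g′ i x ≡ upd h k g′ i x
    upd-upd h k g g′ i x with i FinP.≟ k
    ... | yes _ = refl
    ... | no p = cong (λ f → f x) (upd-other h g p)

    Π-upd : ∀ {m} (h : Family m) k g F → Π (upd h k g) F ≡ g (lookup F k) * Π (upd h k (λ _ → 1ℚ)) F
    Π-upd h k g F = trans (Π-extract (upd h k g) k F) (cong₂ _*_ (cong (λ f → f (lookup F k)) (upd-same h k g)) (Π-cong (upd-upd h k g _) F))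

    average : ∀ {m} → (Fin m → Bool) → Family m → Family m
    average B h i x = if B i then h i x else 𝐊.E (h i)

    Π-inv : ∀ {m} (h : Family m) k → (∀ x y → h k x ≡ h k y) → ∀ F t → Π h (F ⊞ t ⊡ basis k) ≡ Π h F
    Π-inv h k c F t = trans (Π-line h k F t) (trans (cong (_* Π (upd h k (λ _ → 1ℚ)) F) (c _ _)) (sym (Π-extract h k F)))

  module Independence (𝔽 : FinField) (n : ℕ) where
    open Constants n
    open FinField 𝔽
    open FieldFacts 𝔽
    open Space 𝔽
    open Shifts 𝔽
    open Closure 𝔽
    open Analysis 𝔽 n
    open Products 𝔽 hiding (module 𝐊)
    open DecayBound 𝔽 n using (decay)
    open VecSpace uniform using (vecU)
    open 𝐕 using (⟨_,_⟩; ‖_‖²)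
    open 𝐊 using (ω)

    A-Π : ∀ h k → A (basis k) (Π h) ≐ Π (upd h k (λ _ → 𝐊.E (h k)))
    A-Π h k F = trans (𝐊.E-cong (λ t → Π-line h k F t)) (trans (𝐊.E-*ʳ _ _) (trans (cong (_* Π (upd h k (λ _ → 1ℚ)) F)
      (trans (𝐊.E-cong (λ t → cong (h k) (⊕-comm _ t))) (E-shift (lookup F k) (h k)))) (sym (Π-upd h k (λ _ → 𝐊.E (h k)) F))))

    out : List (Fin (suc n)) → B-Set
    out [] i = true
    out (k ∷ ks) i = not (Fin.toℕ i ℕ.≡ᵇ Fin.toℕ k) ∧ out ks i

    module _ where
      open import Data.Nat.Properties using (≡ᵇ⇒≡; ≡⇒≡ᵇ)

      out-∈ : ∀ {ks i} → i ∈ ks → out ks i ≡ false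
      out-∈ {k ∷ ks} {i} (here refl) with toℕ i ℕ.≡ᵇ toℕ i in e
      ... | true = refl
      ... | false = contradiction (≡⇒≡ᵇ (toℕ i) (toℕ i) refl) (subst (λ b → ¬ Bool.T b) (sym e) (λ ()))
      out-∈ {k ∷ ks} {i} (there m) with not (toℕ i ℕ.≡ᵇ toℕ k)
      ... | true = out-∈ m
      ... | false = refl

      out-∉ : ∀ {ks i} → i ∉ ks → out ks i ≡ true
      out-∉ {[]} p = refl
      out-∉ {k ∷ ks} {i} p with toℕ i ℕ.≡ᵇ toℕ k in e
      ... | false = out-∉ (λ m → p (there m))
      ... | true = contradiction (here (FinP.toℕ-injective (≡ᵇ⇒≡ (toℕ i) (toℕ k) (subst Bool.T (sym e) _)))) p

    average-∷ : ∀ k ks (h : Family (suc n)) i x → upd (average (out ks) h) k (λ _ → 𝐊.E (average (out ks) h k)) i x ≡ average (out (k ∷ ks)) h i x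
    average-∷ k ks h i x with i FinP.≟ k
    ... | yes refl = trans mean (cong (λ b → if b then h i x else 𝐊.E (h i)) (sym (out-∈ {k ∷ ks} (here refl))))
      where
      mean : 𝐊.E (average (out ks) h i) ≡ 𝐊.E (h i)
      mean with out ks i
      ... | true = refl
      ... | false = 𝐊.E-const _
    ... | no i≢k with toℕ i ℕ.≡ᵇ toℕ k in e
    ...   | false = refl
    ...   | true = contradiction (FinP.toℕ-injective (ℕP.≡ᵇ⇒≡ (toℕ i) (toℕ k) (subst Bool.T (sym e) _))) i≢k

    As-Π-list : ∀ ks h → As (map basis ks) (Π h) ≐ Π (average (out ks) h)
    As-Π-list [] h F = refl
    As-Π-list (k ∷ ks) h F = trans (A-cong (basis k) (As-Π-list ks h) F) (trans (A-Π _ k F) (Π-cong (average-∷ k ks h) F))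

    As-Π : ∀ B h → As (off B) (Π h) ≐ Π (average B h)
    As-Π B h F = trans (As-Π-list ks h F) (Π-cong (λ i x → cong (λ b → if b then h i x else 𝐊.E (h i)) (agree i)) F)
      where
      ks = List.filter (λ i → B i Bool.≟ false) (List.allFin (suc n))
      agree : ∀ i → out ks i ≡ B i
      agree i with B i in e
      ... | false = out-∈ {ks} (∈-filter⁺ (λ i → B i Bool.≟ false) (∈-allFin i) e)
      ... | true = out-∉ {ks} (λ m → contradiction (trans (sym e) (proj₂ (∈-filter⁻ (λ i → B i Bool.≟ false) {xs = List.allFin (suc n)} m))) λ ())

    cs-1 : ∀ φ w → ‖ w ‖² ≤ 1ℚ → ⟨ φ , w ⟩ * ⟨ φ , w ⟩ ≤ ‖ φ ‖²
    cs-1 φ w p = ≤-trans (CauchySchwarz.cauchy-schwarz (vecU (suc n)) φ w) (≤-trans (*-monoˡ (𝐕.0≤‖‖² φ) p) (≤-reflexive (*-identityʳ _)))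

    three-sq : ∀ x y z {a b c} → x * x ≤ a → y * y ≤ b → z * z ≤ c → (x + y + z) * (x + y + z) ≤ 2ℚ * a + 4ℚ * (b + c)
    three-sq x y z {a} {b} {c} p q r = begin
      (x + y + z) * (x + y + z) ≡⟨ lem₁ x y z ⟩
      (x + (y + z)) * (x + (y + z)) ≤⟨ sq-add x (y + z) ⟩
      2ℚ * (x * x) + 2ℚ * ((y + z) * (y + z)) ≤⟨ +-mono-≤ (*-monoˡ 0≤2 p) (*-monoˡ 0≤2 (≤-trans (sq-add y z) (+-mono-≤ (*-monoˡ 0≤2 q) (*-monoˡ 0≤2 r)))) ⟩
      2ℚ * a + 2ℚ * (2ℚ * b + 2ℚ * c) ≡⟨ lem₂ a b c ⟩
      2ℚ * a + 4ℚ * (b + c) ∎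
      where
      open ≤-Reasoning
      opaque
        unfolding _+_
        lem₁ : ∀ x y z → (x + y + z) * (x + y + z) ≡ (x + (y + z)) * (x + (y + z))
        lem₁ = solve-∀ ℚ-ring
      opaque
        unfolding _+_
        lem₂ : ∀ a b c → 2ℚ * a + 2ℚ * (2ℚ * b + 2ℚ * c) ≡ 2ℚ * a + 4ℚ * (b + c)
        lem₂ = solve-∀ ℚ-ring

    module _ {T : V → ℚ} (symm : Symmetric T) where
      open Symmetric symm
      open Sym symm

      module Removal {B : B-Set} (closed : Closed B) (i₀ : Fin (suc n)) (B₀ : B i₀ ≡ true)
               (maxi : ∀ k → B k ≡ true → toℕ k ℕ.≤ toℕ i₀) where
        open Step closed i₀ B₀ maxi using (Eₛ; B′; B′⊆B; Δ; dir-bound)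

        -- The coordinate of the maximum of a closed set is fixed by `sh b`: the entry `bin k i₀`
        -- vanishes for `k` outside `B` by closedness, and for any other `k` in `B` because
        -- `k < i₀`. So `v` of this coordinate is an admissible weight.
        lookup-sh-top : ∀ b F → lookup (sh b F) i₀ ≡ lookup F i₀
        lookup-sh-top b F = support {S = S} sub F (λ k → inj₂ (bas k))
          where
          S : V → Set
          S F = lookup (sh b F) i₀ ≡ lookup F i₀
          sub : Subspace S
          sub = record
            { S-⊞ = λ {u} {w} p q → trans (cong (λ G → lookup G i₀) (sh-⊞ b u w)) (trans (lookup-⊞ (sh b u) (sh b w) i₀) (trans (cong₂ _⊕_ p q) (sym (lookup-⊞ u w i₀))))
            ; S-⊡ = λ {u} t p → trans (cong (λ G → lookup G i₀) (sh-⊡ b t u)) (trans (lookup-⊡ t (sh b u) i₀) (trans (cong (t ⊗_) p) (sym (lookup-⊡ t u i₀))))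
            ; S-0 = cong (λ G → lookup G i₀) (sh-0v b) }
          bas : ∀ k → S (basis k)
          bas k with k FinP.≟ i₀
          ... | yes refl = trans (lookup-sh b k k) (trans (mono-bin b (toℕ k) (toℕ k)) (trans (cong₂ _⊗_ (bin-diag (toℕ k)) (cong (pow b) (ℕP.n∸n≡0 (toℕ k)))) (trans (⊗-identityʳ 𝟙) (sym (lookup-basis k)))))
          ... | no k≢ = trans (lookup-sh b k i₀) (trans (mono-bin b (toℕ k) (toℕ i₀)) (trans (cong (_⊗ pow b (toℕ k ∸ toℕ i₀)) bin0) (trans (⊗-zeroˡ _) (sym (lookup-basis-≢ (λ e → k≢ (sym e)))))))
            where
            bin0 : bin (toℕ k) (toℕ i₀) ≡ 𝟘
            bin0 with B k in e
            ... | false = Closed.cl closed B₀ e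
            ... | true = mono-< 𝟙 (ℕP.≤∧≢⇒< (maxi k e) (λ q → k≢ (FinP.toℕ-injective q)))

        -- `dir-bound` with weight `v` replaces the average over `Eₛ` by the one over `off B′`,
        -- where `decay` applies.
        weighted : (v : K → ℚ) → (∀ x → v x * v x ≤ 1ℚ) → 𝐊.E v ≡ 0ℚ → ‖ As Eₛ (λ F → T F * v (lookup F i₀)) ‖² ≤ C₃ * ω
        weighted v v-sq v-mean = begin
          ‖ As Eₛ φ ‖² ≡⟨ 𝐕.⟨⟩-cong split split ⟩
          ‖ (λ F → Δ θ θ² θ-sh F + As (off B′) φ F) ‖² ≤⟨ add-sq _ _ ⟩
          2ℚ * ‖ Δ θ θ² θ-sh ‖² + 2ℚ * ‖ As (off B′) φ ‖² ≤⟨ +-mono-≤ (*-monoˡ 0≤2 (dir-bound θ θ² θ-sh)) (*-monoˡ 0≤2 (decay symm closed i₀ B₀ maxi v v-sq v-mean)) ⟩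
          2ℚ * (C₁ * ω) + 2ℚ * (C₂ * ω) ≡⟨ lem C₁ C₂ ω ⟩
          C₃ * ω ∎
          where
          open ≤-Reasoning
          θ φ : V → ℚ
          θ F = v (lookup F i₀)
          φ F = T F * θ F
          θ² : ∀ F → θ F * θ F ≤ 1ℚ
          θ² F = v-sq _
          θ-sh : ∀ b F → θ (sh b F) ≡ θ F
          θ-sh b F = cong v (lookup-sh-top b F)
          split : As Eₛ φ ≐ (λ F → Δ θ θ² θ-sh F + As (off B′) φ F)
          split F = lem₁ _ _
            where
            opaque
              unfolding _+_
              lem₁ : ∀ x y → x ≡ x - y + y
              lem₁ = solve-∀ ℚ-ring
          opaque
            unfolding _+_
            lem : ∀ a b o → 2ℚ * (a * o) + 2ℚ * (b * o) ≡ (2ℚ * a + 2ℚ * b) * o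
            lem = solve-∀ ℚ-ring

        -- `dir-bound` with weight 1. The averages are moved from `T` to `w` by self-adjointness,
        -- and `w` is already fixed by the average over `Eₛ`.
        unweighted : ∀ w → (∀ {d} → d ∈ Eₛ → Inv w d) → ‖ w ‖² ≤ 1ℚ →
          (⟨ T , w ⟩ - ⟨ T , As (off B′) w ⟩) * (⟨ T , w ⟩ - ⟨ T , As (off B′) w ⟩) ≤ C₁ * ω
        unweighted w inv w≤1 = begin
          (⟨ T , w ⟩ - ⟨ T , As (off B′) w ⟩) * (⟨ T , w ⟩ - ⟨ T , As (off B′) w ⟩) ≡⟨ cong (λ z → z * z) eq ⟩
          ⟨ Δ one one² one-sh , w ⟩ * ⟨ Δ one one² one-sh , w ⟩ ≤⟨ cs-1 _ w w≤1 ⟩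
          ‖ Δ one one² one-sh ‖² ≤⟨ dir-bound one one² one-sh ⟩
          C₁ * ω ∎
          where
          open ≤-Reasoning
          one : V → ℚ
          one _ = 1ℚ
          one² : ∀ F → one F * one F ≤ 1ℚ
          one² F = ≤-reflexive (*-identityˡ 1ℚ)
          one-sh : ∀ b F → one (sh b F) ≡ one F
          one-sh b F = refl
          T1 : (λ F → T F * 1ℚ) ≐ T
          T1 F = *-identityʳ (T F)
          eq : ⟨ T , w ⟩ - ⟨ T , As (off B′) w ⟩ ≡ ⟨ Δ one one² one-sh , w ⟩
          eq = begin-equality
            ⟨ T , w ⟩ - ⟨ T , As (off B′) w ⟩ ≡⟨ cong₂ _-_ (trans (𝐕.⟨⟩-cong (λ F → sym (T1 F)) (λ F → sym (As-fix Eₛ inv F))) (sym (As-adj Eₛ _ w))) (trans (𝐕.⟨⟩-cong (λ F → sym (T1 F)) (λ _ → refl)) (sym (As-adj (off B′) _ w))) ⟩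
            ⟨ As Eₛ (λ F → T F * 1ℚ) , w ⟩ - ⟨ As (off B′) (λ F → T F * 1ℚ) , w ⟩ ≡⟨ 𝐕.E-- _ _ ⟨
            𝐕.E (λ F → As Eₛ (λ F → T F * 1ℚ) F * w F - As (off B′) (λ F → T F * 1ℚ) F * w F) ≡⟨ 𝐕.E-cong (λ F → lem _ _ (w F)) ⟩
            ⟨ Δ one one² one-sh , w ⟩ ∎
            where
            opaque
              unfolding _+_
              lem : ∀ a b c → a * c - b * c ≡ (a - b) * c
              lem = solve-∀ ℚ-ring

      module _ (g : Family (suc n)) (g-0≤ : ∀ i x → 0ℚ ≤ g i x) (g-≤1 : ∀ i x → g i x ≤ 1ℚ) where

        u : B-Set → V → ℚ
        u B = Π (average B g)

        ∅ : B-Set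
        ∅ _ = false

        avg-0≤ : ∀ B i x → 0ℚ ≤ average B g i x
        avg-0≤ B i x with B i
        ... | true = g-0≤ i x
        ... | false = 𝐊.E-nonneg (g-0≤ i)

        avg-≤1 : ∀ B i x → average B g i x ≤ 1ℚ
        avg-≤1 B i x with B i
        ... | true = g-≤1 i x
        ... | false = 𝐊.E-≤const (g-≤1 i)

        sq-01 : ∀ {x} → 0ℚ ≤ x → x ≤ 1ℚ → x * x ≤ 1ℚ
        sq-01 p q = ≤-trans (*-mono p p q q) (≤-reflexive (*-identityˡ 1ℚ))

        err : B-Set → ℚ
        err B = ⟨ T , u B ⟩ - ⟨ T , u ∅ ⟩

        empty : ∀ B → (∀ i → B i ≡ false) → err B ≡ 0ℚ
        empty B h = trans (cong (_- ⟨ T , u ∅ ⟩) (𝐕.⟨⟩-cong (λ _ → refl) (Π-cong (λ i x → cong (λ b → if b then g i x else 𝐊.E (g i)) (h i))))) (+-inverseʳ _)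

        -- Induction on a strict bound for the indices in `B`. If the top index occurs in `B`, the
        -- error has three parts: the centred part of its function (`weighted`), the averaging of
        -- the rest over the coordinates outside `B′` (`unweighted`), and the error of `B′`, which
        -- no longer contains that index.
        claim : ∀ f B → f ℕ.≤ suc n → Closed B → (∀ i → B i ≡ true → toℕ i ℕ.< f) → err B * err B ≤ Cst f * ω
        claim zero B f≤ closed lt = ≤-reflexive (trans (cong (λ z → z * z) (empty B none)) (trans (*-zeroˡ 0ℚ) (sym (*-zeroˡ ω))))
          where
          none : ∀ i → B i ≡ false
          none i with B i in e
          ... | false = refl
          ... | true = contradiction (lt i e) λ ()
        claim (suc f) B f≤ closed lt with B (fromℕ< f≤) in B₀
        ... | false = ≤-trans (claim f B (ℕP.≤-trans (ℕP.n≤1+n f) f≤) closed lower) (*-monoʳ 𝐊.0≤ω (Cst-mono f))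
          where
          lower : ∀ i → B i ≡ true → toℕ i ℕ.< f
          lower i e = ℕP.≤∧≢⇒< (ℕP.≤-pred (lt i e)) (λ q → contradiction (trans (sym B₀) (trans (cong B (FinP.toℕ-injective (trans (FinP.toℕ-fromℕ< f≤) (sym q)))) e)) λ ())
        ... | true = ≤-trans (subst (λ z → z * z ≤ _) (sym total) (three-sq X₁ X₂ (err B′) bound₁ bound₂ (claim f B′ (ℕP.≤-trans (ℕP.n≤1+n f) f≤) closed′ lower))) (≤-reflexive (lem C₃ C₁ (Cst f) ω))
          where
          i₀ = fromℕ< f≤
          maxi : ∀ k → B k ≡ true → toℕ k ℕ.≤ toℕ i₀
          maxi k e = subst (toℕ k ℕ.≤_) (sym (FinP.toℕ-fromℕ< f≤)) (ℕP.≤-pred (lt k e))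
          open Step closed i₀ B₀ maxi using (Eₛ; B′; closed′; B′⊆B)
          open Removal closed i₀ B₀ maxi
          i₀∉B′ : B′ i₀ ≢ true
          i₀∉B′ e = 𝟙≢𝟘 (trans (sym (bin-diag (toℕ i₀))) (proj₂ (next-true B i₀ e)))
          lower : ∀ i → B′ i ≡ true → toℕ i ℕ.< f
          lower i e = ℕP.≤∧≢⇒< (ℕP.≤-pred (lt i (B′⊆B e))) (λ q → i₀∉B′ (subst (λ k → B′ k ≡ true) (FinP.toℕ-injective (trans q (sym (FinP.toℕ-fromℕ< f≤)))) e))
          h : Family (suc n)
          h = average B g
          w : V → ℚ
          w = Π (upd h i₀ (λ _ → 1ℚ))
          ḡ : ℚ
          ḡ = 𝐊.E (g i₀)
          v : K → ℚ
          v x = g i₀ x - ḡ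
          w̄ : V → ℚ
          w̄ = Π (upd h i₀ (λ _ → ḡ))
          X₁ X₂ : ℚ
          X₁ = ⟨ T , u B ⟩ - ⟨ T , w̄ ⟩
          X₂ = ⟨ T , w̄ ⟩ - ⟨ T , As (off B′) w̄ ⟩
          const-off : ∀ c k → B k ≡ false ⊎ k ≡ i₀ → ∀ x y → upd h i₀ (λ _ → c) k x ≡ upd h i₀ (λ _ → c) k y
          const-off c k p x y with k FinP.≟ i₀ | p
          ... | yes _ | _ = refl
          ... | no q | inj₂ e = contradiction e q
          ... | no _ | inj₁ e rewrite e = refl
          inv : ∀ c {d} → d ∈ Eₛ → Inv (Π (upd h i₀ (λ _ → c))) d
          inv c (here refl) t F = Π-inv _ i₀ (const-off c i₀ (inj₂ refl)) F t
          inv c (there m) t F with off-∈⁻ B m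
          ... | k , e , refl = Π-inv _ k (const-off c k (inj₁ e)) F t
          upd-0≤ : ∀ {c} → 0ℚ ≤ c → ∀ i x → 0ℚ ≤ upd h i₀ (λ _ → c) i x
          upd-0≤ p i x with i FinP.≟ i₀
          ... | yes _ = p
          ... | no _ = avg-0≤ B i x
          upd-≤1 : ∀ {c} → c ≤ 1ℚ → ∀ i x → upd h i₀ (λ _ → c) i x ≤ 1ℚ
          upd-≤1 p i x with i FinP.≟ i₀
          ... | yes _ = p
          ... | no _ = avg-≤1 B i x
          norm : ∀ {c} → 0ℚ ≤ c → c ≤ 1ℚ → ‖ Π (upd h i₀ (λ _ → c)) ‖² ≤ 1ℚ
          norm p q = ‖‖²≤1 (λ F → sq-01 (Π-0≤ (upd-0≤ p) F) (Π-≤1 (upd-0≤ p) (upd-≤1 q) F))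
          0≤ḡ : 0ℚ ≤ ḡ
          0≤ḡ = 𝐊.E-nonneg (g-0≤ i₀)
          ḡ≤1 : ḡ ≤ 1ℚ
          ḡ≤1 = 𝐊.E-≤const (g-≤1 i₀)
          v-sq : ∀ x → v x * v x ≤ 1ℚ
          v-sq x = sq≤1 (≤-from (g i₀ x + (1ℚ - ḡ)) (0≤+ (g-0≤ i₀ x) (≤-diff ḡ≤1)) (l₁ (g i₀ x) ḡ)) (≤-from (1ℚ - g i₀ x + ḡ) (0≤+ (≤-diff (g-≤1 i₀ x)) 0≤ḡ) (l₂ (g i₀ x) ḡ))
            where
            opaque
              unfolding _+_
              l₁ : ∀ a b → (a - b) - - 1ℚ ≡ a + (1ℚ - b)
              l₁ = solve-∀ ℚ-ring
            opaque
              unfolding _+_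
              l₂ : ∀ a b → 1ℚ - (a - b) ≡ 1ℚ - a + b
              l₂ = solve-∀ ℚ-ring
          v-mean : 𝐊.E v ≡ 0ℚ
          v-mean = trans (𝐊.E-- (g i₀) (λ _ → ḡ)) (trans (cong (λ z → ḡ - z) (𝐊.E-const ḡ)) (+-inverseʳ ḡ))
          X₁≡ : X₁ ≡ ⟨ As Eₛ (λ F → T F * v (lookup F i₀)) , w ⟩
          X₁≡ = begin-equality
            X₁ ≡⟨ 𝐕.E-- _ _ ⟨
            𝐕.E (λ F → T F * u B F - T F * w̄ F) ≡⟨ 𝐕.E-cong (λ F → trans (cong₂ (λ x y → T F * x - T F * y) (trans (Π-extract h i₀ F) (cong (_* w F) (cong (λ b → if b then g i₀ (lookup F i₀) else ḡ) B₀))) (Π-upd h i₀ (λ _ → ḡ) F)) (l (T F) (g i₀ (lookup F i₀)) ḡ (w F))) ⟩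
            ⟨ (λ F → T F * v (lookup F i₀)) , w ⟩ ≡⟨ 𝐕.⟨⟩-cong (λ _ → refl) (λ F → sym (As-fix Eₛ (inv 1ℚ) F)) ⟩
            ⟨ (λ F → T F * v (lookup F i₀)) , As Eₛ w ⟩ ≡⟨ As-adj Eₛ _ w ⟨
            ⟨ As Eₛ (λ F → T F * v (lookup F i₀)) , w ⟩ ∎
            where
            open ≤-Reasoning
            opaque
              unfolding _+_
              l : ∀ t a b w → t * (a * w) - t * (b * w) ≡ t * (a - b) * w
              l = solve-∀ ℚ-ring
          bound₁ : X₁ * X₁ ≤ C₃ * ω
          bound₁ = subst (λ z → z * z ≤ C₃ * ω) (sym X₁≡) (≤-trans (cs-1 _ w (norm 0≤1 ≤-refl)) (weighted v v-sq v-mean))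
          bound₂ : X₂ * X₂ ≤ C₁ * ω
          bound₂ = unweighted w̄ (inv ḡ) (norm 0≤ḡ ḡ≤1)
          same : ∀ i x → average B′ (upd h i₀ (λ _ → ḡ)) i x ≡ average B′ g i x
          same i x with B′ i in e
          ... | true = trans (cong (λ f → f x) (upd-other h (λ _ → ḡ) (λ { refl → i₀∉B′ e }))) (cong (λ b → if b then g i x else 𝐊.E (g i)) (B′⊆B e))
          ... | false with i FinP.≟ i₀
          ...   | yes refl = 𝐊.E-const ḡ
          ...   | no _ with B i
          ...     | true = refl
          ...     | false = 𝐊.E-const _
          As-w̄ : ⟨ T , As (off B′) w̄ ⟩ ≡ ⟨ T , u B′ ⟩
          As-w̄ = 𝐕.⟨⟩-cong (λ _ → refl) (λ F → trans (As-Π B′ _ F) (Π-cong same F))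
          total : err B ≡ X₁ + X₂ + err B′
          total = trans (l ⟨ T , u B ⟩ ⟨ T , w̄ ⟩ ⟨ T , As (off B′) w̄ ⟩ ⟨ T , u ∅ ⟩) (cong (λ z → X₁ + X₂ + (z - ⟨ T , u ∅ ⟩)) As-w̄)
            where
            opaque
              unfolding _+_
              l : ∀ a b c d → a - d ≡ a - b + (b - c) + (c - d)
              l = solve-∀ ℚ-ring
          opaque
            unfolding _+_
            lem : ∀ a b c o → 2ℚ * (a * o) + 4ℚ * (b * o + c * o) ≡ (2ℚ * a + 4ℚ * (b + c)) * o
            lem = solve-∀ ℚ-ring

-- Passage from all forms to monic polynomials.

module Slices where

  open Rat
  open Mean
  open Field
  open Averages
  open Shift
  open Binomial
  open Stage
  open Roots
  open Bounds
  open Claim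
  open import Data.Bool using (true; false; if_then_else_)
  open import Data.Nat as ℕ using (ℕ; zero; suc)
  import Data.Nat.Properties as ℕP
  open import Data.Fin using (Fin; zero; suc; toℕ; fromℕ)
  import Data.Fin.Properties as FinP
  open import Data.Vec using (Vec; []; _∷_; lookup; head; tail)
  open import Data.List using ([]; _∷_)
  open import Data.List.Membership.Propositional using (_∈_)
  open import Data.List.Relation.Unary.Any using (here; there)
  open import Data.Product using (_,_; proj₁; proj₂)
  open import Data.Sum using (inj₁; inj₂)
  open import Relation.Nullary using (yes; no; Dec)
  open import Relation.Nullary.Decidable using (¬?)
  open import Relation.Nullary.Negation using (contradiction)
  open import Relation.Binary.PropositionalEquality
  open import Tactic.RingSolver using (solve-∀)
  open import Data.Rational.Properties using (module ≤-Reasoning)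

  module Monic (𝔽 : FinField) (m : ℕ) where
    open FinField 𝔽
    open FieldFacts 𝔽
    open Space 𝔽
    open Shifts 𝔽
    open Closure 𝔽
    open RootCount 𝔽
    n : ℕ
    n = suc m
    open Analysis 𝔽 n
    open Products 𝔽 hiding (module 𝐊)
    open Independence 𝔽 n
    open Constants n
    open VecSpace uniform using (vecU; E-∷)
    open 𝐕 using (⟨_,_⟩; ‖_‖²)
    open 𝐊 using (ω)
    module 𝐖 = Uniform (vecU n)


    e : Vec K n
    e = basis (fromℕ m)

    q : ℚ
    q = ∑ 𝐊.points (λ _ → 1ℚ)

    qω : q * ω ≡ 1ℚ
    qω = trans (*-comm q ω) 𝐊.total

    ω-cancel : ∀ {x y} → ω * x ≤ ω * y → x ≤ y
    ω-cancel {x} {y} h = subst₂ _≤_ (unq x) (unq y) (*-monoˡ (∑-nonneg 𝐊.points (λ _ → 0≤1)) h)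
      where
      unq : ∀ z → q * (ω * z) ≡ z
      unq z = trans (sym (*-assoc q ω z)) (trans (cong (_* z) qω) (*-identityˡ z))

    nz : K → ℚ
    nz c = ⟦ ¬? (c ≟ 𝟘) ⟧

    E-δ : ∀ c → 𝐊.E (λ x → ⟦ x ≟ c ⟧) ≡ ω
    E-δ c = trans (𝐊.E-cong (λ x → sym (*-identityʳ ⟦ x ≟ c ⟧))) (trans (𝐊.E-point c (λ _ → 1ℚ)) (*-identityʳ ω))

    nz-≡ : ∀ c → nz c ≡ 1ℚ - ⟦ c ≟ 𝟘 ⟧
    nz-≡ c with c ≟ 𝟘
    ... | yes _ = sym (+-inverseʳ 1ℚ)
    ... | no _ = sym (lem 1ℚ)
      where
      opaque
        unfolding _+_
        lem : ∀ x → x - 0ℚ ≡ x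
        lem = solve-∀ ℚ-ring

    ε : ℚ
    ε = 1ℚ - ω

    E-nz : 𝐊.E nz ≡ ε
    E-nz = trans (𝐊.E-cong nz-≡) (trans (𝐊.E-- (λ _ → 1ℚ) (λ c → ⟦ c ≟ 𝟘 ⟧)) (cong₂ _-_ 𝐊.E-1 (E-δ 𝟘)))

    -- The events `x = 0` and `x = 1` exclude each other, so `ω` is at most one half.
    1≤2ε : 1ℚ ≤ 2ℚ * ε
    1≤2ε = ≤-from (1ℚ - (ω + ω)) (≤-diff two) (lem ω)
      where
      opaque
        unfolding _+_
        lem : ∀ o → 2ℚ * (1ℚ - o) - 1ℚ ≡ 1ℚ - (o + o)
        lem = solve-∀ ℚ-ring
      excl : ∀ x → ⟦ x ≟ 𝟘 ⟧ + ⟦ x ≟ 𝟙 ⟧ ≤ 1ℚ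
      excl x with x ≟ 𝟘 | x ≟ 𝟙
      ... | yes refl | yes p = contradiction (sym p) 𝟙≢𝟘
      ... | yes _ | no _ = ≤-reflexive (+-identityʳ 1ℚ)
      ... | no _ | yes _ = ≤-reflexive (+-identityˡ 1ℚ)
      ... | no _ | no _ = ≤-trans (≤-reflexive (+-identityˡ 0ℚ)) 0≤1
      two : ω + ω ≤ 1ℚ
      two = subst (_≤ 1ℚ) (trans (𝐊.E-+ _ _) (cong₂ _+_ (E-δ 𝟘) (E-δ 𝟙))) (𝐊.E-≤const excl)

    -- By `power-fibre` an element has at most `n` roots of order `n`. The inequality is proved with
    -- a factor `ω`, which is the mean of the point mass that expresses `c = l^n`.
    fold-power : ∀ (g : K → ℚ) → (∀ x → 0ℚ ≤ g x) → 𝐊.E (λ l → nz l * g (pow l n)) ≤ ⌜ n ⌝ * 𝐊.E (λ c → nz c * g c)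
    fold-power g g0 = ω-cancel (begin
      ω * 𝐊.E (λ l → nz l * g (pow l n)) ≡⟨ 𝐊.E-*ˡ ω _ ⟨
      𝐊.E (λ l → ω * (nz l * g (pow l n))) ≡⟨ 𝐊.E-cong (λ l → sym (𝐊.E-point (pow l n) (λ c → nz l * g c))) ⟩
      𝐊.E (λ l → 𝐊.E (λ c → ⟦ c ≟ pow l n ⟧ * (nz l * g c))) ≡⟨ E-swap uniform uniform _ ⟩
      𝐊.E (λ c → 𝐊.E (λ l → ⟦ c ≟ pow l n ⟧ * (nz l * g c))) ≤⟨ 𝐊.E-mono (λ c → 𝐊.E-mono (pt c)) ⟩
      𝐊.E (λ c → 𝐊.E (λ l → ⟦ pow l n ≟ c ⟧ * (nz c * g c))) ≡⟨ 𝐊.E-cong (λ c → 𝐊.E-*ʳ (nz c * g c) _) ⟩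
      𝐊.E (λ c → 𝐊.E (λ l → ⟦ pow l n ≟ c ⟧) * (nz c * g c)) ≤⟨ 𝐊.E-mono (λ c → *-monoʳ (0≤* (0≤⟦⟧ (¬? (c ≟ 𝟘))) (g0 c)) (power-fibre m c)) ⟩
      𝐊.E (λ c → ⌜ n ⌝ * ω * (nz c * g c)) ≡⟨ 𝐊.E-*ˡ _ _ ⟩
      ⌜ n ⌝ * ω * 𝐊.E (λ c → nz c * g c) ≡⟨ lem ⌜ n ⌝ ω _ ⟩
      ω * (⌜ n ⌝ * 𝐊.E (λ c → nz c * g c)) ∎)
      where
      open ≤-Reasoning
      opaque
        unfolding _+_
        lem : ∀ a b c → a * b * c ≡ b * (a * c)
        lem = solve-∀ ℚ-ring
      pow-≢0 : ∀ l k → l ≢ 𝟘 → pow l k ≢ 𝟘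
      pow-≢0 l zero p = 𝟙≢𝟘
      pow-≢0 l (suc k) p = ⊗-≢0 p (pow-≢0 l k p)
      pt : ∀ c l → ⟦ c ≟ pow l n ⟧ * (nz l * g c) ≤ ⟦ pow l n ≟ c ⟧ * (nz c * g c)
      pt c l with c ≟ pow l n | l ≟ 𝟘
      ... | no _ | _ = ≤-trans (≤-reflexive (*-zeroˡ _)) (0≤* (0≤⟦⟧ (pow l n ≟ c)) (0≤* (0≤⟦⟧ (¬? (c ≟ 𝟘))) (g0 c)))
      ... | yes _ | yes _ = ≤-trans (≤-reflexive (trans (cong (1ℚ *_) (*-zeroˡ _)) (*-zeroʳ 1ℚ))) (0≤* (0≤⟦⟧ (pow l n ≟ c)) (0≤* (0≤⟦⟧ (¬? (c ≟ 𝟘))) (g0 c)))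
      ... | yes refl | no p = ≤-reflexive (sym (cong₂ (λ x y → x * (y * g c)) (⟦⟧-yes (c ≟ c) refl) (⟦⟧-yes (¬? (c ≟ 𝟘)) (pow-≢0 l n p))))

    module _ {T : V → ℚ} (symm : Symmetric T) (T-zero : ∀ xs → T (𝟘 ∷ xs) ≡ 0ℚ)
             (T-tor : ∀ l F → l ≢ 𝟘 → T (tor l F) ≡ T F) where
      open Symmetric symm
      open Sym symm

      -- Forms with nonzero leading coefficient, parametrised by that coefficient and the
      -- proportional monic form.
      slice : (V → ℚ) → ℚ
      slice φ = 𝐊.E (λ c → nz c * 𝐖.E (λ xs → φ (c ∷ c ⊡ xs)))

      E-dilate : ∀ c → c ≢ 𝟘 → ∀ (φ : Vec K n → ℚ) → 𝐖.E (λ xs → φ (c ⊡ xs)) ≡ 𝐖.E φ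
      E-dilate c c≢0 with inverse c c≢0
      ... | d , cd = Bijection.E-bij (vecU n) (c ⊡_) (d ⊡_)
        (λ F → trans (⊡-⊗ c d F) (trans (cong (_⊡ F) cd) (1⊡ F))) (λ F → trans (⊡-⊗ d c F) (trans (cong (_⊡ F) (trans (⊗-comm d c) cd)) (1⊡ F)))

      slice-≡ : ∀ φ → (∀ xs → φ (𝟘 ∷ xs) ≡ 0ℚ) → 𝐕.E φ ≡ slice φ
      slice-≡ φ h = trans (E-∷ n φ) (𝐊.E-cong go)
        where
        go : ∀ c → 𝐖.E (λ xs → φ (c ∷ xs)) ≡ nz c * 𝐖.E (λ xs → φ (c ∷ c ⊡ xs))
        go c with c ≟ 𝟘
        ... | yes refl = trans (𝐖.E-cong h) (trans (𝐖.E-const 0ℚ) (sym (*-zeroˡ _)))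
        ... | no p = trans (sym (E-dilate c p (λ xs → φ (c ∷ xs)))) (sym (*-identityˡ _))

      slice-≤ : ∀ φ → (∀ F → 0ℚ ≤ φ F) → slice φ ≤ 𝐕.E φ
      slice-≤ φ h = ≤-trans (𝐊.E-mono go) (≤-reflexive (sym (E-∷ n φ)))
        where
        go : ∀ c → nz c * 𝐖.E (λ xs → φ (c ∷ c ⊡ xs)) ≤ 𝐖.E (λ xs → φ (c ∷ xs))
        go c with c ≟ 𝟘
        ... | yes refl = ≤-trans (≤-reflexive (*-zeroˡ _)) (𝐖.E-nonneg (λ xs → h _))
        ... | no p = ≤-reflexive (trans (*-identityˡ _) (E-dilate c p (λ xs → φ (c ∷ xs))))

      full : B-Set
      full _ = true

      full-closed : Closed full
      full-closed = record { cl = λ _ () ; op = λ _ → refl }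

      i₀ : Fin (suc n)
      i₀ = fromℕ n

      maxi : ∀ k → full k ≡ true → toℕ k ℕ.≤ toℕ i₀
      maxi k _ = subst (toℕ k ℕ.≤_) (sym (FinP.toℕ-fromℕ n)) (FinP.toℕ≤pred[n] k)

      open Step full-closed i₀ refl maxi using (Eₛ; B′; closed′)
      module Rm = Removal symm full-closed i₀ refl maxi

      off-full : ∀ φ → As (off full) φ ≐ φ
      off-full φ = As-fix (off full) (λ i → contradiction (proj₁ (proj₂ (off-∈⁻ full i))) λ ())

      μ : ℚ
      μ = 𝐖.E (λ xs → T (𝟙 ∷ xs))

      line : ∀ c xs t → (c ∷ c ⊡ xs) ⊞ (c ⊗ t) ⊡ basis i₀ ≡ c ⊡ (𝟙 ∷ (xs ⊞ t ⊡ e))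
      line c xs t = cong₂ _∷_ (solve 2 (λ c t → c :+ c :* t :* con (ℤ.+ 0) := c :* con (ℤ.+ 1)) refl c t)
        (sym (trans (⊡-⊞ c xs (t ⊡ e)) (cong (c ⊡ xs ⊞_) (⊡-⊗ c t e))))
        where
        open IntSolver commutativeRing using (solve; _:=_; _:+_; _:*_; con)
        import Data.Integer as ℤ

      T-dilate : ∀ c xs → c ≢ 𝟘 → T (c ∷ c ⊡ xs) ≡ T (𝟙 ∷ xs)
      T-dilate c xs p = trans (cong T (cong (_∷ c ⊡ xs) (sym (⊗-identityʳ c)))) (T-scale c (𝟙 ∷ xs) p)

      module Last (v : K → ℚ) (v-sq : ∀ x → v x * v x ≤ 1ℚ) (v-mean : 𝐊.E v ≡ 0ℚ) where

        xₙ : Vec K n → K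
        xₙ xs = lookup xs (fromℕ m)

        a : K → Vec K n → ℚ
        a c xs = 𝐊.E (λ t → T (𝟙 ∷ (xs ⊞ t ⊡ e)) * v (c ⊗ (xₙ xs ⊕ t)))

        -- `weighted` controls only the mean of `Q` over the leading coefficients, whereas monic
        -- polynomials need `Q 𝟙`. The dilations bridge this, since by `Q-tor` they identify `Q 𝟙`
        -- with `Q` at every nonzero n-th power.
        Q : K → ℚ
        Q c = 𝐖.‖ a c ‖²

        xₙ-line : ∀ xs t → xₙ (xs ⊞ t ⊡ e) ≡ xₙ xs ⊕ t
        xₙ-line xs t = trans (lookup-⊞ xs (t ⊡ e) (fromℕ m)) (cong (xₙ xs ⊕_) (trans (lookup-⊡ t e (fromℕ m)) (trans (cong (t ⊗_) (lookup-basis (fromℕ m))) (⊗-identityʳ t))))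

        on-slice : ∀ c → c ≢ 𝟘 → ∀ xs → As Eₛ (λ F → T F * v (lookup F i₀)) (c ∷ c ⊡ xs) ≡ a c xs
        on-slice c p xs = trans (A-cong (basis i₀) (off-full _) (c ∷ c ⊡ xs)) (trans (sym (E-scale c p _))
          (𝐊.E-cong (λ t → trans (cong (λ G → T G * v (lookup G i₀)) (line c xs t)) (cong₂ _*_ (T-scale c _ p)
            (cong v (trans (lookup-⊡ c (xs ⊞ t ⊡ e) (fromℕ m)) (cong (c ⊗_) (xₙ-line xs t))))))))

        Q-sum : 𝐊.E (λ c → nz c * Q c) ≤ C₃ * ω
        Q-sum = ≤-trans (≤-trans (≤-reflexive (𝐊.E-cong go)) (slice-≤ (λ F → φ F * φ F) (λ F → 0≤sq (φ F)))) (Rm.weighted v v-sq v-mean)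
          where
          φ : V → ℚ
          φ = As Eₛ (λ F → T F * v (lookup F i₀))
          go : ∀ c → nz c * Q c ≡ nz c * 𝐖.E (λ xs → φ (c ∷ c ⊡ xs) * φ (c ∷ c ⊡ xs))
          go c with c ≟ 𝟘
          ... | yes _ = trans (*-zeroˡ _) (sym (*-zeroˡ _))
          ... | no p = cong (1ℚ *_) (𝐖.E-cong (λ xs → sym (cong₂ _*_ (on-slice c p xs) (on-slice c p xs))))

        tor-⊞ : ∀ {k} l (u w : Vec K k) → tor l (u ⊞ w) ≡ tor l u ⊞ tor l w
        tor-⊞ l [] [] = refl
        tor-⊞ l (x ∷ u) (y ∷ w) = cong (x ⊕ y ∷_) (trans (cong (l ⊡_) (tor-⊞ l u w)) (⊡-⊞ l _ _))

        tor-⊡ : ∀ {k} l t (u : Vec K k) → tor l (t ⊡ u) ≡ t ⊡ tor l u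
        tor-⊡ l t [] = refl
        tor-⊡ l t (x ∷ u) = cong (t ⊗ x ∷_) (trans (cong (l ⊡_) (tor-⊡ l t u)) (⊡-comm l t _))

        tor-inv : ∀ {k} l d → l ⊗ d ≡ 𝟙 → ∀ (u : Vec K k) → tor l (tor d u) ≡ u
        tor-inv l d ld [] = refl
        tor-inv l d ld (x ∷ u) = cong (x ∷_) (trans (cong (l ⊡_) (tor-⊡ l d _)) (trans (⊡-⊗ l d _) (trans (cong (_⊡ tor l (tor d u)) ld) (trans (1⊡ _) (tor-inv l d ld u)))))

        tor-basis : ∀ k l → tor l (basis (fromℕ k)) ≡ pow l k ⊡ basis (fromℕ k)
        tor-basis zero l = cong (_∷ []) (sym (⊗-identityʳ 𝟙))
        tor-basis (suc k) l = cong₂ _∷_ (sym (⊗-zeroʳ _)) (trans (cong (l ⊡_) (tor-basis k l)) (⊡-⊗ l _ _))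

        tor-last : ∀ k l (u : Vec K (suc k)) → lookup (tor l u) (fromℕ k) ≡ pow l k ⊗ lookup u (fromℕ k)
        tor-last zero l (x ∷ []) = sym (⊗-identityˡ x)
        tor-last (suc k) l (x ∷ u) = trans (lookup-⊡ l (tor l u) (fromℕ k)) (trans (cong (l ⊗_) (tor-last k l u)) (sym (⊗-assoc l _ _)))

        -- The action of `tor l` on the tail of a monic form: `tor l (𝟙 ∷ xs)` is `𝟙 ∷ τ l xs`.
        τ : K → Vec K n → Vec K n
        τ l xs = l ⊡ tor l xs

        a-tor : ∀ l → l ≢ 𝟘 → ∀ c xs → a c (τ l xs) ≡ a (c ⊗ pow l n) xs
        a-tor l p c xs = trans (sym (E-scale (pow l n) pn _)) (𝐊.E-cong (λ t → cong₂ (λ G y → T G * v y)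
            (cong (𝟙 ∷_) (sym (trans (cong (l ⊡_) (tor-⊞ l xs (t ⊡ e))) (trans (⊡-⊞ l _ _) (cong (τ l xs ⊞_) (te t))))))
            (trans (cong (λ z → c ⊗ (z ⊕ pow l n ⊗ t)) (trans (lookup-⊡ l (tor l xs) (fromℕ m)) (trans (cong (l ⊗_) (tor-last m l xs)) (sym (⊗-assoc l _ _)))))
              (solve 4 (λ c x y t → c :* (x :* y :+ x :* t) := c :* x :* (y :+ t)) refl c (pow l n) (xₙ xs) t)))
          ∙ 𝐊.E-cong (λ t → cong (_* v (c ⊗ pow l n ⊗ (xₙ xs ⊕ t))) (T-tor l (𝟙 ∷ (xs ⊞ t ⊡ e)) p)))
          where
          open IntSolver commutativeRing using (solve; _:=_; _:+_; _:*_)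
          _∙_ : ∀ {x y z : ℚ} → x ≡ y → y ≡ z → x ≡ z
          _∙_ = trans
          pn : pow l n ≢ 𝟘
          pn = go n
            where
            go : ∀ k → pow l k ≢ 𝟘
            go zero = 𝟙≢𝟘
            go (suc k) = ⊗-≢0 p (go k)
          te : ∀ t → l ⊡ tor l (t ⊡ e) ≡ (pow l n ⊗ t) ⊡ e
          te t = trans (cong (l ⊡_) (trans (tor-⊡ l t e) (trans (cong (t ⊡_) (tor-basis m l)) (⊡-⊗ t _ _)))) (trans (⊡-⊗ l _ _)
            (cong (_⊡ e) (solve 3 (λ l t x → l :* (t :* x) := l :* x :* t) refl l t (pow l m))))

        Q-tor : ∀ l → l ≢ 𝟘 → Q 𝟙 ≡ Q (pow l n)
        Q-tor l p with inverse l p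
        ... | d , ld = trans (sym (Bijection.E-bij (vecU n) (τ l) (τ d) (τ-inv l d ld) (τ-inv d l (trans (⊗-comm d l) ld)) (λ xs → a 𝟙 xs * a 𝟙 xs)))
            (𝐖.E-cong (λ xs → cong (λ z → z * z) (trans (a-tor l p 𝟙 xs) (cong (λ c → a c xs) (⊗-identityˡ _)))))
          where
          τ-inv : ∀ l d → l ⊗ d ≡ 𝟙 → ∀ u → τ l (τ d u) ≡ u
          τ-inv l d ld u = trans (cong (l ⊡_) (tor-⊡ l d _)) (trans (⊡-⊗ l d _) (trans (cong (_⊡ tor l (tor d u)) ld) (trans (1⊡ _) (tor-inv l d ld u))))

        -- The constant value `Q (pow l n)` is averaged over nonzero `l`, and `fold-power` compares
        -- this with the mean over all `c`. The factor 2 pays for the missing `l = 0`.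
        Q-bound : Q 𝟙 ≤ 2ℚ * (⌜ n ⌝ * (C₃ * ω))
        Q-bound = begin
          Q 𝟙 ≡⟨ *-identityˡ _ ⟨
          1ℚ * Q 𝟙 ≤⟨ *-monoʳ (𝐖.0≤‖‖² (a 𝟙)) 1≤2ε ⟩
          2ℚ * ε * Q 𝟙 ≡⟨ *-assoc 2ℚ ε _ ⟩
          2ℚ * (ε * Q 𝟙) ≡⟨ cong (2ℚ *_) (trans (cong (_* Q 𝟙) (sym E-nz)) (trans (sym (𝐊.E-*ʳ (Q 𝟙) nz)) (𝐊.E-cong go))) ⟩
          2ℚ * 𝐊.E (λ l → nz l * Q (pow l n)) ≤⟨ *-monoˡ 0≤2 (≤-trans (fold-power Q (λ c → 𝐖.0≤‖‖² (a c))) (*-monoˡ (0≤⌜⌝ n) Q-sum)) ⟩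
          2ℚ * (⌜ n ⌝ * (C₃ * ω)) ∎
          where
          open ≤-Reasoning
          go : ∀ l → nz l * Q 𝟙 ≡ nz l * Q (pow l n)
          go l with l ≟ 𝟘
          ... | yes _ = trans (*-zeroˡ _) (sym (*-zeroˡ _))
          ... | no p = cong (1ℚ *_) (Q-tor l p)

        module AW = Averaging 𝔽 n

        last-bound : ∀ w → AW.Inv w e → 𝐖.‖ w ‖² ≤ 1ℚ →
          𝐖.E (λ xs → T (𝟙 ∷ xs) * v (xₙ xs) * w xs) * 𝐖.E (λ xs → T (𝟙 ∷ xs) * v (xₙ xs) * w xs) ≤ 2ℚ * (⌜ n ⌝ * (C₃ * ω))
        last-bound w inv w≤1 = begin
          X * X ≡⟨ cong (λ z → z * z) (trans (𝐖.⟨⟩-cong (λ _ → refl) (λ xs → sym (AW.A-fix inv xs))) (trans (sym (AW.A-adj e φ w)) (𝐖.⟨⟩-cong eq (λ _ → refl)))) ⟩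
          𝐖.⟨ a 𝟙 , w ⟩ * 𝐖.⟨ a 𝟙 , w ⟩ ≤⟨ CauchySchwarz.cauchy-schwarz (vecU n) (a 𝟙) w ⟩
          𝐖.‖ a 𝟙 ‖² * 𝐖.‖ w ‖² ≤⟨ *-monoˡ (𝐖.0≤‖‖² (a 𝟙)) w≤1 ⟩
          Q 𝟙 * 1ℚ ≡⟨ *-identityʳ _ ⟩
          Q 𝟙 ≤⟨ Q-bound ⟩
          2ℚ * (⌜ n ⌝ * (C₃ * ω)) ∎
          where
          open ≤-Reasoning
          φ : Vec K n → ℚ
          φ xs = T (𝟙 ∷ xs) * v (xₙ xs)
          X = 𝐖.E (λ xs → φ xs * w xs)
          eq : ∀ xs → AW.A e φ xs ≡ a 𝟙 xs
          eq xs = 𝐊.E-cong (λ t → cong (λ y → T (𝟙 ∷ (xs ⊞ t ⊡ e)) * v y) (trans (xₙ-line xs t) (sym (⊗-identityˡ _))))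

      module Rest (f : Family n) (f-0≤ : ∀ i x → 0ℚ ≤ f i x) (f-≤1 : ∀ i x → f i x ≤ 1ℚ)
                  (f-last : ∀ x y → f (fromℕ m) x ≡ f (fromℕ m) y) where

        -- A total inverse with default `𝟘` at `𝟘`; wherever it matters, the factor `nz` removes
        -- that case.
        inv : K → K
        inv c with c ≟ 𝟘
        ... | yes _ = 𝟘
        ... | no p = proj₁ (inverse c p)

        inv-≢0 : ∀ c → c ≢ 𝟘 → inv c ⊗ c ≡ 𝟙
        inv-≢0 c p with c ≟ 𝟘
        ... | yes q = contradiction q p
        ... | no q = trans (⊗-comm _ c) (proj₂ (inverse c q))

        inv≢0 : ∀ c → c ≢ 𝟘 → inv c ≢ 𝟘
        inv≢0 c p z = 𝟙≢𝟘 (trans (sym (inv-≢0 c p)) (trans (cong (_⊗ c) z) (⊗-zeroˡ c)))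

        G′ M : ℚ
        G′ = 𝐖.E (λ xs → T (𝟙 ∷ xs) * Π f xs)
        M = Π (λ i _ → 𝐊.E (f i)) (0v {n})

        -- The test function extended to all forms with nonzero leading coefficient, homogeneous of
        -- degree 0. As the last function is constant, the extension does not vary along the last
        -- coordinate, as `unweighted` demands; this is why the last function is treated separately.
        wᵗ : V → ℚ
        wᵗ F = nz (head F) * Π f (inv (head F) ⊡ tail F)

        ⟨T,wᵗ⟩ : ⟨ T , wᵗ ⟩ ≡ ε * G′
        ⟨T,wᵗ⟩ = trans (slice-≡ (λ F → T F * wᵗ F) (λ xs → trans (cong (_* wᵗ (𝟘 ∷ xs)) (T-zero xs)) (*-zeroˡ _)))
          (trans (𝐊.E-cong go) (trans (𝐊.E-*ʳ G′ nz) (cong (_* G′) E-nz)))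
          where
          go : ∀ c → nz c * 𝐖.E (λ xs → T (c ∷ c ⊡ xs) * wᵗ (c ∷ c ⊡ xs)) ≡ nz c * G′
          go c = pick (c ≟ 𝟘)
            where
            pick : Dec (c ≡ 𝟘) → nz c * 𝐖.E (λ xs → T (c ∷ c ⊡ xs) * wᵗ (c ∷ c ⊡ xs)) ≡ nz c * G′
            pick (yes p) = trans (cong (_* 𝐖.E (λ xs → T (c ∷ c ⊡ xs) * wᵗ (c ∷ c ⊡ xs))) z) (trans (*-zeroˡ _) (sym (trans (cong (_* G′) z) (*-zeroˡ _))))
              where
              z : nz c ≡ 0ℚ
              z = ⟦⟧-no (¬? (c ≟ 𝟘)) (λ q → q p)
            pick (no p) = cong (nz c *_) (𝐖.E-cong (λ xs → cong₂ _*_ (T-dilate c xs p)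
              (trans (cong (_* Π f (inv c ⊡ c ⊡ xs)) (⟦⟧-yes (¬? (c ≟ 𝟘)) p)) (trans (*-identityˡ _) (cong (Π f) (trans (⊡-⊗ _ _ xs) (trans (cong (_⊡ xs) (inv-≢0 c p)) (1⊡ xs))))))))

        wᵗ-inv : ∀ {d} → d ∈ Eₛ → Inv wᵗ d
        wᵗ-inv (here refl) t (x ∷ F) = trans (cong (λ z → nz z * Π f (inv z ⊡ (F ⊞ t ⊡ e))) (trans (cong (x ⊕_) (⊗-zeroʳ t)) (⊕-identityʳ x)))
          (cong (nz x *_) (trans (cong (Π f) (trans (⊡-⊞ (inv x) F (t ⊡ e)) (cong (inv x ⊡ F ⊞_) (⊡-⊗ (inv x) t e)))) (Π-inv f (fromℕ m) f-last (inv x ⊡ F) (inv x ⊗ t))))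
        wᵗ-inv (there i) t F = contradiction (proj₁ (proj₂ (off-∈⁻ full i))) λ ()

        wᵗ-norm : ‖ wᵗ ‖² ≤ 1ℚ
        wᵗ-norm = ‖‖²≤1 (λ F → ≤-trans (*-mono (lower F) (lower F) (upper F) (upper F)) (≤-reflexive (*-identityˡ 1ℚ)))
          where
          lower : ∀ F → 0ℚ ≤ wᵗ F
          lower F = 0≤* (0≤⟦⟧ (¬? (head F ≟ 𝟘))) (Π-0≤ f-0≤ (inv (head F) ⊡ tail F))
          upper : ∀ F → wᵗ F ≤ 1ℚ
          upper F = ≤-trans (*-mono (0≤⟦⟧ (¬? (head F ≟ 𝟘))) (Π-0≤ f-0≤ (inv (head F) ⊡ tail F)) (⟦⟧≤1 (¬? (head F ≟ 𝟘))) (Π-≤1 f-0≤ f-≤1 (inv (head F) ⊡ tail F))) (≤-reflexive (*-identityˡ 1ℚ))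

        h hᵗ : K → Family (suc n)
        h c zero x = ⟦ x ≟ c ⟧
        h c (suc i) x = f i (inv c ⊗ x)
        hᵗ c zero x = 1ℚ
        hᵗ c (suc i) x = f i (inv c ⊗ x)

        Π-scale : ∀ {k} (g : Family k) s F → Π (λ i x → g i (s ⊗ x)) F ≡ Π g (s ⊡ F)
        Π-scale g s [] = refl
        Π-scale g s (x ∷ F) = cong (g zero (s ⊗ x) *_) (Π-scale (λ i → g (suc i)) s F)

        -- The extension is no product of functions of single coordinates, but a mean of such
        -- products, one for each leading coefficient `c`, tested by a point mass. The factor `q`
        -- offsets the weight `ω` that `E` gives to a single `c`.
        wᵗ-≡ : wᵗ ≐ (λ F → 𝐊.E (λ c → nz c * (q * Π (h c) F)))
        wᵗ-≡ (x ∷ F) = sym (begin-equality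
          𝐊.E (λ c → nz c * (q * (⟦ x ≟ c ⟧ * Π (λ i y → f i (inv c ⊗ y)) F)))
            ≡⟨ 𝐊.E-cong (λ c → trans (lem (nz c) q ⟦ x ≟ c ⟧ _) (cong₂ (λ y z → y * (q * (nz c * z))) (⟦⟧-⇔ (x ≟ c) (c ≟ x) sym sym) (Π-scale f (inv c) F))) ⟩
          𝐊.E (λ c → ⟦ c ≟ x ⟧ * (q * (nz c * Π f (inv c ⊡ F)))) ≡⟨ 𝐊.E-point x _ ⟩
          ω * (q * (nz x * Π f (inv x ⊡ F))) ≡⟨ trans (sym (*-assoc ω q _)) (trans (cong (_* (nz x * Π f (inv x ⊡ F))) 𝐊.total) (*-identityˡ _)) ⟩
          nz x * Π f (inv x ⊡ F) ∎)
          where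
          open ≤-Reasoning
          opaque
            unfolding _+_
            lem : ∀ a b c d → a * (b * (c * d)) ≡ c * (b * (a * d))
            lem = solve-∀ ℚ-ring

        As-E-swap : ∀ ds (φ : K → V → ℚ) → As ds (λ F → 𝐊.E (λ c → φ c F)) ≐ (λ F → 𝐊.E (λ c → As ds (φ c) F))
        As-E-swap [] φ F = refl
        As-E-swap (d ∷ ds) φ F = trans (A-cong d (As-E-swap ds φ) F) (E-swap uniform uniform _)

        As-*ˡ : ∀ ds c φ → As ds (λ F → c * φ F) ≐ (λ F → c * As ds φ F)
        As-*ˡ [] c φ F = refl
        As-*ˡ (d ∷ ds) c φ F = trans (A-cong d (As-*ˡ ds c φ) F) (𝐊.E-*ˡ c _)

        B′0 : B′ zero ≡ false
        B′0 with B′ zero in eq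
        ... | false = refl
        ... | true = contradiction (trans (sym (bin-0 (toℕ i₀))) (proj₂ (next-true full i₀ {zero} eq))) 𝟙≢𝟘

        -- Index 0 is outside `B′`, because `bin n 0 = 1`; averaging thus replaces the point mass by
        -- its mean `ω`, and the factor `q` cancels it.
        first : ∀ c F → Π (average B′ (h c)) F ≡ ω * Π (average B′ (hᵗ c)) F
        first c (x ∷ F) = trans (cong (_* R) (trans (cong (λ b → if b then ⟦ x ≟ c ⟧ else 𝐊.E (λ y → ⟦ y ≟ c ⟧)) B′0) (E-δ c)))
          (cong (ω *_) (sym (trans (cong (_* R) (trans (cong (λ b → if b then 1ℚ else 𝐊.E (λ y → 1ℚ)) B′0) 𝐊.E-1)) (*-identityˡ R))))
          where
          R = Π (λ i → average B′ (h c) (suc i)) F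

        As-wᵗ : As (off B′) wᵗ ≐ (λ F → 𝐊.E (λ c → nz c * Π (average B′ (hᵗ c)) F))
        As-wᵗ F = trans (As-cong (off B′) wᵗ-≡ F) (trans (As-E-swap (off B′) _ F) (𝐊.E-cong (λ c →
          trans (As-*ˡ (off B′) (nz c) _ F) (cong (nz c *_) (trans (As-*ˡ (off B′) q _ F) (trans (cong (q *_) (trans (As-Π B′ (h c) F) (first c F)))
            (trans (sym (*-assoc q ω _)) (trans (cong (_* Π (average B′ (hᵗ c)) F) qω) (*-identityˡ _)))))))))

        hᵗ-0≤ : ∀ c i x → 0ℚ ≤ hᵗ c i x
        hᵗ-0≤ c zero x = 0≤1
        hᵗ-0≤ c (suc i) x = f-0≤ i _

        hᵗ-≤1 : ∀ c i x → hᵗ c i x ≤ 1ℚ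
        hᵗ-≤1 c zero x = ≤-refl
        hᵗ-≤1 c (suc i) x = f-≤1 i _

        errc : K → ℚ
        errc c = err symm (hᵗ c) (hᵗ-0≤ c) (hᵗ-≤1 c) B′

        B′-small : ∀ i → B′ i ≡ true → toℕ i ℕ.< n
        B′-small i p = ℕP.≤∧≢⇒< (FinP.toℕ≤pred[n] i) (λ q → 𝟙≢𝟘 (trans (sym (bin-diag n)) (trans (cong₂ bin (sym (FinP.toℕ-fromℕ n)) (sym q)) (proj₂ (next-true full i₀ {i} p)))))

        errc-bound : ∀ c → errc c * errc c ≤ Cst n * ω
        errc-bound c = claim symm (hᵗ c) (hᵗ-0≤ c) (hᵗ-≤1 c) n B′ (ℕP.n≤1+n n) closed′ B′-small

        Π-const : ∀ {k} (g : Fin k → ℚ) F G → Π (λ i _ → g i) F ≡ Π (λ i _ → g i) G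
        Π-const g [] [] = refl
        Π-const g (x ∷ F) (y ∷ G) = cong (g zero *_) (Π-const (λ i → g (suc i)) F G)

        mean : ∀ c → c ≢ 𝟘 → ⟨ T , u symm (hᵗ c) (hᵗ-0≤ c) (hᵗ-≤1 c) (∅ symm (hᵗ c) (hᵗ-0≤ c) (hᵗ-≤1 c)) ⟩ ≡ 𝐕.E T * M
        mean c p = trans (𝐕.E-cong (λ F → cong (T F *_) (go F))) (𝐕.E-*ʳ M T)
          where
          go : ∀ F → Π (λ i _ → 𝐊.E (hᵗ c i)) F ≡ M
          go (x ∷ F) = trans (cong₂ _*_ 𝐊.E-1 (trans (Π-cong (λ i _ → E-scale (inv c) (inv≢0 c p) (f i)) F) (Π-const _ F 0v))) (*-identityˡ M)

        ET : 𝐕.E T ≡ ε * μ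
        ET = trans (slice-≡ T T-zero) (trans (𝐊.E-cong go) (trans (𝐊.E-*ʳ μ nz) (cong (_* μ) E-nz)))
          where
          go : ∀ c → nz c * 𝐖.E (λ xs → T (c ∷ c ⊡ xs)) ≡ nz c * μ
          go c with c ≟ 𝟘
          ... | yes _ = trans (*-zeroˡ _) (sym (*-zeroˡ _))
          ... | no p = cong (1ℚ *_) (𝐖.E-cong (λ xs → T-dilate c xs p))

        X₂ X₃ : ℚ
        X₂ = ⟨ T , wᵗ ⟩ - ⟨ T , As (off B′) wᵗ ⟩
        X₃ = 𝐊.E (λ c → nz c * errc c)

        X₃-≡ : ⟨ T , As (off B′) wᵗ ⟩ ≡ X₃ + ε * (ε * μ * M)
        X₃-≡ = begin-equality
          ⟨ T , As (off B′) wᵗ ⟩ ≡⟨ 𝐕.E-cong (λ F → trans (cong (T F *_) (As-wᵗ F)) (trans (sym (𝐊.E-*ˡ (T F) _)) (𝐊.E-cong (λ c → lem (T F) (nz c) _)))) ⟩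
          𝐕.E (λ F → 𝐊.E (λ c → nz c * (T F * Π (average B′ (hᵗ c)) F))) ≡⟨ E-swap (vecU (suc n)) uniform _ ⟩
          𝐊.E (λ c → 𝐕.E (λ F → nz c * (T F * Π (average B′ (hᵗ c)) F))) ≡⟨ 𝐊.E-cong (λ c → trans (𝐕.E-*ˡ (nz c) _) (go c)) ⟩
          𝐊.E (λ c → nz c * errc c + nz c * (ε * μ * M)) ≡⟨ trans (𝐊.E-+ _ _) (cong (X₃ +_) (trans (𝐊.E-*ʳ _ nz) (cong (_* (ε * μ * M)) E-nz))) ⟩
          X₃ + ε * (ε * μ * M) ∎
          where
          open ≤-Reasoning
          opaque
            unfolding _+_
            lem : ∀ a b c → a * (b * c) ≡ b * (a * c)
            lem = solve-∀ ℚ-ring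
          go : ∀ c → nz c * ⟨ T , Π (average B′ (hᵗ c)) ⟩ ≡ nz c * errc c + nz c * (ε * μ * M)
          go c with c ≟ 𝟘
          ... | yes _ = lem₁ _ _ _
            where
            opaque
              unfolding _+_
              lem₁ : ∀ a b c → 0ℚ * a ≡ 0ℚ * b + 0ℚ * c
              lem₁ = solve-∀ ℚ-ring
          ... | no p = trans (lem₂ _ _) (cong (λ z → 1ℚ * errc c + 1ℚ * z) (trans (mean c p) (cong (_* M) ET)))
            where
            opaque
              unfolding _+_
              lem₂ : ∀ a b → 1ℚ * a ≡ 1ℚ * (a - b) + 1ℚ * b
              lem₂ = solve-∀ ℚ-ring

        X₃-bound : X₃ * X₃ ≤ Cst n * ω
        X₃-bound = begin
          X₃ * X₃ ≤⟨ CauchySchwarz.cauchy-schwarz uniform nz errc ⟩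
          𝐊.‖ nz ‖² * 𝐊.‖ errc ‖² ≤⟨ *-mono (𝐊.0≤‖‖² nz) (𝐊.0≤‖‖² errc) (𝐊.E-≤const (λ c → ≤-trans (*-mono (0≤⟦⟧ (¬? (c ≟ 𝟘))) (0≤⟦⟧ (¬? (c ≟ 𝟘))) (⟦⟧≤1 (¬? (c ≟ 𝟘))) (⟦⟧≤1 (¬? (c ≟ 𝟘)))) (≤-reflexive (*-identityˡ 1ℚ)))) (𝐊.E-≤const errc-bound) ⟩
          1ℚ * (Cst n * ω) ≡⟨ *-identityˡ _ ⟩
          Cst n * ω ∎
          where open ≤-Reasoning

        0≤μ : 0ℚ ≤ μ
        0≤μ = 𝐖.E-nonneg (λ xs → T-0≤ (𝟙 ∷ xs))
          where
          T-0≤ : ∀ F → 0ℚ ≤ T F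
          T-0≤ F with T01 F
          ... | inj₁ p = ≤-reflexive (sym p)
          ... | inj₂ p = ≤-trans 0≤1 (≤-reflexive (sym p))

        μ≤1 : μ ≤ 1ℚ
        μ≤1 = 𝐖.E-≤const (λ xs → T-≤1 (𝟙 ∷ xs))
          where
          T-≤1 : ∀ F → T F ≤ 1ℚ
          T-≤1 F with T01 F
          ... | inj₁ p = ≤-trans (≤-reflexive p) 0≤1
          ... | inj₂ p = ≤-reflexive p

        0≤M : 0ℚ ≤ M
        0≤M = Π-0≤ (λ i _ → 𝐊.E-nonneg (f-0≤ i)) (0v {n})

        M≤1 : M ≤ 1ℚ
        M≤1 = Π-≤1 (λ i _ → 𝐊.E-nonneg (f-0≤ i)) (λ i _ → 𝐊.E-≤const (f-≤1 i)) (0v {n})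

        C₄ : ℚ
        C₄ = 2ℚ * (4ℚ * (2ℚ * C₁ + 2ℚ * Cst n)) + 2ℚ

        -- Means over all forms carry a factor `ε`, so `G′` is first compared with `ε * (μ * M)`.
        -- Dividing the estimate of `ε * Z` by `ε` costs 2² = 4 in the square, and the remaining
        -- discrepancy is `ω * (μ * M)`.
        rest-bound : (G′ - μ * M) * (G′ - μ * M) ≤ C₄ * ω
        rest-bound = begin
          (G′ - μ * M) * (G′ - μ * M) ≡⟨ cong (λ z → z * z) (lem₁ G′ (μ * M) ω) ⟩
          (Z + ω * - (μ * M)) * (Z + ω * - (μ * M)) ≤⟨ sq-add Z (ω * - (μ * M)) ⟩
          2ℚ * (Z * Z) + 2ℚ * (ω * - (μ * M) * (ω * - (μ * M))) ≤⟨ +-mono-≤ (*-monoˡ 0≤2 Z-bound) (*-monoˡ 0≤2 small) ⟩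
          2ℚ * (4ℚ * ((2ℚ * C₁ + 2ℚ * Cst n) * ω)) + 2ℚ * ω ≡⟨ lem₂ 4ℚ (2ℚ * C₁ + 2ℚ * Cst n) ω ⟩
          C₄ * ω ∎
          where
          open ≤-Reasoning
          Z : ℚ
          Z = G′ - ε * (μ * M)
          opaque
            unfolding _+_
            lem₁ : ∀ g x o → g - x ≡ g - (1ℚ - o) * x + o * - x
            lem₁ = solve-∀ ℚ-ring
          opaque
            unfolding _+_
            lem₂ : ∀ f c o → 2ℚ * (f * (c * o)) + 2ℚ * o ≡ (2ℚ * (f * c) + 2ℚ) * o
            lem₂ = solve-∀ ℚ-ring
          εZ : ε * Z ≡ X₂ + X₃
          εZ = trans (lem₃ ε G′ (μ * M)) (trans (cong₂ (λ x y → x - y) (sym ⟨T,wᵗ⟩) (cong (ε *_) (sym (*-assoc ε μ M)))) (trans (lem₄ ⟨ T , wᵗ ⟩ ⟨ T , As (off B′) wᵗ ⟩ (ε * (ε * μ * M))) (cong (λ z → X₂ + (z - ε * (ε * μ * M))) X₃-≡) ∙ lem₅ X₂ X₃ _))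
            where
            _∙_ : ∀ {x y z : ℚ} → x ≡ y → y ≡ z → x ≡ z
            _∙_ = trans
            opaque
              unfolding _+_
              lem₃ : ∀ e g x → e * (g - e * x) ≡ e * g - e * (e * x)
              lem₃ = solve-∀ ℚ-ring
            opaque
              unfolding _+_
              lem₄ : ∀ a b c → a - c ≡ a - b + (b - c)
              lem₄ = solve-∀ ℚ-ring
            opaque
              unfolding _+_
              lem₅ : ∀ a b c → a + (b + c - c) ≡ a + b
              lem₅ = solve-∀ ℚ-ring
          Z-bound : Z * Z ≤ 4ℚ * ((2ℚ * C₁ + 2ℚ * Cst n) * ω)
          Z-bound = begin
            Z * Z ≡⟨ *-identityˡ _ ⟨
            1ℚ * (Z * Z) ≤⟨ *-monoʳ (0≤sq Z) (subst (_≤ 2ℚ * ε * (2ℚ * ε)) (*-identityˡ 1ℚ) (*-mono 0≤1 0≤1 1≤2ε 1≤2ε)) ⟩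
            2ℚ * ε * (2ℚ * ε) * (Z * Z) ≡⟨ lem₆ ε Z ⟩
            4ℚ * (ε * Z * (ε * Z)) ≡⟨ cong (λ z → 4ℚ * (z * z)) εZ ⟩
            4ℚ * ((X₂ + X₃) * (X₂ + X₃)) ≤⟨ *-monoˡ (0≤+ 0≤2 0≤2) (≤-trans (sq-add X₂ X₃) (+-mono-≤ (*-monoˡ 0≤2 (Rm.unweighted wᵗ wᵗ-inv wᵗ-norm)) (*-monoˡ 0≤2 X₃-bound))) ⟩
            4ℚ * (2ℚ * (C₁ * ω) + 2ℚ * (Cst n * ω)) ≡⟨ cong (4ℚ *_) (lem₇ C₁ (Cst n) ω) ⟩
            4ℚ * ((2ℚ * C₁ + 2ℚ * Cst n) * ω) ∎
            where
            opaque
              unfolding _+_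
              lem₆ : ∀ e z → 2ℚ * e * (2ℚ * e) * (z * z) ≡ 4ℚ * (e * z * (e * z))
              lem₆ = solve-∀ ℚ-ring
            opaque
              unfolding _+_
              lem₇ : ∀ a b o → 2ℚ * (a * o) + 2ℚ * (b * o) ≡ (2ℚ * a + 2ℚ * b) * o
              lem₇ = solve-∀ ℚ-ring
          small : ω * - (μ * M) * (ω * - (μ * M)) ≤ ω
          small = begin
            ω * - (μ * M) * (ω * - (μ * M)) ≡⟨ lem₈ ω (μ * M) ⟩
            ω * (ω * (μ * M * (μ * M))) ≤⟨ *-monoˡ 𝐊.0≤ω (≤-trans (*-mono 𝐊.0≤ω (0≤sq _) (𝐊.ω≤1 𝟘) (≤-trans (*-mono p p r r) (≤-reflexive (*-identityˡ 1ℚ)))) (≤-reflexive (*-identityˡ 1ℚ))) ⟩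
            ω * 1ℚ ≡⟨ *-identityʳ ω ⟩
            ω ∎
            where
            opaque
              unfolding _+_
              lem₈ : ∀ o x → o * - x * (o * - x) ≡ o * (o * (x * x))
              lem₈ = solve-∀ ℚ-ring
            p : 0ℚ ≤ μ * M
            p = 0≤* 0≤μ 0≤M
            r : μ * M ≤ 1ℚ
            r = ≤-trans (*-mono 0≤μ 0≤M μ≤1 M≤1) (≤-reflexive (*-identityˡ 1ℚ))

      -- The last function is split into its mean and a centred part; `Last` handles the centred
      -- part, and `Rest` the product in which the last function is constant.
      equidistribution : (f : Family n) → (∀ i x → 0ℚ ≤ f i x) → (∀ i x → f i x ≤ 1ℚ) →
        (𝐖.E (λ xs → T (𝟙 ∷ xs) * Π f xs) - μ * Π (λ i _ → 𝐊.E (f i)) (0v {n}))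
          * (𝐖.E (λ xs → T (𝟙 ∷ xs) * Π f xs) - μ * Π (λ i _ → 𝐊.E (f i)) (0v {n})) ≤ C₅ * ω
      equidistribution f f-0≤ f-≤1 = begin
          (G - μ * M₀) * (G - μ * M₀) ≡⟨ cong (λ z → z * z) (trans (lem₁ G R.G′ (μ * M₀)) (cong₂ (λ x y → x + (R.G′ - μ * y)) X≡ M≡)) ⟩
          (X + (R.G′ - μ * R.M)) * (X + (R.G′ - μ * R.M)) ≤⟨ sq-add X _ ⟩
          2ℚ * (X * X) + 2ℚ * ((R.G′ - μ * R.M) * (R.G′ - μ * R.M)) ≤⟨ +-mono-≤ (*-monoˡ 0≤2 (L.last-bound w w-inv w-norm)) (*-monoˡ 0≤2 R.rest-bound) ⟩
          2ℚ * (2ℚ * (⌜ n ⌝ * (C₃ * ω))) + 2ℚ * (R.C₄ * ω) ≡⟨ lem₂ ⌜ n ⌝ C₃ R.C₄ ω ⟩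
          C₅ * ω ∎
        where
        open ≤-Reasoning
        k : Fin n
        k = fromℕ m
        f̄ : ℚ
        f̄ = 𝐊.E (f k)
        v : K → ℚ
        v x = f k x - f̄
        0≤f̄ : 0ℚ ≤ f̄
        0≤f̄ = 𝐊.E-nonneg (f-0≤ k)
        f̄≤1 : f̄ ≤ 1ℚ
        f̄≤1 = 𝐊.E-≤const (f-≤1 k)
        v-sq : ∀ x → v x * v x ≤ 1ℚ
        v-sq x = sq≤1 (≤-from (f k x + (1ℚ - f̄)) (0≤+ (f-0≤ k x) (≤-diff f̄≤1)) (l₁ (f k x) f̄)) (≤-from (1ℚ - f k x + f̄) (0≤+ (≤-diff (f-≤1 k x)) 0≤f̄) (l₂ (f k x) f̄))
          where
          opaque
            unfolding _+_
            l₁ : ∀ a b → (a - b) - - 1ℚ ≡ a + (1ℚ - b)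
            l₁ = solve-∀ ℚ-ring
          opaque
            unfolding _+_
            l₂ : ∀ a b → 1ℚ - (a - b) ≡ 1ℚ - a + b
            l₂ = solve-∀ ℚ-ring
        v-mean : 𝐊.E v ≡ 0ℚ
        v-mean = trans (𝐊.E-- (f k) (λ _ → f̄)) (trans (cong (λ z → f̄ - z) (𝐊.E-const f̄)) (+-inverseʳ f̄))
        fᶜ : ℚ → Family n
        fᶜ c = upd f k (λ _ → c)
        fᶜ-last : ∀ c x y → fᶜ c k x ≡ fᶜ c k y
        fᶜ-last c x y = trans (cong (λ g → g x) (upd-same f k (λ _ → c))) (sym (cong (λ g → g y) (upd-same f k (λ _ → c))))
        fᶜ-0≤ : ∀ {c} → 0ℚ ≤ c → ∀ i x → 0ℚ ≤ fᶜ c i x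
        fᶜ-0≤ p i x with i FinP.≟ k
        ... | yes _ = p
        ... | no _ = f-0≤ i x
        fᶜ-≤1 : ∀ {c} → c ≤ 1ℚ → ∀ i x → fᶜ c i x ≤ 1ℚ
        fᶜ-≤1 p i x with i FinP.≟ k
        ... | yes _ = p
        ... | no _ = f-≤1 i x
        module L = Last v v-sq v-mean
        module R = Rest (fᶜ f̄) (fᶜ-0≤ 0≤f̄) (fᶜ-≤1 f̄≤1) (fᶜ-last f̄)
        w : Vec K n → ℚ
        w = Π (fᶜ 1ℚ)
        w-inv : L.AW.Inv w e
        w-inv t F = Π-inv (fᶜ 1ℚ) k (fᶜ-last 1ℚ) F t
        w-norm : 𝐖.‖ w ‖² ≤ 1ℚ
        w-norm = 𝐖.E-≤const (λ F → let p = Π-0≤ (fᶜ-0≤ 0≤1) F ; r = Π-≤1 (fᶜ-0≤ 0≤1) (fᶜ-≤1 ≤-refl) F in ≤-trans (*-mono p p r r) (≤-reflexive (*-identityˡ 1ℚ)))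
        G M₀ X : ℚ
        G = 𝐖.E (λ xs → T (𝟙 ∷ xs) * Π f xs)
        M₀ = Π (λ i _ → 𝐊.E (f i)) (0v {n})
        X = 𝐖.E (λ xs → T (𝟙 ∷ xs) * v (L.xₙ xs) * w xs)
        opaque
          unfolding _+_
          lem₁ : ∀ g g′ x → g - x ≡ g - g′ + (g′ - x)
          lem₁ = solve-∀ ℚ-ring
        opaque
          unfolding _+_
          lem₂ : ∀ a b c o → 2ℚ * (2ℚ * (a * (b * o))) + 2ℚ * (c * o) ≡ (2ℚ * (2ℚ * (a * b)) + 2ℚ * c) * o
          lem₂ = solve-∀ ℚ-ring
        X≡ : G - R.G′ ≡ X
        X≡ = trans (sym (𝐖.E-- _ _)) (𝐖.E-cong (λ xs → trans (cong₂ (λ x y → T (𝟙 ∷ xs) * x - T (𝟙 ∷ xs) * y) (Π-extract f k xs) (Π-upd f k (λ _ → f̄) xs)) (l (T (𝟙 ∷ xs)) (f k (lookup xs k)) f̄ (w xs))))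
          where
          opaque
            unfolding _+_
            l : ∀ t a b w → t * (a * w) - t * (b * w) ≡ t * (a - b) * w
            l = solve-∀ ℚ-ring
        M≡ : M₀ ≡ R.M
        M≡ = Π-cong (λ i x → sym (go i)) (0v {n})
          where
          go : ∀ i → 𝐊.E (fᶜ f̄ i) ≡ 𝐊.E (f i)
          go i with i FinP.≟ k
          ... | yes refl = 𝐊.E-const f̄
          ... | no _ = refl

-- Power series as carriers of monic polynomials.

module Series where

  open Field
  open import Data.Nat as ℕ using (ℕ; zero; suc; _<_; z≤n; s≤s)
  import Data.Nat.Properties as ℕP
  open import Data.Vec using (Vec; []; _∷_)
  open import Data.Fin using (zero; suc)
  open import Data.Product using (_,_)
  open import Data.Sum using (_⊎_; inj₁; inj₂)
  open import Relation.Binary.PropositionalEquality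
  open import Algebra.Bundles using (CommutativeRing)
  open import Level using (Level; 0ℓ)
  import Data.Integer as ℤ

  module RingIdentities {a ℓ : Level} (R : CommutativeRing a ℓ) where
    open CommutativeRing R using (Carrier; _≈_; _+_; _*_; -_; 0#; +-cong) renaming (refl to ≈-refl; trans to ≈-trans)
    open IntSolver R using (solve; _:=_; _:+_; _:*_; :-_; con)

    distrib-minus : ∀ g a b → g * (a + - b) ≈ g * a + - (g * b)
    distrib-minus = solve 3 (λ g a b → g :* (a :+ :- b) := g :* a :+ :- (g :* b)) ≈-refl

    distrib-minus′ : ∀ g t q h → g * (t + - (q * h)) ≈ g * t + - (g * q * h)
    distrib-minus′ = solve 4 (λ g t q h → g :* (t :+ :- (q :* h)) := g :* t :+ :- (g :* q :* h)) ≈-refl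

    zero-quotient : ∀ f g → f ≈ g * 0# + f
    zero-quotient = solve 2 (λ f g → f := g :* con (ℤ.+ 0) :+ f) ≈-refl

    *-left-comm : ∀ x y z → x * (y * z) ≈ y * (x * z)
    *-left-comm = solve 3 (λ x y z → x :* (y :* z) := y :* (x :* z)) ≈-refl

    rotate : ∀ q r h → q * (r * h) ≈ r * q * h
    rotate = solve 3 (λ q r h → q :* (r :* h) := r :* q :* h) ≈-refl

    subtract-part : ∀ x r h → (x + r) * h + - (x * h) ≈ r * h
    subtract-part = solve 3 (λ x r h → (x :+ r) :* h :+ :- (x :* h) := r :* h) ≈-refl

    long-division : ∀ f y g q r c → f + y * (g * q + r) ≈ g * (y * q + c) + (f + y * r + - (c * g))
    long-division f y g q r c = ≈-trans (+-cong ≈-refl (expand y g q r)) (≈-trans (regroup f (g * (y * q)) (y * r) (c * g)) (+-cong (factor g (y * q) c) ≈-refl))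
      where
      expand : ∀ y g q r → y * (g * q + r) ≈ g * (y * q) + y * r
      expand = solve 4 (λ y g q r → y :* (g :* q :+ r) := g :* (y :* q) :+ y :* r) ≈-refl
      regroup : ∀ f x z w → f + (x + z) ≈ x + w + (f + z + - w)
      regroup = solve 4 (λ f x z w → f :+ (x :+ z) := x :+ w :+ (f :+ z :+ :- w)) ≈-refl
      factor : ∀ g x c → g * x + c * g ≈ g * (x + c)
      factor = solve 3 (λ g x c → g :* x :+ c :* g := g :* (x :+ c)) ≈-refl

  module PowerSeries (𝔽 : FinField) where
    open FinField 𝔽
    open FieldFacts 𝔽
    open IntSolver commutativeRing using (solve; _:=_; _:+_; _:*_; :-_; con)

    -- Coefficient sequences carry no degree, so sums and products need no trimming of leading
    -- zeros; degree bounds are separate predicates.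
    S : Set
    S = ℕ → K

    infix 4 _≋_
    infixl 6 _+ˢ_
    infixl 7 _·_

    _≋_ : S → S → Set
    f ≋ g = ∀ i → f i ≡ g i

    tl : S → S
    tl f i = f (suc i)

    _+ˢ_ : S → S → S
    (f +ˢ g) i = f i ⊕ g i

    -ˢ_ : S → S
    (-ˢ f) i = ⊖ f i

    ι : K → S
    ι c zero = c
    ι c (suc i) = 𝟘

    0ˢ 1ˢ Y : S
    0ˢ _ = 𝟘
    1ˢ = ι 𝟙
    Y zero = 𝟘
    Y (suc i) = 1ˢ i

    _·_ : S → S → S
    (f · g) zero = f 0 ⊗ g 0
    (f · g) (suc i) = f 0 ⊗ g (suc i) ⊕ (tl f · g) i

    ·-cong : ∀ {f f′ g g′} → f ≋ f′ → g ≋ g′ → f · g ≋ f′ · g′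
    ·-cong p r zero = cong₂ _⊗_ (p 0) (r 0)
    ·-cong p r (suc i) = cong₂ _⊕_ (cong₂ _⊗_ (p 0) (r (suc i))) (·-cong (λ j → p (suc j)) r i)

    ·-distribʳ : ∀ h f g → (f +ˢ g) · h ≋ f · h +ˢ g · h
    ·-distribʳ h f g zero = ⊗-distribʳ (h 0) (f 0) (g 0)
    ·-distribʳ h f g (suc i) = trans (cong ((f 0 ⊕ g 0) ⊗ h (suc i) ⊕_) (·-distribʳ h (tl f) (tl g) i))
      (solve 5 (λ a b c x y → (a :+ b) :* c :+ (x :+ y) := a :* c :+ x :+ (b :* c :+ y)) refl (f 0) (g 0) (h (suc i)) ((tl f · h) i) ((tl g · h) i))

    ·-scale : ∀ c f g → (λ i → c ⊗ f i) · g ≋ (λ i → c ⊗ (f · g) i)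
    ·-scale c f g zero = ⊗-assoc c (f 0) (g 0)
    ·-scale c f g (suc i) = trans (cong (c ⊗ f 0 ⊗ g (suc i) ⊕_) (·-scale c (tl f) g i))
      (solve 4 (λ c a b x → c :* a :* b :+ c :* x := c :* (a :* b :+ x)) refl c (f 0) (g (suc i)) ((tl f · g) i))

    ·-right : ∀ f g i → (f · g) (suc i) ≡ f (suc i) ⊗ g 0 ⊕ (f · tl g) i
    ·-right f g zero = ⊕-comm _ _
    ·-right f g (suc i) = trans (cong (f 0 ⊗ g (suc (suc i)) ⊕_) (·-right (tl f) g i))
      (solve 3 (λ a b c → a :+ (b :+ c) := b :+ (a :+ c)) refl (f 0 ⊗ g (suc (suc i))) (f (suc (suc i)) ⊗ g 0) ((tl f · tl g) i))

    ·-comm : ∀ f g → f · g ≋ g · f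
    ·-comm f g zero = ⊗-comm _ _
    ·-comm f g (suc i) = trans (·-right f g i) (cong₂ _⊕_ (⊗-comm _ _) (·-comm f (tl g) i))

    ·-assoc : ∀ f g h → f · g · h ≋ f · (g · h)
    ·-assoc f g h zero = ⊗-assoc _ _ _
    ·-assoc f g h (suc i) = begin
      f 0 ⊗ g 0 ⊗ h (suc i) ⊕ (tl (f · g) · h) i
        ≡⟨ cong (f 0 ⊗ g 0 ⊗ h (suc i) ⊕_) (trans (·-distribʳ h (λ j → f 0 ⊗ tl g j) (tl f · g) i) (cong₂ _⊕_ (·-scale (f 0) (tl g) h i) (·-assoc (tl f) g h i))) ⟩
      f 0 ⊗ g 0 ⊗ h (suc i) ⊕ (f 0 ⊗ (tl g · h) i ⊕ (tl f · (g · h)) i)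
        ≡⟨ solve 5 (λ a b c x y → a :* b :* c :+ (a :* x :+ y) := a :* (b :* c :+ x) :+ y) refl (f 0) (g 0) (h (suc i)) ((tl g · h) i) ((tl f · (g · h)) i) ⟩
      f 0 ⊗ (g · h) (suc i) ⊕ (tl f · (g · h)) i ∎
      where open ≡-Reasoning

    0·  : ∀ g → 0ˢ · g ≋ 0ˢ
    0· g zero = ⊗-zeroˡ _
    0· g (suc i) = trans (cong₂ _⊕_ (⊗-zeroˡ _) (0· g i)) (⊕-identityʳ 𝟘)

    ι· : ∀ c g → ι c · g ≋ (λ i → c ⊗ g i)
    ι· c g zero = refl
    ι· c g (suc i) = trans (cong (c ⊗ g (suc i) ⊕_) (0· g i)) (⊕-identityʳ _)

    1· : ∀ g → 1ˢ · g ≋ g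
    1· g i = trans (ι· 𝟙 g i) (⊗-identityˡ _)

    Y·-0 : ∀ g → (Y · g) 0 ≡ 𝟘
    Y·-0 g = ⊗-zeroˡ _

    Y·-suc : ∀ g i → (Y · g) (suc i) ≡ g i
    Y·-suc g i = trans (cong₂ _⊕_ (⊗-zeroˡ _) (1· g i)) (⊕-identityˡ _)

    series : CommutativeRing 0ℓ 0ℓ
    series = record
      { Carrier = S ; _≈_ = _≋_ ; _+_ = _+ˢ_ ; _*_ = _·_ ; -_ = -ˢ_ ; 0# = 0ˢ ; 1# = 1ˢ
      ; isCommutativeRing = record
        { isRing = record
          { +-isAbelianGroup = record
            { isGroup = record
              { isMonoid = record
                { isSemigroup = record
                  { isMagma = record
                    { isEquivalence = record { refl = λ i → refl ; sym = λ p i → sym (p i) ; trans = λ p r i → trans (p i) (r i) }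
                    ; ∙-cong = λ p r i → cong₂ _⊕_ (p i) (r i) }
                  ; assoc = λ f g h i → ⊕-assoc _ _ _ }
                ; identity = (λ f i → ⊕-identityˡ _) , (λ f i → ⊕-identityʳ _) }
              ; inverse = (λ f i → ⊖-inverseˡ _) , (λ f i → ⊖-inverseʳ _)
              ; ⁻¹-cong = λ p i → cong ⊖_ (p i) }
            ; comm = λ f g i → ⊕-comm _ _ }
          ; *-cong = ·-cong
          ; *-assoc = ·-assoc
          ; *-identity = 1· , (λ f i → trans (·-comm f 1ˢ i) (1· f i))
          ; distrib = (λ f g h i → trans (·-comm f (g +ˢ h) i) (trans (·-distribʳ f g h i) (cong₂ _⊕_ (·-comm g f i) (·-comm h f i)))) , ·-distribʳ }
        ; *-comm = ·-comm } }

    module 𝕊 = CommutativeRing series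
    module 𝕀 = RingIdentities series

    Deg≤ : ℕ → S → Set
    Deg≤ d f = ∀ i → d < i → f i ≡ 𝟘

    ·-deg : ∀ a b f g → Deg≤ a f → Deg≤ b g → Deg≤ (a ℕ.+ b) (f · g)
    ·-deg zero b f g p r (suc i) lt = trans (cong₂ _⊕_ (trans (cong (f 0 ⊗_) (r (suc i) lt)) (⊗-zeroʳ _))
      (trans (·-cong {tl f} {0ˢ} {g} {g} (λ j → p (suc j) (s≤s z≤n)) (λ _ → refl) i) (0· g i))) (⊕-identityʳ 𝟘)
    ·-deg (suc a) b f g p r (suc i) (s≤s lt) = trans (cong₂ _⊕_ (trans (cong (f 0 ⊗_) (r (suc i) (ℕP.≤-trans (s≤s (ℕP.m≤n+m b a)) (ℕP.m≤n⇒m≤1+n lt)))) (⊗-zeroʳ _))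
      (·-deg a b (tl f) g (λ j q → p (suc j) (s≤s q)) r i lt)) (⊕-identityʳ 𝟘)

    ·-top : ∀ a b f g → Deg≤ a f → Deg≤ b g → (f · g) (a ℕ.+ b) ≡ f a ⊗ g b
    ·-top zero zero f g p r = refl
    ·-top zero (suc b) f g p r = trans (cong (f 0 ⊗ g (suc b) ⊕_) (trans (·-cong {tl f} {0ˢ} {g} {g} (λ j → p (suc j) (s≤s z≤n)) (λ _ → refl) b) (0· g b))) (⊕-identityʳ _)
    ·-top (suc a) b f g p r = trans (cong₂ _⊕_ (trans (cong (f 0 ⊗_) (r (suc (a ℕ.+ b)) (s≤s (ℕP.m≤n+m b a)))) (⊗-zeroʳ _))
      (·-top a b (tl f) g (λ j q → p (suc j) (s≤s q)) r)) (⊕-identityˡ _)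

    mseq : ∀ {d} → Vec K d → S
    mseq [] = 1ˢ
    mseq (c ∷ v) zero = c
    mseq (c ∷ v) (suc i) = mseq v i

    mseq-deg : ∀ {d} (v : Vec K d) → Deg≤ d (mseq v)
    mseq-deg [] (suc i) _ = refl
    mseq-deg (c ∷ v) (suc i) (s≤s lt) = mseq-deg v i lt

    mseq-top : ∀ {d} (v : Vec K d) → mseq v d ≡ 𝟙
    mseq-top [] = refl
    mseq-top (c ∷ v) = mseq-top v

    mseq-inj : ∀ {d} {u v : Vec K d} → mseq u ≋ mseq v → u ≡ v
    mseq-inj {u = []} {[]} p = refl
    mseq-inj {u = x ∷ u} {y ∷ v} p = cong₂ _∷_ (p 0) (mseq-inj (λ i → p (suc i)))

    trunc : ∀ d → S → Vec K d
    trunc zero f = []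
    trunc (suc d) f = f 0 ∷ trunc d (tl f)

    mseq-trunc : ∀ d f → Deg≤ d f → f d ≡ 𝟙 → mseq (trunc d f) ≋ f
    mseq-trunc zero f p t zero = sym t
    mseq-trunc zero f p t (suc i) = sym (p (suc i) (s≤s z≤n))
    mseq-trunc (suc d) f p t zero = refl
    mseq-trunc (suc d) f p t (suc i) = mseq-trunc d (tl f) (λ j q → p (suc j) (s≤s q)) t i

    vseq : ∀ {d} → Vec K d → S
    vseq [] = 0ˢ
    vseq (c ∷ v) zero = c
    vseq (c ∷ v) (suc i) = vseq v i

    vseq-deg : ∀ {d} (v : Vec K (suc d)) → Deg≤ d (vseq v)
    vseq-deg (c ∷ []) (suc i) lt = refl
    vseq-deg {suc d} (c ∷ v@(_ ∷ _)) (suc i) (s≤s lt) = vseq-deg v i lt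

    -- A relation rather than a function: `d` need only be provably equal to `a + b`, which avoids
    -- transporting vectors along equations of lengths.
    record Mul {a b d} (g : Vec K a) (h : Vec K b) (f : Vec K d) : Set where
      constructor mul
      field
        degree≡ : a ℕ.+ b ≡ d
        product≡ : mseq g · mseq h ≋ mseq f
    open Mul public

    _⊙_ : ∀ {a b} → Vec K a → Vec K b → Vec K (a ℕ.+ b)
    _⊙_ {a} {b} g h = trunc (a ℕ.+ b) (mseq g · mseq h)

    ⊙-mul : ∀ {a b} (g : Vec K a) (h : Vec K b) → Mul g h (g ⊙ h)
    ⊙-mul {a} {b} g h = mul refl λ i → sym (mseq-trunc (a ℕ.+ b) (mseq g · mseq h) (·-deg a b _ _ (mseq-deg g) (mseq-deg h))
      (trans (·-top a b _ _ (mseq-deg g) (mseq-deg h)) (trans (cong₂ _⊗_ (mseq-top g) (mseq-top h)) (⊗-identityʳ 𝟙))) i)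

    mul-unique : ∀ {a b d} {g : Vec K a} {h : Vec K b} {f f′ : Vec K d} → Mul g h f → Mul g h f′ → f ≡ f′
    mul-unique (mul _ p) (mul _ r) = mseq-inj (λ i → trans (sym (p i)) (r i))

    mul-comm : ∀ {a b d} {g : Vec K a} {h : Vec K b} {f : Vec K d} → Mul g h f → Mul h g f
    mul-comm {a} {b} {g = g} {h} (mul e p) = mul (trans (ℕP.+-comm b a) e) λ i → trans (·-comm (mseq h) (mseq g) i) (p i)

    -- Compare coefficients from the top.
    cancel-zero : ∀ {a} (g : Vec K a) f D → Deg≤ D f → mseq g · f ≋ 0ˢ → f ≋ 0ˢ
    cancel-zero {a} g f D p z = go D p
      where
      step : ∀ d → Deg≤ d f → f d ≡ 𝟘
      step d q = trans (sym (⊗-identityˡ _)) (trans (cong (_⊗ f d) (sym (mseq-top g))) (trans (sym (·-top a d (mseq g) f (mseq-deg g) q)) (z (a ℕ.+ d))))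
      go : ∀ d → Deg≤ d f → f ≋ 0ˢ
      go zero q zero = step 0 q
      go zero q (suc i) = q (suc i) (s≤s z≤n)
      go (suc d) q = go d λ i d<i → pick i d<i (ℕP.m≤n⇒m<n∨m≡n d<i)
        where
        pick : ∀ i → d < i → suc d < i ⊎ suc d ≡ i → f i ≡ 𝟘
        pick i _ (inj₁ lt) = q i lt
        pick i _ (inj₂ refl) = step (suc d) q

    ·-cancelˡ : ∀ {a} (g : Vec K a) f f′ D → Deg≤ D f → Deg≤ D f′ → mseq g · f ≋ mseq g · f′ → f ≋ f′
    ·-cancelˡ g f f′ D p p′ e i = ⊝≡0 (cancel-zero g (f +ˢ -ˢ f′) D
        (λ j q → trans (cong₂ (λ x y → x ⊕ ⊖ y) (p j q) (p′ j q)) (⊖-inverseʳ 𝟘))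
        (λ j → trans (𝕀.distrib-minus (mseq g) f f′ j)
          (trans (cong (λ z → (mseq g · f) j ⊕ ⊖ z) (sym (e j))) (⊖-inverseʳ _))) i)

    mul-cancel : ∀ {a b d} {g : Vec K a} {h h′ : Vec K b} {f : Vec K d} → Mul g h f → Mul g h′ f → h ≡ h′
    mul-cancel {b = b} {g = g} {h} {h′} (mul _ p) (mul _ r) = mseq-inj (·-cancelˡ g _ _ b (mseq-deg h) (mseq-deg h′) (λ i → trans (p i) (sym (r i))))

    mul-assoc : ∀ {a b c d e} {f : Vec K a} {g : Vec K b} {h : Vec K c} {gh : Vec K d} {p : Vec K e} → Mul g h gh → Mul f gh p → Mul (f ⊙ g) h p
    mul-assoc {a} {b} {c} {f = f} {g} {h} (mul e₁ m₁) (mul e₂ m₂) = mul (trans (ℕP.+-assoc a b c) (trans (cong (a ℕ.+_) e₁) e₂))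
      λ i → trans (·-cong {g = mseq h} {mseq h} (λ j → sym (product≡ (⊙-mul f g) j)) (λ _ → refl) i) (trans (·-assoc (mseq f) (mseq g) (mseq h) i) (trans (·-cong {mseq f} {mseq f} (λ _ → refl) m₁ i) (m₂ i)))

-- Unique factorisation of monic polynomials.

module Factor where

  open Field
  open Mean
  open Series
  open import Data.Nat as ℕ using (ℕ; zero; suc; _≤_; _<_; z≤n; s≤s)
  import Data.Nat.Properties as ℕP
  open import Data.Fin using (Fin; toℕ; fromℕ<)
  import Data.Fin.Properties as FinP
  open import Data.Vec using (Vec; []; _∷_)
  import Data.Vec.Properties as VecP
  open import Data.List as List using (List; []; _∷_; _++_)
  open import Data.List.Relation.Unary.All using (All; []; _∷_)
  import Data.List.Relation.Unary.All.Properties as AllP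
  import Data.List.Properties as ListP
  open import Data.List.Relation.Unary.Any using (here; there)
  open import Data.List.Membership.Propositional using (_∈_)
  open import Data.List.Membership.Propositional.Properties using (∈-∃++)
  open import Data.List.Relation.Binary.Permutation.Propositional using (_↭_; refl; prep; swap; trans; ↭-refl; ↭-sym; ↭-trans)
  open import Data.List.Relation.Binary.Permutation.Propositional.Properties using (All-resp-↭; shift; map⁺; filter-↭; ↭-length)
  open import Data.Product using (Σ; ∃; _×_; _,_; proj₁; proj₂)
  open import Data.Sum using (_⊎_; inj₁; inj₂)
  open import Relation.Nullary using (¬_; yes; no; Dec)
  open import Relation.Binary.Definitions using (tri<; tri≈; tri>)
  open import Relation.Nullary.Decidable using (map′)
  open import Relation.Nullary.Negation using (contradiction)
  open import Relation.Binary.PropositionalEquality hiding (trans)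
  import Relation.Binary.PropositionalEquality as P

  module Factorization (𝔽 : FinField) where
    open FinField 𝔽
    open FieldFacts 𝔽
    open PowerSeries 𝔽
    open VecSpace uniform

    -- Degree strictly below `d`; in contrast to `Deg≤`, the case `d = 0` describes the zero
    -- polynomial.
    Low : ℕ → S → Set
    Low d f = ∀ i → d ≤ i → f i ≡ 𝟘

    low-deg : ∀ {d f} → Low d f → Deg≤ d f
    low-deg p i lt = p i (ℕP.<⇒≤ lt)

    opaque
      -- Write `f` as its constant term plus `Y · tl f` and divide the tail. `Y` times its remainder
      -- may reach degree `a`; subtracting the multiple `c` of `g` removes that coefficient, and `c`
      -- enters the quotient.
      divide : ∀ {a} (g : Vec K a) D f → Low D f → ∃ λ q → ∃ λ r → Low D q × Low a r × f ≋ mseq g · q +ˢ r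
      divide {a} g zero f p = 0ˢ , f , (λ _ _ → refl) , (λ i _ → p i z≤n) ,
        𝕀.zero-quotient f (mseq g)
      divide {a} g (suc D) f p with divide g D (tl f) (λ i le → p (suc i) (s≤s le))
      ... | q , r , lq , lr , e = Y · q +ˢ ι c , r′ +ˢ -ˢ (ι c · mseq g) , lowq , lowr , eq
        where
        r′ : S
        r′ = ι (f 0) +ˢ Y · r
        c : K
        c = r′ a
        lowq : Low (suc D) (Y · q +ˢ ι c)
        lowq (suc i) (s≤s le) = P.trans (⊕-identityʳ _) (P.trans (Y·-suc q i) (lq i le))
        cg : ∀ i → (ι c · mseq g) i ≡ c ⊗ mseq g i
        cg = ι· c (mseq g)
        lowr : Low a (r′ +ˢ -ˢ (ι c · mseq g))
        lowr i le with ℕP.m≤n⇒m<n∨m≡n le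
        lowr (suc i) _ | inj₁ (s≤s lt) = P.trans (cong₂ (λ x y → x ⊕ ⊖ y)
            (P.trans (⊕-identityˡ _) (P.trans (Y·-suc r i) (lr i lt)))
            (P.trans (cg (suc i)) (P.trans (cong (c ⊗_) (mseq-deg g (suc i) (s≤s lt))) (⊗-zeroʳ c)))) (⊖-inverseʳ 𝟘)
        lowr i _ | inj₂ refl = P.trans (cong (λ y → c ⊕ ⊖ y) (P.trans (cg a) (P.trans (cong (c ⊗_) (mseq-top g)) (⊗-identityʳ c)))) (⊖-inverseʳ c)
        base : f ≋ ι (f 0) +ˢ Y · tl f
        base zero = sym (P.trans (cong (f 0 ⊕_) (Y·-0 (tl f))) (⊕-identityʳ _))
        base (suc i) = sym (P.trans (⊕-identityˡ _) (Y·-suc (tl f) i))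
        eq : f ≋ mseq g · (Y · q +ˢ ι c) +ˢ (r′ +ˢ -ˢ (ι c · mseq g))
        eq = 𝕊.trans base (𝕊.trans (𝕊.+-cong {ι (f 0)} {ι (f 0)} 𝕊.refl (·-cong {Y} {Y} 𝕊.refl e))
          (𝕀.long-division (ι (f 0)) Y (mseq g) q r (ι c)))

    Monic-of : S → ℕ → Set
    Monic-of f b = ∃ λ κ → κ ≢ 𝟘 × ∃ λ (h : Vec K b) → f ≋ ι κ · mseq h

    opaque
      normalise : ∀ b f → Deg≤ b f → f b ≢ 𝟘 → Monic-of f b
      normalise b f p t with inverse (f b) t
      ... | d , e = f b , t , trunc b f′ , λ i → sym (P.trans (ι· (f b) _ i) (P.trans (cong (f b ⊗_) (mseq-trunc b f′ p′ (P.trans (⊗-comm d _) e) i))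
                      (P.trans (sym (⊗-assoc (f b) d (f i))) (P.trans (cong (_⊗ f i) e) (⊗-identityˡ _)))))
        where
        f′ : S
        f′ i = d ⊗ f i
        p′ : Deg≤ b f′
        p′ i lt = P.trans (cong (d ⊗_) (p i lt)) (⊗-zeroʳ d)

    opaque
      leading : ∀ D f → Low D f → f ≋ 0ˢ ⊎ ∃ λ b → b < D × Monic-of f b
      leading zero f p = inj₁ (λ i → p i z≤n)
      leading (suc D) f p with f D ≟ 𝟘
      ... | no t = inj₂ (D , ℕP.≤-refl , normalise D f p t)
      ... | yes z with leading D f low
        where
        low : Low D f
        low i le with ℕP.m≤n⇒m<n∨m≡n le
        ... | inj₁ lt = p i lt
        ... | inj₂ refl = z
      ... | inj₁ e = inj₁ e
      ... | inj₂ (b , lt , m) = inj₂ (b , ℕP.m≤n⇒m≤1+n lt , m)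

    _∣_ : ∀ {a n} → Vec K a → Vec K n → Set
    g ∣ f = ∃ λ b → ∃ λ (h : Vec K b) → Mul g h f

    infix 4 _∣_ _⊳_
    -- The finite degree of the quotient matters: in the ring of series, 1 + Y divides everything.
    _⊳_ : ∀ {a} → Vec K a → S → Set
    g ⊳ f = ∃ λ q → (∃ λ D → Low D q) × mseq g · q ≋ f

    -- The product on the left has degree exactly `a + b` with top coefficient `κ`; comparison with
    -- a monic polynomial forces both `a + b = c` and `κ = 𝟙`.
    degree-unique : ∀ {a b c} (g : Vec K a) (h : Vec K b) (f : Vec K c) κ → κ ≢ 𝟘 → mseq g · (ι κ · mseq h) ≋ mseq f → Mul g h f
    degree-unique {a} {b} {c} g h f κ κ≢0 e = mul eqd λ i → P.trans (sym (cancel i)) (e i)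
      where
      scaled : ∀ i → (mseq g · (ι κ · mseq h)) i ≡ κ ⊗ (mseq g · mseq h) i
      scaled i = P.trans (𝕀.*-left-comm (mseq g) (ι κ) (mseq h) i) (ι· κ (mseq g · mseq h) i)
      top : (mseq g · mseq h) (a ℕ.+ b) ≡ 𝟙
      top = P.trans (·-top a b _ _ (mseq-deg g) (mseq-deg h)) (P.trans (cong₂ _⊗_ (mseq-top g) (mseq-top h)) (⊗-identityʳ 𝟙))
      ftop : mseq f (a ℕ.+ b) ≡ κ
      ftop = P.trans (sym (e (a ℕ.+ b))) (P.trans (scaled (a ℕ.+ b)) (P.trans (cong (κ ⊗_) top) (⊗-identityʳ κ)))
      eqd : a ℕ.+ b ≡ c
      eqd with ℕP.<-cmp (a ℕ.+ b) c
      ... | tri< lt _ _ = contradiction (P.trans (sym (mseq-top f)) (P.trans (sym (e c)) (P.trans (scaled c) (P.trans (cong (κ ⊗_) (·-deg a b _ _ (mseq-deg g) (mseq-deg h) c lt)) (⊗-zeroʳ κ))))) 𝟙≢𝟘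
      ... | tri≈ _ eq _ = eq
      ... | tri> _ _ gt = contradiction (P.trans (sym ftop) (mseq-deg f _ gt)) κ≢0
      κ≡1 : κ ≡ 𝟙
      κ≡1 = P.trans (sym ftop) (P.trans (cong (mseq f) eqd) (mseq-top f))
      cancel : ∀ i → (mseq g · (ι κ · mseq h)) i ≡ (mseq g · mseq h) i
      cancel i = P.trans (scaled i) (P.trans (cong (_⊗ (mseq g · mseq h) i) κ≡1) (⊗-identityˡ _))

    ⊳⇒∣ : ∀ {a c} (g : Vec K a) (f : Vec K c) → g ⊳ mseq f → g ∣ f
    ⊳⇒∣ {a} {c} g f (q , (D , lq) , e) with leading D q lq
    ... | inj₁ z = contradiction (P.trans (sym (mseq-top f)) (P.trans (sym (e c)) (P.trans (·-cong {mseq g} {mseq g} (λ _ → refl) z c) (P.trans (·-comm (mseq g) 0ˢ c) (0· (mseq g) c))))) 𝟙≢𝟘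
    ... | inj₂ (b , _ , κ , κ≢0 , h , qe) = b , h , degree-unique g h f κ κ≢0 (λ i → P.trans (·-cong {mseq g} {mseq g} (λ _ → refl) (λ j → sym (qe j)) i) (e i))

    ∣⇒⊳ : ∀ {a c} (g : Vec K a) (f : Vec K c) → g ∣ f → g ⊳ mseq f
    ∣⇒⊳ g f (b , h , mul _ e) = mseq h , (suc b , mseq-deg h) , e

    Irr : ∀ {d} → Vec K d → Set
    Irr {d} f = 1 ≤ d × (∀ a b (g : Vec K a) (h : Vec K b) → 1 ≤ a → 1 ≤ b → ¬ Mul g h f)

    ⊳-scale : ∀ {a} (g : Vec K a) κ h → κ ≢ 𝟘 → g ⊳ (ι κ · h) → g ⊳ h
    ⊳-scale g κ h κ≢0 (q , (D , lq) , e) with inverse κ κ≢0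
    ... | d , κd = ι d · q , (D , λ i le → P.trans (ι· d q i) (P.trans (cong (d ⊗_) (lq i le)) (⊗-zeroʳ d))) ,
      λ i → P.trans (𝕀.*-left-comm (mseq g) (ι d) q i)
        (P.trans (ι· d _ i) (P.trans (cong (d ⊗_) (P.trans (e i) (ι· κ h i))) (P.trans (sym (⊗-assoc d κ (h i))) (P.trans (cong (_⊗ h i) (P.trans (⊗-comm d κ) κd)) (⊗-identityˡ _)))))

    ⊳-remainder : ∀ {a} (g : Vec K a) f q r h → (∃ λ D → Low D q) → (∃ λ D → Low D h) → f ≋ mseq g · q +ˢ r → g ⊳ (f · h) → g ⊳ (r · h)
    ⊳-remainder g f q r h (D , lq) (D′ , lh) e (t , (D″ , lt) , e′) = t +ˢ -ˢ (q · h) , (D″ ℕ.+ suc (D ℕ.+ D′) , low) , eq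
      where
      low : Low (D″ ℕ.+ suc (D ℕ.+ D′)) (t +ˢ -ˢ (q · h))
      low i le = P.trans (cong₂ (λ x y → x ⊕ ⊖ y) (lt i (ℕP.≤-trans (ℕP.m≤m+n D″ _) le))
        (·-deg D D′ q h (low-deg {D} lq) (low-deg {D′} lh) i (ℕP.≤-trans (ℕP.m≤n+m _ D″) le))) (⊖-inverseʳ 𝟘)
      eq : mseq g · (t +ˢ -ˢ (q · h)) ≋ r · h
      eq = 𝕊.trans (𝕀.distrib-minus′ (mseq g) t q h)
        (𝕊.trans (𝕊.+-cong {y = f · h} {u = -ˢ (mseq g · q · h)} e′ 𝕊.refl) (𝕊.trans (𝕊.+-cong {u = -ˢ (mseq g · q · h)} (·-cong {g = h} e (λ _ → refl)) 𝕊.refl)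
        (𝕀.subtract-part (mseq g · q) r h)))

    ⊳-cong : ∀ {a} (g : Vec K a) {f f′} → f ≋ f′ → g ⊳ f → g ⊳ f′
    ⊳-cong g e (q , l , e′) = q , l , λ i → P.trans (e′ i) (e i)

    -- Divide g by r and descend to the remainder.
    opaque
      euclid-small : ∀ {a} (g : Vec K a) → Irr g → ∀ h → (∃ λ D → Low D h) → ∀ fuel {d} (r : Vec K d) → d < fuel → d < a → g ⊳ (mseq r · h) → g ⊳ h
      euclid-small {a} g irr h lh (suc fuel) [] _ _ gr = ⊳-cong g (1· h) gr
      euclid-small {a} g irr h lh (suc fuel) {suc d} r (s≤s lt) d<a gr with divide r (suc a) (mseq g) (mseq-deg g)
      ... | q , R , lq , lR , e with leading (suc d) R lR
      -- A zero remainder would make `r` a factor of `g` of degree strictly between 0 and `a`,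
      -- against irreducibility.
      ... | inj₁ z = contradiction (⊳⇒∣ r g (q , (suc a , lq) , λ i → sym (P.trans (e i) (P.trans (cong ((mseq r · q) i ⊕_) (z i)) (⊕-identityʳ _))))) no-factor
        where
        no-factor : ¬ (r ∣ g)
        no-factor (zero , h′ , m) = ℕP.<-irrefl (P.trans (sym (ℕP.+-identityʳ _)) (degree≡ m)) d<a
        no-factor (suc b , h′ , m) = proj₂ irr (suc d) (suc b) r h′ (s≤s z≤n) (s≤s z≤n) m
      ... | inj₂ (d′ , d′<d , κ , κ≢0 , r′ , Re) = euclid-small g irr h lh fuel r′ (ℕP.≤-trans d′<d lt) (ℕP.<-trans d′<d d<a)
        (⊳-scale g κ (mseq r′ · h) κ≢0 (⊳-cong g (λ i → P.trans (·-cong {g = h} Re (λ _ → refl) i) (·-assoc (ι κ) (mseq r′) h i)) Rh))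
        where
        t : S
        t = proj₁ gr
        D : ℕ
        D = proj₁ (proj₁ (proj₂ gr))
        rq-part : g ⊳ (mseq r · q · h)
        rq-part = q · t , (suc (suc a ℕ.+ D) , λ i le → ·-deg (suc a) D q t (low-deg {suc a} lq) (low-deg {D} (proj₂ (proj₁ (proj₂ gr)))) i le) ,
          𝕊.trans (𝕀.*-left-comm (mseq g) q t)
            (𝕊.trans (·-cong {q} {q} (λ _ → refl) (proj₂ (proj₂ gr))) (𝕀.rotate q (mseq r) h))
        Rh : g ⊳ (R · h)
        Rh = with-quotient rq-part
          where
          with-quotient : g ⊳ (mseq r · q · h) → g ⊳ (R · h)
          with-quotient (t , (D , lt′) , te) = h +ˢ -ˢ t , (proj₁ lh ℕ.+ D , λ i le → P.trans (cong₂ (λ x y → x ⊕ ⊖ y) (proj₂ lh i (ℕP.≤-trans (ℕP.m≤m+n _ D) le)) (lt′ i (ℕP.≤-trans (ℕP.m≤n+m D _) le))) (⊖-inverseʳ 𝟘)) ,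
              𝕊.trans (𝕀.distrib-minus (mseq g) h t)
                (𝕊.trans (λ i → cong₂ (λ x y → x ⊕ ⊖ y) (·-cong {g = h} e (λ _ → refl) i) (te i))
            (𝕀.subtract-part (mseq r · q) R h))

    opaque
      -- Reduce `f` modulo `g`. If the remainder is zero, `g` divides `f`; otherwise `g` still
      -- divides remainder times `h`, and `euclid-small` applies as the remainder has smaller
      -- degree.
      euclid : ∀ {a b c n} (g : Vec K a) → Irr g → (f : Vec K b) (h : Vec K c) (p : Vec K n) → Mul f h p → g ∣ p → g ∣ f ⊎ g ∣ h
      euclid {a} {b} {c} g irr f h p (mul _ m) gp with divide g (suc b) (mseq f) (mseq-deg f)
      ... | q , r , lq , lr , e with leading a r lr
      ... | inj₁ z = inj₁ (⊳⇒∣ g f (q , (suc b , lq) , λ i → sym (P.trans (e i) (P.trans (cong ((mseq g · q) i ⊕_) (z i)) (⊕-identityʳ _)))))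
      ... | inj₂ (d , d<a , κ , κ≢0 , r′ , re) = inj₂ (⊳⇒∣ g h (euclid-small g irr (mseq h) (suc c , mseq-deg h) (suc d) r′ ℕP.≤-refl d<a
        (⊳-scale g κ _ κ≢0 (⊳-cong g (λ i → P.trans (·-cong {g = mseq h} re (λ _ → refl) i) (·-assoc (ι κ) (mseq r′) (mseq h) i))
          (⊳-remainder g (mseq f) q r (mseq h) (suc b , lq) (suc c , mseq-deg h) e (⊳-cong g (λ i → sym (m i)) (∣⇒⊳ g p gp)))))))

    Poly : Set
    Poly = Σ ℕ (Vec K)

    data Prod : List Poly → ∀ {n} → Vec K n → Set where
      nil : Prod [] []
      cons : ∀ {a m n} {f : Vec K a} {Q : Vec K m} {P : Vec K n} {fs} → Mul f Q P → Prod fs Q → Prod ((a , f) ∷ fs) P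

    AllIrr : List Poly → Set
    AllIrr = All (λ f → Irr (proj₂ f))

    mul-[] : ∀ {b n} {h : Vec K b} {p : Vec K n} → Mul [] h p → _≡_ {A = Poly} (b , h) (n , p)
    mul-[] {h = h} (mul refl e) = cong (_ ,_) (mseq-inj (λ i → P.trans (sym (1· (mseq h) i)) (e i)))

    mul-assoc′ : ∀ {a b c d e} {f : Vec K a} {g : Vec K b} {h : Vec K c} {fg : Vec K d} {p : Vec K e} → Mul f g fg → Mul fg h p → Mul f (g ⊙ h) p
    mul-assoc′ {a} {b} {c} {f = f} {g} {h} (mul e₁ m₁) (mul e₂ m₂) = mul (P.trans (sym (ℕP.+-assoc a b c)) (P.trans (cong (ℕ._+ c) e₁) e₂))
      λ i → P.trans (·-cong {mseq f} {mseq f} (λ _ → refl) (λ j → sym (product≡ (⊙-mul g h) j)) i) (P.trans (sym (·-assoc (mseq f) (mseq g) (mseq h) i))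
        (P.trans (·-cong {g = mseq h} m₁ (λ _ → refl) i) (m₂ i)))

    prod-++ : ∀ {a b n} {fs gs} {g : Vec K a} {h : Vec K b} {p : Vec K n} → Prod fs g → Prod gs h → Mul g h p → Prod (fs ++ gs) p
    prod-++ nil hs m with mul-[] m
    ... | refl = hs
    prod-++ (cons m′ gs) hs m = cons (mul-assoc′ m′ m) (prod-++ gs hs (⊙-mul _ _))

    irr-associate : ∀ {a b} {g : Vec K a} {f : Vec K b} → Irr g → Irr f → g ∣ f → _≡_ {A = Poly} (a , g) (b , f)
    irr-associate ig jf (zero , [] , m) = mul-[] (mul-comm m)
    irr-associate ig jf (suc c , h , m) = contradiction m (proj₂ jf _ (suc c) _ h (proj₁ ig) (s≤s z≤n))

    irr-degree : ∀ {a} {g : Vec K a} → Irr g → a ≢ 0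
    irr-degree (() , _) refl

    irr∣prod⇒∈ : ∀ {a n fs} {g : Vec K a} {p : Vec K n} → Irr g → AllIrr fs → Prod fs p → g ∣ p → (a , g) ∈ fs
    irr∣prod⇒∈ {a} ig [] nil (b , h , mul e _) = contradiction (ℕP.m+n≡0⇒m≡0 a e) (irr-degree ig)
    irr∣prod⇒∈ {g = g} ig (jf ∷ jfs) (cons {f = f} {Q} {P} m ps) gp with euclid g ig f Q P m gp
    ... | inj₁ gf = here (irr-associate ig jf gf)
    ... | inj₂ gQ = there (irr∣prod⇒∈ ig jfs ps gQ)

    opaque
      mul? : ∀ {a b n} (g : Vec K a) (h : Vec K b) (p : Vec K n) → Dec (Mul g h p)
      mul? {a} {b} {n} g h p with a ℕ.+ b ℕ.≟ n
      ... | no ne = no (λ m → ne (degree≡ m))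
      ... | yes refl = map′ (λ { refl → ⊙-mul g h }) (λ m → mul-unique (⊙-mul g h) m) (VecP.≡-dec _≟_ (g ⊙ h) p)

    vec-any? : ∀ {n} {Q : Vec K n → Set} → (∀ v → Dec (Q v)) → Dec (∃ Q)
    vec-any? {n} Q? with Uniform.search (vecU n) Q?
    ... | inj₁ w = yes w
    ... | inj₂ no-w = no λ { (v , q) → no-w v q }

    -- Both degrees are below `n`, so neither factor can be constant, and the search is over
    -- finitely many vectors.
    Splits : ∀ {n} → Vec K n → Set
    Splits {n} p = ∃ λ (i : Fin n) → ∃ λ (j : Fin n) → ∃ λ (g : Vec K (toℕ i)) → ∃ λ (h : Vec K (toℕ j)) → Mul g h p

    opaque
      splits? : ∀ {n} (p : Vec K n) → Dec (Splits p)
      splits? p = FinP.any? λ i → FinP.any? λ j → vec-any? λ g → vec-any? λ h → mul? g h p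

    ¬splits⇒irr : ∀ {n} (p : Vec K (suc n)) → ¬ Splits p → Irr p
    ¬splits⇒irr {n} p ns = s≤s z≤n , go
      where
      go : ∀ a b (g : Vec K a) (h : Vec K b) → 1 ≤ a → 1 ≤ b → ¬ Mul g h p
      go a b g h 1≤a 1≤b m = ns (wit a b g h (degree≡ m) a<n b<n m)
        where
        a<n : a < suc n
        a<n = subst (a <_) (degree≡ m) (ℕP.m<m+n a 1≤b)
        b<n : b < suc n
        b<n = subst (b <_) (degree≡ m) (ℕP.m<n+m b 1≤a)
        wit : ∀ a b (g : Vec K a) (h : Vec K b) → a ℕ.+ b ≡ suc n → a < suc n → b < suc n → Mul g h p → Splits p
        wit a b g h _ a<n b<n m with fromℕ< a<n | FinP.toℕ-fromℕ< a<n | fromℕ< b<n | FinP.toℕ-fromℕ< b<n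
        ... | i | refl | j | refl = i , j , g , h , m

    opaque
      irr? : ∀ {n} (p : Vec K n) → Dec (Irr p)
      irr? {zero} p = no λ { (() , _) }
      irr? {suc n} p with splits? p
      ... | no ns = yes (¬splits⇒irr p ns)
      ... | yes (i , j , g , h , m) = no λ irr → proj₂ irr _ _ g h (pos (toℕ j) (toℕ i) (FinP.toℕ<n j) (P.trans (ℕP.+-comm (toℕ j) _) (degree≡ m))) (pos (toℕ i) (toℕ j) (FinP.toℕ<n i) (degree≡ m)) m
        where
        pos : ∀ x y → x < suc n → x ℕ.+ y ≡ suc n → 1 ≤ y
        pos x zero lt e = contradiction (P.trans (sym (ℕP.+-identityʳ x)) e) (ℕP.<⇒≢ lt)
        pos x (suc y) lt e = s≤s z≤n

    factorize′ : ∀ fuel {n} (p : Vec K n) → n < fuel → ∃ λ fs → AllIrr fs × Prod fs p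
    factorize′ (suc fuel) [] _ = [] , [] , nil
    factorize′ (suc fuel) {suc n} p (s≤s lt) with splits? p
    ... | no ns = (suc n , p) ∷ [] , ¬splits⇒irr p ns ∷ [] , cons (mul (ℕP.+-identityʳ _) λ i → P.trans (·-comm (mseq p) 1ˢ i) (1· (mseq p) i)) nil
    ... | yes (i , j , g , h , m) with factorize′ fuel g (ℕP.<-≤-trans (FinP.toℕ<n i) lt) | factorize′ fuel h (ℕP.<-≤-trans (FinP.toℕ<n j) lt)
    ... | fs , ifs , pfs | gs , igs , pgs = fs ++ gs , AllP.++⁺ ifs igs , prod-++ pfs pgs m

    opaque
      factorize : ∀ {n} (p : Vec K n) → ∃ λ fs → AllIrr fs × Prod fs p
      factorize {n} p = factorize′ (suc n) p ℕP.≤-refl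

    mul-swap : ∀ {a b c d e} {f : Vec K a} {g : Vec K b} {R : Vec K c} {Q : Vec K d} {p : Vec K e} → Mul f Q p → Mul g R Q → Mul g (f ⊙ R) p
    mul-swap {f = f} {g} {R} m₁ m₂ = mul-assoc′ (mul-comm {g = f} {g} (⊙-mul f g)) (mul-assoc m₂ m₁)

    prod-↭ : ∀ {n fs gs} {p : Vec K n} → fs ↭ gs → Prod fs p → Prod gs p
    prod-↭ refl ps = ps
    prod-↭ (prep f e) (cons m ps) = cons m (prod-↭ e ps)
    prod-↭ (swap f g e) (cons m₁ (cons m₂ ps)) = cons (mul-swap m₁ m₂) (cons (⊙-mul _ _) (prod-↭ e ps))
    prod-↭ (trans e₁ e₂) ps = prod-↭ e₂ (prod-↭ e₁ ps)

    ∈⇒↭ : ∀ {x : Poly} {xs} → x ∈ xs → ∃ λ ys → xs ↭ x ∷ ys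
    ∈⇒↭ {x} i with ∈-∃++ i
    ... | as , bs , refl = as ++ bs , shift x as bs

    opaque
      -- By `irr∣prod⇒∈` the first factor of one list occurs in the other; moved to the front by a
      -- permutation it cancels, and the tails have a common product.
      unique : ∀ {n fs gs} {p : Vec K n} → AllIrr fs → AllIrr gs → Prod fs p → Prod gs p → fs ↭ gs
      unique [] [] nil nil = ↭-refl
      unique [] (ig ∷ _) nil (cons {a} m ps) = contradiction (ℕP.m+n≡0⇒m≡0 a (degree≡ m)) (irr-degree ig)
      unique {gs = gs} {p} (jf ∷ ifs) igs (cons {f = f} {Q} m ps) pgs with ∈⇒↭ (irr∣prod⇒∈ jf igs pgs (_ , Q , m))
      ... | gs′ , e with prod-↭ e pgs | All-resp-↭ e igs
      ... | cons {Q = Q′} m′ ps′ | _ ∷ igs′ = ↭-trans (prep _ (unique ifs igs′ ps (same m m′ ps′))) (↭-sym e)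
        where
        same : ∀ {a b b′ n} {f : Vec K a} {Q : Vec K b} {Q′ : Vec K b′} {p : Vec K n} → Mul f Q p → Mul f Q′ p → Prod gs′ Q′ → Prod gs′ Q
        same {a} {b} {b′} m m′ ps′ with ℕP.+-cancelˡ-≡ a b b′ (P.trans (degree≡ m) (sym (degree≡ m′)))
        ... | refl with mul-cancel m m′
        ... | refl = ps′

    degrees : List Poly → ℕ
    degrees [] = 0
    degrees ((a , _) ∷ fs) = a ℕ.+ degrees fs

    degrees-prod : ∀ {n fs} {p : Vec K n} → Prod fs p → degrees fs ≡ n
    degrees-prod nil = refl
    degrees-prod (cons {a} m ps) = P.trans (cong (a ℕ.+_) (degrees-prod ps)) (degree≡ m)

    count : ℕ → List Poly → ℕ
    count i fs = List.length (List.filter (ℕ._≟ i) (List.map proj₁ fs))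

    count-yes : ∀ {i a} {f : Vec K a} fs → a ≡ i → count i ((a , f) ∷ fs) ≡ suc (count i fs)
    count-yes {i} fs e = cong List.length (ListP.filter-accept (ℕ._≟ i) e)

    count-no : ∀ {i a} {f : Vec K a} fs → a ≢ i → count i ((a , f) ∷ fs) ≡ count i fs
    count-no {i} fs e = cong List.length (ListP.filter-reject (ℕ._≟ i) e)

    count-↭ : ∀ i {fs gs} → fs ↭ gs → count i fs ≡ count i gs
    count-↭ i e = ↭-length (filter-↭ (ℕ._≟ i) (map⁺ proj₁ e))

    HasType : ∀ {n} → Vec K n → (ℕ → ℕ) → Set
    HasType p s = ∃ λ fs → AllIrr fs × Prod fs p × (∀ i → count i fs ≡ s i)

    count-high : ∀ i fs → degrees fs < i → count i fs ≡ 0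
    count-high i [] lt = refl
    count-high i ((a , f) ∷ fs) lt = P.trans (count-no {i} {a} {f} fs (ℕP.<⇒≢ (ℕP.≤-<-trans (ℕP.m≤m+n a _) lt))) (count-high i fs (ℕP.≤-<-trans (ℕP.m≤n+m _ a) lt))

    count-0 : ∀ fs → AllIrr fs → count 0 fs ≡ 0
    count-0 [] [] = refl
    count-0 ((a , f) ∷ fs) (jf ∷ jfs) = P.trans (count-no {0} {a} {f} fs (irr-degree jf)) (count-0 fs jfs)

    opaque
      -- Only the degrees 0, …, n matter, since the degrees of the factors add up to n.
      hasType? : ∀ {n} (p : Vec K n) s → (∀ i → n < i → s i ≡ 0) → Dec (HasType p s)
      hasType? {n} p s s-high with factorize p
      ... | fs , ifs , ps with FinP.all? (λ (i : Fin (suc n)) → count (toℕ i) fs ℕ.≟ s (toℕ i))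
      ... | yes eq = yes (fs , ifs , ps , λ i → at i (i ℕ.<? suc n))
        where
        at : ∀ i → Dec (i < suc n) → count i fs ≡ s i
        at i (yes lt) = subst (λ j → count j fs ≡ s j) (FinP.toℕ-fromℕ< lt) (eq (fromℕ< lt))
        at i (no ge) = P.trans (count-high i fs (subst (_< i) (sym (degrees-prod ps)) (ℕP.≮⇒≥ ge))) (sym (s-high i (ℕP.≮⇒≥ ge)))
      ... | no ne = no λ { (gs , igs , pgs , eq) → ne (λ i → P.trans (count-↭ (toℕ i) (unique ifs igs ps pgs)) (eq (toℕ i))) }

-- Linear substitutions and the preservation of factorisations.

module Substitution where

  open Field
  open Series
  open Factor
  open import Data.Nat as ℕ using (ℕ; zero; suc; z≤n; s≤s)
  import Data.Nat.Properties as ℕP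
  open import Data.Vec using (Vec; []; _∷_)
  open import Data.List as List using (List; []; _∷_)
  open import Data.List.Relation.Unary.All using ([]; _∷_)
  open import Data.Product using (∃; _×_; _,_; proj₁)
  open import Relation.Binary.PropositionalEquality
  open import Algebra.Bundles using (CommutativeRing)
  open import Level using (Level)

  module SubstitutionIdentities {a ℓ : Level} (R : CommutativeRing a ℓ) where
    open CommutativeRing R using (Carrier; _≈_; _+_; _*_) renaming (refl to ≈-refl)
    open IntSolver R using (solve; _:=_; _:+_; _:*_)

    additive : ∀ x y p a h k → (x + y) * p + a * (h + k) ≈ x * p + a * h + (y * p + a * k)
    additive = solve 6 (λ x y p a h k → (x :+ y) :* p :+ a :* (h :+ k) := x :* p :+ a :* h :+ (y :* p :+ a :* k)) ≈-refl

    scaling : ∀ c x p a h → c * x * p + a * (c * h) ≈ c * (x * p + a * h)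
    scaling = solve 5 (λ c x p a h → c :* x :* p :+ a :* (c :* h) := c :* (x :* p :+ a :* h)) ≈-refl

    lifting : ∀ x b p a h → x * (b * p) + a * (b * h) ≈ b * (x * p + a * h)
    lifting = solve 5 (λ x b p a h → x :* (b :* p) :+ a :* (b :* h) := b :* (x :* p :+ a :* h)) ≈-refl

    product-left : ∀ x u h g → x * u * g + h * g ≈ (x * u + h) * g
    product-left = solve 4 (λ x u h g → x :* u :* g :+ h :* g := (x :* u :+ h) :* g) ≈-refl

    product-mid : ∀ x y p a k → x * y * p + a * (x * k) ≈ x * (y * p + a * k)
    product-mid = solve 5 (λ x y p a k → x :* y :* p :+ a :* (x :* k) := x :* (y :* p :+ a :* k)) ≈-refl

  module Substitutions (𝔽 : FinField) where
    open FinField 𝔽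
    open FieldFacts 𝔽
    open PowerSeries 𝔽
    open Factorization 𝔽
    module 𝕁 = SubstitutionIdentities series

    ι-⊗ : ∀ c d → ι (c ⊗ d) ≋ ι c · ι d
    ι-⊗ c d zero = refl
    ι-⊗ c d (suc i) = sym (trans (ι· c (ι d) (suc i)) (⊗-zeroʳ c))

    power : S → ℕ → S
    power B zero = 1ˢ
    power B (suc n) = B · power B n

    split-head : ∀ f → f ≋ ι (f 0) +ˢ Y · tl f
    split-head f zero = sym (trans (cong (f 0 ⊕_) (Y·-0 (tl f))) (⊕-identityʳ _))
    split-head f (suc i) = sym (trans (⊕-identityˡ _) (Y·-suc (tl f) i))

    const : ∀ f → Deg≤ 0 f → f ≋ ι (f 0)
    const f p zero = refl
    const f p (suc i) = p (suc i) (s≤s z≤n)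

    rearrange : ∀ x y z w → x · y · (z · w) ≋ x · z · (y · w)
    rearrange x y z w = 𝕊.trans (·-assoc x y (z · w)) (𝕊.trans (·-cong {x} {x} (λ _ → refl) (𝕀.*-left-comm y z w)) (𝕊.sym (·-assoc x z (y · w))))

    -- The homogeneous substitution Σ fᵢ xⁱ zᴺ⁻ⁱ at x = A, z = B.
    module Homogeneous (A B : S) where
      H : ℕ → S → S
      H zero f = ι (f 0)
      H (suc N) f = ι (f 0) · power B (suc N) +ˢ A · H N (tl f)

      H-cong : ∀ N {f g} → f ≋ g → H N f ≋ H N g
      H-cong zero {f} {g} e zero = e 0
      H-cong zero e (suc i) = refl
      H-cong (suc N) {f} {g} e i = cong₂ _⊕_ (·-cong {ι (f 0)} {ι (g 0)} {power B (suc N)} {power B (suc N)} (λ { zero → e 0 ; (suc _) → refl }) (λ _ → refl) i)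
        (·-cong {A} {A} {H N (tl f)} {H N (tl g)} (λ _ → refl) (H-cong N (λ j → e (suc j))) i)

      H-+ : ∀ N f g → H N (f +ˢ g) ≋ H N f +ˢ H N g
      H-+ zero f g zero = refl
      H-+ zero f g (suc i) = sym (⊕-identityʳ 𝟘)
      H-+ (suc N) f g = 𝕊.trans (λ i → cong₂ _⊕_ (·-cong {ι (f 0 ⊕ g 0)} {ι (f 0) +ˢ ι (g 0)} {power B (suc N)} {power B (suc N)} (λ { zero → refl ; (suc _) → sym (⊕-identityʳ 𝟘) }) (λ _ → refl) i)
          (·-cong {A} {A} {H N (tl f +ˢ tl g)} {H N (tl f) +ˢ H N (tl g)} (λ _ → refl) (H-+ N (tl f) (tl g)) i))
        (𝕁.additive (ι (f 0)) (ι (g 0)) (power B (suc N)) A (H N (tl f)) (H N (tl g)))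

      H-scale : ∀ N c f → H N (λ i → c ⊗ f i) ≋ ι c · H N f
      H-scale zero c f = ι-⊗ c (f 0)
      H-scale (suc N) c f = 𝕊.trans (λ i → cong₂ _⊕_ (·-cong {ι (c ⊗ f 0)} {ι c · ι (f 0)} {power B (suc N)} {power B (suc N)} (ι-⊗ c (f 0)) (λ _ → refl) i)
          (·-cong {A} {A} {H N (λ j → c ⊗ tl f j)} {ι c · H N (tl f)} (λ _ → refl) (H-scale N c (tl f)) i))
        (𝕁.scaling (ι c) (ι (f 0)) (power B (suc N)) A (H N (tl f)))

      H-0 : ∀ N f → f ≋ 0ˢ → H N f ≋ 0ˢ
      H-0 zero f z zero = z 0
      H-0 zero f z (suc i) = refl
      H-0 (suc N) f z i = trans (cong₂ _⊕_ (trans (ι· (f 0) (power B (suc N)) i) (trans (cong (_⊗ power B (suc N) i) (z 0)) (⊗-zeroˡ _)))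
        (trans (·-cong {A} {A} {H N (tl f)} {0ˢ} (λ _ → refl) (H-0 N (tl f) (λ j → z (suc j))) i) (trans (·-comm A 0ˢ i) (0· A i)))) (⊕-identityʳ 𝟘)

      H-lift : ∀ M f → Deg≤ M f → H (suc M) f ≋ B · H M f
      H-lift zero f p = 𝕊.trans (λ i → cong₂ _⊕_ (·-cong {ι (f 0)} {ι (f 0)} {B · 1ˢ} {B} (λ _ → refl) (𝕊.*-identityʳ B) i)
          (trans (·-cong {A} {A} {H zero (tl f)} {0ˢ} (λ _ → refl) (H-0 zero (tl f) (λ j → p (suc j) (s≤s z≤n))) i) (trans (·-comm A 0ˢ i) (0· A i))))
        (λ i → trans (⊕-identityʳ _) (·-comm (ι (f 0)) B i))
      H-lift (suc M) f p = 𝕊.trans (λ i → cong ((ι (f 0) · power B (suc (suc M))) i ⊕_) (·-cong {A} {A} {H (suc M) (tl f)} {B · H M (tl f)} (λ _ → refl) (H-lift M (tl f) (λ j q → p (suc j) (s≤s q))) i))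
        (𝕁.lifting (ι (f 0)) B (power B (suc M)) A (H M (tl f)))

      H-lifts : ∀ N M f → Deg≤ M f → H (N ℕ.+ M) f ≋ power B N · H M f
      H-lifts zero M f p = 𝕊.sym (1· (H M f))
      H-lifts (suc N) M f p = 𝕊.trans (H-lift (N ℕ.+ M) f (λ i q → p i (ℕP.≤-trans (s≤s (ℕP.m≤n+m M N)) q)))
        (𝕊.trans (·-cong {B} {B} (λ _ → refl) (H-lifts N M f p)) (𝕊.sym (·-assoc B (power B N) (H M f))))

      -- Homogenised degrees add under multiplication. In the recursion the constant term of `f`
      -- multiplies `g` taken in too large a degree; `H-lifts` accounts for the surplus by a power
      -- of `B`.
      H-mul : ∀ N M f g → Deg≤ N f → Deg≤ M g → H (N ℕ.+ M) (f · g) ≋ H N f · H M g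
      H-mul zero M f g p r = 𝕊.trans (H-cong M (λ i → trans (·-cong {f} {ι (f 0)} {g} {g} (const f p) (λ _ → refl) i) (ι· (f 0) g i))) (H-scale M (f 0) g)
      H-mul (suc N) M f g p r = 𝕊.trans (λ i → cong₂ _⊕_
          (·-cong {ι (f 0 ⊗ g 0)} {ι (f 0) · ι (g 0)} {P} {P} (ι-⊗ (f 0) (g 0)) (λ _ → refl) i)
          (·-cong {A} {A} {H (N ℕ.+ M) (tl (f · g))} {ι (f 0) · G +ˢ F · H M g} (λ _ → refl)
            (𝕊.trans (H-+ (N ℕ.+ M) (λ j → f 0 ⊗ tl g j) (tl f · g)) (λ j → cong₂ _⊕_ (H-scale (N ℕ.+ M) (f 0) (tl g) j) (H-mul N M (tl f) g (λ k q → p (suc k) (s≤s q)) r j))) i))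
        (𝕊.trans (𝕊.+-cong {ι (f 0) · ι (g 0) · P} {ι (f 0) · ι (g 0) · P} 𝕊.refl (𝕊.distribˡ A (ι (f 0) · G) (F · H M g)))
        (𝕊.trans (𝕊.sym (𝕊.+-assoc (ι (f 0) · ι (g 0) · P) (A · (ι (f 0) · G)) (A · (F · H M g))))
        (𝕊.trans (𝕊.+-cong {ι (f 0) · ι (g 0) · P +ˢ A · (ι (f 0) · G)} {ι (f 0) · Q · H M g} {A · (F · H M g)} {A · F · H M g}
            (𝕊.trans (𝕁.product-mid (ι (f 0)) (ι (g 0)) P A G) (𝕊.trans (·-cong {ι (f 0)} {ι (f 0)} (λ _ → refl) (H-lifts (suc N) M g r)) (𝕊.sym (·-assoc (ι (f 0)) Q (H M g)))))
            (𝕊.sym (·-assoc A F (H M g))))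
        (𝕁.product-left (ι (f 0)) Q (A · F) (H M g)))))
        where
        P Q G F : S
        P = power B (suc (N ℕ.+ M))
        Q = power B (suc N)
        G = H (N ℕ.+ M) (tl g)
        F = H N (tl f)

      module _ (A-deg : Deg≤ 1 A) (B-deg : Deg≤ 1 B) where
        power-deg : ∀ N → Deg≤ N (power B N)
        power-deg zero (suc i) _ = refl
        power-deg (suc N) i lt = ·-deg 1 N B (power B N) B-deg (power-deg N) i lt

        H-deg : ∀ N f → Deg≤ N (H N f)
        H-deg zero f (suc i) _ = refl
        H-deg (suc N) f i lt = trans (cong₂ _⊕_ (trans (ι· (f 0) (power B (suc N)) i) (trans (cong (f 0 ⊗_) (power-deg (suc N) i lt)) (⊗-zeroʳ _)))
          (·-deg 1 N A (H N (tl f)) A-deg (H-deg N (tl f)) i lt)) (⊕-identityʳ 𝟘)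

        record Image {d} (v w : Vec K d) : Set where
          constructor img
          field
            factor : K
            factor≢𝟘 : factor ≢ 𝟘
            image≡ : H d (mseq v) ≋ ι factor · mseq w

        -- The image keeps degree `d` and so is a multiple of a monic polynomial of that degree;
        -- otherwise the substitution has moved a root to infinity.
        Good : ∀ {d} → Vec K d → Set
        Good {d} v = H d (mseq v) d ≢ 𝟘

        image : ∀ {d} (v : Vec K d) → Good v → ∃ λ w → Image v w
        image {d} v t with normalise d (H d (mseq v)) (H-deg d (mseq v)) t
        ... | κ , κ≢𝟘 , w , e = w , img κ κ≢𝟘 e

        image-good : ∀ {d} (v w : Vec K d) → Image v w → Good v
        image-good {d} v w (img κ κ≢𝟘 e) z = κ≢𝟘 (trans (sym (trans (ι· κ (mseq w) d) (trans (cong (κ ⊗_) (mseq-top w)) (⊗-identityʳ κ)))) (trans (sym (e d)) z))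

        good-factor : ∀ {a b d} {g : Vec K a} {h : Vec K b} {f : Vec K d} → Mul g h f → Good f → Good g × Good h
        good-factor {a} {b} {g = g} {h} {f} (mul refl e) t =
          (λ z → t (trans top (trans (cong (_⊗ H b (mseq h) b) z) (⊗-zeroˡ _)))) , (λ z → t (trans top (trans (cong (H a (mseq g) a ⊗_) z) (⊗-zeroʳ _))))
          where
          top : H (a ℕ.+ b) (mseq f) (a ℕ.+ b) ≡ H a (mseq g) a ⊗ H b (mseq h) b
          top = trans (sym (H-cong (a ℕ.+ b) e (a ℕ.+ b))) (trans (H-mul a b (mseq g) (mseq h) (mseq-deg g) (mseq-deg h) (a ℕ.+ b))
            (·-top a b (H a (mseq g)) (H b (mseq h)) (H-deg a (mseq g)) (H-deg b (mseq h))))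

        image-mul : ∀ {a b d} {g g′ : Vec K a} {h h′ : Vec K b} {f f′ : Vec K d} → Image g g′ → Image h h′ → Image f f′ → Mul g h f → Mul g′ h′ f′
        image-mul {a} {b} {g = g} {g′} {h} {h′} {f} {f′} (img κ κ≢𝟘 e) (img l l≢𝟘 e′) (img m m≢𝟘 e″) (mul refl p) with inverse m m≢𝟘
        ... | m⁻¹ , mm = degree-unique g′ h′ f′ (m⁻¹ ⊗ (κ ⊗ l)) (⊗-≢0 (λ { refl → 𝟙≢𝟘 (trans (sym mm) (⊗-zeroʳ m)) }) (⊗-≢0 κ≢𝟘 l≢𝟘)) λ i → begin
            (mseq g′ · (ι (m⁻¹ ⊗ (κ ⊗ l)) · mseq h′)) i
              ≡⟨ 𝕀.*-left-comm (mseq g′) (ι (m⁻¹ ⊗ (κ ⊗ l))) (mseq h′) i ⟩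
            (ι (m⁻¹ ⊗ (κ ⊗ l)) · (mseq g′ · mseq h′)) i
              ≡⟨ ι· (m⁻¹ ⊗ (κ ⊗ l)) (mseq g′ · mseq h′) i ⟩
            m⁻¹ ⊗ (κ ⊗ l) ⊗ (mseq g′ · mseq h′) i
              ≡⟨ trans (⊗-assoc m⁻¹ (κ ⊗ l) _) (cong (m⁻¹ ⊗_) (sym (both i))) ⟩
            m⁻¹ ⊗ (m ⊗ mseq f′ i)
              ≡⟨ trans (sym (⊗-assoc m⁻¹ m _)) (trans (cong (_⊗ mseq f′ i) (trans (⊗-comm m⁻¹ m) mm)) (⊗-identityˡ _)) ⟩
            mseq f′ i ∎
          where
          open ≡-Reasoning
          both : ∀ i → m ⊗ mseq f′ i ≡ κ ⊗ l ⊗ (mseq g′ · mseq h′) i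
          both i = begin
            m ⊗ mseq f′ i ≡⟨ trans (sym (ι· m (mseq f′) i)) (sym (e″ i)) ⟩
            H (a ℕ.+ b) (mseq f) i ≡⟨ sym (H-cong (a ℕ.+ b) p i) ⟩
            H (a ℕ.+ b) (mseq g · mseq h) i ≡⟨ H-mul a b (mseq g) (mseq h) (mseq-deg g) (mseq-deg h) i ⟩
            (H a (mseq g) · H b (mseq h)) i ≡⟨ ·-cong {H a (mseq g)} {ι κ · mseq g′} {H b (mseq h)} {ι l · mseq h′} e e′ i ⟩
            (ι κ · mseq g′ · (ι l · mseq h′)) i ≡⟨ rearrange (ι κ) (mseq g′) (ι l) (mseq h′) i ⟩
            (ι κ · ι l · (mseq g′ · mseq h′)) i ≡⟨ ·-cong {ι κ · ι l} {ι (κ ⊗ l)} {mseq g′ · mseq h′} {mseq g′ · mseq h′} (𝕊.sym (ι-⊗ κ l)) (λ _ → refl) i ⟩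
            (ι (κ ⊗ l) · (mseq g′ · mseq h′)) i ≡⟨ ι· (κ ⊗ l) (mseq g′ · mseq h′) i ⟩
            κ ⊗ l ⊗ (mseq g′ · mseq h′) i ∎

    -- An invertible 2 by 2 matrix: the two variables are replaced by the linear polynomials `A` and
    -- `B`, and the pair `A′`, `B′` undoes this up to the scalar `c`, hence up to `c^N` in degree
    -- `N`.
    record LinearSubstitution : Set where
      field
        A B A′ B′ : S
        c : K
      module H = Homogeneous A B
      module H′ = Homogeneous A′ B′
      field
        A-deg : Deg≤ 1 A
        B-deg : Deg≤ 1 B
        A′-deg : Deg≤ 1 A′
        B′-deg : Deg≤ 1 B′
        c≢𝟘 : c ≢ 𝟘
        H′-A : H′.H 1 A ≋ ι c · Y
        H′-B : H′.H 1 B ≋ ι c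

      cpow : ℕ → K
      cpow zero = 𝟙
      cpow (suc n) = c ⊗ cpow n

      cpow≢𝟘 : ∀ n → cpow n ≢ 𝟘
      cpow≢𝟘 zero = 𝟙≢𝟘
      cpow≢𝟘 (suc n) = ⊗-≢0 c≢𝟘 (cpow≢𝟘 n)

      H′-power : ∀ N → H′.H N (power B N) ≋ ι (cpow N)
      H′-power zero zero = refl
      H′-power zero (suc i) = refl
      H′-power (suc N) = 𝕊.trans (H′.H-mul 1 N B (power B N) B-deg (H.power-deg A-deg B-deg N))
        (𝕊.trans (·-cong H′-B (H′-power N)) (𝕊.sym (ι-⊗ c (cpow N))))

      inverts : ∀ N f → Deg≤ N f → H′.H N (H.H N f) ≋ ι (cpow N) · f
      inverts zero f p = 𝕊.trans (λ { zero → refl ; (suc i) → sym (p (suc i) (s≤s z≤n)) }) (𝕊.sym (1· f))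
      inverts (suc N) f p = 𝕊.trans (H′.H-+ (suc N) (ι (f 0) · power B (suc N)) (A · H.H N (tl f)))
        (𝕊.trans (𝕊.+-cong
            (𝕊.trans (H′.H-cong (suc N) (ι· (f 0) (power B (suc N)))) (𝕊.trans (H′.H-scale (suc N) (f 0) (power B (suc N)))
              (·-cong {ι (f 0)} {ι (f 0)} (λ _ → refl) (H′-power (suc N)))))
            (𝕊.trans (H′.H-mul 1 N A (H.H N (tl f)) A-deg (H.H-deg A-deg B-deg N (tl f)))
              (·-cong H′-A (inverts N (tl f) (λ i q → p (suc i) (s≤s q))))))
        (𝕊.trans (𝕊.+-cong {x = ι (f 0) · ι (c ⊗ cpow N)} {u = ι c · Y · (ι (cpow N) · tl f)} (𝕊.*-comm (ι (f 0)) (ι (c ⊗ cpow N)))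
            (𝕊.trans (rearrange (ι c) Y (ι (cpow N)) (tl f)) (·-cong {g = Y · tl f} {Y · tl f} (𝕊.sym (ι-⊗ c (cpow N))) (λ _ → refl))))
        (𝕊.trans (𝕊.sym (𝕊.distribˡ (ι (c ⊗ cpow N)) (ι (f 0)) (Y · tl f)))
          (·-cong {ι (c ⊗ cpow N)} {ι (c ⊗ cpow N)} (λ _ → refl) (𝕊.sym (split-head f))))))

      Image : ∀ {d} → Vec K d → Vec K d → Set
      Image = H.Image A-deg B-deg

      Image′ : ∀ {d} → Vec K d → Vec K d → Set
      Image′ = H′.Image A′-deg B′-deg

      image-inverse : ∀ {d} {v w : Vec K d} → Image v w → Image′ w v
      image-inverse {d} {v} {w} (H.img κ κ≢𝟘 e) with inverse κ κ≢𝟘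
      ... | κ⁻¹ , κκ = H′.img (κ⁻¹ ⊗ cpow d) (⊗-≢0 (λ { refl → 𝟙≢𝟘 (trans (sym κκ) (⊗-zeroʳ κ)) }) (cpow≢𝟘 d)) λ i → begin
          H′.H d (mseq w) i
            ≡⟨ sym (trans (sym (⊗-assoc κ⁻¹ κ _)) (trans (cong (_⊗ H′.H d (mseq w) i) (trans (⊗-comm κ⁻¹ κ) κκ)) (⊗-identityˡ _))) ⟩
          κ⁻¹ ⊗ (κ ⊗ H′.H d (mseq w) i)
            ≡⟨ cong (κ⁻¹ ⊗_) (sym (trans (H′.H-cong d (ι· κ (mseq w)) i) (trans (H′.H-scale d κ (mseq w) i) (ι· κ (H′.H d (mseq w)) i)))) ⟩
          κ⁻¹ ⊗ H′.H d (ι κ · mseq w) i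
            ≡⟨ cong (κ⁻¹ ⊗_) (trans (sym (H′.H-cong d e i)) (trans (inverts d (mseq v) (mseq-deg v) i) (ι· (cpow d) (mseq v) i))) ⟩
          κ⁻¹ ⊗ (cpow d ⊗ mseq v i)
            ≡⟨ trans (sym (⊗-assoc κ⁻¹ (cpow d) _)) (sym (ι· (κ⁻¹ ⊗ cpow d) (mseq v) i)) ⟩
          (ι (κ⁻¹ ⊗ cpow d) · mseq v) i ∎
        where open ≡-Reasoning

      -- A factorisation of the image is pulled back by the inverse substitution. The degrees
      -- survive, since by `good-factor` the factors of a good polynomial are good.
      irr-image : ∀ {d} {v w : Vec K d} → Image v w → Irr v → Irr w
      irr-image {d} {v} {w} im (1≤d , irr) = 1≤d , λ a b g h 1≤a 1≤b m →
        let im′ = image-inverse im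
            gg , gh = H′.good-factor A′-deg B′-deg m (H′.image-good A′-deg B′-deg w v im′)
            g′ , ig = H′.image A′-deg B′-deg g gg
            h′ , ih = H′.image A′-deg B′-deg h gh
        in irr a b g′ h′ 1≤a 1≤b (H′.image-mul A′-deg B′-deg ig ih im′ m)

      prod-image : ∀ {n fs} {p q : Vec K n} → AllIrr fs → Prod fs p → Image p q → ∃ λ gs → AllIrr gs × Prod gs q × List.map proj₁ fs ≡ List.map proj₁ gs
      prod-image {q = []} [] nil im = [] , [] , nil , refl
      prod-image (jf ∷ jfs) (cons {f = f} {Q} m ps) im =
        let gf , gQ = H.good-factor A-deg B-deg m (H.image-good A-deg B-deg _ _ im)
            f′ , imf = H.image A-deg B-deg f gf
            Q′ , imQ = H.image A-deg B-deg Q gQ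
            gs , igs , pgs , e = prod-image jfs ps imQ
        in (_ , f′) ∷ gs , irr-image imf jf ∷ igs , cons (H.image-mul A-deg B-deg imf imQ im m) pgs , cong (_ ∷_) e

      hasType-image : ∀ {n} {p q : Vec K n} {s} → Image p q → HasType p s → HasType q s
      hasType-image im (fs , ifs , ps , cnt) =
        let gs , igs , pgs , e = prod-image ifs ps im
        in gs , igs , pgs , λ i → trans (cong (λ ds → List.length (List.filter (ℕ._≟ i) ds)) (sym e)) (cnt i)

-- Invariance of the splitting type under translation, dilation, reversal and scaling.

module SplitTypes where

  open Rat using (ℚ; 0ℚ; 1ℚ; ⟦_⟧; ⟦⟧-⇔; ⟦⟧-no)
  open Field
  open Series
  open Factor
  open Substitution
  open Shift
  open Bounds
  open import Data.Nat as ℕ using (ℕ; zero; suc; _<_; s≤s; _∸_)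
  import Data.Nat.Properties as ℕP
  open import Data.Fin using (Fin; zero; suc; toℕ; fromℕ; fromℕ<; opposite)
  import Data.Fin.Properties as FinP
  open import Data.Vec using (Vec; []; _∷_; _∷ʳ_; head; lookup; reverse)
  import Data.Vec.Properties as VecP
  open import Data.Product using (_,_; proj₁; proj₂)
  open import Data.Sum using (_⊎_; inj₁; inj₂)
  open import Relation.Nullary using (yes; no; Dec)
  open import Relation.Binary.PropositionalEquality

  module Coefficients (𝔽 : FinField) where
    open FinField 𝔽
    open FieldFacts 𝔽
    open Space 𝔽
    open PowerSeries 𝔽
    open Substitutions 𝔽
    open Shifts 𝔽 using (sh; sh⁺; tor; pow; lookup-⊡; lookup-reverse′)
    open IntSolver commutativeRing using (solve; _:=_; _:+_)

    vseq-toℕ : ∀ {k} (v : Vec K k) i → vseq v (toℕ i) ≡ lookup v i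
    vseq-toℕ (x ∷ v) zero = refl
    vseq-toℕ (x ∷ v) (suc i) = vseq-toℕ v i

    vseq-⊞ : ∀ {k} (u v : Vec K k) → vseq (u ⊞ v) ≋ vseq u +ˢ vseq v
    vseq-⊞ [] [] i = sym (⊕-identityʳ 𝟘)
    vseq-⊞ (x ∷ u) (y ∷ v) zero = refl
    vseq-⊞ (x ∷ u) (y ∷ v) (suc i) = vseq-⊞ u v i

    vseq-⊡ : ∀ {k} c (v : Vec K k) i → vseq (c ⊡ v) i ≡ c ⊗ vseq v i
    vseq-⊡ c [] i = sym (⊗-zeroʳ c)
    vseq-⊡ c (x ∷ v) zero = refl
    vseq-⊡ c (x ∷ v) (suc i) = vseq-⊡ c v i

    vseq-∷ : ∀ {k} x (v : Vec K k) → vseq (x ∷ v) ≋ ι x +ˢ Y · vseq v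
    vseq-∷ x v zero = sym (trans (cong (x ⊕_) (Y·-0 (vseq v))) (⊕-identityʳ x))
    vseq-∷ x v (suc i) = sym (trans (⊕-identityˡ _) (Y·-suc (vseq v) i))

    vseq-∷ʳ : ∀ {k} (v : Vec K k) x → vseq (v ∷ʳ x) ≋ vseq v +ˢ ι x · power Y k
    vseq-∷ʳ [] x zero = sym (trans (⊕-identityˡ _) (⊗-identityʳ x))
    vseq-∷ʳ [] x (suc i) = sym (trans (⊕-identityˡ _) (trans (ι· x 1ˢ (suc i)) (⊗-zeroʳ x)))
    vseq-∷ʳ {suc k} (y ∷ v) x zero = sym (trans (cong (y ⊕_) (trans (cong (x ⊗_) (Y·-0 (power Y k))) (⊗-zeroʳ x))) (⊕-identityʳ y))
    vseq-∷ʳ {suc k} (y ∷ v) x (suc i) = trans (vseq-∷ʳ v x i) (cong (vseq v i ⊕_)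
      (trans (ι· x (power Y k) i) (trans (cong (x ⊗_) (sym (Y·-suc (power Y k) i))) (sym (ι· x (power Y (suc k)) (suc i))))))

    vseq-∷ʳ𝟘 : ∀ {k} (v : Vec K k) → vseq (v ∷ʳ 𝟘) ≋ vseq v
    vseq-∷ʳ𝟘 {k} v i = trans (vseq-∷ʳ v 𝟘 i) (trans (cong (vseq v i ⊕_) (trans (ι· 𝟘 (power Y k) i) (⊗-zeroˡ _))) (⊕-identityʳ _))

    vseq-∷ʳ𝟙 : ∀ {k} (v : Vec K k) → vseq (v ∷ʳ 𝟙) ≋ mseq v
    vseq-∷ʳ𝟙 [] zero = refl
    vseq-∷ʳ𝟙 [] (suc i) = refl
    vseq-∷ʳ𝟙 (x ∷ v) zero = refl
    vseq-∷ʳ𝟙 (x ∷ v) (suc i) = vseq-∷ʳ𝟙 v i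

    vseq-∷ʳ-top : ∀ {k} (v : Vec K k) x → vseq (v ∷ʳ x) k ≡ x
    vseq-∷ʳ-top [] x = refl
    vseq-∷ʳ-top (y ∷ v) x = vseq-∷ʳ-top v x

    vseq-top : ∀ {n} (F : Vec K (suc n)) → vseq (reverse F) n ≡ head F
    vseq-top (x ∷ xs) = trans (cong (λ v → vseq v _) (VecP.reverse-∷ x xs)) (vseq-∷ʳ-top (reverse xs) x)

    ≋-toℕ : ∀ {n f g} → Deg≤ n f → Deg≤ n g → (∀ (i : Fin (suc n)) → f (toℕ i) ≡ g (toℕ i)) → f ≋ g
    ≋-toℕ {n} {f} {g} p r e i with i ℕ.<? suc n
    ... | yes lt = subst (λ j → f j ≡ g j) (FinP.toℕ-fromℕ< lt) (e (fromℕ< lt))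
    ... | no ge = trans (p i (ℕP.≮⇒≥ ge)) (sym (r i (ℕP.≮⇒≥ ge)))

    H-1 : ∀ A B f → Homogeneous.H A B 1 f ≋ (λ i → f 0 ⊗ B i ⊕ f 1 ⊗ A i)
    H-1 A B f i = cong₂ _⊕_ (trans (ι· (f 0) (B · 1ˢ) i) (cong (f 0 ⊗_) (𝕊.*-identityʳ B i))) (trans (·-comm A (ι (f 1)) i) (ι· (f 1) A i))

    ι-deg : ∀ c → Deg≤ 1 (ι c)
    ι-deg c (suc i) _ = refl

    Y-deg : Deg≤ 1 Y
    Y-deg (suc (suc i)) _ = refl
    Y-deg (suc zero) (s≤s ())

    linear-deg : ∀ a → Deg≤ 1 (ι a +ˢ Y)
    linear-deg a (suc zero) (s≤s ())
    linear-deg a (suc (suc i)) _ = ⊕-identityʳ 𝟘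

    translation : K → LinearSubstitution
    translation a = record
      { A = ι a +ˢ Y ; B = 1ˢ ; A′ = ι (⊖ a) +ˢ Y ; B′ = 1ˢ ; c = 𝟙
      ; A-deg = linear-deg a ; B-deg = ι-deg 𝟙 ; A′-deg = linear-deg (⊖ a) ; B′-deg = ι-deg 𝟙 ; c≢𝟘 = 𝟙≢𝟘
      ; H′-A = 𝕊.trans (H-1 (ι (⊖ a) +ˢ Y) 1ˢ (ι a +ˢ Y)) (𝕊.trans A-eq (𝕊.sym (1· Y)))
      ; H′-B = 𝕊.trans (H-1 (ι (⊖ a) +ˢ Y) 1ˢ 1ˢ) (λ i → trans (cong₂ _⊕_ (⊗-identityˡ _) (⊗-zeroˡ _)) (⊕-identityʳ _)) }
      where
      A-eq : (λ i → (a ⊕ 𝟘) ⊗ 1ˢ i ⊕ (𝟘 ⊕ 𝟙) ⊗ (ι (⊖ a) i ⊕ Y i)) ≋ Y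
      A-eq i = trans (cong₂ _⊕_ (cong (_⊗ 1ˢ i) (⊕-identityʳ a)) (trans (cong (_⊗ (ι (⊖ a) i ⊕ Y i)) (⊕-identityˡ 𝟙)) (⊗-identityˡ _))) (cases i)
        where
        cases : ∀ i → a ⊗ 1ˢ i ⊕ (ι (⊖ a) i ⊕ Y i) ≡ Y i
        cases zero = trans (cong₂ _⊕_ (⊗-identityʳ a) (⊕-identityʳ _)) (⊖-inverseʳ a)
        cases (suc i) = trans (cong₂ _⊕_ (⊗-zeroʳ a) (⊕-identityˡ _)) (⊕-identityˡ _)

    dilation : ∀ l l⁻¹ → l ⊗ l⁻¹ ≡ 𝟙 → LinearSubstitution
    dilation l l⁻¹ ll = record
      { A = Y ; B = ι l ; A′ = Y ; B′ = ι l⁻¹ ; c = 𝟙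
      ; A-deg = Y-deg ; B-deg = ι-deg l ; A′-deg = Y-deg ; B′-deg = ι-deg l⁻¹ ; c≢𝟘 = 𝟙≢𝟘
      ; H′-A = 𝕊.trans (H-1 Y (ι l⁻¹) Y) (𝕊.trans (λ i → trans (cong₂ _⊕_ (⊗-zeroˡ _) (⊗-identityˡ _)) (⊕-identityˡ _)) (𝕊.sym (1· Y)))
      ; H′-B = 𝕊.trans (H-1 Y (ι l⁻¹) (ι l)) (λ { zero → trans (cong₂ _⊕_ ll (⊗-zeroˡ _)) (⊕-identityʳ _) ; (suc i) → trans (cong₂ _⊕_ (⊗-zeroʳ l) (⊗-zeroˡ _)) (⊕-identityʳ _) }) }

    reversal : LinearSubstitution
    reversal = record
      { A = 1ˢ ; B = Y ; A′ = 1ˢ ; B′ = Y ; c = 𝟙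
      ; A-deg = ι-deg 𝟙 ; B-deg = Y-deg ; A′-deg = ι-deg 𝟙 ; B′-deg = Y-deg ; c≢𝟘 = 𝟙≢𝟘
      ; H′-A = 𝕊.trans (H-1 1ˢ Y 1ˢ) (𝕊.trans (λ i → trans (cong₂ _⊕_ (⊗-identityˡ _) (⊗-zeroˡ _)) (⊕-identityʳ _)) (𝕊.sym (1· Y)))
      ; H′-B = 𝕊.trans (H-1 1ˢ Y Y) (λ i → trans (cong₂ _⊕_ (⊗-zeroˡ _) (⊗-identityˡ _)) (⊕-identityˡ _)) }

    module Tr a = Homogeneous (ι a +ˢ Y) 1ˢ
    module Dil l = Homogeneous Y (ι l)
    module Rev = Homogeneous 1ˢ Y

    power-1 : ∀ N → power 1ˢ N ≋ 1ˢ
    power-1 zero i = refl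
    power-1 (suc N) i = trans (1· (power 1ˢ N) i) (power-1 N i)

    translation-sh : ∀ a {n} (v : Vec K (suc n)) → vseq (sh a v) ≋ Tr.H a n (vseq v)
    translation-sh a (x ∷ []) zero = trans (cong (x ⊕_) (⊗-zeroʳ a)) (⊕-identityʳ x)
    translation-sh a (x ∷ []) (suc i) = refl
    translation-sh a {suc n} (x ∷ v@(_ ∷ _)) i = begin
        vseq ((x ∷ w) ⊞ a ⊡ (w ∷ʳ 𝟘)) i
          ≡⟨ vseq-⊞ (x ∷ w) (a ⊡ (w ∷ʳ 𝟘)) i ⟩
        vseq (x ∷ w) i ⊕ vseq (a ⊡ (w ∷ʳ 𝟘)) i
          ≡⟨ cong₂ _⊕_ (vseq-∷ x w i) (trans (vseq-⊡ a (w ∷ʳ 𝟘) i) (cong (a ⊗_) (vseq-∷ʳ𝟘 w i))) ⟩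
        ι x i ⊕ (Y · vseq w) i ⊕ a ⊗ vseq w i
          ≡⟨ solve 3 (λ x y z → x :+ y :+ z := x :+ (z :+ y)) refl (ι x i) ((Y · vseq w) i) (a ⊗ vseq w i) ⟩
        ι x i ⊕ (a ⊗ vseq w i ⊕ (Y · vseq w) i)
          ≡⟨ cong₂ _⊕_ (sym (trans (ι· x (power 1ˢ (suc n)) i) (trans (cong (x ⊗_) (power-1 (suc n) i)) (trans (sym (ι· x 1ˢ i)) (𝕊.*-identityʳ (ι x) i)))))
               (trans (cong (_⊕ (Y · vseq w) i) (sym (ι· a (vseq w) i))) (sym (·-distribʳ (vseq w) (ι a) Y i))) ⟩
        (ι x · power 1ˢ (suc n)) i ⊕ ((ι a +ˢ Y) · vseq w) i
          ≡⟨ cong ((ι x · power 1ˢ (suc n)) i ⊕_) (·-cong {ι a +ˢ Y} {ι a +ˢ Y} {vseq w} {Tr.H a n (vseq v)} (λ _ → refl) (translation-sh a v) i) ⟩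
        Tr.H a (suc n) (vseq (x ∷ v)) i ∎
      where
      open ≡-Reasoning
      w : Vec K (suc n)
      w = sh a v

    translation-sh⁺ : ∀ a {n} (F : Vec K (suc n)) → vseq (reverse (sh⁺ a F)) ≋ Tr.H a n (vseq (reverse F))
    translation-sh⁺ a F i = trans (cong (λ v → vseq v i) (VecP.reverse-involutive (sh a (reverse F)))) (translation-sh a (reverse F) i)

    power-ι : ∀ l N → power (ι l) N ≋ ι (pow l N)
    power-ι l zero i = refl
    power-ι l (suc N) i = trans (·-cong {ι l} {ι l} (λ _ → refl) (power-ι l N) i) (sym (ι-⊗ l (pow l N) i))

    lookup-tor : ∀ l {k} (v : Vec K k) i → lookup (tor l v) i ≡ pow l (toℕ i) ⊗ lookup v i
    lookup-tor l (x ∷ v) zero = sym (⊗-identityˡ x)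
    lookup-tor l (x ∷ v) (suc i) = trans (lookup-⊡ l (tor l v) i) (trans (cong (l ⊗_) (lookup-tor l v i)) (sym (⊗-assoc l _ _)))

    dilation-coeff : ∀ l {n} (v : Vec K (suc n)) i → Dil.H l n (vseq v) (toℕ i) ≡ pow l (n ∸ toℕ i) ⊗ lookup v i
    dilation-coeff l (x ∷ []) zero = sym (⊗-identityˡ x)
    dilation-coeff l {suc n} (x ∷ v@(_ ∷ _)) zero = trans (cong₂ _⊕_ (cong (x ⊗_) (power-ι l (suc n) 0)) (Y·-0 (Dil.H l n (vseq v)))) (trans (⊕-identityʳ _) (⊗-comm x _))
    dilation-coeff l {suc n} (x ∷ v@(_ ∷ _)) (suc i) = trans (cong₂ _⊕_
        (trans (ι· x (power (ι l) (suc n)) (suc (toℕ i))) (trans (cong (x ⊗_) (power-ι l (suc n) (suc (toℕ i)))) (⊗-zeroʳ x)))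
        (Y·-suc (Dil.H l n (vseq v)) (toℕ i)))
      (trans (⊕-identityˡ _) (dilation-coeff l v i))

    dilation-tor : ∀ l {n} (F : Vec K (suc n)) → vseq (reverse (tor l F)) ≋ Dil.H l n (vseq (reverse F))
    dilation-tor l {n} F = ≋-toℕ (vseq-deg (reverse (tor l F))) (Dil.H-deg l Y-deg (ι-deg l) n (vseq (reverse F))) λ i → begin
      vseq (reverse (tor l F)) (toℕ i) ≡⟨ trans (vseq-toℕ (reverse (tor l F)) i) (lookup-reverse′ (tor l F) i) ⟩
      lookup (tor l F) (opposite i) ≡⟨ lookup-tor l F (opposite i) ⟩
      pow l (toℕ (opposite i)) ⊗ lookup F (opposite i) ≡⟨ cong₂ (λ e x → pow l e ⊗ x) (FinP.opposite-prop i) (sym (lookup-reverse′ F i)) ⟩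
      pow l (n ∸ toℕ i) ⊗ lookup (reverse F) i ≡⟨ sym (dilation-coeff l (reverse F) i) ⟩
      Dil.H l n (vseq (reverse F)) (toℕ i) ∎
      where open ≡-Reasoning

    reversal-reverse : ∀ {n} (v : Vec K (suc n)) → vseq (reverse v) ≋ Rev.H n (vseq v)
    reversal-reverse (x ∷ []) zero = refl
    reversal-reverse (x ∷ []) (suc i) = refl
    reversal-reverse {suc n} (x ∷ v@(_ ∷ _)) i = trans (cong (λ w → vseq w i) (VecP.reverse-∷ x v)) (trans (vseq-∷ʳ (reverse v) x i)
      (trans (⊕-comm _ _) (cong ((ι x · power Y (suc n)) i ⊕_) (trans (reversal-reverse v i) (sym (1· (Rev.H n (vseq v)) i))))))

  module SplitType (𝔽 : FinField) (n : ℕ) (s : ℕ → ℕ) (s-high : ∀ i → n < i → s i ≡ 0) where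
    open FinField 𝔽
    open FieldFacts 𝔽
    open Space 𝔽
    open PowerSeries 𝔽
    open Factorization 𝔽
    open Substitutions 𝔽
    open Coefficients 𝔽
    open Shifts 𝔽 using (sh⁺; tor; lookup-reverse′)

    -- F lists the coefficients from the leading one downwards.
    record Split (F : Vec K (suc n)) : Set where
      constructor split
      field
        leading≢𝟘 : head F ≢ 𝟘
        monic : Vec K n
        monic≡ : vseq (reverse F) ≋ ι (head F) · mseq monic
        hasType : HasType monic s

    split? : ∀ F → Dec (Split F)
    split? F with head F ≟ 𝟘
    ... | yes z = no λ t → Split.leading≢𝟘 t z
    ... | no nz with inverse (head F) nz
    ... | d , e = decide (hasType? P s s-high)
      where
      f : S
      f i = d ⊗ vseq (reverse F) i
      P : Vec K n
      P = trunc n f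
      unit : d ⊗ head F ≡ 𝟙
      unit = trans (⊗-comm d _) e
      P≡ : mseq P ≋ f
      P≡ = mseq-trunc n f (λ i lt → trans (cong (d ⊗_) (vseq-deg (reverse F) i lt)) (⊗-zeroʳ d)) (trans (cong (d ⊗_) (vseq-top F)) unit)
      decide : Dec (HasType P s) → Dec (Split F)
      decide (yes t) = yes (split nz P (λ i → sym (trans (ι· (head F) (mseq P) i) (trans (cong (head F ⊗_) (P≡ i)) (trans (sym (⊗-assoc _ d _)) (trans (cong (_⊗ vseq (reverse F) i) e) (⊗-identityˡ _)))))) t)
      decide (no nt) = no λ { (split _ Q eq t) → nt (subst (λ R → HasType R s) (mseq-inj (λ i →
        trans (sym (⊗-identityˡ _)) (trans (cong (_⊗ mseq Q i) (sym unit)) (trans (⊗-assoc d (head F) _) (trans (cong (d ⊗_) (sym (trans (eq i) (ι· (head F) (mseq Q) i)))) (sym (P≡ i)))))) ) t) }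

    module _ (σ : LinearSubstitution) where
      open LinearSubstitution σ

      -- `head G` is `head F` times the coefficient of degree `n` in the image of the monic part;
      -- its being nonzero is what makes that part `Good`.
      split-substitute : ∀ F G → vseq (reverse G) ≋ H.H n (vseq (reverse F)) → head G ≢ 𝟘 → Split F → Split G
      split-substitute F G eq nz (split nzF P P≡ t) = split nz Q G≡ (hasType-image im t)
        where
        HF : ∀ i → vseq (reverse G) i ≡ head F ⊗ H.H n (mseq P) i
        HF i = trans (eq i) (trans (H.H-cong n (λ j → trans (P≡ j) (ι· (head F) (mseq P) j)) i) (trans (H.H-scale n (head F) (mseq P) i) (ι· (head F) (H.H n (mseq P)) i)))
        top : head G ≡ head F ⊗ H.H n (mseq P) n
        top = trans (sym (vseq-top G)) (HF n)
        good : H.Good A-deg B-deg P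
        good z = nz (trans top (trans (cong (head F ⊗_) z) (⊗-zeroʳ _)))
        Q : Vec K n
        Q = proj₁ (H.image A-deg B-deg P good)
        im : Image P Q
        im = proj₂ (H.image A-deg B-deg P good)
        κ : K
        κ = H.Image.factor im
        Q≡ : ∀ i → H.H n (mseq P) i ≡ κ ⊗ mseq Q i
        Q≡ i = trans (H.Image.image≡ im i) (ι· κ (mseq Q) i)
        headG : head G ≡ head F ⊗ κ
        headG = trans top (cong (head F ⊗_) (trans (Q≡ n) (trans (cong (κ ⊗_) (mseq-top Q)) (⊗-identityʳ κ))))
        G≡ : vseq (reverse G) ≋ ι (head G) · mseq Q
        G≡ i = trans (HF i) (trans (cong (head F ⊗_) (Q≡ i)) (trans (sym (⊗-assoc _ κ _)) (trans (cong (_⊗ mseq Q i) (sym headG)) (sym (ι· (head G) (mseq Q) i)))))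

    split-scale : ∀ c F → c ≢ 𝟘 → Split F → Split (c ⊡ F)
    split-scale c F@(x ∷ xs) nz (split nzF P P≡ t) = split (⊗-≢0 nz nzF) P eq t
      where
      eq : vseq (reverse (c ⊡ F)) ≋ ι (c ⊗ x) · mseq P
      eq i = trans (cong (λ v → vseq v i) (sym (VecP.map-reverse (c ⊗_) F))) (trans (vseq-⊡ c (reverse F) i)
        (trans (cong (c ⊗_) (trans (P≡ i) (ι· x (mseq P) i))) (trans (sym (⊗-assoc c x _)) (sym (ι· (c ⊗ x) (mseq P) i)))))

    T : Vec K (suc n) → ℚ
    T F = ⟦ split? F ⟧

    T-zero : ∀ xs → T (𝟘 ∷ xs) ≡ 0ℚ
    T-zero xs = ⟦⟧-no (split? (𝟘 ∷ xs)) (λ t → Split.leading≢𝟘 t refl)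

    T-monic : ∀ xs → T (𝟙 ∷ xs) ≡ ⟦ hasType? (reverse xs) s s-high ⟧
    T-monic xs = ⟦⟧-⇔ (split? (𝟙 ∷ xs)) (hasType? (reverse xs) s s-high)
      (λ { (split _ P P≡ t) → subst (λ R → HasType R s) (mseq-inj (λ i → trans (sym (1· (mseq P) i)) (trans (sym (P≡ i)) (reverse-monic i)))) t })
      (λ t → split 𝟙≢𝟘 (reverse xs) (λ i → trans (reverse-monic i) (sym (1· (mseq (reverse xs)) i))) t)
      where
      reverse-monic : vseq (reverse (𝟙 ∷ xs)) ≋ mseq (reverse xs)
      reverse-monic i = trans (cong (λ v → vseq v i) (VecP.reverse-∷ 𝟙 xs)) (vseq-∷ʳ𝟙 (reverse xs) i)

    T-tor : ∀ l F → l ≢ 𝟘 → T (tor l F) ≡ T F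
    T-tor l F@(x ∷ xs) nz with inverse l nz
    ... | l⁻¹ , ll = ⟦⟧-⇔ (split? (tor l F)) (split? F)
      (λ t → split-substitute (dilation l⁻¹ l ll′) (tor l F) F back (Split.leading≢𝟘 t) t)
      (λ t → split-substitute (dilation l l⁻¹ ll) F (tor l F) (dilation-tor l F) (Split.leading≢𝟘 t) t)
      where
      ll′ : l⁻¹ ⊗ l ≡ 𝟙
      ll′ = trans (⊗-comm l⁻¹ l) ll
      -- The inverse dilation is read off from `inverts`; its scalar is a power of 1.
      back : vseq (reverse F) ≋ Dil.H l⁻¹ n (vseq (reverse (tor l F)))
      back i = sym (trans (Dil.H-cong l⁻¹ n (dilation-tor l F) i) (trans (LinearSubstitution.inverts (dilation l l⁻¹ ll) n (vseq (reverse F)) (vseq-deg (reverse F)) i)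
        (trans (ι· _ (vseq (reverse F)) i) (trans (cong (_⊗ vseq (reverse F) i) (ones n)) (⊗-identityˡ _)))))
        where
        ones : ∀ n → LinearSubstitution.cpow (dilation l l⁻¹ ll) n ≡ 𝟙
        ones zero = refl
        ones (suc n) = trans (⊗-identityˡ _) (ones n)

    T-symmetric : Analysis.Symmetric 𝔽 n T
    T-symmetric = record
      { T01 = λ F → zero-or-one (split? F)
      ; T-scale = scale
      ; T-sh⁺ = λ a F → ⟦⟧-⇔ (split? (sh⁺ a F)) (split? F)
          (λ t → subst Split (Shifts.sh⁺-inv 𝔽 a (⊖ a) (⊖-inverseʳ a) F) (shift-by (⊖ a) (sh⁺ a F) t)) (shift-by a F)
      ; T-rev = λ F nz nz′ → ⟦⟧-⇔ (split? (reverse F)) (split? F)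
          (λ t → subst Split (VecP.reverse-involutive F) (rev (reverse F) (λ z → nz (trans (sym (trans (cong head (VecP.reverse-involutive F)) refl)) z)) t))
          (rev F (λ z → nz′ (trans (sym (head-reverse F)) z))) }
      where
      zero-or-one : ∀ {A : Set} (d : Dec A) → ⟦ d ⟧ ≡ 0ℚ ⊎ ⟦ d ⟧ ≡ 1ℚ
      zero-or-one (yes _) = inj₂ refl
      zero-or-one (no _) = inj₁ refl
      scale : ∀ c F → c ≢ 𝟘 → T (c ⊡ F) ≡ T F
      scale c F nz with inverse c nz
      ... | d , e = ⟦⟧-⇔ (split? (c ⊡ F)) (split? F)
        (λ t → subst Split (trans (⊡-⊗ d c F) (trans (cong (_⊡ F) (trans (⊗-comm d c) e)) (1⊡ F))) (split-scale d (c ⊡ F) (λ { refl → 𝟙≢𝟘 (trans (sym e) (⊗-zeroʳ c)) }) t))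
        (split-scale c F nz)
      head-sh⁺ : ∀ a F → head (sh⁺ a F) ≡ head F
      head-sh⁺ a F = trans (sym (vseq-top (sh⁺ a F))) (trans (translation-sh⁺ a F n) (trans (top n (vseq (reverse F))) (vseq-top F)))
        where
        top : ∀ N f → Tr.H a N f N ≡ f N
        top zero f = refl
        top (suc N) f = trans (cong₂ _⊕_
            (trans (ι· (f 0) (power 1ˢ (suc N)) (suc N)) (trans (cong (f 0 ⊗_) (power-1 (suc N) (suc N))) (⊗-zeroʳ _)))
            (trans (·-top 1 N (ι a +ˢ Y) (Tr.H a N (tl f)) (linear-deg a) (Tr.H-deg a (linear-deg a) (ι-deg 𝟙) N (tl f))) (trans (cong₂ _⊗_ (⊕-identityˡ 𝟙) (top N (tl f))) (⊗-identityˡ _))))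
          (⊕-identityˡ _)
      shift-by : ∀ a F → Split F → Split (sh⁺ a F)
      shift-by a F t = split-substitute (translation a) F (sh⁺ a F) (translation-sh⁺ a F) (λ z → Split.leading≢𝟘 t (trans (sym (head-sh⁺ a F)) z)) t
      rev : ∀ F → head (reverse F) ≢ 𝟘 → Split F → Split (reverse F)
      rev F nz t = split-substitute reversal F (reverse F) (reversal-reverse (reverse F)) nz t
      head-reverse : ∀ (F : Vec K (suc n)) → head (reverse F) ≡ lookup F (fromℕ n)
      head-reverse F = trans (sym (lookup-head (reverse F))) (lookup-reverse′ F zero)
        where
        lookup-head : ∀ (v : Vec K (suc n)) → lookup v zero ≡ head v
        lookup-head (x ∷ v) = refl

-- Densities of irreducible polynomials.

module Density where

  open Rat
  open Mean
  open Field
  open Averages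
  open Series
  open Factor
  open import Data.Nat as ℕ using (ℕ; zero; suc; z≤n; s≤s)
  import Data.Nat.Properties as ℕP
  open import Data.Fin using (Fin; toℕ; fromℕ<)
  import Data.Fin.Properties as FinP
  open import Data.Vec as Vec using (Vec; []; _∷_)
  import Data.Vec.Properties as VecP
  open import Data.List as List using (List; []; _∷_)
  open import Data.List.Relation.Unary.All using ([]; _∷_)
  open import Data.List.Relation.Unary.Any using (here; there; any?)
  open import Data.List.Membership.Propositional using (_∈_; _∉_)
  open import Data.List.Relation.Binary.Permutation.Propositional using (_↭_; refl; prep; swap; trans)
  open import Data.List.Relation.Binary.Permutation.Propositional.Properties using (All-resp-↭)
  open import Data.Product using (∃; _×_; _,_; proj₁; proj₂)
  import Data.Product.Properties as ProdP
  open import Relation.Nullary using (yes; no; Dec)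
  open import Relation.Nullary.Decidable using (map′)
  open import Relation.Nullary.Negation using (contradiction)
  open import Relation.Binary.Definitions using (DecidableEquality)
  open import Relation.Binary.PropositionalEquality hiding (trans)
  import Relation.Binary.PropositionalEquality as P
  open import Tactic.RingSolver using (solve-∀)
  open import Data.Rational.Properties using (module ≤-Reasoning)

  ⌜⌝-+ : ∀ a b → ⌜ a ℕ.+ b ⌝ ≡ ⌜ a ⌝ + ⌜ b ⌝
  ⌜⌝-+ zero b = sym (+-identityˡ _)
  ⌜⌝-+ (suc a) b = P.trans (cong (1ℚ +_) (⌜⌝-+ a b)) (sym (+-assoc 1ℚ _ _))

  ⌜⌝-* : ∀ a b → ⌜ a ℕ.* b ⌝ ≡ ⌜ a ⌝ * ⌜ b ⌝
  ⌜⌝-* zero b = sym (*-zeroˡ _)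
  ⌜⌝-* (suc a) b = P.trans (⌜⌝-+ b (a ℕ.* b)) (P.trans (cong (⌜ b ⌝ +_) (⌜⌝-* a b)) (lem ⌜ a ⌝ ⌜ b ⌝))
    where
    opaque
      unfolding _+_
      lem : ∀ a b → b + a * b ≡ (1ℚ + a) * b
      lem = solve-∀ ℚ-ring

  ∑-↭ : ∀ {X : Set} {xs ys : List X} (f : X → ℚ) → xs ↭ ys → ∑ xs f ≡ ∑ ys f
  ∑-↭ f refl = refl
  ∑-↭ f (prep x e) = cong (f x +_) (∑-↭ f e)
  ∑-↭ f (swap x y e) = P.trans (cong (λ z → f x + (f y + z)) (∑-↭ f e)) (lem (f x) (f y) _)
    where
    opaque
      unfolding _+_
      lem : ∀ a b c → a + (b + c) ≡ b + (a + c)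
      lem = solve-∀ ℚ-ring
  ∑-↭ f (trans e e′) = P.trans (∑-↭ f e) (∑-↭ f e′)

  ∑-mono : ∀ {X : Set} (xs : List X) {f g} → (∀ x → f x ≤ g x) → ∑ xs f ≤ ∑ xs g
  ∑-mono [] p = ≤-refl
  ∑-mono (x ∷ xs) p = +-mono-≤ (p x) (∑-mono xs p)

  E-∑ : ∀ {X Y : Set} (U : Uniform X) (ys : List Y) (f : Y → X → ℚ) → Uniform.E U (λ x → ∑ ys (λ y → f y x)) ≡ ∑ ys (λ y → Uniform.E U (f y))
  E-∑ U ys f = P.trans (cong (Uniform.ω U *_) (∑-swap (Uniform.points U) ys (λ x y → f y x))) (sym (∑-*ˡ ys (Uniform.ω U) _))

  wsum : ℕ → (ℕ → ℚ) → ℚ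
  wsum zero g = 0ℚ
  wsum (suc k) g = wsum k g + ⌜ suc k ⌝ * g (suc k)

  wsum-cong : ∀ k {f g} → (∀ i → f i ≡ g i) → wsum k f ≡ wsum k g
  wsum-cong zero e = refl
  wsum-cong (suc k) e = cong₂ (λ x y → x + ⌜ suc k ⌝ * y) (wsum-cong k e) (e (suc k))

  wsum-+ : ∀ k f g → wsum k (λ i → f i + g i) ≡ wsum k f + wsum k g
  wsum-+ zero f g = sym (+-identityˡ 0ℚ)
  wsum-+ (suc k) f g = P.trans (cong (_+ ⌜ suc k ⌝ * (f (suc k) + g (suc k))) (wsum-+ k f g)) (lem (wsum k f) (wsum k g) ⌜ suc k ⌝ (f (suc k)) (g (suc k)))
    where
    opaque
      unfolding _+_
      lem : ∀ a b c x y → a + b + c * (x + y) ≡ a + c * x + (b + c * y)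
      lem = solve-∀ ℚ-ring

  wsum-mono : ∀ k {f g} → (∀ i → 1 ℕ.≤ i → i ℕ.≤ k → f i ≤ g i) → wsum k f ≤ wsum k g
  wsum-mono zero p = ≤-refl
  wsum-mono (suc k) p = +-mono-≤ (wsum-mono k (λ i 1≤i le → p i 1≤i (ℕP.m≤n⇒m≤1+n le))) (*-monoˡ (0≤⌜⌝ (suc k)) (p (suc k) (s≤s z≤n) ℕP.≤-refl))

  wsum-const : ∀ k n c → k ℕ.≤ n → 0ℚ ≤ c → wsum k (λ _ → c) ≤ ⌜ k ⌝ * (⌜ n ⌝ * c)
  wsum-const zero n c le 0≤c = ≤-reflexive (sym (*-zeroˡ _))
  wsum-const (suc k) n c le 0≤c = ≤-trans (+-mono-≤ (wsum-const k n c (ℕP.<⇒≤ le) 0≤c) (*-monoʳ 0≤c (⌜⌝-mono le))) (≤-reflexive (lem ⌜ k ⌝ (⌜ n ⌝ * c)))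
    where
    opaque
      unfolding _+_
      lem : ∀ a b → a * b + b ≡ (1ℚ + a) * b
      lem = solve-∀ ℚ-ring

  E-wsum : ∀ {X : Set} (U : Uniform X) k (f : ℕ → X → ℚ) → Uniform.E U (λ x → wsum k (λ i → f i x)) ≡ wsum k (λ i → Uniform.E U (f i))
  E-wsum U zero f = Uniform.E-const U 0ℚ
  E-wsum U (suc k) f = P.trans (Uniform.E-+ U _ _) (cong₂ _+_ (E-wsum U k f) (Uniform.E-*ˡ U ⌜ suc k ⌝ (f (suc k))))

  wsum-below : ∀ k a → k ℕ.< a → wsum k (λ i → ⟦ a ℕ.≟ i ⟧) ≡ 0ℚ
  wsum-below zero a lt = refl
  wsum-below (suc k) a lt = P.trans (cong₂ _+_ (wsum-below k a (ℕP.<⇒≤ lt)) (P.trans (cong (⌜ suc k ⌝ *_) (⟦⟧-no (a ℕ.≟ suc k) (λ e → ℕP.<⇒≢ lt (sym e)))) (*-zeroʳ _))) (+-identityˡ 0ℚ)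

  wsum-indicator : ∀ k a → a ℕ.≤ k → wsum k (λ i → ⟦ a ℕ.≟ i ⟧) ≡ ⌜ a ⌝
  wsum-indicator zero .0 z≤n = refl
  wsum-indicator (suc k) a le with a ℕ.≟ suc k
  ... | yes refl = P.trans (cong₂ _+_ (wsum-below k (suc k) ℕP.≤-refl) (*-identityʳ _)) (+-identityˡ _)
  ... | no ne = P.trans (cong₂ _+_ (wsum-indicator k a (ℕP.≤-pred (ℕP.≤∧≢⇒< le ne))) (*-zeroʳ _)) (+-identityʳ _)

  -- At most `n` degrees, each of weight at most `n`, each with an error of `⌜ n ⌝ * ω` in the mean
  -- number of factors.
  cube : ℕ → ℚ
  cube n = ⌜ n ⌝ * (⌜ n ⌝ * ⌜ n ⌝)

  0≤cube : ∀ n → 0ℚ ≤ cube n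
  0≤cube n = 0≤* (0≤⌜⌝ n) (0≤* (0≤⌜⌝ n) (0≤⌜⌝ n))

  cube-mono : ∀ {a b} → a ℕ.≤ b → cube a ≤ cube b
  cube-mono {a} p = *-mono (0≤⌜⌝ a) (0≤* (0≤⌜⌝ a) (0≤⌜⌝ a)) (⌜⌝-mono p) (*-mono (0≤⌜⌝ a) (0≤⌜⌝ a) (⌜⌝-mono p) (⌜⌝-mono p))

  module Densities (𝔽 : FinField) where
    open FinField 𝔽
    open PowerSeries 𝔽
    open Factorization 𝔽
    open VecSpace uniform
    module 𝐊 = Uniform uniform
    open 𝐊 using (ω)
    module 𝐏 n = Uniform (vecU n)

    ω^-+ : ∀ a b → ω ^^ (a ℕ.+ b) ≡ ω ^^ a * ω ^^ b
    ω^-+ zero b = sym (*-identityˡ _)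
    ω^-+ (suc a) b = P.trans (cong (ω *_) (ω^-+ a b)) (sym (*-assoc ω _ _))

    0≤ω^ : ∀ a → 0ℚ ≤ ω ^^ a
    0≤ω^ a = 𝐏.0≤ω a

    ω^≤ω : ∀ a → 1 ℕ.≤ a → ω ^^ a ≤ ω
    ω^≤ω (suc a) _ = ≤-trans (*-monoˡ 𝐊.0≤ω (𝐏.ω≤1 a (Vec.replicate a 𝟘))) (≤-reflexive (*-identityʳ ω))

    opaque
      _∣?_ : ∀ {a n} (g : Vec K a) (p : Vec K n) → Dec (g ∣ p)
      _∣?_ {a} {n} g p = map′ (λ { (j , h , m) → toℕ j , h , m }) (λ { (b , h , m) → wit b h m })
        (FinP.any? {n = suc n} λ j → vec-any? λ h → mul? g h p)
        where
        wit : ∀ b (h : Vec K b) → Mul g h p → ∃ λ (j : Fin (suc n)) → ∃ λ (h : Vec K (toℕ j)) → Mul g h p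
        wit b h m with fromℕ< (s≤s b≤n) | FinP.toℕ-fromℕ< (s≤s b≤n)
          where
          b≤n : b ℕ.≤ n
          b≤n = subst (b ℕ.≤_) (degree≡ m) (ℕP.m≤n+m b a)
        ... | j | refl = j , h , m

    same-degree : ∀ {a b m} {g : Vec K a} {h : Vec K b} {p : Vec K (a ℕ.+ m)} → Mul g h p → b ≡ m
    same-degree {a} {b} {m} e = ℕP.+-cancelˡ-≡ a b m (degree≡ e)

    -- By cancellation, multiplication by `h` is a bijection from the monic polynomials of degree
    -- `m` to the multiples of `h`; point masses express it as an exchange of sums.
    divisible-mean : ∀ a m (h : Vec K a) φ → 𝐏.E (a ℕ.+ m) (λ P → ⟦ h ∣? P ⟧ * φ P) ≡ ω ^^ a * 𝐏.E m (λ Q → φ (h ⊙ Q))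
    divisible-mean a m h φ = begin
      𝐏.E n (λ P → ⟦ h ∣? P ⟧ * φ P) ≡⟨ 𝐏.E-cong n pt ⟩
      𝐏.E n (λ P → ∑ (vecs m) (λ Q → ⟦ 𝐏._≟_ n P (h ⊙ Q) ⟧ * φ P)) ≡⟨ E-∑ (vecU n) (vecs m) _ ⟩
      ∑ (vecs m) (λ Q → 𝐏.E n (λ P → ⟦ 𝐏._≟_ n P (h ⊙ Q) ⟧ * φ P)) ≡⟨ ∑-cong (vecs m) (λ Q → 𝐏.E-point n (h ⊙ Q) φ) ⟩
      ∑ (vecs m) (λ Q → ω ^^ n * φ (h ⊙ Q)) ≡⟨ ∑-*ˡ (vecs m) (ω ^^ n) _ ⟩
      ω ^^ n * ∑ (vecs m) (λ Q → φ (h ⊙ Q)) ≡⟨ cong (_* ∑ (vecs m) (λ Q → φ (h ⊙ Q))) (ω^-+ a m) ⟩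
      ω ^^ a * ω ^^ m * ∑ (vecs m) (λ Q → φ (h ⊙ Q)) ≡⟨ *-assoc (ω ^^ a) (ω ^^ m) _ ⟩
      ω ^^ a * 𝐏.E m (λ Q → φ (h ⊙ Q)) ∎
      where
      open ≡-Reasoning
      n = a ℕ.+ m
      pt : ∀ P → ⟦ h ∣? P ⟧ * φ P ≡ ∑ (vecs m) (λ Q → ⟦ 𝐏._≟_ n P (h ⊙ Q) ⟧ * φ P)
      pt P = go (h ∣? P)
        where
        go : (d : Dec (h ∣ P)) → ⟦ d ⟧ * φ P ≡ ∑ (vecs m) (λ Q → ⟦ 𝐏._≟_ n P (h ⊙ Q) ⟧ * φ P)
        go (no nd) = P.trans (*-zeroˡ _) (sym (P.trans (∑-cong (vecs m) (λ Q → P.trans (cong (_* φ P) (⟦⟧-no (𝐏._≟_ n P (h ⊙ Q)) (λ { refl → nd (m , Q , ⊙-mul h Q) }))) (*-zeroˡ _))) (∑-0 (vecs m))))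
        go (yes (b , Q₀ , e)) with same-degree e
        ... | refl = P.trans (*-identityˡ _) (sym (P.trans (∑-cong (vecs m) (λ Q → cong (_* φ P)
              (⟦⟧-⇔ (𝐏._≟_ n P (h ⊙ Q)) (𝐏._≟_ m Q Q₀) (λ { refl → mul-cancel (⊙-mul h Q) e }) (λ { refl → mul-unique e (⊙-mul h Q) }))))
            (𝐏.point m Q₀ (λ _ → φ P))))

    divisible-density : ∀ {a} n (h : Vec K a) → 𝐏.E n (λ P → ⟦ h ∣? P ⟧) ≤ ω ^^ a
    divisible-density {a} n h with a ℕ.≤? n
    ... | yes le with n ℕ.∸ a | ℕP.m+[n∸m]≡n le
    ... | m | refl = ≤-reflexive (P.trans (𝐏.E-cong (a ℕ.+ m) (λ P → sym (*-identityʳ _))) (P.trans (divisible-mean a m h (λ _ → 1ℚ)) (P.trans (cong (ω ^^ a *_) (𝐏.E-1 m)) (*-identityʳ _))))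
    divisible-density {a} n h | no nle = ≤-trans (≤-reflexive (P.trans (𝐏.E-cong n (λ P → ⟦⟧-no (h ∣? P) (λ { (b , _ , e) → nle (subst (a ℕ.≤_) (degree≡ e) (ℕP.m≤m+n a b)) }))) (𝐏.E-const n 0ℚ))) (0≤ω^ a)

    _≟P_ : DecidableEquality Poly
    _≟P_ = ProdP.≡-dec ℕ._≟_ (VecP.≡-dec _≟_)

    mult : ∀ {a} → Vec K a → List Poly → ℚ
    mult f fs = ∑ fs (λ g → ⟦ g ≟P (_ , f) ⟧)

    count-sum : ∀ i fs → ⌜ count i fs ⌝ ≡ ∑ fs (λ g → ⟦ proj₁ g ℕ.≟ i ⟧)
    count-sum i [] = refl
    count-sum i ((a , f) ∷ fs) = go (a ℕ.≟ i)
      where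
      go : (d : Dec (a ≡ i)) → ⌜ count i ((a , f) ∷ fs) ⌝ ≡ ∑ ((a , f) ∷ fs) (λ g → ⟦ proj₁ g ℕ.≟ i ⟧)
      go (yes e) = P.trans (cong ⌜_⌝ (count-yes {i} {a} {f} fs e)) (cong₂ _+_ (sym (⟦⟧-yes (a ℕ.≟ i) e)) (count-sum i fs))
      go (no ne) = P.trans (cong ⌜_⌝ (count-no {i} {a} {f} fs ne)) (P.trans (count-sum i fs) (P.trans (sym (+-identityˡ _)) (cong (_+ ∑ fs (λ g → ⟦ proj₁ g ℕ.≟ i ⟧)) (sym (⟦⟧-no (a ℕ.≟ i) ne)))))

    count-mult : ∀ i fs → ⌜ count i fs ⌝ ≡ ∑ (vecs i) (λ f → mult f fs)
    count-mult i fs = P.trans (count-sum i fs) (P.trans (∑-cong fs pt) (∑-swap fs (vecs i) _))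
      where
      pt : ∀ g → ⟦ proj₁ g ℕ.≟ i ⟧ ≡ ∑ (vecs i) (λ f → ⟦ g ≟P (i , f) ⟧)
      pt (b , g) = go (b ℕ.≟ i)
        where
        go : (d : Dec (b ≡ i)) → ⟦ d ⟧ ≡ ∑ (vecs i) (λ f → ⟦ (b , g) ≟P (i , f) ⟧)
        go (no ne) = sym (P.trans (∑-cong (vecs i) (λ f → ⟦⟧-no ((b , g) ≟P (i , f)) (λ e → ne (cong proj₁ e)))) (∑-0 (vecs i)))
        go (yes refl) = sym (P.trans (∑-cong (vecs i) (λ f → P.trans (⟦⟧-⇔ ((i , g) ≟P (i , f)) (𝐏._≟_ i f g) (λ { refl → refl }) (λ { refl → refl })) (sym (*-identityʳ _)))) (𝐏.point i g (λ _ → 1ℚ)))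

    mult-∉ : ∀ {a} (f : Vec K a) fs → (a , f) ∉ fs → mult f fs ≡ 0ℚ
    mult-∉ f [] i = refl
    mult-∉ f (g ∷ fs) i = P.trans (cong₂ _+_ (⟦⟧-no (g ≟P (_ , f)) (λ e → i (here (sym e)))) (mult-∉ f fs (λ j → i (there j)))) (+-identityˡ _)

    mult≤length : ∀ {a} (f : Vec K a) fs → mult f fs ≤ ⌜ List.length fs ⌝
    mult≤length f [] = ≤-refl
    mult≤length f (g ∷ fs) = +-mono-≤ (⟦⟧≤1 (g ≟P (_ , f))) (mult≤length f fs)

    length≤degrees : ∀ fs → AllIrr fs → List.length fs ℕ.≤ degrees fs
    length≤degrees [] [] = z≤n
    length≤degrees (_ ∷ fs) ((1≤a , _) ∷ ifs) = ℕP.+-mono-≤ 1≤a (length≤degrees fs ifs)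

    δ : ∀ {a n} → Vec K a → Vec K n → ℚ
    δ f P = ⟦ irr? f ⟧ * ⟦ f ∣? P ⟧

    -- `δ f P` is 1 exactly when `f` occurs among the factors. A second occurrence makes the square
    -- of `f` divide `P`, and the multiplicity never exceeds `n`, because every factor has degree at
    -- least 1.
    mult-bounds : ∀ {a n fs} (f : Vec K a) (P : Vec K n) → AllIrr fs → Prod fs P →
      δ f P ≤ mult f fs × mult f fs ≤ δ f P + ⌜ n ⌝ * ⟦ (f ⊙ f) ∣? P ⟧
    mult-bounds {a} {n} {fs} f P ifs ps = go (any? ((a , f) ≟P_) fs)
      where
      square : ℚ
      square = ⌜ n ⌝ * ⟦ (f ⊙ f) ∣? P ⟧
      0≤square : 0ℚ ≤ square
      0≤square = 0≤* (0≤⌜⌝ n) (0≤⟦⟧ ((f ⊙ f) ∣? P))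
      at-most : mult f fs ≤ ⌜ n ⌝
      at-most = ≤-trans (mult≤length f fs) (⌜⌝-mono (subst (List.length fs ℕ.≤_) (degrees-prod ps) (length≤degrees fs ifs)))
      δ-no : (a , f) ∉ fs → δ f P ≡ 0ℚ
      δ-no i with irr? f | f ∣? P
      ... | no _ | d = *-zeroˡ _
      ... | yes _ | no _ = *-zeroʳ _
      ... | yes irr | yes d = contradiction (irr∣prod⇒∈ irr ifs ps d) i
      go : Dec ((a , f) ∈ fs) → δ f P ≤ mult f fs × mult f fs ≤ δ f P + square
      go (no i) = ≤-reflexive (P.trans (δ-no i) (sym (mult-∉ f fs i))) ,
        ≤-trans (≤-reflexive (mult-∉ f fs i)) (0≤+ (≤-reflexive (sym (δ-no i))) 0≤square)
      go (yes i) with ∈⇒↭ i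
      ... | gs , e with prod-↭ e ps | All-resp-↭ e ifs
      ... | cons {Q = Q} m pgs | irr ∷ igs = ≤-trans (≤-reflexive δ≡1) (≤-trans (≤-reflexive (sym (+-identityʳ 1ℚ))) (≤-trans (+-mono-≤ (≤-refl {1ℚ}) (∑-nonneg gs (λ g → 0≤⟦⟧ (g ≟P (a , f))))) (≤-reflexive (sym mult≡)))) ,
          upper (any? ((a , f) ≟P_) gs)
        where
        δ≡1 : δ f P ≡ 1ℚ
        δ≡1 = P.trans (cong₂ _*_ (⟦⟧-yes (irr? f) irr) (⟦⟧-yes (f ∣? P) (_ , Q , m))) (*-identityˡ 1ℚ)
        mult≡ : mult f fs ≡ 1ℚ + mult f gs
        mult≡ = P.trans (∑-↭ (λ g → ⟦ g ≟P (a , f) ⟧) e) (cong (_+ mult f gs) (⟦⟧-yes ((a , f) ≟P (a , f)) refl))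
        upper : Dec ((a , f) ∈ gs) → mult f fs ≤ δ f P + square
        upper (no j) = ≤-trans (≤-reflexive (P.trans mult≡ (cong (1ℚ +_) (mult-∉ f gs j)))) (+-mono-≤ (≤-reflexive (sym δ≡1)) 0≤square)
        upper (yes j) with ∈⇒↭ j
        ... | hs , e′ with prod-↭ e′ pgs
        ... | cons {Q = R} m′ _ = ≤-trans at-most (≤-trans (≤-reflexive (P.trans (sym (+-identityˡ _)) (cong (0ℚ +_) (P.trans (sym (*-identityʳ _)) (cong (⌜ n ⌝ *_) (sym (⟦⟧-yes ((f ⊙ f) ∣? P) (_ , R , mul-assoc m′ m))))))))
            (+-mono-≤ (0≤* (0≤⟦⟧ (irr? f)) (0≤⟦⟧ (f ∣? P))) (≤-refl {square})))

    factors : ∀ {n} → Vec K n → List Poly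
    factors P = proj₁ (factorize P)

    Σδ : ∀ {n} → ℕ → Vec K n → ℚ
    Σδ i P = ∑ (vecs i) (λ f → δ f P)

    module _ (n i : ℕ) (1≤i : 1 ℕ.≤ i) (φ : Vec K n → ℚ) (0≤φ : ∀ P → 0ℚ ≤ φ P) (φ≤1 : ∀ P → φ P ≤ 1ℚ) where
      count-lower : 𝐏.E n (λ P → Σδ i P * φ P) ≤ 𝐏.E n (λ P → ⌜ count i (factors P) ⌝ * φ P)
      count-lower = 𝐏.E-mono n (λ P → *-monoʳ (0≤φ P) (≤-trans (∑-mono (vecs i) (λ f → proj₁ (mult-bounds f P (proj₁ (proj₂ (factorize P))) (proj₂ (proj₂ (factorize P)))))) (≤-reflexive (sym (count-mult i (factors P))))))

      -- Repeated factors are rare: the multiples of a square of degree `2 i` have density at most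
      -- `ω^(2 i)`, and there are `ω^(- i)` monic `f` of degree `i`, which leaves `ω^i`, at most
      -- `ω`.
      count-upper : 𝐏.E n (λ P → ⌜ count i (factors P) ⌝ * φ P) ≤ 𝐏.E n (λ P → Σδ i P * φ P) + ⌜ n ⌝ * ω
      count-upper = begin
        𝐏.E n (λ P → ⌜ count i (factors P) ⌝ * φ P) ≤⟨ 𝐏.E-mono n pt ⟩
        𝐏.E n (λ P → Σδ i P * φ P + ⌜ n ⌝ * sq P) ≡⟨ P.trans (𝐏.E-+ n _ _) (cong (𝐏.E n (λ P → Σδ i P * φ P) +_) (𝐏.E-*ˡ n ⌜ n ⌝ sq)) ⟩
        𝐏.E n (λ P → Σδ i P * φ P) + ⌜ n ⌝ * 𝐏.E n sq ≤⟨ +-mono-≤ (≤-refl {𝐏.E n (λ P → Σδ i P * φ P)}) (*-monoˡ (0≤⌜⌝ n) sq-density) ⟩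
        𝐏.E n (λ P → Σδ i P * φ P) + ⌜ n ⌝ * ω ∎
        where
        open ≤-Reasoning
        sq : Vec K n → ℚ
        sq P = ∑ (vecs i) (λ f → ⟦ (f ⊙ f) ∣? P ⟧)
        0≤sq′ : ∀ P → 0ℚ ≤ sq P
        0≤sq′ P = ∑-nonneg (vecs i) (λ f → 0≤⟦⟧ ((f ⊙ f) ∣? P))
        bound : ∀ P → ⌜ count i (factors P) ⌝ ≤ Σδ i P + ⌜ n ⌝ * sq P
        bound P = ≤-trans (≤-reflexive (count-mult i (factors P))) (≤-trans
          (∑-mono (vecs i) (λ f → proj₂ (mult-bounds f P (proj₁ (proj₂ (factorize P))) (proj₂ (proj₂ (factorize P))))))
          (≤-reflexive (P.trans (∑-+ (vecs i) _ _) (cong (Σδ i P +_) (∑-*ˡ (vecs i) ⌜ n ⌝ _)))))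
        pt : ∀ P → ⌜ count i (factors P) ⌝ * φ P ≤ Σδ i P * φ P + ⌜ n ⌝ * sq P
        pt P = ≤-trans (*-monoʳ (0≤φ P) (bound P)) (≤-trans (≤-reflexive (*-distribʳ-+ (φ P) (Σδ i P) (⌜ n ⌝ * sq P)))
          (+-mono-≤ (≤-refl {Σδ i P * φ P}) (≤-trans (*-monoˡ (0≤* (0≤⌜⌝ n) (0≤sq′ P)) (φ≤1 P)) (≤-reflexive (*-identityʳ _)))))
        sq-density : 𝐏.E n sq ≤ ω
        sq-density = begin
          𝐏.E n sq ≡⟨ E-∑ (vecU n) (vecs i) _ ⟩
          ∑ (vecs i) (λ f → 𝐏.E n (λ P → ⟦ (f ⊙ f) ∣? P ⟧)) ≤⟨ ∑-mono (vecs i) (λ f → divisible-density n (f ⊙ f)) ⟩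
          ∑ (vecs i) (λ f → ω ^^ (i ℕ.+ i)) ≡⟨ ∑-cong (vecs i) (λ f → ω^-+ i i) ⟩
          ∑ (vecs i) (λ f → ω ^^ i * ω ^^ i) ≡⟨ ∑-*ˡ (vecs i) (ω ^^ i) _ ⟩
          𝐏.E i (λ _ → ω ^^ i) ≡⟨ 𝐏.E-const i _ ⟩
          ω ^^ i ≤⟨ ω^≤ω i 1≤i ⟩
          ω ∎

    irr-density : ℕ → ℚ
    irr-density i = 𝐏.E i (λ f → ⟦ irr? f ⟧)

    Σδ-mean : ∀ i m (φ : Vec K (i ℕ.+ m) → ℚ) ψ → (∀ (f : Vec K i) → Irr f → ∀ Q → φ (f ⊙ Q) ≡ ψ Q) →
      𝐏.E (i ℕ.+ m) (λ P → Σδ i P * φ P) ≡ irr-density i * 𝐏.E m ψ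
    Σδ-mean i m φ ψ h = begin
      𝐏.E n (λ P → Σδ i P * φ P) ≡⟨ 𝐏.E-cong n (λ P → P.trans (*-comm (Σδ i P) (φ P)) (P.trans (sym (∑-*ˡ (vecs i) (φ P) _)) (∑-cong (vecs i) (λ f → lem (φ P) ⟦ irr? f ⟧ ⟦ f ∣? P ⟧)))) ⟩
      𝐏.E n (λ P → ∑ (vecs i) (λ f → ⟦ irr? f ⟧ * (⟦ f ∣? P ⟧ * φ P))) ≡⟨ E-∑ (vecU n) (vecs i) _ ⟩
      ∑ (vecs i) (λ f → 𝐏.E n (λ P → ⟦ irr? f ⟧ * (⟦ f ∣? P ⟧ * φ P))) ≡⟨ ∑-cong (vecs i) (λ f → P.trans (𝐏.E-*ˡ n _ _) (cong (⟦ irr? f ⟧ *_) (divisible-mean i m f φ))) ⟩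
      ∑ (vecs i) (λ f → ⟦ irr? f ⟧ * (ω ^^ i * 𝐏.E m (λ Q → φ (f ⊙ Q)))) ≡⟨ ∑-cong (vecs i) (λ f → P.trans (reduce f (irr? f)) (lem₂ ⟦ irr? f ⟧ (ω ^^ i) (𝐏.E m ψ))) ⟩
      ∑ (vecs i) (λ f → ω ^^ i * 𝐏.E m ψ * ⟦ irr? f ⟧) ≡⟨ ∑-*ˡ (vecs i) _ _ ⟩
      ω ^^ i * 𝐏.E m ψ * ∑ (vecs i) (λ f → ⟦ irr? f ⟧) ≡⟨ lem₃ (ω ^^ i) (𝐏.E m ψ) _ ⟩
      irr-density i * 𝐏.E m ψ ∎
      where
      open ≡-Reasoning
      n = i ℕ.+ m
      opaque
        unfolding _+_
        lem : ∀ a b c → a * (b * c) ≡ b * (c * a)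
        lem = solve-∀ ℚ-ring
      opaque
        unfolding _+_
        lem₂ : ∀ a b c → a * (b * c) ≡ b * c * a
        lem₂ = solve-∀ ℚ-ring
      opaque
        unfolding _+_
        lem₃ : ∀ a b c → a * b * c ≡ a * c * b
        lem₃ = solve-∀ ℚ-ring
      reduce : ∀ f (d : Dec (Irr f)) → ⟦ d ⟧ * (ω ^^ i * 𝐏.E m (λ Q → φ (f ⊙ Q))) ≡ ⟦ d ⟧ * (ω ^^ i * 𝐏.E m ψ)
      reduce f (no _) = P.trans (*-zeroˡ _) (sym (*-zeroˡ _))
      reduce f (yes irr) = cong (λ z → 1ℚ * (ω ^^ i * z)) (𝐏.E-cong m (h f irr))

    total-degree : ∀ {n} k fs → degrees fs ≡ n → n ℕ.≤ k → wsum k (λ i → ⌜ count i fs ⌝) ≡ ⌜ n ⌝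
    total-degree k [] refl le = zeros k
      where
      zeros : ∀ k → wsum k (λ _ → 0ℚ) ≡ 0ℚ
      zeros zero = refl
      zeros (suc k) = P.trans (cong₂ _+_ (zeros k) (*-zeroʳ _)) (+-identityˡ 0ℚ)
    total-degree k ((a , f) ∷ fs) refl le = begin
      wsum k (λ i → ⌜ count i ((a , f) ∷ fs) ⌝) ≡⟨ wsum-cong k (λ i → P.trans (count-sum i ((a , f) ∷ fs)) (cong (⟦ a ℕ.≟ i ⟧ +_) (sym (count-sum i fs)))) ⟩
      wsum k (λ i → ⟦ a ℕ.≟ i ⟧ + ⌜ count i fs ⌝) ≡⟨ wsum-+ k (λ i → ⟦ a ℕ.≟ i ⟧) (λ i → ⌜ count i fs ⌝) ⟩
      wsum k (λ i → ⟦ a ℕ.≟ i ⟧) + wsum k (λ i → ⌜ count i fs ⌝)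
        ≡⟨ cong₂ _+_ (wsum-indicator k a (ℕP.≤-trans (ℕP.m≤m+n a _) le)) (total-degree k fs refl (ℕP.≤-trans (ℕP.m≤n+m _ a) le)) ⟩
      ⌜ a ⌝ + ⌜ degrees fs ⌝ ≡⟨ sym (⌜⌝-+ a (degrees fs)) ⟩
      ⌜ a ℕ.+ degrees fs ⌝ ∎
      where open ≡-Reasoning

    mean-count : ℕ → ℕ → ℚ
    mean-count n i = 𝐏.E n (λ P → ⌜ count i (factors P) ⌝)

    mean-count-total : ∀ n → wsum n (mean-count n) ≡ ⌜ n ⌝
    mean-count-total n = P.trans (sym (E-wsum (vecU n) n (λ i P → ⌜ count i (factors P) ⌝)))
      (P.trans (𝐏.E-cong n (λ P → total-degree n (factors P) (degrees-prod (proj₂ (proj₂ (factorize P)))) ℕP.≤-refl)) (𝐏.E-const n ⌜ n ⌝))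

    mean-count-bounds : ∀ n i → 1 ℕ.≤ i → i ℕ.≤ n → irr-density i ≤ mean-count n i × mean-count n i ≤ irr-density i + ⌜ n ⌝ * ω
    mean-count-bounds n i 1≤i le with n ℕ.∸ i | ℕP.m+[n∸m]≡n le
    ... | m | refl = ≤-trans (≤-reflexive (sym mean)) (≤-trans (count-lower N i 1≤i (λ _ → 1ℚ) (λ _ → 0≤1) (λ _ → ≤-refl)) (≤-reflexive unweight)) ,
        ≤-trans (≤-reflexive (sym unweight)) (≤-trans (count-upper N i 1≤i (λ _ → 1ℚ) (λ _ → 0≤1) (λ _ → ≤-refl)) (≤-reflexive (cong (_+ ⌜ N ⌝ * ω) mean)))
      where
      N = i ℕ.+ m
      mean : 𝐏.E N (λ P → Σδ i P * 1ℚ) ≡ irr-density i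
      mean = P.trans (Σδ-mean i m (λ _ → 1ℚ) (λ _ → 1ℚ) (λ _ _ _ → refl)) (P.trans (cong (irr-density i *_) (𝐏.E-1 m)) (*-identityʳ _))
      unweight : 𝐏.E N (λ P → ⌜ count i (factors P) ⌝ * 1ℚ) ≡ mean-count N i
      unweight = 𝐏.E-cong N (λ P → *-identityʳ _)

    irr-sum-upper : ∀ n → wsum n irr-density ≤ ⌜ n ⌝
    irr-sum-upper n = ≤-trans (wsum-mono n (λ i 1≤i le → proj₁ (mean-count-bounds n i 1≤i le))) (≤-reflexive (mean-count-total n))

    irr-sum-lower : ∀ n → ⌜ n ⌝ ≤ wsum n irr-density + cube n * ω
    irr-sum-lower n = ≤-trans (≤-reflexive (sym (mean-count-total n))) (≤-trans (wsum-mono n (λ i 1≤i le → proj₂ (mean-count-bounds n i 1≤i le)))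
      (≤-trans (≤-reflexive (wsum-+ n irr-density (λ _ → ⌜ n ⌝ * ω))) (+-mono-≤ (≤-refl {wsum n irr-density})
        (≤-trans (wsum-const n n (⌜ n ⌝ * ω) ℕP.≤-refl (0≤* (0≤⌜⌝ n) 𝐊.0≤ω)) (≤-reflexive (lem ⌜ n ⌝ ω))))))
      where
      opaque
        unfolding _+_
        lem : ∀ a b → a * (a * (a * b)) ≡ a * (a * a) * b
        lem = solve-∀ ℚ-ring

    -- The term of index `i` is the difference of two consecutive sums, so the upper bound for one
    -- sum is combined with the lower bound for the preceding one.
    prime-polynomial-upper : ∀ i N → 1 ℕ.≤ i → i ℕ.≤ N → ⌜ i ⌝ * irr-density i ≤ 1ℚ + cube N * ω
    prime-polynomial-upper (suc k) N _ le = ≤-trans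
      (≤-from _ (0≤+ (≤-diff (irr-sum-upper (suc k))) (≤-diff (irr-sum-lower k))) (lem (wsum k irr-density) (⌜ suc k ⌝ * irr-density (suc k)) (cube k * ω) ⌜ k ⌝))
      (+-mono-≤ (≤-refl {1ℚ}) (*-monoʳ 𝐊.0≤ω (cube-mono (ℕP.≤-trans (ℕP.n≤1+n k) le))))
      where
      opaque
        unfolding _+_
        lem : ∀ w x c k → 1ℚ + c - x ≡ 1ℚ + k - (w + x) + (w + c - k)
        lem = solve-∀ ℚ-ring

    prime-polynomial-lower : ∀ i N → 1 ℕ.≤ i → i ℕ.≤ N → 1ℚ ≤ ⌜ i ⌝ * irr-density i + cube N * ω
    prime-polynomial-lower (suc k) N _ le = ≤-trans
      (≤-from _ (0≤+ (≤-diff (irr-sum-lower (suc k))) (≤-diff (irr-sum-upper k))) (lem (wsum k irr-density) (⌜ suc k ⌝ * irr-density (suc k)) (cube (suc k) * ω) ⌜ k ⌝))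
      (+-mono-≤ (≤-refl {⌜ suc k ⌝ * irr-density (suc k)}) (*-monoʳ 𝐊.0≤ω (cube-mono le)))
      where
      opaque
        unfolding _+_
        lem : ∀ w x c k → x + c - 1ℚ ≡ w + x + c - (1ℚ + k) + (k - w)
        lem = solve-∀ ℚ-ring

-- The mean of the indicator of a splitting type.

module TypeMeans where

  open Rat
  open Mean
  open Field
  open Averages
  open Series
  open Factor
  open Density
  open import Data.Nat as ℕ using (ℕ; zero; suc; z≤n; s≤s; _!)
  import Data.Nat.Properties as ℕP
  open import Data.Nat.Solver using (module +-*-Solver)
  open import Data.Vec using (Vec; []; _∷_)
  open import Data.List using (List; []; _∷_)
  open import Data.List.Relation.Unary.All using ([]; _∷_)
  open import Data.List.Relation.Binary.Permutation.Propositional.Properties using (All-resp-↭)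
  open import Data.Product using (_×_; _,_)
  open import Relation.Nullary using (yes; no; Dec)
  open import Relation.Nullary.Negation using (contradiction)
  open import Relation.Binary.PropositionalEquality
  open import Tactic.RingSolver using (solve-∀)
  open import Data.Rational.Properties using (module ≤-Reasoning)

  -- xs lists the numbers of factors of degrees k, k + 1, …
  weight : ℕ → List ℕ → ℕ
  weight k [] = 0
  weight k (x ∷ xs) = k ℕ.* x ℕ.+ weight (suc k) xs

  denom : ℕ → List ℕ → ℕ
  denom k [] = 1
  denom k (x ∷ xs) = (k ℕ.^ x) ℕ.* (x !) ℕ.* denom (suc k) xs

  counts : ℕ → List ℕ → ℕ → ℕ
  counts k [] d = 0
  counts k (x ∷ xs) d with d ℕ.≟ k
  ... | yes _ = x
  ... | no _ = counts (suc k) xs d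

  total : List ℕ → ℕ
  total [] = 0
  total (x ∷ xs) = x ℕ.+ total xs

  counts-here : ∀ k x xs → counts k (x ∷ xs) k ≡ x
  counts-here k x xs with k ℕ.≟ k
  ... | yes _ = refl
  ... | no ne = contradiction refl ne

  counts-there : ∀ k x xs d → d ≢ k → counts k (x ∷ xs) d ≡ counts (suc k) xs d
  counts-there k x xs d ne with d ℕ.≟ k
  ... | yes e = contradiction e ne
  ... | no _ = refl

  counts-low : ∀ k xs d → d ℕ.< k → counts k xs d ≡ 0
  counts-low k [] d lt = refl
  counts-low k (x ∷ xs) d lt = trans (counts-there k x xs d (ℕP.<⇒≢ lt)) (counts-low (suc k) xs d (ℕP.m≤n⇒m≤1+n lt))

  counts-high : ∀ k xs d → weight k xs ℕ.< d → counts k xs d ≡ 0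
  counts-high k [] d lt = refl
  counts-high k (x ∷ xs) d lt with d ℕ.≟ k
  ... | no _ = counts-high (suc k) xs d (ℕP.≤-<-trans (ℕP.m≤n+m _ (k ℕ.* x)) lt)
  counts-high k (zero ∷ xs) .k lt | yes refl = refl
  counts-high k (suc x ∷ xs) .k lt | yes refl = contradiction (ℕP.≤-trans (ℕP.m≤m*n k (suc x)) (ℕP.m≤m+n (k ℕ.* suc x) _)) (ℕP.<⇒≱ lt)

  counts-zero : ∀ k xs d → counts k (0 ∷ xs) d ≡ counts (suc k) xs d
  counts-zero k xs d with d ℕ.≟ k
  ... | yes refl = sym (counts-low (suc k) xs k ℕP.≤-refl)
  ... | no _ = refl

  weight-zero : ∀ k xs → weight k (0 ∷ xs) ≡ weight (suc k) xs
  weight-zero k xs = cong (ℕ._+ weight (suc k) xs) (ℕP.*-zeroʳ k)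

  weight-suc : ∀ k x xs → weight k (suc x ∷ xs) ≡ k ℕ.+ weight k (x ∷ xs)
  weight-suc k x xs = trans (cong (ℕ._+ weight (suc k) xs) (ℕP.*-suc k x)) (ℕP.+-assoc k (k ℕ.* x) _)

  denom-zero : ∀ k xs → denom k (0 ∷ xs) ≡ denom (suc k) xs
  denom-zero k xs = ℕP.+-identityʳ _

  denom-suc : ∀ k x xs → denom k (suc x ∷ xs) ≡ k ℕ.* suc x ℕ.* denom k (x ∷ xs)
  denom-suc k x xs = solve 5 (λ k p s f z → k :* p :* (s :* f) :* z := k :* s :* (p :* f :* z)) refl k (k ℕ.^ x) (suc x) (x !) (denom (suc k) xs)
    where open +-*-Solver

  total≤weight : ∀ k xs → 1 ℕ.≤ k → total xs ℕ.≤ weight k xs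
  total≤weight k [] _ = z≤n
  total≤weight (suc k) (x ∷ xs) _ = ℕP.+-mono-≤ (ℕP.m≤m+n x (k ℕ.* x)) (total≤weight (suc (suc k)) xs (s≤s z≤n))

  -- The error constant: cube N comes from the density of irreducibles, ⌜ N ⌝ from repeated factors.
  rate : ℕ → ℚ
  rate N = cube N + ⌜ N ⌝

  module TypeMean (𝔽 : FinField) where
    open FinField 𝔽
    open PowerSeries 𝔽
    open Factorization 𝔽
    open VecSpace uniform
    open Densities 𝔽
    open 𝐊 using (ω)

    High : ℕ → (ℕ → ℕ) → Set
    High m s = ∀ i → m ℕ.< i → s i ≡ 0

    indicator : ∀ {m} s → High m s → Vec K m → ℚ
    indicator s hi P = ⟦ hasType? P s hi ⟧

    type-mean : ∀ m s → High m s → ℚ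
    type-mean m s hi = 𝐏.E m (indicator s hi)

    type-mean-cong : ∀ {m s s′} hi hi′ → (∀ i → s i ≡ s′ i) → type-mean m s hi ≡ type-mean m s′ hi′
    type-mean-cong {m} {s} {s′} hi hi′ e = 𝐏.E-cong m λ P → ⟦⟧-⇔ (hasType? P s hi) (hasType? P s′ hi′)
      (λ { (fs , ifs , ps , c) → fs , ifs , ps , λ i → trans (c i) (e i) })
      (λ { (fs , ifs , ps , c) → fs , ifs , ps , λ i → trans (c i) (sym (e i)) })

    module Step (i m : ℕ) (1≤i : 1 ℕ.≤ i) (s s′ : ℕ → ℕ) (at : s i ≡ suc (s′ i)) (off : ∀ j → j ≢ i → s j ≡ s′ j)
                (hi : High (i ℕ.+ m) s) (hi′ : High m s′) where
      n : ℕ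
      n = i ℕ.+ m

      add : ∀ (f : Vec K i) (Q : Vec K m) → Irr f → HasType Q s′ → HasType (f ⊙ Q) s
      add f Q irr (fs , ifs , ps , c) = (i , f) ∷ fs , irr ∷ ifs , cons (⊙-mul f Q) ps , λ j → go j (i ℕ.≟ j)
        where
        go : ∀ j → Dec (i ≡ j) → count j ((i , f) ∷ fs) ≡ s j
        go j (yes refl) = trans (count-yes {i} {i} {f} fs refl) (trans (cong suc (c i)) (sym at))
        go j (no ne) = trans (count-no {j} {i} {f} fs ne) (trans (c j) (sym (off j (λ e → ne (sym e)))))

      remove : ∀ (f : Vec K i) (Q : Vec K m) → Irr f → HasType (f ⊙ Q) s → HasType Q s′
      remove f Q irr (fs , ifs , ps , c) with ∈⇒↭ (irr∣prod⇒∈ {p = f ⊙ Q} irr ifs ps (m , Q , ⊙-mul f Q))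
      ... | gs , e with prod-↭ e ps | All-resp-↭ e ifs
      ... | cons {Q = R} m′ pgs | _ ∷ igs with same-degree m′
      ... | refl with mul-cancel m′ (⊙-mul f Q)
      ... | refl = gs , igs , pgs , λ j → go j (i ℕ.≟ j)
        where
        go : ∀ j → Dec (i ≡ j) → count j gs ≡ s′ j
        go j (yes refl) = ℕP.suc-injective (trans (sym (count-yes {i} {i} {f} gs refl)) (trans (sym (count-↭ i e)) (trans (c i) at)))
        go j (no ne) = trans (sym (count-no {j} {i} {f} gs ne)) (trans (sym (count-↭ j e)) (trans (c j) (off j (λ e′ → ne (sym e′)))))

      M M′ : ℚ
      M = type-mean n s hi
      M′ = type-mean m s′ hi′

      φ : Vec K n → ℚ
      φ = indicator s hi

      -- On polynomials of type `s` the factorisation chosen by `factorize` has `s i` factors of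
      -- degree `i`, by uniqueness.
      counted : 𝐏.E n (λ P → ⌜ count i (factors P) ⌝ * φ P) ≡ ⌜ s i ⌝ * M
      counted = trans (𝐏.E-cong n (λ P → pt P (hasType? P s hi))) (𝐏.E-*ˡ n ⌜ s i ⌝ φ)
        where
        pt : ∀ P (d : Dec (HasType P s)) → ⌜ count i (factors P) ⌝ * ⟦ d ⟧ ≡ ⌜ s i ⌝ * ⟦ d ⟧
        pt P (no _) = trans (*-zeroʳ _) (sym (*-zeroʳ _))
        pt P (yes (gs , igs , pgs , c)) with factorize P
        ... | fs , ifs , ps = cong (λ k → ⌜ k ⌝ * 1ℚ) (trans (count-↭ i (unique ifs igs ps pgs)) (c i))

      reduced : 𝐏.E n (λ P → Σδ i P * φ P) ≡ irr-density i * M′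
      reduced = Σδ-mean i m φ (indicator s′ hi′) λ f irr Q → ⟦⟧-⇔ (hasType? (f ⊙ Q) s hi) (hasType? Q s′ hi′) (remove f Q irr) (add f Q irr)

      step-lower : irr-density i * M′ ≤ ⌜ s i ⌝ * M
      step-lower = subst₂ _≤_ reduced counted (count-lower n i 1≤i φ (λ P → 0≤⟦⟧ (hasType? P s hi)) (λ P → ⟦⟧≤1 (hasType? P s hi)))

      step-upper : ⌜ s i ⌝ * M ≤ irr-density i * M′ + ⌜ n ⌝ * ω
      step-upper = subst₂ _≤_ counted (cong (_+ ⌜ n ⌝ * ω) reduced) (count-upper n i 1≤i φ (λ P → 0≤⟦⟧ (hasType? P s hi)) (λ P → ⟦⟧≤1 (hasType? P s hi)))

    type-mean≤1 : ∀ m s hi → type-mean m s hi ≤ 1ℚ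
    type-mean≤1 m s hi = 𝐏.E-≤const m (λ P → ⟦⟧≤1 (hasType? P s hi))

    0≤type-mean : ∀ m s hi → 0ℚ ≤ type-mean m s hi
    0≤type-mean m s hi = 𝐏.E-nonneg m (λ P → 0≤⟦⟧ (hasType? P s hi))

    -- `z` times the mean `M` is 1, up to an error that grows by `⌜ z ⌝ * (rate N * ω)` for each of
    -- the `k` factors removed so far.
    Close : ℕ → ℕ → ℕ → ℚ → Set
    Close N k z M = (⌜ z ⌝ * M ≤ 1ℚ + ⌜ k ⌝ * (⌜ z ⌝ * (rate N * ω))) × (1ℚ ≤ ⌜ z ⌝ * M + ⌜ k ⌝ * (⌜ z ⌝ * (rate N * ω)))

    -- `Step` relates `s i` times the new mean to the density of irreducibles times the old mean.
    -- Multiplied by `i * z`, the right side is close to `z` times the old mean, as `i` times that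
    -- density is close to 1; the denominator thus gains `i * s i`.
    close-step : ∀ N i m → 1 ℕ.≤ i → i ℕ.+ m ℕ.≤ N → ∀ s s′ (at : s i ≡ suc (s′ i)) (off : ∀ j → j ≢ i → s j ≡ s′ j) hi hi′ k z →
      Close N k z (type-mean m s′ hi′) → Close N (suc k) (i ℕ.* suc (s′ i) ℕ.* z) (type-mean (i ℕ.+ m) s hi)
    close-step N i m 1≤i le s s′ at off hi hi′ k z (up , low) = upper , lower
      where
      open ≤-Reasoning
      module 𝕊𝕥 = Step i m 1≤i s s′ at off hi hi′
      M M′ p r Z Z′ e I σ : ℚ
      M = 𝕊𝕥.M
      M′ = 𝕊𝕥.M′
      p = irr-density i
      I = ⌜ i ⌝
      σ = ⌜ suc (s′ i) ⌝
      Z′ = ⌜ z ⌝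
      Z = ⌜ i ℕ.* suc (s′ i) ℕ.* z ⌝
      r = rate N * ω
      e = cube N * ω
      Z≡ : Z ≡ I * σ * Z′
      Z≡ = trans (⌜⌝-* (i ℕ.* suc (s′ i)) z) (cong (_* Z′) (⌜⌝-* i (suc (s′ i))))
      i≤N : i ℕ.≤ N
      i≤N = ℕP.≤-trans (ℕP.m≤m+n i m) le
      0≤M′ : 0ℚ ≤ M′
      0≤M′ = 0≤type-mean m s′ hi′
      0≤Z′ : 0ℚ ≤ Z′
      0≤Z′ = 0≤⌜⌝ z
      0≤e : 0ℚ ≤ e
      0≤e = 0≤* (0≤cube N) 𝐊.0≤ω
      0≤r : 0ℚ ≤ r
      0≤r = 0≤* (0≤+ (0≤cube N) (0≤⌜⌝ N)) 𝐊.0≤ω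
      at′ : ⌜ s i ⌝ ≡ σ
      at′ = cong ⌜_⌝ at
      scaled : Z * M ≡ I * Z′ * (⌜ s i ⌝ * M)
      scaled = trans (cong (_* M) Z≡) (trans (lem I σ Z′ M) (cong (λ x → I * Z′ * (x * M)) (sym at′)))
        where
        opaque
          unfolding _+_
          lem : ∀ a b c d → a * b * c * d ≡ a * c * (b * d)
          lem = solve-∀ ℚ-ring
      1≤iσ : 1 ℕ.≤ i ℕ.* suc (s′ i)
      1≤iσ = ℕP.≤-trans 1≤i (ℕP.m≤m*n i (suc (s′ i)))
      Z′≤Z : Z′ ≤ Z
      Z′≤Z = ⌜⌝-mono (ℕP.≤-trans (ℕP.≤-reflexive (sym (ℕP.+-identityʳ z))) (ℕP.*-monoˡ-≤ z 1≤iσ))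
      IZ′≤Z : I * Z′ ≤ Z
      IZ′≤Z = ≤-trans (≤-reflexive (sym (⌜⌝-* i z))) (⌜⌝-mono (ℕP.*-monoˡ-≤ z (ℕP.m≤m*n i (suc (s′ i)))))
      err≤ : Z′ * M′ * e ≤ Z * e
      err≤ = *-monoʳ 0≤e (≤-trans (≤-trans (*-monoˡ 0≤Z′ (type-mean≤1 m s′ hi′)) (≤-reflexive (*-identityʳ Z′))) Z′≤Z)
      grow : ⌜ k ⌝ * (Z′ * r) ≤ ⌜ k ⌝ * (Z * r)
      grow = *-monoˡ (0≤⌜⌝ k) (*-monoʳ 0≤r Z′≤Z)
      opaque
        unfolding _+_
        lem₁ : ∀ a b c d → a * b * (c * d) ≡ b * d * (a * c)
        lem₁ = solve-∀ ℚ-ring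
      opaque
        unfolding _+_
        lem₂ : ∀ a b → a * (1ℚ + b) ≡ a + a * b
        lem₂ = solve-∀ ℚ-ring
      sum-err : Z * e + Z * (⌜ N ⌝ * ω) ≡ Z * r
      sum-err = lem Z (cube N) ⌜ N ⌝ ω
        where
        opaque
          unfolding _+_
          lem : ∀ z a b w → z * (a * w) + z * (b * w) ≡ z * ((a + b) * w)
          lem = solve-∀ ℚ-ring
      opaque
        unfolding _+_
        collect : ∀ a k x → a + k * x + x ≡ a + (1ℚ + k) * x
        collect = solve-∀ ℚ-ring
      upper : Z * M ≤ 1ℚ + ⌜ suc k ⌝ * (Z * r)
      upper = begin
        Z * M ≡⟨ scaled ⟩
        I * Z′ * (⌜ s i ⌝ * M) ≤⟨ *-monoˡ (0≤* (0≤⌜⌝ i) 0≤Z′) 𝕊𝕥.step-upper ⟩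
        I * Z′ * (p * M′ + ⌜ i ℕ.+ m ⌝ * ω) ≡⟨ trans (*-distribˡ-+ (I * Z′) (p * M′) (⌜ i ℕ.+ m ⌝ * ω)) (cong (_+ I * Z′ * (⌜ i ℕ.+ m ⌝ * ω)) (lem₁ I Z′ p M′)) ⟩
        Z′ * M′ * (I * p) + I * Z′ * (⌜ i ℕ.+ m ⌝ * ω)
          ≤⟨ +-mono-≤ (*-monoˡ (0≤* 0≤Z′ 0≤M′) (prime-polynomial-upper i N 1≤i i≤N)) (*-mono (0≤* (0≤⌜⌝ i) 0≤Z′) (0≤* (0≤⌜⌝ (i ℕ.+ m)) 𝐊.0≤ω) IZ′≤Z (*-monoʳ 𝐊.0≤ω (⌜⌝-mono le))) ⟩
        Z′ * M′ * (1ℚ + e) + Z * (⌜ N ⌝ * ω) ≡⟨ cong (_+ Z * (⌜ N ⌝ * ω)) (lem₂ (Z′ * M′) e) ⟩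
        Z′ * M′ + Z′ * M′ * e + Z * (⌜ N ⌝ * ω) ≤⟨ +-mono-≤ (+-mono-≤ up err≤) (≤-refl {Z * (⌜ N ⌝ * ω)}) ⟩
        1ℚ + ⌜ k ⌝ * (Z′ * r) + Z * e + Z * (⌜ N ⌝ * ω) ≡⟨ trans (+-assoc _ (Z * e) (Z * (⌜ N ⌝ * ω))) (cong (1ℚ + ⌜ k ⌝ * (Z′ * r) +_) sum-err) ⟩
        1ℚ + ⌜ k ⌝ * (Z′ * r) + Z * r ≤⟨ +-mono-≤ (+-mono-≤ (≤-refl {1ℚ}) grow) (≤-refl {Z * r}) ⟩
        1ℚ + ⌜ k ⌝ * (Z * r) + Z * r ≡⟨ collect 1ℚ ⌜ k ⌝ (Z * r) ⟩
        1ℚ + ⌜ suc k ⌝ * (Z * r) ∎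
      e≤r : Z * e ≤ Z * r
      e≤r = *-monoˡ (0≤⌜⌝ (i ℕ.* suc (s′ i) ℕ.* z)) (*-monoʳ 𝐊.0≤ω (≤-trans (≤-reflexive (sym (+-identityʳ _))) (+-mono-≤ (≤-refl {cube N}) (0≤⌜⌝ N))))
      lower : 1ℚ ≤ Z * M + ⌜ suc k ⌝ * (Z * r)
      lower = begin
        1ℚ ≤⟨ low ⟩
        Z′ * M′ + ⌜ k ⌝ * (Z′ * r) ≡⟨ cong (_+ ⌜ k ⌝ * (Z′ * r)) (sym (*-identityʳ (Z′ * M′))) ⟩
        Z′ * M′ * 1ℚ + ⌜ k ⌝ * (Z′ * r) ≤⟨ +-mono-≤ (*-monoˡ (0≤* 0≤Z′ 0≤M′) (prime-polynomial-lower i N 1≤i i≤N)) grow ⟩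
        Z′ * M′ * (I * p + e) + ⌜ k ⌝ * (Z * r) ≡⟨ cong (_+ ⌜ k ⌝ * (Z * r)) (trans (*-distribˡ-+ (Z′ * M′) (I * p) e) (cong (_+ Z′ * M′ * e) (sym (lem₁ I Z′ p M′)))) ⟩
        I * Z′ * (p * M′) + Z′ * M′ * e + ⌜ k ⌝ * (Z * r)
          ≤⟨ +-mono-≤ (+-mono-≤ (*-monoˡ (0≤* (0≤⌜⌝ i) 0≤Z′) 𝕊𝕥.step-lower) (≤-trans err≤ e≤r)) (≤-refl {⌜ k ⌝ * (Z * r)}) ⟩
        I * Z′ * (⌜ s i ⌝ * M) + Z * r + ⌜ k ⌝ * (Z * r) ≡⟨ cong (λ x → x + Z * r + ⌜ k ⌝ * (Z * r)) (sym scaled) ⟩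
        Z * M + Z * r + ⌜ k ⌝ * (Z * r) ≡⟨ collect′ (Z * M) ⌜ k ⌝ (Z * r) ⟩
        Z * M + ⌜ suc k ⌝ * (Z * r) ∎
        where
        opaque
          unfolding _+_
          collect′ : ∀ a k x → a + x + k * x ≡ a + (1ℚ + k) * x
          collect′ = solve-∀ ℚ-ring

    -- One irreducible factor of the lowest remaining degree `k` is removed at a time; an exhausted
    -- entry passes to the next degree.
    close : ∀ N k xs m hi → 1 ℕ.≤ k → m ≡ weight k xs → m ℕ.≤ N → Close N (total xs) (denom k xs) (type-mean m (counts k xs) hi)
    close N k [] .0 hi 1≤k refl le = ≤-reflexive (trans lhs (sym rhs)) , ≤-reflexive (sym (trans (cong₂ _+_ lhs (*-zeroˡ _)) (+-identityʳ 1ℚ)))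
      where
      mean≡1 : type-mean 0 (λ _ → 0) hi ≡ 1ℚ
      mean≡1 = trans (𝐏.E-cong 0 {indicator (λ _ → 0) hi} {λ _ → 1ℚ} (λ { [] → ⟦⟧-yes (hasType? [] (λ _ → 0) hi) ([] , [] , nil , λ _ → refl) })) (𝐏.E-1 0)
      lhs : (1ℚ + 0ℚ) * type-mean 0 (λ _ → 0) hi ≡ 1ℚ
      lhs = trans (cong₂ _*_ (+-identityʳ 1ℚ) mean≡1) (*-identityˡ 1ℚ)
      rhs : 1ℚ + 0ℚ * ((1ℚ + 0ℚ) * (rate N * ω)) ≡ 1ℚ
      rhs = trans (cong (1ℚ +_) (*-zeroˡ _)) (+-identityʳ 1ℚ)
    close N k (zero ∷ xs) m hi 1≤k e le = subst₂ (Close N (total xs)) (sym (denom-zero k xs)) (type-mean-cong hi′ hi (λ d → sym (counts-zero k xs d)))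
      (close N (suc k) xs m hi′ (s≤s z≤n) (trans e (weight-zero k xs)) le)
      where
      hi′ : High m (counts (suc k) xs)
      hi′ i lt = trans (sym (counts-zero k xs i)) (hi i lt)
    close N k (suc x ∷ xs) m hi 1≤k e le = go m hi (trans e (weight-suc k x xs)) le
      (close N k (x ∷ xs) (weight k (x ∷ xs)) (counts-high k (x ∷ xs)) 1≤k refl (ℕP.≤-trans (ℕP.≤-trans (ℕP.m≤n+m _ k) (ℕP.≤-reflexive (sym (trans e (weight-suc k x xs))))) le))
      where
      s s′ : ℕ → ℕ
      s = counts k (suc x ∷ xs)
      s′ = counts k (x ∷ xs)
      at : s k ≡ suc (s′ k)
      at = trans (counts-here k (suc x) xs) (cong suc (sym (counts-here k x xs)))
      off : ∀ j → j ≢ k → s j ≡ s′ j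
      off j ne = trans (counts-there k (suc x) xs j ne) (sym (counts-there k x xs j ne))
      m′ : ℕ
      m′ = weight k (x ∷ xs)
      hi′ : High m′ s′
      hi′ = counts-high k (x ∷ xs)
      go : ∀ m hi → m ≡ k ℕ.+ m′ → m ℕ.≤ N → Close N (total (x ∷ xs)) (denom k (x ∷ xs)) (type-mean m′ s′ hi′) → Close N (suc (x ℕ.+ total xs)) (denom k (suc x ∷ xs)) (type-mean m s hi)
      go .(k ℕ.+ m′) hi refl le rec = subst (λ z → Close N (suc (x ℕ.+ total xs)) z (type-mean (k ℕ.+ m′) s hi))
        (trans (cong (λ y → k ℕ.* suc y ℕ.* denom k (x ∷ xs)) (counts-here k x xs)) (sym (denom-suc k x xs)))
        (close-step N k m′ 1≤k le s s′ at off hi hi′ (x ℕ.+ total xs) (denom k (x ∷ xs)) rec)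

-- Independence combined with the mean value.

module Combine where

  open Rat
  open Mean
  open Field
  open Averages
  open Factor
  open Claim
  open Slices
  open SplitTypes
  open Density
  open TypeMeans
  open import Data.Nat as ℕ using (ℕ; suc)
  import Data.Nat.Properties as ℕP
  open import Data.Vec using (Vec; _∷_; reverse)
  import Data.Vec.Properties as VecP
  open import Data.List using (List)
  open import Data.Product using (proj₁; proj₂)
  open import Relation.Binary.PropositionalEquality
  open import Tactic.RingSolver using (solve-∀)
  open import Data.Rational.Properties using (module ≤-Reasoning)

  -- The first summand bounds the failure of independence, the second the squared error of the mean;
  -- the factors 2 come from `sq-add`.
  constant : ℕ → ℚ
  constant n = 2ℚ * Constants.C₅ n + 2ℚ * (⌜ n ⌝ * rate n * (⌜ n ⌝ * rate n))

  square≤ : ∀ {y c} → y ≤ c → - c ≤ y → y * y ≤ c * c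
  square≤ {y} {c} p r = ≤-from ((c - y) * (y - - c)) (0≤* (≤-diff p) (≤-diff r)) (lem y c)
    where
    opaque
      unfolding _+_
      lem : ∀ y c → c * c - y * y ≡ (c - y) * (y - - c)
      lem = solve-∀ ℚ-ring

  module Combination (𝔽 : FinField) (m : ℕ) (xs : List ℕ) (weight≡ : suc m ≡ weight 1 xs) where
    open FinField 𝔽
    open Factorization 𝔽
    open Space 𝔽 using (0v)
    open VecSpace uniform using (vecU)
    module 𝐊 = Uniform uniform
    open 𝐊 using (ω)
    open TypeMean 𝔽
    n : ℕ
    n = suc m
    module 𝐖 = Uniform (vecU n)
    open Products 𝔽 using (Family; Π; Π-0≤; Π-≤1)

    s : ℕ → ℕ
    s = counts 1 xs

    s-high : High n s
    s-high i lt = counts-high 1 xs i (subst (ℕ._< i) weight≡ lt)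

    module 𝐓 = SplitType 𝔽 n s s-high

    typed : Vec K n → ℚ
    typed ξ = ⟦ hasType? (reverse ξ) s s-high ⟧

    z μ : ℚ
    z = ⌜ denom 1 xs ⌝
    μ = type-mean n s s-high

    μ≡ : 𝐖.E (λ ξ → 𝐓.T (𝟙 ∷ ξ)) ≡ μ
    μ≡ = trans (𝐖.E-cong 𝐓.T-monic) (Bijection.E-bij (vecU n) reverse reverse VecP.reverse-involutive VecP.reverse-involutive (indicator s s-high))

    module _ (f : Family n) (f-0≤ : ∀ i x → 0ℚ ≤ f i x) (f-≤1 : ∀ i x → f i x ≤ 1ℚ) where
      G M : ℚ
      G = 𝐖.E (λ ξ → typed ξ * Π f ξ)
      M = Π (λ i _ → 𝐊.E (f i)) (0v {n})

      equidistributed : (G - μ * M) * (G - μ * M) ≤ Constants.C₅ n * ω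
      equidistributed = subst₂ (λ g a → (g - a * M) * (g - a * M) ≤ Constants.C₅ n * ω) (𝐖.E-cong (λ ξ → cong (_* Π f ξ) (𝐓.T-monic ξ))) μ≡
        (Monic.equidistribution 𝔽 m 𝐓.T-symmetric 𝐓.T-zero 𝐓.T-tor f f-0≤ f-≤1)

      0≤M : 0ℚ ≤ M
      0≤M = Π-0≤ (λ i _ → 𝐊.E-nonneg (f-0≤ i)) (0v {n})

      M≤1 : M ≤ 1ℚ
      M≤1 = Π-≤1 (λ i _ → 𝐊.E-nonneg (f-0≤ i)) (λ i _ → 𝐊.E-≤const (f-≤1 i)) (0v {n})

      -- The difference is `z * (G - μ * M)` plus `(z * μ - 1ℚ) * M`. Multiplying by the denominator
      -- `z` throughout avoids dividing by it.
      combined : (z * G - M) * (z * G - M) ≤ constant n * (z * z * ω)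
      combined = begin
        (z * G - M) * (z * G - M) ≡⟨ cong (λ y → y * y) (split z G μ M) ⟩
        (x + y) * (x + y) ≤⟨ sq-add x y ⟩
        2ℚ * (x * x) + 2ℚ * (y * y) ≤⟨ +-mono-≤ (*-monoˡ 0≤2 x-bound) (*-monoˡ 0≤2 y-bound) ⟩
        2ℚ * (z * z * (Constants.C₅ n * ω)) + 2ℚ * (R * z * (R * z) * ω) ≡⟨ collect z (Constants.C₅ n) ω R ⟩
        constant n * (z * z * ω) ∎
        where
        open ≤-Reasoning
        x y R : ℚ
        x = z * (G - μ * M)
        y = (z * μ - 1ℚ) * M
        R = ⌜ n ⌝ * rate n
        opaque
          unfolding _+_
          split : ∀ z g u m → z * g - m ≡ z * (g - u * m) + (z * u - 1ℚ) * m
          split = solve-∀ ℚ-ring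
        opaque
          unfolding _+_
          collect : ∀ z c w r → 2ℚ * (z * z * (c * w)) + 2ℚ * (r * z * (r * z) * w) ≡ (2ℚ * c + 2ℚ * (r * r)) * (z * z * w)
          collect = solve-∀ ℚ-ring
        0≤z : 0ℚ ≤ z
        0≤z = 0≤⌜⌝ (denom 1 xs)
        x-bound : x * x ≤ z * z * (Constants.C₅ n * ω)
        x-bound = ≤-trans (≤-reflexive (lem z (G - μ * M))) (*-monoˡ (0≤* 0≤z 0≤z) equidistributed)
          where
          opaque
            unfolding _+_
            lem : ∀ z a → z * a * (z * a) ≡ z * z * (a * a)
            lem = solve-∀ ℚ-ring
        k : ℚ
        k = ⌜ TypeMeans.total xs ⌝
        close-n : Close n (TypeMeans.total xs) (denom 1 xs) μ
        close-n = close n 1 xs n s-high ℕP.≤-refl weight≡ ℕP.≤-refl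
        0≤rate : 0ℚ ≤ rate n
        0≤rate = 0≤+ (0≤cube n) (0≤⌜⌝ n)
        k≤n : k ≤ ⌜ n ⌝
        k≤n = ⌜⌝-mono (ℕP.≤-trans (total≤weight 1 xs ℕP.≤-refl) (ℕP.≤-reflexive (sym weight≡)))
        err : ℚ
        err = R * z * ω
        grow : k * (z * (rate n * ω)) ≤ err
        grow = ≤-trans (*-monoʳ (0≤* 0≤z (0≤* 0≤rate 𝐊.0≤ω)) k≤n) (≤-reflexive (lem ⌜ n ⌝ z (rate n) ω))
          where
          opaque
            unfolding _+_
            lem : ∀ a z r w → a * (z * (r * w)) ≡ a * r * z * w
            lem = solve-∀ ℚ-ring
        upper : z * μ - 1ℚ ≤ err
        upper = ≤-trans (≤-from _ (≤-diff (proj₁ close-n)) (lem (z * μ) (k * (z * (rate n * ω))))) grow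
          where
          opaque
            unfolding _+_
            lem : ∀ a b → b - (a - 1ℚ) ≡ 1ℚ + b - a
            lem = solve-∀ ℚ-ring
        lower : - err ≤ z * μ - 1ℚ
        lower = ≤-trans (neg-mono grow) (≤-from _ (≤-diff (proj₂ close-n)) (lem (z * μ) (k * (z * (rate n * ω)))))
          where
          opaque
            unfolding _+_
            lem : ∀ a b → a - 1ℚ - - b ≡ a + b - 1ℚ
            lem = solve-∀ ℚ-ring
        y-bound : y * y ≤ R * z * (R * z) * ω
        y-bound = begin
          y * y ≡⟨ lem (z * μ - 1ℚ) M ⟩
          (z * μ - 1ℚ) * (z * μ - 1ℚ) * (M * M) ≤⟨ *-mono (0≤sq (z * μ - 1ℚ)) (0≤sq M) (square≤ upper lower) (≤-trans (*-mono 0≤M 0≤M M≤1 M≤1) (≤-reflexive (*-identityˡ 1ℚ))) ⟩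
          err * err * 1ℚ ≡⟨ lem₂ (R * z) ω ⟩
          R * z * (R * z) * (ω * ω) ≤⟨ *-monoˡ (0≤sq (R * z)) (≤-trans (*-monoˡ 𝐊.0≤ω (𝐊.ω≤1 𝟘)) (≤-reflexive (*-identityʳ ω))) ⟩
          R * z * (R * z) * ω ∎
          where
          opaque
            unfolding _+_
            lem : ∀ a m → a * m * (a * m) ≡ a * a * (m * m)
            lem = solve-∀ ℚ-ring
          opaque
            unfolding _+_
            lem₂ : ∀ a w → a * w * (a * w) * 1ℚ ≡ a * a * (w * w)
            lem₂ = solve-∀ ℚ-ring

-- Natural numbers as rationals, and the uniform space on a finite ordinal.

module Cardinality where

  open Rat
  open Mean
  open Averages
  import Data.Rational as Q
  import Data.Rational.Properties as QP
  import Data.Rational.Unnormalised as U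
  import Data.Rational.Unnormalised.Properties as UP
  import Data.Integer as ℤ
  import Data.Integer.Properties as ℤP
  open import Data.Nat as ℕ using (ℕ; zero; suc)
  import Data.Nat.Properties as ℕP
  open import Data.Nat.Coprimality using (sym; 1-coprimeTo)
  open import Data.Fin using (Fin; zero; suc)
  import Data.Fin.Properties as FinP
  open import Data.List using (allFin)
  import Data.List.Properties as ListP
  open import Data.Product using (∃; _,_; proj₁; proj₂)
  open import Relation.Binary.PropositionalEquality as P using (_≡_; refl; cong; cong₂; subst)

  opaque
    unfolding _+_

    ⌜⌝≡ : ∀ k → ⌜ k ⌝ ≡ Q.mkℚ (ℤ.+ k) 0 (sym (1-coprimeTo k))
    ⌜⌝≡ zero = refl
    ⌜⌝≡ (suc k) = P.trans (cong (1ℚ +_) (⌜⌝≡ k)) (QP.toℚᵘ-injective (UP.≃-trans (QP.toℚᵘ-homo-+ 1ℚ (Q.mkℚ (ℤ.+ k) 0 (sym (1-coprimeTo k))))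
      (U.*≡* (cong (ℤ._* ℤ.+ 1) (cong (λ z → ℤ._+_ (ℤ.+ 1) z) (ℤP.*-identityʳ (ℤ.+ k)))))))

    ceiling : ∀ x → ∃ λ c → x ≤ ⌜ c ⌝
    ceiling x@(Q.mkℚ p d _) = ℤ.∣ p ∣ , subst (x ≤_) (P.sym (⌜⌝≡ ℤ.∣ p ∣)) (Q.*≤* (begin
        p ℤ.* ℤ.+ 1 ≡⟨ ℤP.*-identityʳ p ⟩
        p ≤⟨ i≤∣i∣ p ⟩
        ℤ.+ ℤ.∣ p ∣ ≤⟨ ℤ.+≤+ (ℕP.m≤m*n ℤ.∣ p ∣ (suc d)) ⟩
        ℤ.+ (ℤ.∣ p ∣ ℕ.* suc d) ≡⟨ ℤP.pos-* ℤ.∣ p ∣ (suc d) ⟩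
        ℤ.+ ℤ.∣ p ∣ ℤ.* ℤ.+ suc d ∎))
      where
      open ℤP.≤-Reasoning
      i≤∣i∣ : ∀ i → i ℤ.≤ ℤ.+ ℤ.∣ i ∣
      i≤∣i∣ (ℤ.+ n) = ℤP.≤-refl
      i≤∣i∣ ℤ.-[1+ n ] = ℤ.-≤+

    reciprocal : ∀ k → ∃ λ w → w * ⌜ suc k ⌝ ≡ 1ℚ
    reciprocal k = Q.1/_ ⌜ suc k ⌝ {{nz}} , QP.*-inverseˡ ⌜ suc k ⌝ {{nz}}
      where
      nz : Q.NonZero ⌜ suc k ⌝
      nz = subst Q.NonZero (P.sym (⌜⌝≡ (suc k))) _

  ∑-allFin : ∀ n f → ∑ (allFin (suc n)) f ≡ f zero + ∑ (allFin n) (λ i → f (suc i))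
  ∑-allFin n f = cong (λ xs → f zero + xs) (P.trans (cong (λ xs → ∑ xs f) (P.sym (ListP.map-tabulate {n = n} (λ i → i) suc))) (∑-map suc (allFin n) f))

  ∑-allFin-1 : ∀ n → ∑ (allFin n) (λ _ → 1ℚ) ≡ ⌜ n ⌝
  ∑-allFin-1 zero = refl
  ∑-allFin-1 (suc n) = P.trans (∑-allFin n (λ _ → 1ℚ)) (cong (1ℚ +_) (∑-allFin-1 n))

  ∑-allFin-point : ∀ n (c : Fin n) (f : Fin n → ℚ) → ∑ (allFin n) (λ x → ⟦ x FinP.≟ c ⟧ * f x) ≡ f c
  ∑-allFin-point (suc n) zero f = P.trans (∑-allFin n _) (P.trans (cong₂ _+_ (*-identityˡ (f zero))
    (P.trans (∑-cong (allFin n) (λ x → *-zeroˡ (f (suc x)))) (∑-0 (allFin n)))) (+-identityʳ _))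
  ∑-allFin-point (suc n) (suc c) f = P.trans (∑-allFin n _) (P.trans (cong₂ _+_ (*-zeroˡ (f zero))
    (P.trans (∑-cong (allFin n) (λ x → cong (_* f (suc x)) (⟦⟧-⇔ (suc x FinP.≟ suc c) (x FinP.≟ c) FinP.suc-injective (cong suc)))) (∑-allFin-point n c (λ x → f (suc x))))) (+-identityˡ _))

  uniform-Fin : ∀ n → 1 ℕ.≤ n → Uniform (Fin n)
  uniform-Fin n@(suc k) _ = record
    { _≟_ = FinP._≟_ ; points = allFin n ; ω = w
    ; 0≤ω = subst (0ℚ ≤_) (P.trans (*-assoc w w ⌜ n ⌝) (P.trans (cong (w *_) w⌜n⌝) (*-identityʳ w))) (0≤* (0≤sq w) (0≤⌜⌝ n))
    ; total = P.trans (cong (w *_) (∑-allFin-1 n)) w⌜n⌝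
    ; point = ∑-allFin-point n }
    where
    w : ℚ
    w = proj₁ (reciprocal k)
    w⌜n⌝ : w * ⌜ n ⌝ ≡ 1ℚ
    w⌜n⌝ = proj₂ (reciprocal k)

-- A model of the given field with propositional equality.

module Model where

  open import Defs
  open Field
  open Cardinality using (uniform-Fin)
  open import Data.Nat as ℕ using (ℕ; zero; suc; z≤n; s≤s)
  import Data.Nat.Properties as ℕP
  open import Data.Fin using (Fin; zero; suc)
  import Data.Fin.Properties as FinP
  open import Data.List as List using (List; _∷_; length)
  open import Data.List.Relation.Unary.Any as Any using (Any)
  import Data.List.Relation.Unary.Any.Properties as AnyP
  open import Data.List.Relation.Unary.All as All using (All; _∷_)
  open import Data.List.Relation.Unary.AllPairs using (AllPairs; _∷_)
  open import Data.List.Membership.Propositional.Properties using (∈-lookup)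
  open import Data.Product using (_,_)
  open import Relation.Nullary using (¬_)
  open import Relation.Nullary.Negation using (contradiction)
  open import Relation.Binary.PropositionalEquality as P using (_≡_; refl; cong; cong₂)

  -- Replacing the elements of F by their positions in the list of elements turns ≈ into ≡.
  module Positions {q : ℕ} (F : FiniteField q) where
    open FiniteField F renaming (_+_ to _+ᶠ_; _*_ to _*ᶠ_; -_ to -ᶠ_; refl to ≈-refl; sym to ≈-sym; trans to ≈-trans; distinct to elements-distinct)

    K : Set
    K = Fin (length elements)

    val : K → Carrier
    val = List.lookup elements

    pos : Carrier → K
    pos x = Any.index (complete x)

    val-pos : ∀ x → x ≈ val (pos x)
    val-pos x = AnyP.lookup-index (complete x)

    lookup-injective : ∀ {xs : List Carrier} → AllPairs (λ x y → ¬ (x ≈ y)) xs → ∀ i j → List.lookup xs i ≈ List.lookup xs j → i ≡ j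
    lookup-injective (a ∷ as) zero zero e = refl
    lookup-injective {x ∷ xs} (a ∷ as) zero (suc j) e = contradiction e (All.lookup a (∈-lookup j))
    lookup-injective {x ∷ xs} (a ∷ as) (suc i) zero e = contradiction (≈-sym e) (All.lookup a (∈-lookup i))
    lookup-injective (a ∷ as) (suc i) (suc j) e = cong suc (lookup-injective as i j e)

    val-injective : ∀ {i j} → val i ≈ val j → i ≡ j
    val-injective {i} {j} = lookup-injective elements-distinct i j

    pos-val : ∀ i → pos (val i) ≡ i
    pos-val i = val-injective (≈-sym (val-pos (val i)))

    pos-cong : ∀ {x y} → x ≈ y → pos x ≡ pos y
    pos-cong {x} {y} e = val-injective (≈-trans (≈-sym (val-pos x)) (≈-trans e (val-pos y)))

    pos-injective : ∀ {x y} → pos x ≡ pos y → x ≈ y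
    pos-injective {x} {y} e = ≈-trans (val-pos x) (≈-trans (reflexive (cong val e)) (≈-sym (val-pos y)))

    infixl 6 _⊕_
    infixl 7 _⊗_
    _⊕_ _⊗_ : K → K → K
    i ⊕ j = pos (val i +ᶠ val j)
    i ⊗ j = pos (val i *ᶠ val j)

    pos-+ : ∀ x y → pos (x +ᶠ y) ≡ pos x ⊕ pos y
    pos-+ x y = pos-cong (+-cong (val-pos x) (val-pos y))

    pos-* : ∀ x y → pos (x *ᶠ y) ≡ pos x ⊗ pos y
    pos-* x y = pos-cong (*-cong (val-pos x) (val-pos y))

    val-⊕ : ∀ i j → val i +ᶠ val j ≈ val (i ⊕ j)
    val-⊕ i j = val-pos _

    val-⊗ : ∀ i j → val i *ᶠ val j ≈ val (i ⊗ j)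
    val-⊗ i j = val-pos _

    nonempty : 1 ℕ.≤ length elements
    nonempty = ℕP.≤-trans (s≤s z≤n) (FinP.toℕ<n (pos 0#))

    𝔽 : FinField
    𝔽 = record
      { K = K ; _⊕_ = _⊕_ ; _⊗_ = _⊗_ ; ⊖_ = λ i → pos (-ᶠ val i) ; 𝟘 = pos 0# ; 𝟙 = pos 1#
      ; isCommutativeRing = record
        { isRing = record
          { +-isAbelianGroup = record
            { isGroup = record
              { isMonoid = record
                { isSemigroup = record
                  { isMagma = record { isEquivalence = P.isEquivalence ; ∙-cong = cong₂ _⊕_ }
                  ; assoc = λ i j k → pos-cong (≈-trans (+-congʳ (≈-sym (val-⊕ i j))) (≈-trans (+-assoc (val i) (val j) (val k)) (+-congˡ (val-⊕ j k)))) }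
                ; identity = (λ i → to-pos (≈-trans (+-congʳ (≈-sym (val-pos 0#))) (+-identityˡ (val i))))
                           , (λ i → to-pos (≈-trans (+-congˡ (≈-sym (val-pos 0#))) (+-identityʳ (val i)))) }
              ; inverse = (λ i → pos-cong (≈-trans (+-congʳ (≈-sym (val-pos (-ᶠ val i)))) (-‿inverseˡ (val i))))
                        , (λ i → pos-cong (≈-trans (+-congˡ (≈-sym (val-pos (-ᶠ val i)))) (-‿inverseʳ (val i))))
              ; ⁻¹-cong = cong (λ i → pos (-ᶠ val i)) }
            ; comm = λ i j → pos-cong (+-comm (val i) (val j)) }
          ; *-cong = cong₂ _⊗_
          ; *-assoc = λ i j k → pos-cong (≈-trans (*-congʳ (≈-sym (val-⊗ i j))) (≈-trans (*-assoc (val i) (val j) (val k)) (*-congˡ (val-⊗ j k))))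
          ; *-identity = (λ i → to-pos (≈-trans (*-congʳ (≈-sym (val-pos 1#))) (*-identityˡ (val i))))
                       , (λ i → to-pos (≈-trans (*-congˡ (≈-sym (val-pos 1#))) (*-identityʳ (val i))))
          ; distrib = (λ i j k → pos-cong (≈-trans (*-congˡ (≈-sym (val-⊕ j k))) (≈-trans (distribˡ (val i) (val j) (val k)) (+-cong (val-⊗ i j) (val-⊗ i k)))))
                    , (λ i j k → pos-cong (≈-trans (*-congʳ (≈-sym (val-⊕ j k))) (≈-trans (distribʳ (val i) (val j) (val k)) (+-cong (val-⊗ j i) (val-⊗ k i))))) }
        ; *-comm = λ i j → pos-cong (*-comm (val i) (val j)) }
      ; 𝟙≢𝟘 = λ e → 1≉0 (pos-injective e)
      ; inverse = λ i i≢0 → let y , e = FiniteField.inverse F (val i) (λ z → i≢0 (P.trans (P.sym (pos-val i)) (pos-cong z)))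
          in pos y , pos-cong (≈-trans (*-congˡ (≈-sym (val-pos y))) e)
      ; uniform = uniform-Fin (length elements) nonempty }
      where
      to-pos : ∀ {x i} → x ≈ val i → pos x ≡ i
      to-pos {x} {i} e = P.trans (pos-cong e) (pos-val i)

-- Translation between coefficient lists and series.

module Transport where

  import Defs as D
  open Field
  open Series
  open Factor
  open Model
  open TypeMeans using (counts; weight; counts-here; counts-there; counts-low; counts-high)
  open import Data.Nat as ℕ using (ℕ; zero; suc; s≤s)
  import Data.Nat.Properties as ℕP
  open import Data.Fin using (Fin; zero; suc; toℕ; fromℕ<)
  import Data.Fin.Properties as FinP
  open import Data.Vec as Vec using (Vec; []; _∷_; lookup; reverse)
  import Data.Vec.Properties as VecP
  open import Data.List as List using (List; []; _∷_; length)
  import Data.List.Properties as ListP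
  open import Data.List.Relation.Unary.All using (All; []; _∷_)
  open import Data.List.Relation.Binary.Pointwise using ([]; _∷_)
  open import Data.Product using (Σ; ∃; _×_; _,_; proj₁; proj₂)
  open import Function.Bundles using (_⇔_; mk⇔)
  open import Relation.Nullary using (yes; no)
  open import Relation.Binary.PropositionalEquality

  counts-lookup : ∀ {m} k (s : Vec ℕ m) (i : Fin m) → counts k (Vec.toList s) (k ℕ.+ toℕ i) ≡ lookup s i
  counts-lookup k (x ∷ s) zero = trans (cong (counts k (x ∷ Vec.toList s)) (ℕP.+-identityʳ k)) (counts-here k x (Vec.toList s))
  counts-lookup k (x ∷ s) (suc i) = trans (cong (counts k (x ∷ Vec.toList s)) (ℕP.+-suc k (toℕ i)))
    (trans (counts-there k x (Vec.toList s) _ (λ e → ℕP.<⇒≢ (s≤s (ℕP.m≤m+n k (toℕ i))) (sym e))) (counts-lookup (suc k) s i))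

  module Translation {q : ℕ} (F : D.FiniteField q) where
    open D.FiniteField F using (Carrier; _≈_; 0#; 1#; reflexive) renaming (_+_ to _+ᶠ_; _*_ to _*ᶠ_)
    open Positions F
    open FinField 𝔽 using (𝟘; ⊕-identityˡ; ⊕-identityʳ; ⊗-zeroʳ)
    open PowerSeries 𝔽
    open Factorization 𝔽 hiding (Poly)

    infixl 6 _+ₚ_
    infixl 7 _*ₚ_
    infix 4 _≈ₚ_
    _+ₚ_ _*ₚ_ : List Carrier → List Carrier → List Carrier
    _+ₚ_ = D._+ₚ_ F
    _*ₚ_ = D._*ₚ_ F

    _≈ₚ_ : List Carrier → List Carrier → Set
    _≈ₚ_ = D._≈ₚ_ F

    coeffs : List Carrier → S
    coeffs [] i = 𝟘
    coeffs (a ∷ f) zero = pos a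
    coeffs (a ∷ f) (suc i) = coeffs f i

    coeffs-+ : ∀ f g → coeffs (f +ₚ g) ≋ coeffs f +ˢ coeffs g
    coeffs-+ [] g i = sym (⊕-identityˡ _)
    coeffs-+ (a ∷ f) [] i = sym (⊕-identityʳ _)
    coeffs-+ (a ∷ f) (b ∷ g) zero = pos-+ a b
    coeffs-+ (a ∷ f) (b ∷ g) (suc i) = coeffs-+ f g i

    coeffs-scale : ∀ a g i → coeffs (List.map (a *ᶠ_) g) i ≡ pos a ⊗ coeffs g i
    coeffs-scale a [] i = sym (⊗-zeroʳ (pos a))
    coeffs-scale a (b ∷ g) zero = pos-* a b
    coeffs-scale a (b ∷ g) (suc i) = coeffs-scale a g i

    coeffs-* : ∀ f g → coeffs (f *ₚ g) ≋ coeffs f · coeffs g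
    coeffs-* [] g i = sym (0· (coeffs g) i)
    coeffs-* (a ∷ []) g i = trans (coeffs-scale a g i) (trans (sym (ι· (pos a) (coeffs g) i)) (·-cong {ι (pos a)} {coeffs (a ∷ [])} {coeffs g} {coeffs g} (λ { zero → refl ; (suc j) → refl }) (λ _ → refl) i))
    coeffs-* (a ∷ f@(_ ∷ _)) g zero = trans (coeffs-+ (List.map (a *ᶠ_) g) (0# ∷ (f *ₚ g)) zero) (trans (cong (_⊕ 𝟘) (coeffs-scale a g zero)) (⊕-identityʳ _))
    coeffs-* (a ∷ f@(_ ∷ _)) g (suc i) = trans (coeffs-+ (List.map (a *ᶠ_) g) (0# ∷ (f *ₚ g)) (suc i)) (cong₂ _⊕_ (coeffs-scale a g (suc i)) (coeffs-* f g i))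

    length-+ : ∀ f g → length f ℕ.≤ length g → length (f +ₚ g) ≡ length g
    length-+ [] g le = refl
    length-+ (a ∷ f) (b ∷ g) (s≤s le) = cong suc (length-+ f g le)

    -- The list product has exactly the expected length, without surplus zeros, so `≈ₚ`, which also
    -- compares lengths, agrees for monic polynomials with equality of degrees and coefficients.
    length-* : ∀ a b f g → length f ≡ suc a → length g ≡ suc b → length (f *ₚ g) ≡ suc (a ℕ.+ b)
    length-* zero b (x ∷ []) g refl e = trans (ListP.length-map _ g) e
    length-* (suc a) b (x ∷ f@(_ ∷ _)) g e e′ = trans (length-+ (List.map (x *ᶠ_) g) (0# ∷ (f *ₚ g)) (subst₂ ℕ._≤_ (sym (trans (ListP.length-map _ g) e′)) (sym (cong suc rec)) (s≤s (ℕP.≤-trans (ℕP.m≤n+m b a) (ℕP.n≤1+n _))))) (cong suc rec)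
      where
      rec : length (f *ₚ g) ≡ suc (a ℕ.+ b)
      rec = length-* a b f g (ℕP.suc-injective e) e′

    ≈ₚ⇒length : ∀ {f g} → f ≈ₚ g → length f ≡ length g
    ≈ₚ⇒length [] = refl
    ≈ₚ⇒length (_ ∷ e) = cong suc (≈ₚ⇒length e)

    ≈ₚ⇒coeffs : ∀ {f g} → f ≈ₚ g → coeffs f ≋ coeffs g
    ≈ₚ⇒coeffs [] i = refl
    ≈ₚ⇒coeffs (x ∷ e) zero = pos-cong x
    ≈ₚ⇒coeffs (x ∷ e) (suc i) = ≈ₚ⇒coeffs e i

    coeffs⇒≈ₚ : ∀ f g → length f ≡ length g → coeffs f ≋ coeffs g → f ≈ₚ g
    coeffs⇒≈ₚ [] [] l e = []
    coeffs⇒≈ₚ (a ∷ f) (b ∷ g) l e = pos-injective (e 0) ∷ coeffs⇒≈ₚ f g (ℕP.suc-injective l) (λ i → e (suc i))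

    to : ∀ {d} → Vec Carrier d → Vec K d
    to = Vec.map pos

    from : ∀ {d} → Vec K d → Vec Carrier d
    from = Vec.map val

    to-from : ∀ {d} (v : Vec K d) → to (from v) ≡ v
    to-from [] = refl
    to-from (x ∷ v) = cong₂ _∷_ (pos-val x) (to-from v)

    monicPoly : ∀ {d} → Vec Carrier d → List Carrier
    monicPoly = D.monicPoly F

    length-monic : ∀ {d} (v : Vec Carrier d) → length (monicPoly v) ≡ suc d
    length-monic [] = refl
    length-monic (x ∷ v) = cong suc (length-monic v)

    coeffs-monic : ∀ {d} (v : Vec Carrier d) → coeffs (monicPoly v) ≋ mseq (to v)
    coeffs-monic [] zero = refl
    coeffs-monic [] (suc i) = refl
    coeffs-monic (x ∷ v) zero = refl
    coeffs-monic (x ∷ v) (suc i) = coeffs-monic v i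

    product⇒mul : ∀ {a b d} (g : Vec Carrier a) (h : Vec Carrier b) (f : Vec Carrier d) → monicPoly g *ₚ monicPoly h ≈ₚ monicPoly f → Mul (to g) (to h) (to f)
    product⇒mul {a} {b} g h f e = mul
      (ℕP.suc-injective (trans (sym (length-* a b (monicPoly g) (monicPoly h) (length-monic g) (length-monic h))) (trans (≈ₚ⇒length e) (length-monic f))))
      λ i → trans (sym (·-cong (coeffs-monic g) (coeffs-monic h) i)) (trans (sym (coeffs-* (monicPoly g) (monicPoly h) i)) (trans (≈ₚ⇒coeffs e i) (coeffs-monic f i)))

    mul⇒product : ∀ {a b d} (g : Vec Carrier a) (h : Vec Carrier b) (f : Vec Carrier d) → Mul (to g) (to h) (to f) → monicPoly g *ₚ monicPoly h ≈ₚ monicPoly f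
    mul⇒product {a} {b} g h f (mul d e) = coeffs⇒≈ₚ _ _
      (trans (length-* a b (monicPoly g) (monicPoly h) (length-monic g) (length-monic h)) (trans (cong suc d) (sym (length-monic f))))
      λ i → trans (coeffs-* (monicPoly g) (monicPoly h) i) (trans (·-cong (coeffs-monic g) (coeffs-monic h) i) (trans (e i) (sym (coeffs-monic f i))))

    irreducible⇒irr : ∀ {d} (f : Vec Carrier d) → D.Irreducible F f → Irr (to f)
    irreducible⇒irr f (1≤d , h) = 1≤d , λ a b g g′ 1≤a 1≤b m → h a b (from g) (from g′) 1≤a 1≤b
      (mul⇒product (from g) (from g′) f (subst₂ (λ x y → Mul x y (to f)) (sym (to-from g)) (sym (to-from g′)) m))

    irr⇒irreducible : ∀ {d} (f : Vec Carrier d) → Irr (to f) → D.Irreducible F f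
    irr⇒irreducible f (1≤d , h) = 1≤d , λ a b g g′ 1≤a 1≤b e → h a b (to g) (to g′) 1≤a 1≤b (product⇒mul g g′ f e)

    toList : List (Σ ℕ (Vec Carrier)) → List (Factorization.Poly 𝔽)
    toList = List.map (λ f → proj₁ f , to (proj₂ f))

    fromList : List (Factorization.Poly 𝔽) → List (Σ ℕ (Vec Carrier))
    fromList = List.map (λ f → proj₁ f , from (proj₂ f))

    toList-fromList : ∀ fs → toList (fromList fs) ≡ fs
    toList-fromList [] = refl
    toList-fromList ((d , f) ∷ fs) = cong₂ _∷_ (cong (d ,_) (to-from f)) (toList-fromList fs)

    irreducibles⇒ : ∀ fs → All (λ f → D.Irreducible F (proj₂ f)) fs → AllIrr (toList fs)
    irreducibles⇒ [] [] = []
    irreducibles⇒ ((_ , f) ∷ fs) (i ∷ is) = irreducible⇒irr f i ∷ irreducibles⇒ fs is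

    irreducibles⇐ : ∀ fs → AllIrr (toList fs) → All (λ f → D.Irreducible F (proj₂ f)) fs
    irreducibles⇐ [] [] = []
    irreducibles⇐ ((_ , f) ∷ fs) (i ∷ is) = irr⇒irreducible f i ∷ irreducibles⇐ fs is

    prod-exists : ∀ fs → ∃ λ m → ∃ λ (Q : Vec K m) → Prod (toList fs) Q × length (D.prodₚ F fs) ≡ suc m × coeffs (D.prodₚ F fs) ≋ mseq Q
    prod-exists [] = 0 , [] , nil , refl , λ { zero → refl ; (suc i) → refl }
    prod-exists ((a , f) ∷ fs) with prod-exists fs
    ... | m , Q , ps , l , e = a ℕ.+ m , to f ⊙ Q , cons (⊙-mul (to f) Q) ps , length-* a m (monicPoly f) (D.prodₚ F fs) (length-monic f) l ,
      λ i → trans (coeffs-* (monicPoly f) (D.prodₚ F fs) i) (trans (·-cong (coeffs-monic f) e i) (product≡ (⊙-mul (to f) Q) i))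

    prod⇒ : ∀ {n} fs (p : Vec Carrier n) → D.prodₚ F fs ≈ₚ monicPoly p → Prod (toList fs) (to p)
    prod⇒ fs p e with prod-exists fs
    ... | m , Q , ps , l , c with ℕP.suc-injective (trans (sym l) (trans (≈ₚ⇒length e) (length-monic p)))
    ... | refl = subst (Prod (toList fs)) (mseq-inj (λ i → trans (sym (c i)) (trans (≈ₚ⇒coeffs e i) (coeffs-monic p i)))) ps

    prod-unique : ∀ {m n fs} {P : Vec K m} {Q : Vec K n} → Prod fs P → Prod fs Q → (m ≡ n) × mseq P ≋ mseq Q
    prod-unique nil nil = refl , λ _ → refl
    prod-unique (cons {f = f} (mul d e) ps) (cons (mul d′ e′) qs) with prod-unique ps qs
    ... | refl , c = trans (sym d) d′ , λ i → trans (sym (e i)) (trans (·-cong {mseq f} {mseq f} (λ _ → refl) c i) (e′ i))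

    prod⇐ : ∀ {n} fs (p : Vec Carrier n) → Prod (toList fs) (to p) → D.prodₚ F fs ≈ₚ monicPoly p
    prod⇐ fs p ps with prod-exists fs
    ... | m , Q , qs , l , c with prod-unique qs ps
    ... | refl , c′ = coeffs⇒≈ₚ _ _ (trans l (sym (length-monic p))) (λ i → trans (c i) (trans (c′ i) (sym (coeffs-monic p i))))

    countDeg≡count : ∀ i fs → D.countDeg F i fs ≡ count i (toList fs)
    countDeg≡count i [] = refl
    countDeg≡count i ((a , f) ∷ fs) with a ℕ.≟ i
    ... | yes e = trans (cong length (ListP.filter-accept (λ g → proj₁ g ℕ.≟ i) {x = a , f} {xs = fs} e)) (trans (cong suc (countDeg≡count i fs)) (sym (count-yes {i} {a} {to f} (toList fs) e)))
    ... | no ne = trans (cong length (ListP.filter-reject (λ g → proj₁ g ℕ.≟ i) {x = a , f} {xs = fs} ne)) (trans (countDeg≡count i fs) (sym (count-no {i} {a} {to f} (toList fs) ne)))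

    toList-∷ʳ : ∀ {m} (v : Vec Carrier m) x → Vec.toList (v Vec.∷ʳ x) ≡ Vec.toList v List.∷ʳ x
    toList-∷ʳ [] x = refl
    toList-∷ʳ (y ∷ v) x = cong (y ∷_) (toList-∷ʳ v x)

    toList-reverse : ∀ {m} (v : Vec Carrier m) → List.reverse (Vec.toList v) ≡ Vec.toList (reverse v)
    toList-reverse [] = refl
    toList-reverse (x ∷ v) = trans (ListP.unfold-reverse x (Vec.toList v)) (trans (cong (List._∷ʳ x) (toList-reverse v))
      (trans (sym (toList-∷ʳ (reverse v) x)) (cong Vec.toList (sym (VecP.reverse-∷ x v)))))

    charPoly-monic : ∀ {n} (ξ : Vec Carrier n) → D.charPoly F ξ ≡ monicPoly (reverse ξ)
    charPoly-monic ξ = cong (List._++ (1# ∷ [])) (toList-reverse ξ)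

    -- `HasSplitType` fixes the counts in degrees 1 to `n` only. Degree 0 does not occur among
    -- irreducibles, and a degree above `n` would exceed the total degree.
    split-type : ∀ {n} (ξ : Vec Carrier n) (s : Vec ℕ n) → weight 1 (Vec.toList s) ≡ n →
      D.HasSplitType F (D.charPoly F ξ) s ⇔ HasType (reverse (to ξ)) (counts 1 (Vec.toList s))
    split-type {n} ξ s w = mk⇔ forth back
      where
      to-reverse : to (reverse ξ) ≡ reverse (to ξ)
      to-reverse = VecP.map-reverse pos ξ
      S′ : ℕ → ℕ
      S′ = counts 1 (Vec.toList s)
      forth : D.HasSplitType F (D.charPoly F ξ) s → HasType (reverse (to ξ)) S′
      forth (fs , is , e , c) = toList fs , ifs , ps , at
        where
        ifs : AllIrr (toList fs)
        ifs = irreducibles⇒ fs is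
        ps : Prod (toList fs) (reverse (to ξ))
        ps = subst (Prod (toList fs)) to-reverse (prod⇒ fs (reverse ξ) (subst (D.prodₚ F fs ≈ₚ_) (charPoly-monic ξ) e))
        at : ∀ i → count i (toList fs) ≡ S′ i
        at zero = trans (count-0 (toList fs) ifs) (sym (counts-low 1 (Vec.toList s) 0 ℕP.≤-refl))
        at (suc i) with i ℕ.<? n
        ... | yes lt = subst (λ j → count (suc j) (toList fs) ≡ S′ (suc j)) (FinP.toℕ-fromℕ< lt)
              (trans (sym (countDeg≡count (suc (toℕ (fromℕ< lt))) fs)) (trans (c (fromℕ< lt)) (sym (counts-lookup 1 s (fromℕ< lt)))))
        ... | no ge = trans (count-high (suc i) (toList fs) (subst (ℕ._< suc i) (sym (degrees-prod ps)) (s≤s (ℕP.≮⇒≥ ge))))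
              (sym (counts-high 1 (Vec.toList s) (suc i) (subst (ℕ._< suc i) (sym w) (s≤s (ℕP.≮⇒≥ ge)))))
      back : HasType (reverse (to ξ)) S′ → D.HasSplitType F (D.charPoly F ξ) s
      back (fs , ifs , ps , c) = fromList fs , irreducibles⇐ (fromList fs) (subst AllIrr (sym (toList-fromList fs)) ifs) ,
        subst (D.prodₚ F (fromList fs) ≈ₚ_) (sym (charPoly-monic ξ)) (prod⇐ (fromList fs) (reverse ξ) (subst₂ (λ gs P → Prod gs P) (sym (toList-fromList fs)) (sym to-reverse) ps)) ,
        λ i → trans (countDeg≡count (suc (toℕ i)) (fromList fs)) (trans (cong (count (suc (toℕ i))) (toList-fromList fs)) (trans (c (suc (toℕ i))) (counts-lookup 1 s i)))

-- Counting tuples and the final estimate.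

module Tuples where

  import Defs as D
  open Rat
  open Mean
  open Field
  open Averages
  open Claim
  open Density
  open Cardinality
  open Model
  open Factor
  open Transport
  open TypeMeans
  open Combine
  open import Data.Nat as ℕ using (ℕ; zero; suc; z≤n; s≤s)
  import Data.Nat.Properties as ℕP
  import Data.Integer as ℤ
  import Data.Integer.Properties as ℤP
  open import Data.Fin using (zero; suc)
  open import Data.Vec as Vec using (Vec; []; _∷_; lookup; reverse)
  open import Data.Vec.Relation.Unary.All using ([]; _∷_)
  open import Data.List as List using (List; []; _∷_; length)
  open import Data.List.Relation.Unary.All using (All; []; _∷_)
  open import Data.List.Relation.Unary.AllPairs using (AllPairs; []; _∷_)
  open import Data.Product using (∃; _×_; _,_; proj₁; proj₂)
  open import Data.Sum using (inj₁; inj₂)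
  open import Function.Bundles using (_⇔_; Equivalence)
  open import Relation.Nullary using (¬_; yes; no; Dec)
  open import Relation.Nullary.Negation using (contradiction)
  open import Relation.Binary.PropositionalEquality
  open import Tactic.RingSolver using (solve-∀)
  open import Data.Rational.Properties using (module ≤-Reasoning)

  ⌜⌝-cancel-≤ : ∀ a b → ⌜ a ⌝ ≤ ⌜ b ⌝ → a ℕ.≤ b
  ⌜⌝-cancel-≤ zero b p = z≤n
  ⌜⌝-cancel-≤ (suc a) zero p = contradiction (≤-antisym (≤-trans (≤-reflexive (sym (+-identityʳ 1ℚ))) (≤-trans (+-mono-≤ (≤-refl {1ℚ}) (0≤⌜⌝ a)) p)) 0≤1) λ ()
  ⌜⌝-cancel-≤ (suc a) (suc b) p = s≤s (⌜⌝-cancel-≤ a b (≤-from _ (≤-diff p) (lem ⌜ a ⌝ ⌜ b ⌝)))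
    where
    opaque
      unfolding _+_
      lem : ∀ a b → b - a ≡ 1ℚ + b - (1ℚ + a)
      lem = solve-∀ ℚ-ring

  square-distance : ∀ a b d → (⌜ a ⌝ - ⌜ b ⌝) * (⌜ a ⌝ - ⌜ b ⌝) ≤ ⌜ d ⌝ → (ℤ.+ a ℤ.- ℤ.+ b) ℤ.^ 2 ℤ.≤ ℤ.+ d
  square-distance a b d p with ℕP.≤-total b a
  ... | inj₁ b≤a = subst (ℤ._≤ ℤ.+ d) (sym square≡) (ℤ.+≤+ (⌜⌝-cancel-≤ (e ℕ.* e) d (≤-trans (≤-reflexive (trans (⌜⌝-* e e) (cong (λ x → x * x) e≡))) p)))
    where
    e : ℕ
    e = a ℕ.∸ b
    e≡ : ⌜ e ⌝ ≡ ⌜ a ⌝ - ⌜ b ⌝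
    e≡ = trans (lem ⌜ e ⌝ ⌜ b ⌝) (cong (_- ⌜ b ⌝) (trans (sym (⌜⌝-+ e b)) (cong ⌜_⌝ (ℕP.m∸n+n≡m b≤a))))
      where
      opaque
        unfolding _+_
        lem : ∀ x y → x ≡ x + y - y
        lem = solve-∀ ℚ-ring
    square≡ : (ℤ.+ a ℤ.- ℤ.+ b) ℤ.^ 2 ≡ ℤ.+ (e ℕ.* e)
    square≡ = trans (cong (ℤ._^ 2) (trans (ℤP.m-n≡m⊖n a b) (ℤP.⊖-≥ b≤a))) (trans (cong (λ i → ℤ.+ e ℤ.* i) (ℤP.*-identityʳ (ℤ.+ e))) (sym (ℤP.pos-* e e)))
  ... | inj₂ a≤b = subst (ℤ._≤ ℤ.+ d) (sym square≡) (ℤ.+≤+ (⌜⌝-cancel-≤ (e ℕ.* e) d (≤-trans (≤-reflexive (trans (⌜⌝-* e e) (trans (cong (λ x → x * x) e≡) (flip ⌜ a ⌝ ⌜ b ⌝)))) p)))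
    where
    opaque
      unfolding _+_
      flip : ∀ x y → (y - x) * (y - x) ≡ (x - y) * (x - y)
      flip = solve-∀ ℚ-ring
    e : ℕ
    e = b ℕ.∸ a
    e≡ : ⌜ e ⌝ ≡ ⌜ b ⌝ - ⌜ a ⌝
    e≡ = trans (lem ⌜ e ⌝ ⌜ a ⌝) (cong (_- ⌜ a ⌝) (trans (sym (⌜⌝-+ e a)) (cong ⌜_⌝ (ℕP.m∸n+n≡m a≤b))))
      where
      opaque
        unfolding _+_
        lem : ∀ x y → x ≡ x + y - y
        lem = solve-∀ ℚ-ring
    neg-square : ∀ i → (ℤ.- i) ℤ.* (ℤ.- i) ≡ i ℤ.* i
    neg-square i = trans (sym (ℤP.neg-distribˡ-* i (ℤ.- i))) (trans (cong ℤ.-_ (sym (ℤP.neg-distribʳ-* i i))) (ℤP.neg-involutive _))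
    square≡ : (ℤ.+ a ℤ.- ℤ.+ b) ℤ.^ 2 ≡ ℤ.+ (e ℕ.* e)
    square≡ = trans (cong (ℤ._^ 2) (trans (ℤP.m-n≡m⊖n a b) (ℤP.⊖-≤ a≤b)))
      (trans (cong (λ i → (ℤ.- ℤ.+ e) ℤ.* i) (ℤP.*-identityʳ (ℤ.- ℤ.+ e))) (trans (neg-square (ℤ.+ e)) (sym (ℤP.pos-* e e))))

  -- weightedSum and splitDenom recurse through local functions of Defs; only unification can name these.
  mutual
    weight-go denom-go : ∀ {n} → Vec ℕ n → ℕ → List ℕ → ℕ
    weight-go s = _
    denom-go s = _

    weightedSum≡ : ∀ {n} (s : Vec ℕ n) → D.weightedSum s ≡ weight 1 (Vec.toList s)
    weightedSum≡ s with Vec.toList s | 1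
    ... | l | k = weight-unique (weight-go s) (λ _ → refl) (λ _ _ _ → refl) k l
      where
      weight-unique : (g : ℕ → List ℕ → ℕ) → (∀ k → g k [] ≡ 0) → (∀ k x xs → g k (x ∷ xs) ≡ k ℕ.* x ℕ.+ g (suc k) xs) → ∀ k xs → g k xs ≡ weight k xs
      weight-unique g p r k [] = p k
      weight-unique g p r k (x ∷ xs) = trans (r k x xs) (cong (k ℕ.* x ℕ.+_) (weight-unique g p r (suc k) xs))

    splitDenom≡ : ∀ {n} (s : Vec ℕ n) → D.splitDenom s ≡ denom 1 (Vec.toList s)
    splitDenom≡ s with Vec.toList s | 1
    ... | l | k = denom-unique (denom-go s) (λ _ → refl) (λ _ _ _ → refl) k l
      where
      denom-unique : (g : ℕ → List ℕ → ℕ) → (∀ k → g k [] ≡ 1) → (∀ k x xs → g k (x ∷ xs) ≡ (k ℕ.^ x) ℕ.* (x ℕ.!) ℕ.* g (suc k) xs) → ∀ k xs → g k xs ≡ denom k xs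
      denom-unique g p r k [] = p k
      denom-unique g p r k (x ∷ xs) = trans (r k x xs) (cong ((k ℕ.^ x) ℕ.* (x ℕ.!) ℕ.*_) (denom-unique g p r (suc k) xs))

  -- `CountOf` carries no decision procedure. An equivalent decidable proposition supplies the
  -- indicator, and the derivation of the count fixes its value at each entry.
  count-indicator : ∀ {A : Set} {P : A → Set} (Q? : ∀ x → ∃ λ (B : Set) → Dec B × (P x ⇔ B)) {xs N} → D.CountOf P xs N → ⌜ N ⌝ ≡ ∑ xs (λ x → ⟦ proj₁ (proj₂ (Q? x)) ⟧)
  count-indicator Q? D.c-nil = refl
  count-indicator Q? (D.c-yes {x} p c) = cong₂ _+_ (sym (⟦⟧-yes (proj₁ (proj₂ (Q? x))) (Equivalence.to (proj₂ (proj₂ (Q? x))) p))) (count-indicator Q? c)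
  count-indicator Q? (D.c-no {x} np c) = trans (count-indicator Q? c) (trans (sym (+-identityˡ _)) (cong₂ _+_ (sym (⟦⟧-no (proj₁ (proj₂ (Q? x))) (λ b → np (Equivalence.from (proj₂ (proj₂ (Q? x))) b)))) refl))

  module TupleCount {q : ℕ} (F : D.FiniteField q) where
    open D.FiniteField F using (Carrier; _≈_; elements; card)
    open Positions F
    open Translation F using (to)
    open Factorization 𝔽 using (HasType; hasType?)
    open Products 𝔽 using (Family; Π)
    open Space 𝔽 using (0v)
    open FinField 𝔽 using (uniform)
    module 𝐊 = Uniform uniform
    open 𝐊 using (ω; points)
    open VecSpace uniform

    -- The number of occurrences; for a list of distinct elements it is the indicator of the set,
    -- with values in [0, 1] as the test functions require.
    membership : List Carrier → K → ℚ
    membership U x = ∑ U (λ u → ⟦ x 𝐊.≟ pos u ⟧)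

    0≤membership : ∀ U x → 0ℚ ≤ membership U x
    0≤membership U x = ∑-nonneg U (λ u → 0≤⟦⟧ (x 𝐊.≟ pos u))

    membership≤1 : ∀ U → AllPairs (λ x y → ¬ (x ≈ y)) U → ∀ x → membership U x ≤ 1ℚ
    membership≤1 [] [] x = 0≤1
    membership≤1 (u ∷ U) (a ∷ as) x = go (x 𝐊.≟ pos u)
      where
      absent : ∀ {V} → All (λ y → ¬ (u ≈ y)) V → ∑ V (λ v → ⟦ pos u 𝐊.≟ pos v ⟧) ≡ 0ℚ
      absent [] = refl
      absent {v ∷ V} (n ∷ ns) = trans (cong₂ _+_ (⟦⟧-no (pos u 𝐊.≟ pos v) (λ e → n (pos-injective e))) (absent ns)) (+-identityˡ 0ℚ)
      go : (d : Dec (x ≡ pos u)) → membership (u ∷ U) x ≤ 1ℚ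
      go (yes refl) = ≤-reflexive (trans (cong₂ _+_ (⟦⟧-yes (pos u 𝐊.≟ pos u) refl) (absent a)) (+-identityʳ 1ℚ))
      go (no ne) = ≤-trans (≤-reflexive (trans (cong (_+ membership U x) (⟦⟧-no (x 𝐊.≟ pos u) ne)) (+-identityˡ _))) (membership≤1 U as x)

    ∑-membership : ∀ U g → ∑ U (λ u → g (pos u)) ≡ ∑ points (λ x → membership U x * g x)
    ∑-membership U g = begin
      ∑ U (λ u → g (pos u)) ≡⟨ ∑-cong U (λ u → sym (𝐊.point (pos u) g)) ⟩
      ∑ U (λ u → ∑ points (λ x → ⟦ x 𝐊.≟ pos u ⟧ * g x)) ≡⟨ ∑-swap U points _ ⟩
      ∑ points (λ x → ∑ U (λ u → ⟦ x 𝐊.≟ pos u ⟧ * g x))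
        ≡⟨ ∑-cong points (λ x → trans (∑-cong U (λ u → *-comm _ (g x))) (trans (∑-*ˡ U (g x) _) (*-comm (g x) _))) ⟩
      ∑ points (λ x → membership U x * g x) ∎
      where open ≡-Reasoning

    E-membership : ∀ U → 𝐊.E (membership U) ≡ ω * ⌜ length U ⌝
    E-membership U = cong (ω *_) (trans (∑-cong points (λ x → sym (*-identityʳ _))) (trans (sym (∑-membership U (λ _ → 1ℚ))) (ones U)))
      where
      ones : ∀ (U : List Carrier) → ∑ U (λ _ → 1ℚ) ≡ ⌜ length U ⌝
      ones [] = refl
      ones (u ∷ U) = cong (1ℚ +_) (ones U)

    family : ∀ {n} → Vec (List Carrier) n → Family n
    family Us i = membership (lookup Us i)

    ∑-allTuples : ∀ {n} (Us : Vec (List Carrier) n) φ → ∑ (D.allTuples F Us) (λ ξ → φ (to ξ)) ≡ ∑ (vecs n) (λ v → φ v * Π (family Us) v)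
    ∑-allTuples [] φ = cong (_+ 0ℚ) (sym (*-identityʳ (φ [])))
    ∑-allTuples {suc n} (U ∷ Us) φ = begin
      ∑ (D.allTuples F (U ∷ Us)) (λ ξ → φ (to ξ)) ≡⟨ ∑-concatMap _ U _ ⟩
      ∑ U (λ u → ∑ (List.map (u ∷_) (D.allTuples F Us)) (λ ξ → φ (to ξ))) ≡⟨ ∑-cong U (λ u → trans (∑-map (u ∷_) (D.allTuples F Us) _) (∑-allTuples Us (λ v → φ (pos u ∷ v)))) ⟩
      ∑ U (λ u → ∑ (vecs n) (λ v → φ (pos u ∷ v) * Π (family Us) v)) ≡⟨ ∑-membership U (λ x → ∑ (vecs n) (λ v → φ (x ∷ v) * Π (family Us) v)) ⟩
      ∑ points (λ x → membership U x * ∑ (vecs n) (λ v → φ (x ∷ v) * Π (family Us) v))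
        ≡⟨ ∑-cong points (λ x → trans (sym (∑-*ˡ (vecs n) (membership U x) _)) (∑-cong (vecs n) (λ v → lem (membership U x) (φ (x ∷ v)) (Π (family Us) v)))) ⟩
      ∑ points (λ x → ∑ (vecs n) (λ v → φ (x ∷ v) * Π (family (U ∷ Us)) (x ∷ v))) ≡⟨ ∑-vecs n _ ⟨
      ∑ (vecs (suc n)) (λ v → φ v * Π (family (U ∷ Us)) v) ∎
      where
      open ≡-Reasoning
      opaque
        unfolding _+_
        lem : ∀ a b c → a * (b * c) ≡ b * (a * c)
        lem = solve-∀ ℚ-ring

    Π-means : ∀ {n} (Us : Vec (List Carrier) n) → Π (λ i _ → 𝐊.E (family Us i)) (0v {n}) ≡ ω ^^ n * ⌜ D.prodCard Us ⌝
    Π-means [] = sym (trans (*-identityˡ _) (+-identityʳ 1ℚ))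
    Π-means {suc n} (U ∷ Us) = trans (cong₂ _*_ (E-membership U) (Π-means Us)) (trans (lem ω ⌜ length U ⌝ (ω ^^ n) ⌜ D.prodCard Us ⌝) (cong (ω * ω ^^ n *_) (sym (⌜⌝-* (length U) (D.prodCard Us)))))
      where
      opaque
        unfolding _+_
        lem : ∀ a b c d → a * b * (c * d) ≡ a * c * (b * d)
        lem = solve-∀ ℚ-ring

    ωq : ω * ⌜ q ⌝ ≡ 1ℚ
    ωq = trans (cong (λ k → ω * ⌜ k ⌝) (sym card)) (trans (cong (ω *_) (sym (∑-allFin-1 (length elements)))) (trans (cong (λ xs → ω * ∑ xs (λ _ → 1ℚ)) (sym points≡)) 𝐊.total))
      where
      points≡ : points ≡ List.allFin (length elements)
      points≡ = go (length elements) nonempty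
        where
        go : ∀ n (p : 1 ℕ.≤ n) → Uniform.points (uniform-Fin n p) ≡ List.allFin n
        go (suc k) p = refl

    ω^q^ : ∀ k → ω ^^ k * ⌜ q ℕ.^ k ⌝ ≡ 1ℚ
    ω^q^ zero = trans (*-identityˡ _) (+-identityʳ 1ℚ)
    ω^q^ (suc k) = trans (cong (ω * ω ^^ k *_) (⌜⌝-* q (q ℕ.^ k))) (trans (lem ω (ω ^^ k) ⌜ q ⌝ ⌜ q ℕ.^ k ⌝) (trans (cong₂ _*_ ωq (ω^q^ k)) (*-identityˡ 1ℚ)))
      where
      opaque
        unfolding _+_
        lem : ∀ a b c d → a * b * (c * d) ≡ a * c * (b * d)
        lem = solve-∀ ℚ-ring

    module _ (m : ℕ) (s : Vec ℕ (suc m)) (weight≡ : suc m ≡ weight 1 (Vec.toList s)) where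
      n : ℕ
      n = suc m
      module 𝐂 = Combination 𝔽 m (Vec.toList s) weight≡

      -- Multiplication by `ω ^^ n` turns counts into the means of `combined`. Undoing it in the
      -- square costs `q^(2 n)`, and the factor `ω` of the bound lowers the exponent to
      -- `2 n - 1 = m + suc m`.
      tuple-bound : (Us : Vec (List Carrier) n) → (∀ i → AllPairs (λ x y → ¬ (x ≈ y)) (lookup Us i)) →
        ∀ N → D.CountOf (λ ξ → D.HasSplitType F (D.charPoly F ξ) s) (D.allTuples F Us) N →
        (⌜ denom 1 (Vec.toList s) ℕ.* N ⌝ - ⌜ D.prodCard Us ⌝) * (⌜ denom 1 (Vec.toList s) ℕ.* N ⌝ - ⌜ D.prodCard Us ⌝)
          ≤ constant n * (𝐂.z * 𝐂.z * ⌜ q ℕ.^ (m ℕ.+ suc m) ⌝)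
      tuple-bound Us distinct N cnt = begin
          X * X ≡⟨ lem₁ X W Q (ω^q^ n) ⟩
          Q * Q * (W * X * (W * X)) ≡⟨ cong (λ y → Q * Q * (y * y)) WX ⟩
          Q * Q * ((𝐂.z * G - M) * (𝐂.z * G - M)) ≤⟨ *-monoˡ (0≤sq Q) (𝐂.combined f (λ i → 0≤membership (lookup Us i)) (λ i → membership≤1 (lookup Us i) (distinct i))) ⟩
          Q * Q * (constant n * (𝐂.z * 𝐂.z * ω)) ≡⟨ cong₂ (λ a b → a * b * (constant n * (𝐂.z * 𝐂.z * ω))) Q≡ refl ⟩
          ⌜ q ⌝ * Q′ * Q * (constant n * (𝐂.z * 𝐂.z * ω)) ≡⟨ lem₂ ⌜ q ⌝ Q′ Q (constant n) (𝐂.z * 𝐂.z) ω ⟩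
          constant n * (𝐂.z * 𝐂.z * (Q′ * Q)) * (ω * ⌜ q ⌝) ≡⟨ trans (cong (constant n * (𝐂.z * 𝐂.z * (Q′ * Q)) *_) ωq) (*-identityʳ _) ⟩
          constant n * (𝐂.z * 𝐂.z * (Q′ * Q)) ≡⟨ cong (λ y → constant n * (𝐂.z * 𝐂.z * y)) (trans (sym (⌜⌝-* (q ℕ.^ m) (q ℕ.^ n))) (cong ⌜_⌝ (sym (ℕP.^-distribˡ-+-* q m n)))) ⟩
          constant n * (𝐂.z * 𝐂.z * ⌜ q ℕ.^ (m ℕ.+ suc m) ⌝) ∎
        where
        open ≤-Reasoning
        f : Family n
        f = family Us
        G M W Q Q′ X : ℚ
        G = 𝐂.G f (λ i → 0≤membership (lookup Us i)) (λ i → membership≤1 (lookup Us i) (distinct i))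
        M = 𝐂.M f (λ i → 0≤membership (lookup Us i)) (λ i → membership≤1 (lookup Us i) (distinct i))
        W = ω ^^ n
        Q = ⌜ q ℕ.^ n ⌝
        Q′ = ⌜ q ℕ.^ m ⌝
        X = ⌜ denom 1 (Vec.toList s) ℕ.* N ⌝ - ⌜ D.prodCard Us ⌝
        Q≡ : Q ≡ ⌜ q ⌝ * Q′
        Q≡ = ⌜⌝-* q (q ℕ.^ m)
        N≡ : ⌜ N ⌝ ≡ ∑ (vecs n) (λ v → 𝐂.typed v * Π f v)
        N≡ = trans (count-indicator (λ ξ → HasType (reverse (to ξ)) 𝐂.s , hasType? (reverse (to ξ)) 𝐂.s 𝐂.s-high , Translation.split-type F ξ s (sym weight≡)) cnt) (∑-allTuples Us 𝐂.typed)
        WX : W * X ≡ 𝐂.z * G - M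
        WX = trans (lem W ⌜ denom 1 (Vec.toList s) ℕ.* N ⌝ ⌜ D.prodCard Us ⌝) (cong₂ _-_
            (trans (cong (W *_) (⌜⌝-* (denom 1 (Vec.toList s)) N)) (trans (lem′ W 𝐂.z ⌜ N ⌝) (cong (λ y → 𝐂.z * (W * y)) N≡)))
            (sym (Π-means Us)))
          where
          opaque
            unfolding _+_
            lem : ∀ w a b → w * (a - b) ≡ w * a - w * b
            lem = solve-∀ ℚ-ring
          opaque
            unfolding _+_
            lem′ : ∀ w z a → w * (z * a) ≡ z * (w * a)
            lem′ = solve-∀ ℚ-ring
        lem₁ : ∀ x w q → w * q ≡ 1ℚ → x * x ≡ q * q * (w * x * (w * x))
        lem₁ x w q e = trans (sym (trans (cong (λ y → y * y * (x * x)) e) (trans (cong (_* (x * x)) (*-identityˡ 1ℚ)) (*-identityˡ _)))) (lem x w q)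
          where
          opaque
            unfolding _+_
            lem : ∀ x w q → w * q * (w * q) * (x * x) ≡ q * q * (w * x * (w * x))
            lem = solve-∀ ℚ-ring
        opaque
          unfolding _+_
          lem₂ : ∀ a b c d e w → a * b * c * (d * (e * w)) ≡ d * (e * (b * c)) * (w * a)
          lem₂ = solve-∀ ℚ-ring

  -- The statement has the square of the constant; an integer above `constant n` suffices, since a
  -- natural number is at most its own square.
  bound-constant : ℕ → ℕ
  bound-constant n = proj₁ (ceiling (constant n))

  module _ {q m : ℕ} (F : D.FiniteField q) where
    open D.FiniteField F using (Carrier; _≈_)

    split-type-count : (s : Vec ℕ (suc m)) → D.weightedSum s ≡ suc m →
      (Us : Vec (List Carrier) (suc m)) → (∀ i → AllPairs (λ x y → ¬ (x ≈ y)) (lookup Us i)) →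
      ∀ N → D.CountOf (λ ξ → D.HasSplitType F (D.charPoly F ξ) s) (D.allTuples F Us) N → let C = bound-constant (suc m) in
      (ℤ.+ (D.splitDenom s ℕ.* N) ℤ.- ℤ.+ D.prodCard Us) ℤ.^ 2 ℤ.≤ ℤ.+ (C ℕ.* C ℕ.* D.splitDenom s ℕ.* D.splitDenom s ℕ.* q ℕ.^ (2 ℕ.* suc m ℕ.∸ 1))
    split-type-count s w Us distinct N cnt = square-distance (D.splitDenom s ℕ.* N) (D.prodCard Us) _ (begin
        (⌜ D.splitDenom s ℕ.* N ⌝ - P) * (⌜ D.splitDenom s ℕ.* N ⌝ - P) ≡⟨ cong (λ d → (⌜ d ℕ.* N ⌝ - P) * (⌜ d ℕ.* N ⌝ - P)) (splitDenom≡ s) ⟩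
        (⌜ d ℕ.* N ⌝ - P) * (⌜ d ℕ.* N ⌝ - P) ≤⟨ TupleCount.tuple-bound F m s (trans (sym w) (weightedSum≡ s)) Us distinct N cnt ⟩
        constant (suc m) * (⌜ d ⌝ * ⌜ d ⌝ * ⌜ q ℕ.^ (m ℕ.+ suc m) ⌝)
          ≤⟨ *-monoʳ (0≤* (0≤* (0≤⌜⌝ d) (0≤⌜⌝ d)) (0≤⌜⌝ (q ℕ.^ (m ℕ.+ suc m)))) (≤-trans (proj₂ (ceiling (constant (suc m)))) (⌜⌝-mono (n≤n*n C))) ⟩
        ⌜ C ℕ.* C ⌝ * (⌜ d ⌝ * ⌜ d ⌝ * ⌜ q ℕ.^ (m ℕ.+ suc m) ⌝)
          ≡⟨ regroup ⌜ C ℕ.* C ⌝ ⌜ d ⌝ ⌜ q ℕ.^ (m ℕ.+ suc m) ⌝ ⟩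
        ⌜ C ℕ.* C ⌝ * ⌜ d ⌝ * ⌜ d ⌝ * ⌜ q ℕ.^ (m ℕ.+ suc m) ⌝
          ≡⟨ trans (⌜⌝-* (C ℕ.* C ℕ.* d ℕ.* d) (q ℕ.^ (m ℕ.+ suc m))) (cong (_* ⌜ q ℕ.^ (m ℕ.+ suc m) ⌝) (trans (⌜⌝-* (C ℕ.* C ℕ.* d) d) (cong (_* ⌜ d ⌝) (⌜⌝-* (C ℕ.* C) d)))) ⟨
        ⌜ C ℕ.* C ℕ.* d ℕ.* d ℕ.* q ℕ.^ (m ℕ.+ suc m) ⌝
          ≡⟨ cong₂ (λ d k → ⌜ C ℕ.* C ℕ.* d ℕ.* d ℕ.* q ℕ.^ (m ℕ.+ k) ⌝) (sym (splitDenom≡ s)) (sym (ℕP.+-identityʳ (suc m))) ⟩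
        ⌜ C ℕ.* C ℕ.* D.splitDenom s ℕ.* D.splitDenom s ℕ.* q ℕ.^ (2 ℕ.* suc m ℕ.∸ 1) ⌝ ∎)
      where
      open ≤-Reasoning
      C d : ℕ
      C = bound-constant (suc m)
      d = denom 1 (Vec.toList s)
      P : ℚ
      P = ⌜ D.prodCard Us ⌝
      n≤n*n : ∀ n → n ℕ.≤ n ℕ.* n
      n≤n*n zero = z≤n
      n≤n*n (suc n) = ℕP.m≤m*n (suc n) (suc n)
      opaque
        unfolding _+_
        regroup : ∀ c d q → c * (d * d * q) ≡ c * d * d * q
        regroup = solve-∀ ℚ-ring

open import Defs
open import Data.Nat using (ℕ; _≤_; _*_; _^_; _∸_)
open import Data.Integer as ℤ using (ℤ; +_)
open import Data.Vec using (Vec)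
open import Data.List using (List)
open import Data.Vec.Relation.Unary.All using (All)
open import Data.Product using (∃-syntax; _×_)
open import Relation.Binary.PropositionalEquality using (_≡_)
open import Data.Nat using (suc)
open import Data.Product using (_,_; proj₁)
open import Data.Vec.Relation.Unary.All.Properties using (lookup⁺)

theorem3p1 : (n M : ℕ) → 1 ≤ n → 1 ≤ M →
    ∃[ C ] ∃[ q₀ ] ((q : ℕ) → q₀ ≤ q → OddPrimePower q → (F : FiniteField q) →
    (s : Vec ℕ n) → weightedSum s ≡ n →
    (Us : Vec (List (FiniteField.Carrier F)) n) → All (GoodSubset F M) Us →
    (N : ℕ) → CountOf (λ ξ → HasSplitType F (charPoly F ξ) s) (allTuples F Us) N →
    ((+ (splitDenom s * N) ℤ.- + prodCard Us) ℤ.^ 2)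
    ℤ.≤ + (C * C * splitDenom s * splitDenom s * q ^ (2 * n ∸ 1)))
theorem3p1 (suc m) M _ _ = Tuples.bound-constant (suc m) , 0 , λ q _ _ F s w Us good N cnt →
  Tuples.split-type-count F s w Us (λ i → proj₁ (lookup⁺ good i)) N cnt
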